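{- For every positive integer $k$, the polynomial $\Delta_{3k,3}(c)$ is irreducible over $\mathbb{Q}$.
   Context: Let $f_c(z)=z^2+c\in\mathbb{Z}[c][z]$, and define iterates by $f_c^{\circ 0}(z)=z$, $f_c^{\circ j}=f_c\circ f_c^{\circ(j-1)}$. For $n\ge1$ the $n$-th dynatomic polynomial is $\Phi_n^*(z,c)=\prod_{j\mid n}(f_c^{\circ j}(z)-z)^{\mu(n/j)}$ ($\mu$ the Möbius function). The $n$-th multiplier polynomial $\delta_n(x,c)\in\mathbb{Z}[x,c]$ is the polynomial, monic in $x$, with $\delta_n(x,c)^n=\operatorname{Res}_z\big(\Phi_n^*(z,c),\,x-(f_c^{\circ n})'(z)\big)$. Let $\Psi_j(x)$ denote the $j$-th cyclotomic polynomial. For positive integers $m\mid n$ with $m<n$, the delta factor is $\Delta_{n,m}(c)=\operatorname{Res}_x(\Psi_{n/m}(x),\delta_m(x,c))$; and $\Delta_{n,n}(c)$ is defined by $\delta_n(1,c)=\Delta_{n,n}(c)\prod_{m\mid n,\,m\neq n}\Delta_{n,m}(c)$. -}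

module Defs where

open import Algebra.Bundles.Raw using (RawRing)
import Algebra.Definitions.RawSemiring as RawSemiringDefs
open import Data.Bool.Base using (if_then_else_)
open import Data.Fin.Base using (Fin; zero; suc; toℕ; punchIn; splitAt)
open import Data.Integer.Base as ℤ using (ℤ; 0ℤ; 1ℤ; -1ℤ; ∣_∣)
import Data.Integer.Properties as ℤₚ
open import Data.List.Base as List using (List; []; _∷_; foldr; filter; upTo; length)
open import Data.List.Relation.Unary.Unique.DecPropositional using (unique?)
open import Data.Nat.Base as ℕ using (ℕ; zero; suc; _∸_; _<_; _≤ᵇ_)
open import Data.Nat.Divisibility using (_∣_; _∣?_; quotient)
open import Data.Nat.DivMod using (_/_)
open import Data.Nat.Primality.Factorisation using (factorise; factors)
import Data.Nat.Properties as ℕₚ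
open import Data.Product.Base using (_×_; _,_; Σ-syntax; proj₁)
open import Data.Rational.Base as ℚ using (ℚ; 0ℚ)
import Data.Rational.Properties as ℚₚ
open import Data.Sum.Base using ([_,_]′)
open import Level using (0ℓ) renaming (suc to lsuc)
open import Relation.Nullary.Decidable using (Dec; yes; no; does)

-- Deciding a ≈ 0# is what makes degrees of polynomials computable.
record RawRing₀ : Set (lsuc 0ℓ) where
  field
    rawRing : RawRing 0ℓ 0ℓ
  open RawRing rawRing public
  field
    _≈0? : (a : Carrier) → Dec (a ≈ 0#)
  open RawSemiringDefs rawSemiring public using (_^_; sum; Irreducible)

  infixl 6 _-_
  _-_ : Carrier → Carrier → Carrier
  a - b = a + - b

  ∏ : List Carrier → Carrier
  ∏ = foldr _*_ 1#

ℤR : RawRing₀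
ℤR = record { rawRing = ℤ.+-*-rawRing ; _≈0? = λ a → a ℤₚ.≟ 0ℤ }

ℚR : RawRing₀
ℚR = record { rawRing = ℚ.+-*-rawRing ; _≈0? = λ a → a ℚₚ.≟ 0ℚ }

-- Polynomials are lists of coefficients, constant term first; trailing zeros
-- are allowed and are ignored by the equality _≋_.
module Polynomial (R : RawRing₀) where
  open RawRing₀ R

  Poly : Set
  Poly = List Carrier

  infix 4 _≋_
  data _≋_ : Poly → Poly → Set where
    []≋[] : [] ≋ []
    ∷≋∷   : ∀ {a b p q} → a ≈ b → p ≋ q → a ∷ p ≋ b ∷ q
    ∷≋[]  : ∀ {a p} → a ≈ 0# → p ≋ [] → a ∷ p ≋ []
    []≋∷  : ∀ {b q} → b ≈ 0# → [] ≋ q → [] ≋ b ∷ q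

  infixl 6 _⊕_
  _⊕_ : Poly → Poly → Poly
  []      ⊕ q       = q
  (a ∷ p) ⊕ []      = a ∷ p
  (a ∷ p) ⊕ (b ∷ q) = a + b ∷ p ⊕ q

  infixl 7 _⊗_
  _⊗_ : Poly → Poly → Poly
  []      ⊗ q = []
  (a ∷ p) ⊗ q = List.map (a *_) q ⊕ (0# ∷ p ⊗ q)

  _≋0? : (p : Poly) → Dec (p ≋ [])
  [] ≋0? = yes []≋[]
  (a ∷ p) ≋0? with a ≈0? | p ≋0?
  ... | yes a≈0 | yes p≋0 = yes (∷≋[] a≈0 p≋0)
  ... | no a≉0  | _       = no λ { (∷≋[] a≈0 _) → a≉0 a≈0 }
  ... | _       | no p≋̸0  = no λ { (∷≋[] _ p≋0) → p≋̸0 p≋0 }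

  polyRing : RawRing₀
  polyRing = record
    { rawRing = record
      { Carrier = Poly
      ; _≈_     = _≋_
      ; _+_     = _⊕_
      ; _*_     = _⊗_
      ; -_      = List.map (-_)
      ; 0#      = []
      ; 1#      = 1# ∷ []
      }
    ; _≈0? = _≋0?
    }

  const : Carrier → Poly
  const a = a ∷ []

  X : Poly
  X = 0# ∷ 1# ∷ []

  coeff : Poly → ℕ → Carrier
  coeff []      _       = 0#
  coeff (a ∷ p) zero    = a
  coeff (a ∷ p) (suc i) = coeff p i

  -- The zero polynomial gets degree 0.
  deg : Poly → ℕ
  deg []      = 0
  deg (a ∷ p) = if does (p ≋0?) then 0 else suc (deg p)

  Monic : Poly → Set
  Monic p = coeff p (deg p) ≈ 1#

  eval : Poly → Carrier → Carrier
  eval p a = foldr (λ b v → b + a * v) 0# p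

  -- (a + X p)′ = p + X p′
  derivative : Poly → Poly
  derivative []      = []
  derivative (a ∷ p) = p ⊕ (0# ∷ derivative p)

  Matrix : ℕ → Set
  Matrix n = Fin n → Fin n → Carrier

  -- Laplace expansion along the first column.
  det : ∀ {n} → Matrix n → Carrier
  det {zero}  M = 1#
  det {suc n} M = sum λ i →
    (- 1#) ^ toℕ i * (M i zero * det (λ r s → M (punchIn i r) (suc s)))

  -- Entry in column j of the i-th shifted coefficient row of a polynomial of
  -- degree d:  0 … 0  p_d  p_{d-1}  …  p_0  0 … 0,  with i leading zeros.
  shiftedRow : Poly → (d i j : ℕ) → Carrier
  shiftedRow p d i j = if j ≤ᵇ d ℕ.+ i then coeff p (d ℕ.+ i ∸ j) else 0#

  sylvester : (p q : Poly) → Matrix (deg q ℕ.+ deg p)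
  sylvester p q i j =
    [ (λ r → shiftedRow p (deg p) (toℕ r) (toℕ j))
    , (λ r → shiftedRow q (deg q) (toℕ r) (toℕ j))
    ]′ (splitAt (deg q) i)

  Res : Poly → Poly → Carrier
  Res p q = det (sylvester p q)

infix 30 _[X]
_[X] : RawRing₀ → RawRing₀
R [X] = Polynomial.polyRing R

-- The pairs (j , n / j) for the positive divisors j of n.
divisorPairs : ℕ → List (ℕ × ℕ)
divisorPairs n =
  List.map (λ i → suc i , n / suc i) (filter (λ i → suc i ∣? n) (upTo n))

properDivisors : ℕ → List ℕ
properDivisors n = filter (ℕₚ._<? n) (List.map proj₁ (divisorPairs n))

-- The value at 0 is irrelevant.
μ : ℕ → ℤ
μ zero      = 0ℤ
μ n@(suc _) = if does (unique? ℕₚ._≟_ ps) then -1ℤ ℤ.^ length ps else 0ℤ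
  where ps = factors (factorise n)

-- P = ∏_{j∣n} (g j)^{μ(n/j)}, with the negative powers moved to the other side.
IsMöbiusProduct : (R : RawRing₀) (let open RawRing₀ R) →
                  ℕ → (ℕ → Carrier) → Carrier → Set
IsMöbiusProduct R n g P =
  P * ∏ (List.map (λ (j , q) → g j ^ ∣ μ q ℤ.⊓ 0ℤ ∣) (divisorPairs n))
    ≈ ∏ (List.map (λ (j , q) → g j ^ ∣ μ q ℤ.⊔ 0ℤ ∣) (divisorPairs n))
  where open RawRing₀ R

ℤ[X] ℤ[c] ℤ[c][z] ℤ[c][x] ℚ[c] : RawRing₀
ℤ[X]    = ℤR [X]
ℤ[c]    = ℤR [X]
ℤ[c][z] = ℤ[c] [X]
ℤ[c][x] = ℤ[c] [X]
ℚ[c]    = ℚR [X]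

open RawRing₀ using (Carrier)

module _ where
  open RawRing₀ ℤ[X]
  open Polynomial ℤR using (X)

  IsCyclotomic : ℕ → Carrier ℤ[X] → Set
  IsCyclotomic n = IsMöbiusProduct ℤ[X] n (λ j → X ^ j - 1#)

module _ where
  open RawRing₀ ℤ[c][z]
  open Polynomial ℤ[c] using (const) renaming (X to z)
  open Polynomial ℤR using () renaming (X to c)

  f : Carrier ℤ[c][z] → Carrier ℤ[c][z]
  f w = w ^ 2 + const c

  iterate-f : ℕ → Carrier ℤ[c][z]
  iterate-f zero    = z
  iterate-f (suc j) = f (iterate-f j)

  IsDynatomic : ℕ → Carrier ℤ[c][z] → Set
  IsDynatomic n = IsMöbiusProduct ℤ[c][z] n (λ j → iterate-f j - z)

module _ where
  open RawRing₀ ℤ[c][x]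
  open Polynomial ℤ[c] using (const; derivative; Monic) renaming (X to x)
  private
    module Over-ℤ[c][x] = Polynomial ℤ[c][x]
    module ℤ[c][x][z] = RawRing₀ (ℤ[c][x] [X])

  -- Elements of ℤ[c][z] are viewed in ℤ[c][x][z] by mapping const over their
  -- coefficients; the resultant eliminates z.
  multiplierResultant : ℕ → Carrier ℤ[c][z] → Carrier ℤ[c][x]
  multiplierResultant n Φ =
    Over-ℤ[c][x].Res
      (List.map const Φ)
      (Over-ℤ[c][x].const x ℤ[c][x][z].- List.map const (derivative (iterate-f n)))

  IsMultiplierPolynomial : ℕ → Carrier ℤ[c][x] → Set
  IsMultiplierPolynomial n δ =
    Σ[ Φ ∈ Carrier ℤ[c][z] ]
      IsDynatomic n Φ × Monic δ × δ ^ n ≈ multiplierResultant n Φ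

module _ where
  open RawRing₀ ℤ[c]
  open Polynomial ℤ[c] using (Res; eval)
  open Polynomial ℤR using (const)

  data IsDeltaFactor (n : ℕ) : ℕ → Carrier ℤ[c] → Set where
    proper : ∀ {m Ψ δ Δ} (m∣n : m ∣ n) → m < n →
             IsCyclotomic (quotient m∣n) Ψ →
             IsMultiplierPolynomial m δ →
             Δ ≈ Res (List.map const Ψ) δ →
             IsDeltaFactor n m Δ
    diagonal : ∀ {δ Δₙₙ} (Δ : ℕ → Carrier ℤ[c]) →
               IsMultiplierPolynomial n δ →
               (∀ m → m ∣ n → m < n → IsDeltaFactor n m (Δ m)) →
               eval δ 1# ≈ Δₙₙ * ∏ (List.map Δ (properDivisors n)) →
               IsDeltaFactor n n Δₙₙ

IrreducibleOverℚ : Carrier ℤ[c] → Set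
IrreducibleOverℚ p = RawRing₀.Irreducible ℚ[c] (List.map (ℚ._/ 1) p)

{-# OPTIONS --safe #-}
-- Put 4c = -(t² + 7). The two 3-cycles of z² + c then have the multipliers A(t) and A(-t), where
-- A(t) = t³ - t² + 7t + 1, so for k ≥ 2 the delta factor becomes Ψ_k(A(t)) Ψ_k(A(-t)).
--
-- Ψ_k(A(t)) is irreducible, because A(T) = ω has no solution T in ℚ(ω), ω a primitive k-th root of
-- unity: for y = T(T + T̄ - 1) and |ω| = 1 one has 16 = 27|y|² + 4|1 + ω|² + |c|² for a suitable c, so
-- multiplication by y shrinks a positive definite form on ℚ(ω); as T is integral, the powers of y have
-- a common denominator, and y = 0 by descent. This leaves T = 0, where ω = 1, and T + T̄ = 1, which a
-- second descent excludes.
--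
-- A polynomial in c is even in t, so a factor of the delta factor that is divisible by Ψ_k(A(t)) is
-- also divisible by Ψ_k(A(-t)), which is coprime to Ψ_k(A(t)).
module Submission where

-- The substitution comes from the discriminant of `δ₃` in x, which is -64c²(4c + 7): once -(4c + 7)
-- is a square t², the quadratic splits. At each complex embedding the unit circle identity bounds
-- |y|² by 16/27, so the norm of the algebraic integer y is less than 1. No embeddings occur in the
-- proof. Their place is taken by the form p ↦ λ(p p*) on ℚ[X]/(X^k - 1), a sum of squares of
-- rational coefficients; multiplication by Θ = (X^k - 1)/Ψ_k carries it over to ℚ(ω), with X ↦
-- X^(k-1) as complex conjugation. An obstacle is that the objects are given by specifications only:
-- Ψ_k by a Möbius product, δ_n by its n-th power. That Ψ_k divides X^k - 1, has positive degree and
-- is irreducible must all be extracted from the product formula, and δ₃ from a Sylvester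
-- determinant of size 13. The case k = 1 stands apart: Δ_{3,3} is defined by division of δ₃(1, c),
-- and equals 4c + 7.

module Rings where
  open import Defs using (RawRing₀; _[X]; module Polynomial; module RawRing₀; ℤR; ℚR)
  open import Algebra.Bundles using (CommutativeRing)
  open import Algebra.Structures using (IsCommutativeRing)
  open import Algebra.Solver.Ring.AlmostCommutativeRing
    using (fromCommutativeRing; _-Raw-AlmostCommutative⟶_)
  import Algebra.Solver.Ring as RingSolver
  import Algebra.Properties.Ring
  import Algebra.Properties.Semiring.Mult
  open import Data.Integer.Base as ℤ using (ℤ; +_; -[1+_]; _⊖_)
  import Data.Integer.Properties as ℤₚ
  import Data.Rational.Properties as ℚₚ
  open import Data.List.Base using ([]; _∷_; map)
  open import Data.Bool.Base using (T)
  open import Data.Maybe.Base using (just; nothing; is-just)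
  open import Data.Maybe using (to-witness-T)
  open import Data.Vec.Base as Vec using (allFin)
  open import Data.Vec.N-ary using (N-ary; Eq; curryⁿ; curryⁿ-cong; _$ⁿ_)
  open import Data.Nat.Base as ℕ using (ℕ; zero; suc)
  import Data.Nat.Properties as ℕₚ
  open import Data.Product.Base using (_,_; proj₁; proj₂) renaming (_×_ to _×ᵖ_)
  open import Level using (0ℓ) renaming (suc to lsuc)
  open import Relation.Nullary using (yes; no)
  open import Relation.Binary.PropositionalEquality as ≡ using (_≡_)
  open import Relation.Binary.Definitions using (WeaklyDecidable)

  -- Commutative rings, homomorphisms, and polynomial rings with their evaluation maps

  Ring₀ : Set₁
  Ring₀ = CommutativeRing 0ℓ 0ℓ

  record IsHom (R S : Ring₀) (φ : CommutativeRing.Carrier R → CommutativeRing.Carrier S) : Set where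
    private
      module R = CommutativeRing R
      module S = CommutativeRing S
    field
      cong   : ∀ {a b} → a R.≈ b → φ a S.≈ φ b
      +-homo : ∀ a b → φ (a R.+ b) S.≈ φ a S.+ φ b
      *-homo : ∀ a b → φ (a R.* b) S.≈ φ a S.* φ b
      -‿homo : ∀ a → φ (R.- a) S.≈ S.- φ a
      0-homo : φ R.0# S.≈ S.0#
      1-homo : φ R.1# S.≈ S.1#

    ‿-homo : ∀ a b → φ (a R.- b) S.≈ φ a S.- φ b
    ‿-homo a b = S.trans (+-homo a (R.- b)) (S.+-congˡ (-‿homo b))

  idHom : (R : Ring₀) → IsHom R R (λ a → a)
  idHom R = record
    { cong = λ e → e ; +-homo = λ _ _ → refl ; *-homo = λ _ _ → refl
    ; -‿homo = λ _ → refl ; 0-homo = refl ; 1-homo = refl }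
    where open CommutativeRing R

  infixr 9 _∘ʰ_
  _∘ʰ_ : ∀ {R S T : Ring₀} {ψ φ} → IsHom S T ψ → IsHom R S φ → IsHom R T (λ a → ψ (φ a))
  _∘ʰ_ {T = T} Ψ Φ = record
    { cong   = λ e → Ψ.cong (Φ.cong e)
    ; +-homo = λ a b → trans (Ψ.cong (Φ.+-homo a b)) (Ψ.+-homo _ _)
    ; *-homo = λ a b → trans (Ψ.cong (Φ.*-homo a b)) (Ψ.*-homo _ _)
    ; -‿homo = λ a → trans (Ψ.cong (Φ.-‿homo a)) (Ψ.-‿homo _)
    ; 0-homo = trans (Ψ.cong Φ.0-homo) Ψ.0-homo
    ; 1-homo = trans (Ψ.cong Φ.1-homo) Ψ.1-homo }
    where
    module Ψ = IsHom Ψ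
    module Φ = IsHom Φ
    open CommutativeRing T using (trans)

  ℤ-ring : Ring₀
  ℤ-ring = ℤₚ.+-*-commutativeRing

  module IntegerMultiples (R : Ring₀) where
    open CommutativeRing R
    open Algebra.Properties.Ring ring
    open Algebra.Properties.Semiring.Mult semiring
    open import Relation.Binary.Reasoning.Setoid setoid

    -- The homomorphism from ℤ supplies integer coefficients to the ring solver in every commutative
    -- ring. `ι (+ 1)` unfolds to `1# + 0#`, so it equals `1#` only up to `≈`.
    ι : ℤ → Carrier
    ι (+ n)     = n × 1#
    ι -[1+ n ] = - (suc n × 1#)

    private
      ι-⊖ : ∀ m n → ι (m ⊖ n) ≈ m × 1# + - (n × 1#)
      ι-⊖ zero zero = sym (trans (+-congˡ -0#≈0#) (+-identityˡ _))
      ι-⊖ zero (suc n) = sym (+-identityˡ _)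
      ι-⊖ (suc m) zero = sym (trans (+-congˡ -0#≈0#) (+-identityʳ _))
      ι-⊖ (suc m) (suc n) = begin
        ι (suc m ⊖ suc n)                ≡⟨ ≡.cong ι (ℤₚ.[1+m]⊖[1+n]≡m⊖n m n) ⟩
        ι (m ⊖ n)                        ≈⟨ ι-⊖ m n ⟩
        m × 1# + - (n × 1#)              ≈⟨ +-congʳ (+-identityʳ _) ⟨
        m × 1# + 0# + - (n × 1#)         ≈⟨ +-congʳ (+-congˡ (-‿inverseʳ 1#)) ⟨
        m × 1# + (1# + - 1#) + - (n × 1#) ≈⟨ +-congʳ (sym (+-assoc _ _ _)) ⟩
        m × 1# + 1# + - 1# + - (n × 1#)  ≈⟨ +-assoc _ _ _ ⟩
        m × 1# + 1# + (- 1# + - (n × 1#)) ≈⟨ +-cong (+-comm _ _) (-‿+-comm _ _) ⟩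
        suc m × 1# + - (suc n × 1#)      ∎

      ι-neg : ∀ i → ι (ℤ.- i) ≈ - ι i
      ι-neg (+ zero)  = sym -0#≈0#
      ι-neg (+ suc n) = refl
      ι-neg -[1+ n ]  = sym (-‿involutive _)

      ι-+ : ∀ i j → ι (i ℤ.+ j) ≈ ι i + ι j
      ι-+ (+ m) (+ n) = ×-homo-+ 1# m n
      ι-+ (+ m) -[1+ n ] = ι-⊖ m (suc n)
      ι-+ -[1+ m ] (+ n) = trans (ι-⊖ n (suc m)) (+-comm _ _)
      ι-+ -[1+ m ] -[1+ n ] = begin
        - (suc (suc (m ℕ.+ n)) × 1#)      ≡⟨ ≡.cong (λ k → - (k × 1#)) (ℕₚ.+-suc (suc m) n) ⟨
        - ((suc m ℕ.+ suc n) × 1#)        ≈⟨ -‿cong (×-homo-+ 1# (suc m) (suc n)) ⟩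
        - (suc m × 1# + suc n × 1#)       ≈⟨ -‿+-comm _ _ ⟨
        - (suc m × 1#) + - (suc n × 1#)   ∎

      ι-*⁺ : ∀ m n → ι (+ m ℤ.* + n) ≈ ι (+ m) * ι (+ n)
      ι-*⁺ m n = trans (reflexive (≡.cong ι (≡.sym (ℤₚ.pos-* m n)))) (×1-homo-* m n)

      ι-*ʳ : ∀ m j → ι (+ m ℤ.* j) ≈ ι (+ m) * ι j
      ι-*ʳ m (+ n) = ι-*⁺ m n
      ι-*ʳ m -[1+ n ] = begin
        ι (+ m ℤ.* ℤ.- (+ suc n))   ≡⟨ ≡.cong ι (ℤₚ.neg-distribʳ-* (+ m) (+ suc n)) ⟨
        ι (ℤ.- (+ m ℤ.* + suc n))   ≈⟨ ι-neg (+ m ℤ.* + suc n) ⟩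
        - ι (+ m ℤ.* + suc n)       ≈⟨ -‿cong (ι-*⁺ m (suc n)) ⟩
        - (ι (+ m) * ι (+ suc n))   ≈⟨ -‿distribʳ-* _ _ ⟩
        ι (+ m) * ι -[1+ n ]        ∎

      ι-* : ∀ i j → ι (i ℤ.* j) ≈ ι i * ι j
      ι-* (+ m) j = ι-*ʳ m j
      ι-* -[1+ m ] j = begin
        ι (ℤ.- (+ suc m) ℤ.* j)   ≡⟨ ≡.cong ι (ℤₚ.neg-distribˡ-* (+ suc m) j) ⟨
        ι (ℤ.- (+ suc m ℤ.* j))   ≈⟨ ι-neg (+ suc m ℤ.* j) ⟩
        - ι (+ suc m ℤ.* j)       ≈⟨ -‿cong (ι-*ʳ (suc m) j) ⟩
        - (ι (+ suc m) * ι j)     ≈⟨ -‿distribˡ-* _ _ ⟩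
        ι -[1+ m ] * ι j          ∎

    ι-hom : IsHom ℤ-ring R ι
    ι-hom = record
      { cong = λ e → reflexive (≡.cong ι e) ; +-homo = ι-+ ; *-homo = ι-*
      ; -‿homo = ι-neg ; 0-homo = refl ; 1-homo = +-identityʳ 1# }

    private
      morphism : CommutativeRing.rawRing ℤ-ring -Raw-AlmostCommutative⟶ fromCommutativeRing R
      morphism = record
        { ⟦_⟧ = ι ; +-homo = ι-+ ; *-homo = ι-* ; -‿homo = ι-neg
        ; 0-homo = refl ; 1-homo = +-identityʳ 1# }

      weaklyDec : WeaklyDecidable (λ i j → ι i ≈ ι j)
      weaklyDec i j with i ℤₚ.≟ j
      ... | yes i≡j = just (reflexive (≡.cong ι i≡j))
      ... | no  _   = nothing

    private module Solver = RingSolver _ (fromCommutativeRing R) morphism weaklyDec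
    open Solver public using (Polynomial; _:=_; _:+_; _:*_; _:-_; :-_; con; _:^_)
    open Solver using (⟦_⟧; normalise; _≟N_; ⟦_⟧N-cong; prove; var)

    private
      close : ∀ n → N-ary n (Polynomial n) (Polynomial n ×ᵖ Polynomial n) → Polynomial n ×ᵖ Polynomial n
      close n f = f $ⁿ Vec.map var (allFin n)

    -- Normal forms are compared by decision; comparing their interpretations would unfold the
    -- operations of concrete rings.
    solve : ∀ n (f : N-ary n (Polynomial n) (Polynomial n ×ᵖ Polynomial n)) →
      let l = proj₁ (close n f) ; r = proj₂ (close n f) in
      {T (is-just (normalise l ≟N normalise r))} → Eq n _≈_ (curryⁿ ⟦ l ⟧) (curryⁿ ⟦ r ⟧)
    solve n f {equal} = curryⁿ-cong _≈_ ⟦ l ⟧ ⟦ r ⟧ λ ρ →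
      prove ρ l r (⟦ to-witness-T (normalise l ≟N normalise r) equal ⟧N-cong ρ)
      where
      l = proj₁ (close n f)
      r = proj₂ (close n f)

  -- The statement lives over raw rings with a zero test; this adds the ring laws to exactly those
  -- data, so that ℤ[c], ℤ[c][x] and ℤ[c][x][z] arise by iteration.
  record CRing : Set₁ where
    field
      raw : RawRing₀
    open RawRing₀ raw
    field
      isCommutativeRing : IsCommutativeRing _≈_ _+_ _*_ -_ 0# 1#
    ring₀ : Ring₀
    ring₀ = record { isCommutativeRing = isCommutativeRing }

  ℤC : CRing
  ℤC = record { raw = ℤR ; isCommutativeRing = ℤₚ.+-*-isCommutativeRing }

  ℚC : CRing
  ℚC = record { raw = ℚR ; isCommutativeRing = ℚₚ.+-*-isCommutativeRing }

  module Poly (C : CRing) where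
    open CRing C
    open RawRing₀ raw using (_≈0?)
    open CommutativeRing ring₀
    open Polynomial raw
    open Algebra.Properties.Ring ring using (-0#≈0#; -‿distribˡ-*; -‿+-comm)
    open IntegerMultiples ring₀
    open import Relation.Binary.Reasoning.Setoid setoid

    -- Together with the converse below, this turns equality of lists up to trailing zeros into
    -- equality of all coefficients, so the additive laws can be checked one coefficient at a time.
    ≋⇒coeff : ∀ {p q} → p ≋ q → ∀ i → coeff p i ≈ coeff q i
    ≋⇒coeff []≋[]       i       = refl
    ≋⇒coeff (∷≋∷ a≈b e) zero    = a≈b
    ≋⇒coeff (∷≋∷ a≈b e) (suc i) = ≋⇒coeff e i
    ≋⇒coeff (∷≋[] a≈0 e) zero    = a≈0
    ≋⇒coeff (∷≋[] a≈0 e) (suc i) = ≋⇒coeff e i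
    ≋⇒coeff ([]≋∷ b≈0 e) zero    = sym b≈0
    ≋⇒coeff ([]≋∷ b≈0 e) (suc i) = ≋⇒coeff e i

    coeff⇒≋ : ∀ {p q} → (∀ i → coeff p i ≈ coeff q i) → p ≋ q
    coeff⇒≋ {[]}    {[]}    h = []≋[]
    coeff⇒≋ {[]}    {b ∷ q} h = []≋∷ (sym (h 0)) (coeff⇒≋ λ i → h (suc i))
    coeff⇒≋ {a ∷ p} {[]}    h = ∷≋[] (h 0) (coeff⇒≋ λ i → h (suc i))
    coeff⇒≋ {a ∷ p} {b ∷ q} h = ∷≋∷ (h 0) (coeff⇒≋ λ i → h (suc i))

    ≋-refl : ∀ {p} → p ≋ p
    ≋-refl = coeff⇒≋ λ _ → refl

    ≋-sym : ∀ {p q} → p ≋ q → q ≋ p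
    ≋-sym e = coeff⇒≋ λ i → sym (≋⇒coeff e i)

    ≋-trans : ∀ {p q r} → p ≋ q → q ≋ r → p ≋ r
    ≋-trans e f = coeff⇒≋ λ i → trans (≋⇒coeff e i) (≋⇒coeff f i)

    infixr 8 _·_
    _·_ : Carrier → Poly → Poly
    a · p = map (a *_) p

    neg : Poly → Poly
    neg = map (-_)

    coeff-⊕ : ∀ p q i → coeff (p ⊕ q) i ≈ coeff p i + coeff q i
    coeff-⊕ []      q       i       = sym (+-identityˡ _)
    coeff-⊕ (a ∷ p) []      i       = sym (+-identityʳ _)
    coeff-⊕ (a ∷ p) (b ∷ q) zero    = refl
    coeff-⊕ (a ∷ p) (b ∷ q) (suc i) = coeff-⊕ p q i

    coeff-· : ∀ a p i → coeff (a · p) i ≈ a * coeff p i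
    coeff-· a []      i       = sym (zeroʳ a)
    coeff-· a (b ∷ p) zero    = refl
    coeff-· a (b ∷ p) (suc i) = coeff-· a p i

    coeff-neg : ∀ p i → coeff (neg p) i ≈ - coeff p i
    coeff-neg []      i       = sym -0#≈0#
    coeff-neg (b ∷ p) zero    = refl
    coeff-neg (b ∷ p) (suc i) = coeff-neg p i

    ⊕-cong : ∀ {p p′ q q′} → p ≋ p′ → q ≋ q′ → p ⊕ q ≋ p′ ⊕ q′
    ⊕-cong {p} {p′} {q} {q′} e f = coeff⇒≋ λ i →
      trans (coeff-⊕ p q i) (trans (+-cong (≋⇒coeff e i) (≋⇒coeff f i)) (sym (coeff-⊕ p′ q′ i)))

    ·-cong : ∀ {a b p q} → a ≈ b → p ≋ q → a · p ≋ b · q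
    ·-cong {a} {b} {p} {q} e f = coeff⇒≋ λ i →
      trans (coeff-· a p i) (trans (*-cong e (≋⇒coeff f i)) (sym (coeff-· b q i)))

    neg-cong : ∀ {p q} → p ≋ q → neg p ≋ neg q
    neg-cong {p} {q} e = coeff⇒≋ λ i →
      trans (coeff-neg p i) (trans (-‿cong (≋⇒coeff e i)) (sym (coeff-neg q i)))

    ⊕-assoc : ∀ p q r → (p ⊕ q) ⊕ r ≋ p ⊕ (q ⊕ r)
    ⊕-assoc p q r = coeff⇒≋ λ i → begin
      coeff ((p ⊕ q) ⊕ r) i               ≈⟨ coeff-⊕ (p ⊕ q) r i ⟩
      coeff (p ⊕ q) i + coeff r i         ≈⟨ +-congʳ (coeff-⊕ p q i) ⟩
      coeff p i + coeff q i + coeff r i   ≈⟨ +-assoc _ _ _ ⟩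
      coeff p i + (coeff q i + coeff r i) ≈⟨ +-congˡ (coeff-⊕ q r i) ⟨
      coeff p i + coeff (q ⊕ r) i         ≈⟨ coeff-⊕ p (q ⊕ r) i ⟨
      coeff (p ⊕ (q ⊕ r)) i               ∎

    ⊕-comm : ∀ p q → p ⊕ q ≋ q ⊕ p
    ⊕-comm p q = coeff⇒≋ λ i →
      trans (coeff-⊕ p q i) (trans (+-comm _ _) (sym (coeff-⊕ q p i)))

    ⊕-identityʳ : ∀ p → p ⊕ [] ≋ p
    ⊕-identityʳ p = coeff⇒≋ λ i → trans (coeff-⊕ p [] i) (+-identityʳ _)

    neg-inverseʳ : ∀ p → p ⊕ neg p ≋ []
    neg-inverseʳ p = coeff⇒≋ λ i →
      trans (coeff-⊕ p (neg p) i) (trans (+-congˡ (coeff-neg p i)) (-‿inverseʳ _))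

    ⊕-interchange : ∀ p q r s → (p ⊕ q) ⊕ (r ⊕ s) ≋ (p ⊕ r) ⊕ (q ⊕ s)
    ⊕-interchange p q r s = coeff⇒≋ λ i → begin
      coeff ((p ⊕ q) ⊕ (r ⊕ s)) i ≈⟨ expand p q r s i ⟩
      (coeff p i + coeff q i) + (coeff r i + coeff s i)
        ≈⟨ solve 4 (λ a b c d → (a :+ b) :+ (c :+ d) := (a :+ c) :+ (b :+ d)) _ _ _ _ ⟩
      (coeff p i + coeff r i) + (coeff q i + coeff s i) ≈⟨ expand p r q s i ⟨
      coeff ((p ⊕ r) ⊕ (q ⊕ s)) i ∎
      where
      expand : ∀ p q r s i → coeff ((p ⊕ q) ⊕ (r ⊕ s)) i ≈ (coeff p i + coeff q i) + (coeff r i + coeff s i)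
      expand p q r s i = trans (coeff-⊕ (p ⊕ q) (r ⊕ s) i) (+-cong (coeff-⊕ p q i) (coeff-⊕ r s i))

    ↑-cong : ∀ {p q} → p ≋ q → 0# ∷ p ≋ 0# ∷ q
    ↑-cong = ∷≋∷ refl

    ↑-⊕ : ∀ p q → 0# ∷ (p ⊕ q) ≋ (0# ∷ p) ⊕ (0# ∷ q)
    ↑-⊕ p q = ∷≋∷ (sym (+-identityˡ _)) ≋-refl

    ·-⊕ : ∀ a p q → a · (p ⊕ q) ≋ a · p ⊕ a · q
    ·-⊕ a p q = coeff⇒≋ λ i → begin
      coeff (a · (p ⊕ q)) i               ≈⟨ coeff-· a (p ⊕ q) i ⟩
      a * coeff (p ⊕ q) i                 ≈⟨ *-congˡ (coeff-⊕ p q i) ⟩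
      a * (coeff p i + coeff q i)         ≈⟨ distribˡ _ _ _ ⟩
      a * coeff p i + a * coeff q i       ≈⟨ +-cong (coeff-· a p i) (coeff-· a q i) ⟨
      coeff (a · p) i + coeff (a · q) i   ≈⟨ coeff-⊕ (a · p) (a · q) i ⟨
      coeff (a · p ⊕ a · q) i             ∎

    ·-· : ∀ a b p → a · b · p ≋ (a * b) · p
    ·-· a b p = coeff⇒≋ λ i → begin
      coeff (a · b · p) i     ≈⟨ coeff-· a (b · p) i ⟩
      a * coeff (b · p) i     ≈⟨ *-congˡ (coeff-· b p i) ⟩
      a * (b * coeff p i)     ≈⟨ *-assoc _ _ _ ⟨
      a * b * coeff p i       ≈⟨ coeff-· (a * b) p i ⟨
      coeff ((a * b) · p) i   ∎

    ·-↑ : ∀ a p → a · (0# ∷ p) ≋ 0# ∷ a · p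
    ·-↑ a p = ∷≋∷ (zeroʳ a) ≋-refl

    1·-identity : ∀ p → 1# · p ≋ p
    1·-identity p = coeff⇒≋ λ i → trans (coeff-· 1# p i) (*-identityˡ _)

    0·-zero : ∀ p → 0# · p ≋ []
    0·-zero p = coeff⇒≋ λ i → trans (coeff-· 0# p i) (zeroˡ _)

    0∷[] : 0# ∷ [] ≋ []
    0∷[] = ∷≋[] refl []≋[]

    ⊗-zeroʳ : ∀ p → p ⊗ [] ≋ []
    ⊗-zeroʳ []      = []≋[]
    ⊗-zeroʳ (a ∷ p) = ∷≋[] refl (⊗-zeroʳ p)

    ⊗-congʳ : ∀ p {q r} → q ≋ r → p ⊗ q ≋ p ⊗ r
    ⊗-congʳ []      e = []≋[]
    ⊗-congʳ (a ∷ p) e = ⊕-cong (·-cong refl e) (↑-cong (⊗-congʳ p e))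

    -- The mirror image of the recursion that defines the product; commutativity follows from the
    -- two by induction.
    ⊗-∷ʳ : ∀ p b q → p ⊗ (b ∷ q) ≋ b · p ⊕ (0# ∷ p ⊗ q)
    ⊗-∷ʳ []      b q = []≋∷ refl []≋[]
    ⊗-∷ʳ (a ∷ p) b q = ∷≋∷ (+-congʳ (*-comm a b))
      (≋-trans (⊕-cong (≋-refl {a · q}) (⊗-∷ʳ p b q))
      (≋-trans (≋-sym (⊕-assoc (a · q) (b · p) _))
      (≋-trans (⊕-cong (⊕-comm (a · q) (b · p)) ≋-refl) (⊕-assoc (b · p) (a · q) _))))

    ⊗-comm : ∀ p q → p ⊗ q ≋ q ⊗ p
    ⊗-comm []      q = ≋-sym (⊗-zeroʳ q)
    ⊗-comm (a ∷ p) q = ≋-trans (⊕-cong (≋-refl {a · q}) (↑-cong (⊗-comm p q))) (≋-sym (⊗-∷ʳ q a p))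

    ⊗-congˡ : ∀ {p q} r → p ≋ q → p ⊗ r ≋ q ⊗ r
    ⊗-congˡ {p} {q} r e = ≋-trans (⊗-comm p r) (≋-trans (⊗-congʳ r e) (⊗-comm r q))

    ⊗-cong : ∀ {p p′ q q′} → p ≋ p′ → q ≋ q′ → p ⊗ q ≋ p′ ⊗ q′
    ⊗-cong {p} {p′} {q} {q′} e f = ≋-trans (⊗-congˡ q e) (⊗-congʳ p′ f)

    ⊗-distribˡ : ∀ p q r → p ⊗ (q ⊕ r) ≋ p ⊗ q ⊕ p ⊗ r
    ⊗-distribˡ []      q r = []≋[]
    ⊗-distribˡ (a ∷ p) q r = ≋-trans
      (⊕-cong (·-⊕ a q r) (≋-trans (↑-cong (⊗-distribˡ p q r)) (↑-⊕ (p ⊗ q) (p ⊗ r))))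
      (⊕-interchange (a · q) (a · r) (0# ∷ p ⊗ q) (0# ∷ p ⊗ r))

    ⊗-distribʳ : ∀ r p q → (p ⊕ q) ⊗ r ≋ p ⊗ r ⊕ q ⊗ r
    ⊗-distribʳ r p q = ≋-trans (⊗-comm (p ⊕ q) r)
      (≋-trans (⊗-distribˡ r p q) (⊕-cong (⊗-comm r p) (⊗-comm r q)))

    ·-⊗ : ∀ a p q → (a · p) ⊗ q ≋ a · (p ⊗ q)
    ·-⊗ a []      q = []≋[]
    ·-⊗ a (b ∷ p) q = ≋-trans
      (⊕-cong (≋-sym (·-· a b q)) (≋-trans (↑-cong (·-⊗ a p q)) (≋-sym (·-↑ a (p ⊗ q)))))
      (≋-sym (·-⊕ a (b · q) (0# ∷ p ⊗ q)))

    ↑-⊗ : ∀ p q → (0# ∷ p) ⊗ q ≋ 0# ∷ p ⊗ q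
    ↑-⊗ p q = ≋-trans (⊕-cong (0·-zero q) ≋-refl) ≋-refl

    ⊗-assoc : ∀ p q r → (p ⊗ q) ⊗ r ≋ p ⊗ (q ⊗ r)
    ⊗-assoc []      q r = []≋[]
    ⊗-assoc (a ∷ p) q r = ≋-trans (⊗-distribʳ r (a · q) (0# ∷ p ⊗ q))
      (⊕-cong (·-⊗ a q r) (≋-trans (↑-⊗ (p ⊗ q) r) (↑-cong (⊗-assoc p q r))))

    const-⊗ : ∀ a p → const a ⊗ p ≋ a · p
    const-⊗ a p = ≋-trans (⊕-cong (≋-refl {a · p}) 0∷[]) (⊕-identityʳ (a · p))

    ⊗-identityˡ : ∀ p → const 1# ⊗ p ≋ p
    ⊗-identityˡ p = ≋-trans (const-⊗ 1# p) (1·-identity p)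

    polyC : CRing
    polyC = record { raw = raw [X] ; isCommutativeRing = record
      { isRing = record
        { +-isAbelianGroup = record
          { isGroup = record
            { isMonoid = record
              { isSemigroup = record
                { isMagma = record
                  { isEquivalence = record { refl = ≋-refl ; sym = ≋-sym ; trans = ≋-trans }
                  ; ∙-cong = ⊕-cong }
                ; assoc = ⊕-assoc }
              ; identity = (λ _ → ≋-refl) , ⊕-identityʳ }
            ; inverse = (λ p → ≋-trans (⊕-comm (neg p) p) (neg-inverseʳ p)) , neg-inverseʳ
            ; ⁻¹-cong = neg-cong }
          ; comm = ⊕-comm }
        ; *-cong = ⊗-cong
        ; *-assoc = ⊗-assoc
        ; *-identity = ⊗-identityˡ , λ p → ≋-trans (⊗-comm p (const 1#)) (⊗-identityˡ p)
        ; distrib = ⊗-distribˡ , ⊗-distribʳ }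
      ; *-comm = ⊗-comm } }

    poly : Ring₀
    poly = CRing.ring₀ polyC

    X⊗ : ∀ p → X ⊗ p ≋ 0# ∷ p
    X⊗ p = ≋-trans (↑-⊗ (const 1#) p) (↑-cong (⊗-identityˡ p))

    ∷-decompose : ∀ a p → a ∷ p ≋ const a ⊕ X ⊗ p
    ∷-decompose a p = ≋-trans (∷≋∷ (sym (+-identityʳ a)) ≋-refl) (⊕-cong (≋-refl {const a}) (≋-sym (X⊗ p)))

    const-hom : IsHom ring₀ poly const
    const-hom = record
      { cong = λ e → ∷≋∷ e []≋[] ; +-homo = λ _ _ → ≋-refl
      ; *-homo = λ a b → ∷≋∷ (sym (+-identityʳ _)) []≋[] ; -‿homo = λ _ → ≋-refl
      ; 0-homo = 0∷[] ; 1-homo = ≋-refl }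

  module Evaluation (C : CRing) (S : Ring₀)
    {φ : CommutativeRing.Carrier (CRing.ring₀ C) → CommutativeRing.Carrier S}
    (φ-hom : IsHom (CRing.ring₀ C) S φ) where
    private module R = CommutativeRing (CRing.ring₀ C)
    open Polynomial (CRing.raw C) hiding (eval)
    open Poly C
    open CommutativeRing S
    open IsHom φ-hom
    open IntegerMultiples S
    open import Relation.Binary.Reasoning.Setoid setoid

    ev : Carrier → Poly → Carrier
    ev s []      = 0#
    ev s (a ∷ p) = φ a + s * ev s p

    private
      ev-[] : ∀ s {p} → p ≋ [] → ev s p ≈ 0#
      ev-[] s []≋[] = refl
      ev-[] s (∷≋[] e f) = trans (+-cong (trans (cong e) 0-homo) (trans (*-congˡ (ev-[] s f)) (zeroʳ s))) (+-identityˡ _)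

    ev-cong : ∀ s {p q} → p ≋ q → ev s p ≈ ev s q
    ev-cong s []≋[] = refl
    ev-cong s (∷≋∷ e f) = +-cong (cong e) (*-congˡ (ev-cong s f))
    ev-cong s e@(∷≋[] _ _) = ev-[] s e
    ev-cong s e@([]≋∷ _ _) = sym (ev-[] s (≋-sym e))

    ev-congˡ : ∀ {s t} p → s ≈ t → ev s p ≈ ev t p
    ev-congˡ []      e = refl
    ev-congˡ (a ∷ p) e = +-congˡ (*-cong e (ev-congˡ p e))

    ev-⊕ : ∀ s p q → ev s (p ⊕ q) ≈ ev s p + ev s q
    ev-⊕ s []      q       = sym (+-identityˡ _)
    ev-⊕ s (a ∷ p) []      = sym (+-identityʳ _)
    ev-⊕ s (a ∷ p) (b ∷ q) = trans (+-cong (+-homo a b) (*-congˡ (ev-⊕ s p q)))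
      (solve 5 (λ a b s p q → (a :+ b) :+ s :* (p :+ q) := (a :+ s :* p) :+ (b :+ s :* q)) _ _ _ _ _)

    ev-· : ∀ s a p → ev s (a · p) ≈ φ a * ev s p
    ev-· s a []      = sym (zeroʳ _)
    ev-· s a (b ∷ p) = trans (+-cong (*-homo a b) (*-congˡ (ev-· s a p)))
      (solve 4 (λ a b s p → a :* b :+ s :* (a :* p) := a :* (b :+ s :* p)) _ _ _ _)

    ev-⊗ : ∀ s p q → ev s (p ⊗ q) ≈ ev s p * ev s q
    ev-⊗ s []      q = sym (zeroˡ _)
    ev-⊗ s (a ∷ p) q = begin
      ev s (a · q ⊕ (R.0# ∷ p ⊗ q))                ≈⟨ ev-⊕ s (a · q) _ ⟩
      ev s (a · q) + (φ R.0# + s * ev s (p ⊗ q))   ≈⟨ +-cong (ev-· s a q) (+-cong 0-homo (*-congˡ (ev-⊗ s p q))) ⟩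
      φ a * ev s q + (0# + s * (ev s p * ev s q))
        ≈⟨ solve 4 (λ a q s p → a :* q :+ (con ℤ.0ℤ :+ s :* (p :* q)) := (a :+ s :* p) :* q) _ _ _ _ ⟩
      (φ a + s * ev s p) * ev s q                  ∎

    ev-const : ∀ s a → ev s (const a) ≈ φ a
    ev-const s a = trans (+-congˡ (zeroʳ s)) (+-identityʳ _)

    ev-neg : ∀ s p → ev s (neg p) ≈ - ev s p
    ev-neg s []      = sym (Algebra.Properties.Ring.-0#≈0# ring)
    ev-neg s (a ∷ p) = trans (+-cong (-‿homo a) (*-congˡ (ev-neg s p)))
      (solve 3 (λ a s p → :- a :+ s :* :- p := :- (a :+ s :* p)) _ _ _)

    ev-hom : ∀ s → IsHom poly S (ev s)
    ev-hom s = record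
      { cong = ev-cong s ; +-homo = ev-⊕ s ; *-homo = ev-⊗ s ; -‿homo = ev-neg s
      ; 0-homo = refl ; 1-homo = trans (ev-const s R.1#) 1-homo }

    ev-X : ∀ s → ev s X ≈ s
    ev-X s = trans (+-cong 0-homo (*-congˡ (trans (ev-const s R.1#) 1-homo)))
      (trans (+-identityˡ _) (*-identityʳ s))

    -- Universal property of the polynomial ring. It is the usual way below to identify two
    -- composites of substitutions and reductions: both are homomorphisms, so only constants and `X`
    -- have to be compared.
    ev-unique : ∀ {ψ} → IsHom poly S ψ → (∀ a → ψ (const a) ≈ φ a) → ∀ p → ψ p ≈ ev (ψ X) p
    ev-unique {ψ} ψ-hom onConst [] = IsHom.0-homo ψ-hom
    ev-unique {ψ} ψ-hom onConst (a ∷ p) = begin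
      ψ (a ∷ p)                ≈⟨ Ψ.cong (∷-decompose a p) ⟩
      ψ (const a ⊕ X ⊗ p)      ≈⟨ Ψ.+-homo (const a) (X ⊗ p) ⟩
      ψ (const a) + ψ (X ⊗ p)  ≈⟨ +-cong (onConst a) (trans (Ψ.*-homo X p) (*-congˡ (ev-unique ψ-hom onConst p))) ⟩
      ev (ψ X) (a ∷ p)         ∎
      where module Ψ = IsHom ψ-hom

-- Integral domains and decidable equality

module Domains where
  open import Defs using (RawRing₀; module Polynomial; module RawRing₀)
  open Rings
  open import Algebra.Bundles using (CommutativeRing)
  import Data.Integer.Properties as ℤₚ
  open import Data.List.Base using ([]; _∷_)
  open import Data.Nat.Base using (suc)
  open import Data.Product.Base using (∃-syntax)
  open import Data.Sum.Base as Sum using (_⊎_; inj₁; inj₂)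
  open import Relation.Nullary using (¬_; Dec; yes; no; contradiction)
  open import Relation.Nullary.Decidable using (True; toWitness)

  IsDomain : Ring₀ → Set
  IsDomain R = ∀ {a b} → a * b ≈ 0# → a ≈ 0# ⊎ b ≈ 0#
    where open CommutativeRing R

  Nontrivial : Ring₀ → Set
  Nontrivial R = ¬ 1# ≈ 0#
    where open CommutativeRing R

  HasInverses : Ring₀ → Set
  HasInverses R = ∀ a → ¬ a ≈ 0# → ∃[ b ] b * a ≈ 1#
    where open CommutativeRing R

  module Decidable (C : CRing) where
    open CRing C
    open CommutativeRing ring₀
    open RawRing₀ raw using (_≈0?)
    open IntegerMultiples ring₀

    difference-zero : ∀ {a b} → a - b ≈ 0# → a ≈ b
    difference-zero {a} {b} e = trans (solve 2 (λ a b → a := (a :- b) :+ b) a b) (trans (+-congʳ e) (+-identityˡ b))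

    _≈?_ : ∀ a b → Dec (a ≈ b)
    a ≈? b with (a - b) ≈0?
    ... | yes e = yes (difference-zero e)
    ... | no ¬e = no λ e → ¬e (trans (+-congʳ e) (-‿inverseʳ b))

    -- Closed identities in the iterated polynomial rings over ℤ are proved by running the zero test
    -- on the difference.
    by-computation : ∀ {a b} {_ : True (a ≈? b)} → a ≈ b
    by-computation {_} {_} {t} = toWitness t

    cancelʳ : IsDomain ring₀ → ∀ {a b} c → ¬ c ≈ 0# → a * c ≈ b * c → a ≈ b
    cancelʳ domain {a} {b} c c≉0 e with domain (trans (solve 3 (λ a b c → (a :- b) :* c := a :* c :- b :* c) a b c) (trans (+-congʳ e) (-‿inverseʳ _)))
    ... | inj₁ d = difference-zero d
    ... | inj₂ d = contradiction d c≉0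

  module PolyDomain (C : CRing) (domain : IsDomain (CRing.ring₀ C)) where
    open CRing C
    open CommutativeRing ring₀
    open RawRing₀ raw using (_≈0?)
    open Polynomial raw
    open Poly C hiding (poly)

    private
      ≋-head : ∀ {a p} → a ∷ p ≋ [] → a ≈ 0#
      ≋-head e = ≋⇒coeff e 0

      ≋-tail : ∀ {a p} → a ∷ p ≋ [] → p ≋ []
      ≋-tail e = coeff⇒≋ λ i → ≋⇒coeff e (suc i)

      ZeroProduct : Poly → Poly → Set
      ZeroProduct p q = p ⊗ q ≋ [] → p ≋ [] ⊎ q ≋ []

      -- If a constant term vanishes, a factor X can be stripped from that polynomial; if neither
      -- does, the constant term of the product is nonzero. Each recursive call shortens only one of
      -- the lists, and both calls are passed in as arguments.
      step : ∀ a p b q → ZeroProduct p (b ∷ q) → ZeroProduct (a ∷ p) q → ZeroProduct (a ∷ p) (b ∷ q)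
      step a p b q dropˡ dropʳ e with a ≈0? | b ≈0?
      ... | yes a≈0 | _ = Sum.map₁ (∷≋[] a≈0) (dropˡ (≋-tail (≋-trans (≋-sym (↑-⊗ p (b ∷ q)))
              (≋-trans (⊗-congˡ {0# ∷ p} {a ∷ p} (b ∷ q) (∷≋∷ (sym a≈0) ≋-refl)) e))))
      ... | no _ | yes b≈0 = Sum.map₂ (∷≋[] b≈0) (dropʳ (≋-tail (≋-trans
              (≋-sym (≋-trans (⊗-comm (a ∷ p) (0# ∷ q)) (≋-trans (↑-⊗ q (a ∷ p)) (↑-cong (⊗-comm q (a ∷ p))))))
              (≋-trans (⊗-congʳ (a ∷ p) {0# ∷ q} {b ∷ q} (∷≋∷ (sym b≈0) ≋-refl)) e))))
      ... | no a≉0 | no b≉0 with domain (trans (sym (+-identityʳ _)) (≋-head e))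
      ...   | inj₁ a≈0 = contradiction a≈0 a≉0
      ...   | inj₂ b≈0 = contradiction b≈0 b≉0

    poly-domain : ∀ {p q} → p ⊗ q ≋ [] → p ≋ [] ⊎ q ≋ []
    poly-domain {[]}    {q}     e = inj₁ []≋[]
    poly-domain {a ∷ p} {[]}    e = inj₂ []≋[]
    poly-domain {a ∷ p} {b ∷ q} e = step a p b q (poly-domain {p} {b ∷ q}) (poly-domain {a ∷ p} {q}) e

  ℤ-domain : IsDomain ℤ-ring
  ℤ-domain {a} = ℤₚ.i*j≡0⇒i≡0∨j≡0 a

  domain-cancelʳ : ∀ (R : Ring₀) → IsDomain R → let open CommutativeRing R in
    ∀ {a b c} → ¬ c ≈ 0# → a * c ≈ b * c → a ≈ b
  domain-cancelʳ R domain {a} {b} {c} c≉0 e =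
    Sum.[ difference-zero , (λ z → contradiction z c≉0) ]′ (domain (trans (solve 3 (λ a b c → (a :- b) :* c := a :* c :- b :* c) a b c) (trans (+-congʳ e) (-‿inverseʳ _))))
    where
    open CommutativeRing R
    open IntegerMultiples R
    difference-zero : a - b ≈ 0# → a ≈ b
    difference-zero d = trans (solve 2 (λ a b → a := (a :- b) :+ b) a b) (trans (+-congʳ d) (+-identityˡ b))

-- Determinants and row operations

module Determinants where
  open import Defs using (RawRing₀; module Polynomial; module RawRing₀)
  open Rings
  open import Algebra.Bundles using (CommutativeRing)
  import Algebra.Properties.Ring
  import Algebra.Properties.CommutativeMonoid.Sum
  import Algebra.Properties.Semiring.Sum
  open import Data.Fin.Base as Fin using (Fin; zero; suc; toℕ; inject₁; punchIn; punchOut; fromℕ<)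
  import Data.Fin.Properties as Finₚ
  import Data.Integer.Base as ℤ
  open import Data.Nat.Base as ℕ using (ℕ; zero; suc; _<_; s≤s)
  import Data.Nat.Properties as ℕₚ
  open import Data.Product.Base using (_,_; _×_; Σ-syntax)
  open import Data.Sum.Base using (_⊎_; inj₁; inj₂)
  open import Function.Base using (_∘_)
  open import Relation.Nullary using (¬_; yes; no; contradiction)
  open import Relation.Binary.Definitions using (tri<; tri≈; tri>)
  open import Relation.Binary.PropositionalEquality as ≡ using (_≡_; _≢_)

  adjacent-punchIn : ∀ {n} (r : Fin (suc (suc n))) (i : Fin (suc n)) → r ≢ inject₁ i → r ≢ suc i →
    Σ[ i′ ∈ Fin n ] (punchIn r (inject₁ i′) ≡ inject₁ i) × (punchIn r (suc i′) ≡ suc i)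
  adjacent-punchIn zero zero p q = contradiction ≡.refl p
  adjacent-punchIn zero (suc i) p q = i , ≡.refl , ≡.refl
  adjacent-punchIn (suc zero) zero p q = contradiction ≡.refl q
  adjacent-punchIn {suc n} (suc (suc r)) zero p q = zero , ≡.refl , ≡.refl
  adjacent-punchIn {suc n} (suc r) (suc i) p q
    with i′ , e , f ← adjacent-punchIn r i (p ∘ ≡.cong suc) (q ∘ ≡.cong suc)
    = suc i′ , ≡.cong suc e , ≡.cong suc f

  -- Deleting row i or deleting row i + 1 leaves the same rows, except that one list keeps row i + 1
  -- where the other keeps row i. If these two rows are equal, the minors coincide.
  punchIn-neighbours : ∀ {n} (i : Fin n) (x : Fin n) →
    punchIn (inject₁ i) x ≡ punchIn (suc i) x ⊎
    (punchIn (inject₁ i) x ≡ suc i × punchIn (suc i) x ≡ inject₁ i)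
  punchIn-neighbours zero zero = inj₂ (≡.refl , ≡.refl)
  punchIn-neighbours zero (suc x) = inj₁ ≡.refl
  punchIn-neighbours (suc i) zero = inj₁ ≡.refl
  punchIn-neighbours (suc i) (suc x) with punchIn-neighbours i x
  ... | inj₁ e = inj₁ (≡.cong suc e)
  ... | inj₂ (e , f) = inj₂ (≡.cong suc e , ≡.cong suc f)

  module Determinant (C : CRing) where
    open CRing C
    open CommutativeRing ring₀ hiding (zero)
    open Polynomial raw using (Matrix; det)
    open RawRing₀ raw using (_^_; sum)
    open Algebra.Properties.Ring ring using (-0#≈0#)
    open Algebra.Properties.CommutativeMonoid.Sum +-commutativeMonoid
      using (sum-cong-≋; ∑-distrib-+; sum-remove; sum-replicate-zero)
    open Algebra.Properties.Semiring.Sum semiring using (*-distribˡ-sum)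
    open IntegerMultiples ring₀
    open import Relation.Binary.Reasoning.Setoid setoid

    minor : ∀ {n} → Matrix (suc n) → Fin (suc n) → Matrix n
    minor M i r s = M (punchIn i r) (suc s)

    sign : ∀ {n} → Fin n → Carrier
    sign i = (- 1#) ^ toℕ i

    term : ∀ {n} → Matrix (suc n) → Fin (suc n) → Carrier
    term M i = sign i * (M i zero * det (minor M i))

    det-cong : ∀ {n} {M N : Matrix n} → (∀ i j → M i j ≈ N i j) → det M ≈ det N
    det-cong {zero}  h = refl
    det-cong {suc n} h = sum-cong-≋ λ i →
      *-congˡ {sign i} (*-cong (h i zero) (det-cong λ r s → h (punchIn i r) (suc s)))

    sum-zero : ∀ {n} {f : Fin n → Carrier} → (∀ i → f i ≈ 0#) → sum f ≈ 0#
    sum-zero {n} h = trans (sum-cong-≋ h) (sum-replicate-zero n)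

    sum-single : ∀ {n} (f : Fin (suc n) → Carrier) i → (∀ r → r ≢ i → f r ≈ 0#) → sum f ≈ f i
    sum-single f i h = trans (sum-remove {i = i} f)
      (trans (+-congˡ (sum-zero λ r → h (punchIn i r) (Finₚ.punchInᵢ≢i i r))) (+-identityʳ _))

    sum-adjacent : ∀ {n} (f : Fin (suc (suc n)) → Carrier) (i : Fin (suc n)) →
      (∀ r → r ≢ inject₁ i → r ≢ suc i → f r ≈ 0#) → f (inject₁ i) + f (suc i) ≈ 0# → sum f ≈ 0#
    sum-adjacent f zero h e = begin
      f zero + (f (suc zero) + _)   ≈⟨ +-assoc _ _ _ ⟨
      f zero + f (suc zero) + _     ≈⟨ +-cong e (sum-zero λ r → h (suc (suc r)) (λ ()) (λ ())) ⟩
      0# + 0#                       ≈⟨ +-identityʳ 0# ⟩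
      0#                            ∎
    sum-adjacent {suc n} f (suc i) h e = trans
      (+-cong (h zero (λ ()) (λ ()))
        (sum-adjacent (f ∘ suc) i (λ r p q → h (suc r) (p ∘ Finₚ.suc-injective) (q ∘ Finₚ.suc-injective)) e))
      (+-identityʳ 0#)

    -- In the Laplace expansion the term of row i has the same minor for all three matrices; in
    -- every other term the claim passes to the minors.
    det-row-linear : ∀ {n} (M N P : Matrix n) i c →
      (∀ j → P i j ≈ M i j + c * N i j) →
      (∀ r → r ≢ i → ∀ j → P r j ≈ M r j) → (∀ r → r ≢ i → ∀ j → N r j ≈ M r j) →
      det P ≈ det M + c * det N
    det-row-linear {suc n} M N P i c at-i PM NM = begin
      sum (term P)                                ≈⟨ sum-cong-≋ linear ⟩
      sum (λ r → term M r + c * term N r)         ≈⟨ ∑-distrib-+ (term M) (λ r → c * term N r) ⟩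
      sum (term M) + sum (λ r → c * term N r)     ≈⟨ +-congˡ (*-distribˡ-sum c (term N)) ⟨
      det M + c * det N                           ∎
      where
      linear : ∀ r → term P r ≈ term M r + c * term N r
      linear r with r Finₚ.≟ i
      ... | yes ≡.refl = begin
        sign r * (P r zero * det (minor P r))
          ≈⟨ *-congˡ (*-cong (at-i zero) (det-cong λ x y → PM (punchIn r x) (Finₚ.punchInᵢ≢i r x) (suc y))) ⟩
        sign r * ((M r zero + c * N r zero) * det (minor M r))
          ≈⟨ solve 5 (λ s a c b d → s :* ((a :+ c :* b) :* d) := s :* (a :* d) :+ c :* (s :* (b :* d)))
               (sign r) (M r zero) c (N r zero) (det (minor M r)) ⟩
        term M r + c * (sign r * (N r zero * det (minor M r)))
          ≈⟨ +-congˡ (*-congˡ (*-congˡ (*-congˡ (det-cong λ x y → NM (punchIn r x) (Finₚ.punchInᵢ≢i r x) (suc y))))) ⟨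
        term M r + c * term N r ∎
      ... | no r≢i = begin
        sign r * (P r zero * det (minor P r))
          ≈⟨ *-congˡ (*-cong (PM r r≢i zero) (det-row-linear (minor M r) (minor N r) (minor P r) i′ c
               (λ j → ≡.subst (λ k → P k (suc j) ≈ M k (suc j) + c * N k (suc j)) (≡.sym i′↦i) (at-i (suc j)))
               (λ x x≢i′ j → PM (punchIn r x) (x≢i′ ∘ back x) (suc j))
               (λ x x≢i′ j → NM (punchIn r x) (x≢i′ ∘ back x) (suc j)))) ⟩
        sign r * (M r zero * (det (minor M r) + c * det (minor N r)))
          ≈⟨ solve 5 (λ s a c d e → s :* (a :* (d :+ c :* e)) := s :* (a :* d) :+ c :* (s :* (a :* e)))
               (sign r) (M r zero) c (det (minor M r)) (det (minor N r)) ⟩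
        term M r + c * (sign r * (M r zero * det (minor N r)))
          ≈⟨ +-congˡ (*-congˡ (*-congˡ (*-congʳ (NM r r≢i zero)))) ⟨
        term M r + c * term N r ∎
        where
        i′ = punchOut r≢i
        i′↦i : punchIn r i′ ≡ i
        i′↦i = Finₚ.punchIn-punchOut r≢i
        back : ∀ x → punchIn r x ≡ i → x ≡ i′
        back x e = Finₚ.punchIn-injective r x i′ (≡.trans e (≡.sym i′↦i))

    -- The terms of the other rows vanish by induction, as the equal rows stay adjacent in their
    -- minors; the two remaining terms have equal minors and opposite signs.
    det-adjacent-equal : ∀ {n} (M : Matrix (suc n)) (i : Fin n) →
      (∀ j → M (inject₁ i) j ≈ M (suc i) j) → det M ≈ 0#
    det-adjacent-equal {suc n} M i e = sum-adjacent (term M) i other cancel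
      where
      other : ∀ r → r ≢ inject₁ i → r ≢ suc i → term M r ≈ 0#
      other r p q with i′ , f , g ← adjacent-punchIn r i p q = trans
        (*-congˡ (trans (*-congˡ (det-adjacent-equal (minor M r) i′ λ j →
          ≡.subst₂ (λ a b → M a (suc j) ≈ M b (suc j)) (≡.sym f) (≡.sym g) (e (suc j)))) (zeroʳ _)))
        (zeroʳ _)
      sameMinor : ∀ x y → minor M (inject₁ i) x y ≈ minor M (suc i) x y
      sameMinor x y with punchIn-neighbours i x
      ... | inj₁ f = reflexive (≡.cong (λ a → M a (suc y)) f)
      ... | inj₂ (f , g) = trans (reflexive (≡.cong (λ a → M a (suc y)) f))
        (trans (sym (e (suc y))) (reflexive (≡.cong (λ a → M a (suc y)) (≡.sym g))))
      cancel : term M (inject₁ i) + term M (suc i) ≈ 0#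
      cancel = begin
        term M (inject₁ i) + term M (suc i)
          ≈⟨ +-congʳ (*-cong (reflexive (≡.cong ((- 1#) ^_) (Finₚ.toℕ-inject₁ i))) (*-cong (e zero) (det-cong sameMinor))) ⟩
        sign i * (M (suc i) zero * det (minor M (suc i))) + - 1# * sign i * (M (suc i) zero * det (minor M (suc i)))
          ≈⟨ solve 3 (λ s t o → s :* t :+ (:- o) :* s :* t := (con ℤ.1ℤ :- o) :* (s :* t)) (sign i) (M (suc i) zero * det (minor M (suc i))) 1# ⟩
        (ι ℤ.1ℤ - 1#) * _ ≈⟨ *-congʳ (trans (+-congʳ (+-identityʳ 1#)) (-‿inverseʳ 1#)) ⟩
        0# * _ ≈⟨ zeroˡ _ ⟩
        0# ∎

    infixl 10 _[_≔_]
    _[_≔_] : ∀ {n} → Matrix n → Fin n → (Fin n → Carrier) → Matrix n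
    (M [ i ≔ v ]) r j with r Finₚ.≟ i
    ... | yes _ = v j
    ... | no  _ = M r j

    ≔-at : ∀ {n} (M : Matrix n) i v j → (M [ i ≔ v ]) i j ≈ v j
    ≔-at M i v j with i Finₚ.≟ i
    ... | yes _ = refl
    ... | no ¬e = contradiction ≡.refl ¬e

    ≔-off : ∀ {n} (M : Matrix n) i v r → r ≢ i → ∀ j → (M [ i ≔ v ]) r j ≈ M r j
    ≔-off M i v r r≢i j with r Finₚ.≟ i
    ... | yes e = contradiction e r≢i
    ... | no _  = refl

    private
      -- Induction on the distance d. Let w be the row `suc b` and u the row above it. Expanding the
      -- vanishing determinant with u + w in both places gives det (F u w) + det (F w u) = 0, and in
      -- F w u the two equal rows are one step closer.
      det-equal-rows< : ∀ d {n} (M : Matrix n) a b → toℕ b ≡ d ℕ.+ suc (toℕ a) →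
        (∀ j → M a j ≈ M b j) → det M ≈ 0#
      det-equal-rows< zero {suc n} M a (suc b) eq e = det-adjacent-equal M b λ j →
        ≡.subst (λ x → M x j ≈ M (suc b) j) a≡ (e j)
        where
        a≡ : a ≡ inject₁ b
        a≡ = Finₚ.toℕ-injective (≡.trans (≡.sym (ℕₚ.suc-injective eq)) (≡.sym (Finₚ.toℕ-inject₁ b)))
      det-equal-rows< (suc d) {suc n} M a (suc b) eq e = begin
        det M                         ≈⟨ det-cong (λ r j → M≈Fuw r j) ⟩
        det (F u w)                   ≈⟨ +-identityʳ _ ⟨
        det (F u w) + 0#              ≈⟨ +-congˡ Fwu≈0 ⟨
        det (F u w) + det (F w u)     ≈⟨ total ⟨
        det (F u+w u+w)               ≈⟨ diagonal u+w ⟩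
        0#                            ∎
        where
        c = inject₁ b
        u w u+w : Fin (suc n) → Carrier
        u = M c
        w = M (suc b)
        u+w j = u j + 1# * w j
        F : (x y : Fin (suc n) → Carrier) → Matrix (suc n)
        F x y = M [ c ≔ x ] [ suc b ≔ y ]
        c≢sb : c ≢ suc b
        c≢sb f = ℕₚ.1+n≢n (≡.trans (≡.sym (≡.cong toℕ f)) (Finₚ.toℕ-inject₁ b))
        toℕc : toℕ c ≡ d ℕ.+ suc (toℕ a)
        toℕc = ≡.trans (Finₚ.toℕ-inject₁ b) (ℕₚ.suc-injective eq)
        a≢c : a ≢ c
        a≢c f = ℕₚ.m≢1+n+m (toℕ a) (≡.trans (≡.cong toℕ f) (≡.trans toℕc (ℕₚ.+-suc d (toℕ a))))
        a≢sb : a ≢ suc b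
        a≢sb f = ℕₚ.m≢1+n+m (toℕ a) (≡.trans (≡.cong toℕ f) (≡.trans eq (≡.cong suc (ℕₚ.+-suc d (toℕ a)))))
        atᵇ : ∀ x y j → F x y (suc b) j ≈ y j
        atᵇ x y = ≔-at _ (suc b) y
        atᶜ : ∀ x y j → F x y c j ≈ x j
        atᶜ x y j = trans (≔-off _ (suc b) y c c≢sb j) (≔-at M c x j)
        off : ∀ x y r → r ≢ c → r ≢ suc b → ∀ j → F x y r j ≈ M r j
        off x y r p q j = trans (≔-off _ (suc b) y r q j) (≔-off M c x r p j)
        M≈Fuw : ∀ r j → M r j ≈ F u w r j
        M≈Fuw r j with r Finₚ.≟ suc b
        ... | yes ≡.refl = refl
        ... | no _ with r Finₚ.≟ c
        ...   | yes ≡.refl = refl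
        ...   | no _ = refl
        diagonal : ∀ x → det (F x x) ≈ 0#
        diagonal x = det-adjacent-equal (F x x) b λ j → trans (atᶜ x x j) (sym (atᵇ x x j))
        Fwu≈0 : det (F w u) ≈ 0#
        Fwu≈0 = det-equal-rows< d (F w u) a c toℕc λ j →
          trans (off w u a a≢c a≢sb j) (trans (e j) (sym (atᶜ w u j)))
        splitᶜ : ∀ y → det (F u+w y) ≈ det (F u y) + 1# * det (F w y)
        splitᶜ y = det-row-linear (F u y) (F w y) (F u+w y) c 1#
          (λ j → trans (atᶜ u+w y j) (sym (+-cong (atᶜ u y j) (*-congˡ (atᶜ w y j)))))
          (λ r r≢c j → same r r≢c u+w u j) (λ r r≢c j → same r r≢c w u j)
          where
          same : ∀ r → r ≢ c → ∀ x x′ j → F x y r j ≈ F x′ y r j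
          same r r≢c x x′ j with r Finₚ.≟ suc b
          ... | yes _ = refl
          ... | no _ = trans (≔-off M c x r r≢c j) (sym (≔-off M c x′ r r≢c j))
        splitᵇ : ∀ x → det (F x u+w) ≈ det (F x u) + 1# * det (F x w)
        splitᵇ x = det-row-linear (F x u) (F x w) (F x u+w) (suc b) 1#
          (λ j → trans (atᵇ x u+w j) (sym (+-cong (atᵇ x u j) (*-congˡ (atᵇ x w j)))))
          (λ r q j → trans (≔-off _ (suc b) u+w r q j) (sym (≔-off _ (suc b) u r q j)))
          (λ r q j → trans (≔-off _ (suc b) w r q j) (sym (≔-off _ (suc b) u r q j)))
        total : det (F u+w u+w) ≈ det (F u w) + det (F w u)
        total = begin
          det (F u+w u+w)                          ≈⟨ splitᶜ u+w ⟩
          det (F u u+w) + 1# * det (F w u+w)       ≈⟨ +-cong (splitᵇ u) (*-congˡ (splitᵇ w)) ⟩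
          (det (F u u) + 1# * det (F u w)) + 1# * (det (F w u) + 1# * det (F w w))
            ≈⟨ +-cong (+-cong (diagonal u) (*-identityˡ _)) (trans (*-identityˡ _) (+-congˡ (trans (*-identityˡ _) (diagonal w)))) ⟩
          (0# + det (F u w)) + (det (F w u) + 0#)  ≈⟨ +-cong (+-identityˡ _) (+-identityʳ _) ⟩
          det (F u w) + det (F w u)                ∎

    det-equal-rows : ∀ {n} (M : Matrix n) a b → a ≢ b → (∀ j → M a j ≈ M b j) → det M ≈ 0#
    det-equal-rows M a b a≢b e with ℕₚ.<-cmp (toℕ a) (toℕ b)
    ... | tri< a<b _ _ = det-equal-rows< _ M a b (≡.sym (ℕₚ.m∸n+n≡m a<b)) e
    ... | tri≈ _ q _ = contradiction (Finₚ.toℕ-injective q) a≢b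
    ... | tri> _ _ b<a = det-equal-rows< _ M b a (≡.sym (ℕₚ.m∸n+n≡m b<a)) λ j → sym (e j)

    -- Rows are changed one at a time: in the m-th matrix the first m rows are done.
    det-add-multiples : ∀ {n} (M N : Matrix n) r (c : Fin n → Carrier) → c r ≈ 0# →
      (∀ i j → N i j ≈ M i j + c i * M r j) → det N ≈ det M
    det-add-multiples {n} M N r c cr≈0 h = begin
      det N           ≈⟨ det-cong (λ i j → trans (h i j) (sym (done i j (Finₚ.toℕ<n i)))) ⟩
      det (stage n)   ≈⟨ stages n ⟩
      det M           ∎
      where
      stage : ℕ → Matrix n
      stage m i j with toℕ i ℕₚ.<? m
      ... | yes _ = M i j + c i * M r j
      ... | no _  = M i j
      done : ∀ {m} i j → toℕ i < m → stage m i j ≈ M i j + c i * M r j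
      done {m} i j lt with toℕ i ℕₚ.<? m
      ... | yes _ = refl
      ... | no ¬lt = contradiction lt ¬lt
      todo : ∀ {m} i j → ¬ toℕ i < m → stage m i j ≈ M i j
      todo {m} i j ¬lt with toℕ i ℕₚ.<? m
      ... | yes lt = contradiction lt ¬lt
      ... | no _ = refl
      pivot : ∀ m j → stage m r j ≈ M r j
      pivot m j with toℕ r ℕₚ.<? m
      ... | yes _ = trans (+-congˡ (trans (*-congʳ cr≈0) (zeroˡ _))) (+-identityʳ _)
      ... | no _ = refl
      stages : ∀ m → det (stage m) ≈ det M
      stages zero = det-cong λ i j → todo {0} i j (λ ())
      stages (suc m) with m ℕₚ.<? n
      ... | no m≮n = trans (det-cong λ i j → trans
              (done i j (ℕₚ.m<n⇒m<1+n (below i))) (sym (done i j (below i)))) (stages m)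
        where
        below : ∀ i → toℕ i < m
        below i = ℕₚ.<-≤-trans (Finₚ.toℕ<n i) (ℕₚ.≮⇒≥ m≮n)
      ... | yes m<n = begin
        det (stage (suc m)) ≈⟨ det-row-linear (stage m) R (stage (suc m)) i (c i)
          (λ j → trans (done i j (s≤s (ℕₚ.≤-reflexive toℕi)))
            (sym (+-cong (todo i j (λ lt → ℕₚ.<-irrefl toℕi lt)) (*-congˡ (≔-at (stage m) i (M r) j)))))
          (λ x x≢i j → same x x≢i j) (λ x x≢i j → ≔-off (stage m) i (M r) x x≢i j) ⟩
        det (stage m) + c i * det R ≈⟨ +-cong (stages m) cR≈0 ⟩
        det M + 0#                  ≈⟨ +-identityʳ _ ⟩
        det M                       ∎
        where
        i = fromℕ< m<n
        toℕi : toℕ i ≡ m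
        toℕi = Finₚ.toℕ-fromℕ< m<n
        R = stage m [ i ≔ M r ]
        same : ∀ x → x ≢ i → ∀ j → stage (suc m) x j ≈ stage m x j
        same x x≢i j with toℕ x ℕₚ.<? m
        ... | yes lt = done x j (ℕₚ.m<n⇒m<1+n lt)
        ... | no ¬lt = todo x j λ lt → x≢i (Finₚ.toℕ-injective
                (≡.trans (ℕₚ.≤-antisym (ℕ.s≤s⁻¹ lt) (ℕₚ.≮⇒≥ ¬lt)) (≡.sym toℕi)))
        cR≈0 : c i * det R ≈ 0#
        cR≈0 with i Finₚ.≟ r
        ... | yes i≡r = trans (*-congʳ (≡.subst (λ x → c x ≈ 0#) (≡.sym i≡r) cr≈0)) (zeroˡ _)
        ... | no i≢r = trans (*-congˡ (det-equal-rows R r i (i≢r ∘ ≡.sym) λ j →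
                trans (≔-off (stage m) i (M r) r (i≢r ∘ ≡.sym) j)
                  (trans (pivot m j) (sym (≔-at (stage m) i (M r) j))))) (zeroʳ _)

    -- Gaussian elimination in the first column: row r clears every other entry, after which a
    -- single term of the Laplace expansion survives.
    det-pivot : ∀ {n} (M : Matrix (suc n)) r → M r zero ≈ 1# →
      det M ≈ sign r * det λ i j → M (punchIn r i) (suc j) + - M (punchIn r i) zero * M r (suc j)
    det-pivot {n} M r pivot = begin
      det M                                     ≈⟨ det-add-multiples M N r c c-at (λ _ _ → refl) ⟨
      sum (term N)                              ≈⟨ sum-single (term N) r vanish ⟩
      sign r * (N r zero * det (minor N r))     ≈⟨ *-congˡ (trans (*-congʳ N-pivot) (*-identityˡ _)) ⟩
      sign r * det (minor N r)                  ≈⟨ *-congˡ (det-cong λ i j →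
        +-congˡ (*-congʳ (c-off (punchIn r i) (Finₚ.punchInᵢ≢i r i)))) ⟩
      sign r * det {n} (λ i j → M (punchIn r i) (suc j) + - M (punchIn r i) zero * M r (suc j)) ∎
      where
      c : Fin (suc n) → Carrier
      c i with i Finₚ.≟ r
      ... | yes _ = 0#
      ... | no _  = - M i zero
      c-at : c r ≈ 0#
      c-at with r Finₚ.≟ r
      ... | yes _ = refl
      ... | no ¬e = contradiction ≡.refl ¬e
      c-off : ∀ i → i ≢ r → c i ≈ - M i zero
      c-off i i≢r with i Finₚ.≟ r
      ... | yes e = contradiction e i≢r
      ... | no _ = refl
      N : Matrix (suc n)
      N i j = M i j + c i * M r j
      N-pivot : N r zero ≈ 1#
      N-pivot = trans (+-cong pivot (trans (*-congʳ c-at) (zeroˡ _))) (+-identityʳ 1#)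
      vanish : ∀ i → i ≢ r → term N i ≈ 0#
      vanish i i≢r = trans (*-congˡ (trans (*-congʳ (trans
        (+-congˡ (trans (*-cong (c-off i i≢r) pivot) (*-identityʳ _))) (-‿inverseʳ _))) (zeroˡ _))) (zeroʳ _)

-- Resultants as determinants of multiplication maps

module Resultants where
  open import Defs using (RawRing₀; module Polynomial; module RawRing₀)
  open Rings
  open Determinants
  open import Algebra.Bundles using (CommutativeRing)
  import Algebra.Properties.Ring
  import Relation.Binary.Reasoning.Setoid as SetoidReasoning
  open import Data.Bool.Base using (true; false; T)
  open import Data.Fin.Base as Fin using (Fin; zero; suc; toℕ; splitAt; punchIn)
  import Data.Fin.Properties as Finₚ
  import Data.Integer.Base as ℤ
  open import Data.List.Base as List using (List; []; _∷_)
  open import Data.Nat.Base as ℕ using (ℕ; zero; suc; _<_; _≤_; _≤ᵇ_; s≤s; z≤n; _∸_)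
  import Data.Nat.Properties as ℕₚ
  open import Data.Product.Base using (_,_; ∃-syntax)
  open import Data.Sum.Base as Sum using (inj₁; inj₂; [_,_]′)
  open import Data.Unit.Base using (tt)
  open import Function.Base using (_∘_)
  open import Relation.Nullary using (yes; no; contradiction)
  open import Relation.Binary.PropositionalEquality as ≡ using (_≡_)

  module SylvesterRows (raw : RawRing₀) where
    open RawRing₀ raw
    open Polynomial raw using (Matrix; det; Poly; coeff; deg; _≋_; _⊕_; Res)

    shift : ℕ → Poly → Poly
    shift zero    p = p
    shift (suc s) p = 0# ∷ shift s p

    -- Rows are read as polynomials, highest coefficient in the first column. In this reading a row
    -- operation with a shift of Φ is a division step by Φ.
    rowsMatrix : ∀ {n} → (Fin n → Poly) → Matrix n
    rowsMatrix {n} v i j = coeff (v i) (n ∸ suc (toℕ j))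

    module Reduce (Φ : Poly) (e : ℕ) where

      -- Removes the term of degree m + e when Φ is monic of degree e; iterated by `reduce`, it
      -- yields the remainder modulo Φ. It never inspects actual degrees, which lets it run in
      -- parallel with the pivoting of a matrix whose shape is fixed.
      reduceStep : ℕ → Poly → Poly
      reduceStep m w = w ⊕ List.map ((- coeff w (m ℕ.+ e)) *_) (shift m Φ)

      reduce : ℕ → Poly → Poly
      reduce zero    w = w
      reduce (suc m) w = reduce m (reduceStep m w)

    ReducesTo : (Φ q : Poly) (d e : ℕ) → (Fin d → Poly) → Set
    ReducesTo Φ q d e v = ∀ r → Reduce.reduce Φ d e (shift (d ∸ suc (toℕ r)) q) ≋ v r

    -- For monic Φ the resultant is the determinant of multiplication by q on polynomials modulo Φ:
    -- row r of the matrix is the remainder of X^(d-1-r) q. The degrees are variables tied to `deg`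
    -- by equations, so that instances can supply numerals.
    ResMonic : Set
    ResMonic = ∀ {Φ′ Φ q w d e} → Φ′ ≋ Φ → deg Φ ≡ d → deg q ≡ e → coeff Φ d ≈ 1# →
      (v : Fin d → Poly) → ReducesTo Φ q d e v → det (rowsMatrix v) ≈ w → Res Φ′ q ≈ w

  module Resultant (C : CRing) where
    open CRing C
    open CommutativeRing ring₀ hiding (zero)
    open Polynomial raw using (Matrix; det; Poly; coeff; deg; _≋_; []≋[]; ∷≋∷; ∷≋[]; []≋∷; _≋0?; shiftedRow; sylvester; Res; _⊕_; _⊗_; const)
    open RawRing₀ raw using (_^_; sum)
    open Poly C hiding (poly)
    open Determinant C
    open Algebra.Properties.Ring ring using (-0#≈0#)
    open IntegerMultiples ring₀
    open SylvesterRows raw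
    open import Relation.Binary.Reasoning.Setoid setoid

    deg-cong : ∀ {p q} → p ≋ q → deg p ≡ deg q
    deg-cong []≋[] = ≡.refl
    deg-cong {a ∷ p} {b ∷ q} (∷≋∷ _ e) with p ≋0? | q ≋0?
    ... | yes _   | yes _   = ≡.refl
    ... | no _    | no _    = ≡.cong suc (deg-cong e)
    ... | yes p≋0 | no q≋̸0  = contradiction (≋-trans (≋-sym e) p≋0) q≋̸0
    ... | no p≋̸0  | yes q≋0 = contradiction (≋-trans e q≋0) p≋̸0
    deg-cong {a ∷ p} (∷≋[] _ e) with p ≋0?
    ... | yes _  = ≡.refl
    ... | no p≋̸0 = contradiction e p≋̸0
    deg-cong {[]} {b ∷ q} ([]≋∷ _ e) with q ≋0?
    ... | yes _  = ≡.refl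
    ... | no q≋̸0 = contradiction (≋-sym e) q≋̸0

    coeff-above-deg : ∀ p i → deg p < i → coeff p i ≈ 0#
    coeff-above-deg [] i lt = refl
    coeff-above-deg (a ∷ p) (suc i) lt with p ≋0?
    ... | yes p≋0 = ≋⇒coeff p≋0 i
    ... | no _    = coeff-above-deg p i (ℕ.s≤s⁻¹ lt)

    -- Separating the degrees from the polynomials makes it possible to replace `deg p` by an equal
    -- number in the size of the matrix.
    Res′ : (p q : Poly) (d e : ℕ) → Carrier
    Res′ p q d e = det {e ℕ.+ d} λ i j →
      [ (λ r → shiftedRow p d (toℕ r) (toℕ j)) , (λ r → shiftedRow q e (toℕ r) (toℕ j)) ]′ (splitAt e i)

    shiftedRow-cong : ∀ {p q} → p ≋ q → ∀ d i j → shiftedRow p d i j ≈ shiftedRow q d i j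
    shiftedRow-cong e d i j with j ≤ᵇ d ℕ.+ i
    ... | true  = ≋⇒coeff e (d ℕ.+ i ∸ j)
    ... | false = refl

    Res-cong : ∀ {p p′ q q′} → p ≋ p′ → q ≋ q′ → Res p q ≈ Res p′ q′
    Res-cong {p} {p′} {q} {q′} e f = trans
      (reflexive (≡.cong₂ (Res′ p q) (deg-cong e) (deg-cong f)))
      (det-cong same)
      where
      sylv : (p q : Poly) → Matrix (deg q′ ℕ.+ deg p′)
      sylv p q i j = [ (λ r → shiftedRow p (deg p′) (toℕ r) (toℕ j))
                     , (λ r → shiftedRow q (deg q′) (toℕ r) (toℕ j)) ]′ (splitAt (deg q′) i)
      same : ∀ i j → sylv p q i j ≈ sylv p′ q′ i j
      same i j with splitAt (deg q′) i
      ... | inj₁ r = shiftedRow-cong e (deg p′) (toℕ r) (toℕ j)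
      ... | inj₂ r = shiftedRow-cong f (deg q′) (toℕ r) (toℕ j)

    coeff-shift : ∀ s p m → coeff (shift s p) (s ℕ.+ m) ≡ coeff p m
    coeff-shift zero    p m = ≡.refl
    coeff-shift (suc s) p m = coeff-shift s p m

    coeff-shift-low : ∀ s p m → m < s → coeff (shift s p) m ≡ 0#
    coeff-shift-low (suc s) p zero    lt = ≡.refl
    coeff-shift-low (suc s) p (suc m) lt = coeff-shift-low s p m (ℕ.s≤s⁻¹ lt)

    private
      shiftedRow-shift : ∀ p s d r j n → n ≡ s ℕ.+ suc (d ℕ.+ r) → j < n →
        shiftedRow p d r j ≡ coeff (shift s p) (n ∸ suc j)
      shiftedRow-shift p s d r j n eq j<n with j ≤ᵇ d ℕ.+ r in le
      ... | true = ≡.trans (≡.sym (coeff-shift s p (d ℕ.+ r ∸ j))) (≡.cong (coeff (shift s p)) index)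
        where
        j≤ : j ≤ d ℕ.+ r
        j≤ = ℕₚ.≤ᵇ⇒≤ j _ (≡.subst T (≡.sym le) tt)
        index : s ℕ.+ (d ℕ.+ r ∸ j) ≡ n ∸ suc j
        index = ≡.trans (≡.sym (ℕₚ.+-∸-assoc s j≤)) (≡.sym (≡.cong (_∸ suc j) (≡.trans eq (ℕₚ.+-suc s _))))
      ... | false = ≡.sym (coeff-shift-low s p (n ∸ suc j) small)
        where
        j> : suc (d ℕ.+ r) ≤ j
        j> = ℕₚ.≰⇒> λ j≤ → ≡.subst T le (ℕₚ.≤⇒≤ᵇ j≤)
        small : n ∸ suc j < s
        small = ℕₚ.+-cancelʳ-< (suc j) _ s (≡.subst (_< s ℕ.+ suc j) (≡.sym (ℕₚ.m∸n+n≡m j<n))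
          (≡.subst (_< s ℕ.+ suc j) (≡.sym eq) (ℕₚ.+-monoʳ-< s (s≤s j>))))

    sylvesterRows : (p q : Poly) (d e : ℕ) → Fin (e ℕ.+ d) → Poly
    sylvesterRows p q d e i =
      [ (λ r → shift (e ∸ suc (toℕ r)) p) , (λ r → shift (d ∸ suc (toℕ r)) q) ]′ (splitAt e i)

    Res-rows : ∀ p q → Res p q ≈ det (rowsMatrix (sylvesterRows p q (deg p) (deg q)))
    Res-rows p q = det-cong same
      where
      d = deg p
      e = deg q
      same : ∀ i j → sylvester p q i j ≈ rowsMatrix (sylvesterRows p q d e) i j
      same i j with splitAt e i
      ... | inj₁ r = reflexive (shiftedRow-shift p (e ∸ suc (toℕ r)) d (toℕ r) (toℕ j) (e ℕ.+ d) eq (Finₚ.toℕ<n j))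
        where
        eq : e ℕ.+ d ≡ (e ∸ suc (toℕ r)) ℕ.+ suc (d ℕ.+ toℕ r)
        eq = ≡.trans (≡.cong (ℕ._+ d) (≡.sym (ℕₚ.m∸n+n≡m (Finₚ.toℕ<n r))))
          (≡.trans (ℕₚ.+-assoc _ (suc (toℕ r)) d) (≡.cong (λ x → (e ∸ suc (toℕ r)) ℕ.+ suc x) (ℕₚ.+-comm (toℕ r) d)))
      ... | inj₂ r = reflexive (shiftedRow-shift q (d ∸ suc (toℕ r)) e (toℕ r) (toℕ j) (e ℕ.+ d) eq (Finₚ.toℕ<n j))
        where
        eq : e ℕ.+ d ≡ (d ∸ suc (toℕ r)) ℕ.+ suc (e ℕ.+ toℕ r)
        eq = ≡.trans (ℕₚ.+-comm e d) (≡.trans (≡.cong (ℕ._+ e) (≡.sym (ℕₚ.m∸n+n≡m (Finₚ.toℕ<n r))))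
          (≡.trans (ℕₚ.+-assoc _ (suc (toℕ r)) e) (≡.cong (λ x → (d ∸ suc (toℕ r)) ℕ.+ suc x) (ℕₚ.+-comm (toℕ r) e))))

    module Reduction (Φ : Poly) (e : ℕ) (lead : coeff Φ e ≈ 1#) (above : ∀ i → e < i → coeff Φ i ≈ 0#) where
      open Reduce Φ e

      coeff-reduceStep : ∀ m w i →
        coeff (reduceStep m w) i ≈ coeff w i + - coeff w (m ℕ.+ e) * coeff (shift m Φ) i
      coeff-reduceStep m w i = trans (coeff-⊕ w _ i) (+-congˡ (coeff-· _ (shift m Φ) i))

      shift-⊗ : ∀ m → ∃[ q ] shift m Φ ≋ q ⊗ Φ
      shift-⊗ zero = const 1# , ≋-sym (⊗-identityˡ Φ)
      shift-⊗ (suc m) with q , e ← shift-⊗ m = 0# ∷ q , ≋-trans (↑-cong e) (≋-sym (↑-⊗ q Φ))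

      reduce-∣ : ∀ m w → ∃[ q ] reduce m w ≋ w ⊕ q ⊗ Φ
      reduce-∣ zero w = [] , ≋-sym (⊕-identityʳ w)
      reduce-∣ (suc m) w with q , r ← reduce-∣ m (reduceStep m w) | s , f ← shift-⊗ m =
        a · s ⊕ q , ≋-trans r (≋-trans (⊕-assoc w _ (q ⊗ Φ)) (⊕-cong (≋-refl {w})
          (≋-trans (⊕-cong (≋-trans (·-cong refl f) (≋-sym (·-⊗ a s Φ))) (≋-refl {q ⊗ Φ}))
            (≋-sym (⊗-distribʳ Φ (a · s) q)))))
        where a = - coeff w (m ℕ.+ e)

      coeff-shift-above : ∀ s m → s < m → coeff (shift s Φ) (m ℕ.+ e) ≈ 0#
      coeff-shift-above zero    (suc m) lt = above _ (s≤s (ℕₚ.m≤n+m e m))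
      coeff-shift-above (suc s) (suc m) lt = coeff-shift-above s m (ℕ.s≤s⁻¹ lt)

      coeff-shift-lead : ∀ m → coeff (shift m Φ) (m ℕ.+ e) ≈ 1#
      coeff-shift-lead m = trans (reflexive (coeff-shift m Φ e)) lead

      private
        unchanged : ∀ {a b c} → b ≈ 0# → a + - b * c ≈ a
        unchanged b≈0 = trans (+-congˡ (trans (*-congʳ (trans (-‿cong b≈0) -0#≈0#)) (zeroˡ _))) (+-identityʳ _)

      -- The top row is a shift of the monic Φ and has 1 in the first column. Pivoting on it removes
      -- the row, applies `reduceStep` to each w, and leaves the lower shifts of Φ alone, since
      -- their first entry is 0.
      det-monic-above : ∀ m (w : Fin e → Poly) →
        det (rowsMatrix {m ℕ.+ e} λ i → [ (λ r → shift (m ∸ suc (toℕ r)) Φ) , w ]′ (splitAt m i))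
          ≈ det (rowsMatrix (reduce m ∘ w))
      det-monic-above zero w = refl
      det-monic-above (suc m) w = begin
        det (rowsMatrix {suc m ℕ.+ e} (rows (suc m) w))   ≈⟨ det-pivot (rowsMatrix (rows (suc m) w)) zero (coeff-shift-lead m) ⟩
        1# * det {m ℕ.+ e} _                     ≈⟨ *-identityˡ _ ⟩
        det {m ℕ.+ e} _                          ≈⟨ det-cong same ⟩
        det (rowsMatrix {m ℕ.+ e} (rows m (reduceStep m ∘ w))) ≈⟨ det-monic-above m (reduceStep m ∘ w) ⟩
        det (rowsMatrix (reduce (suc m) ∘ w))    ∎
        where
        rows : ∀ m → (Fin e → Poly) → Fin (m ℕ.+ e) → Poly
        rows m w i = [ (λ r → shift (m ∸ suc (toℕ r)) Φ) , w ]′ (splitAt m i)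
        same : ∀ i j →
          coeff (rows (suc m) w (suc i)) (m ℕ.+ e ∸ suc (toℕ j))
            + - coeff (rows (suc m) w (suc i)) (m ℕ.+ e) * coeff (shift m Φ) (m ℕ.+ e ∸ suc (toℕ j))
          ≈ coeff (rows m (reduceStep m ∘ w) i) (m ℕ.+ e ∸ suc (toℕ j))
        same i j with splitAt m i
        ... | inj₁ r = unchanged (coeff-shift-above (m ∸ suc (toℕ r)) m (ℕₚ.∸-monoʳ-< (s≤s z≤n) (Finₚ.toℕ<n r)))
        ... | inj₂ x = sym (coeff-reduceStep m (w x) _)

      module _ (S : Ring₀) {φ} (φ-hom : IsHom ring₀ S φ) where
        private module S = CommutativeRing S
        open Evaluation C S φ-hom
        private module E a = IsHom (ev-hom a)

        ev-shift : ∀ a s p → ev a p S.≈ S.0# → ev a (shift s p) S.≈ S.0#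
        ev-shift a zero p e = e
        ev-shift a (suc s) p e = S.trans (S.+-cong (IsHom.0-homo φ-hom) (S.trans (S.*-congˡ (ev-shift a s p e)) (S.zeroʳ a))) (S.+-identityˡ S.0#)

        ev-reduce : ∀ a → ev a Φ S.≈ S.0# → ∀ m w → ev a (reduce m w) S.≈ ev a w
        ev-reduce a root zero w = S.refl
        ev-reduce a root (suc m) w = S.trans (ev-reduce a root m (reduceStep m w))
          (S.trans (E.+-homo a w _) (S.trans (S.+-congˡ (S.trans (ev-· a _ (shift m Φ))
            (S.trans (S.*-congˡ (ev-shift a m Φ root)) (S.zeroʳ _)))) (S.+-identityʳ _)))

      reduce-deg : ∀ m w → (∀ i → m ℕ.+ e ≤ i → coeff w i ≈ 0#) → ∀ i → e ≤ i → coeff (reduce m w) i ≈ 0#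
      reduce-deg zero w h i le = h i le
      reduce-deg (suc m) w h = reduce-deg m (reduceStep m w) λ i le → trans (coeff-reduceStep m w i) (go i le (ℕₚ.m≤n⇒m<n∨m≡n le))
        where
        go : ∀ i → m ℕ.+ e ≤ i → m ℕ.+ e < i Sum.⊎ m ℕ.+ e ≡ i → coeff w i + - coeff w (m ℕ.+ e) * coeff (shift m Φ) i ≈ 0#
        go i le (inj₂ ≡.refl) = trans (+-congˡ (trans (*-congˡ (coeff-shift-lead m)) (*-identityʳ _))) (-‿inverseʳ _)
        go i le (inj₁ lt) = trans (+-cong (h i lt) (trans (*-congˡ above-shift) (zeroʳ _))) (+-identityʳ 0#)
          where
          above-shift : coeff (shift m Φ) i ≈ 0#
          above-shift with k , ≡.refl ← ℕₚ.m≤n⇒∃[o]m+o≡n le = trans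
            (reflexive (≡.trans (≡.cong (coeff (shift m Φ)) (ℕₚ.+-assoc m e k)) (coeff-shift m Φ (e ℕ.+ k))))
            (above _ (ℕₚ.+-cancelˡ-< m e _ (≡.subst (m ℕ.+ e <_) (ℕₚ.+-assoc m e k) lt)))

    Res-monic : ResMonic
    Res-monic {Φ′} {Φ} {q} {w} {d} {e} Φ′≋Φ ≡.refl ≡.refl lead v reduces det≈w = begin
      Res Φ′ q                                                   ≈⟨ Res-cong Φ′≋Φ (≋-refl {q}) ⟩
      Res Φ q                                                    ≈⟨ Res-rows Φ q ⟩
      det (rowsMatrix (sylvesterRows Φ q d e))
        ≈⟨ Reduction.det-monic-above Φ d lead (coeff-above-deg Φ) e (λ r → shift (d ∸ suc (toℕ r)) q) ⟩
      det (rowsMatrix {d} λ r → Reduce.reduce Φ d e (shift (d ∸ suc (toℕ r)) q))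
        ≈⟨ det-cong (λ r j → ≋⇒coeff (reduces r) (d ∸ suc (toℕ j))) ⟩
      det (rowsMatrix v)                                         ≈⟨ det≈w ⟩
      w                                                          ∎

    det₂ : ∀ (M : Matrix 2) → det M ≈ M zero zero * M (suc zero) (suc zero) - M (suc zero) zero * M zero (suc zero)
    det₂ M = trans (+-cong (*-congˡ {1#} (*-congˡ (det₁ (minor M zero)))) (+-congʳ (*-congˡ {(- 1#) * 1# } (*-congˡ (det₁ (minor M (suc zero)))))))
      (trans (solve 5 (λ o a b c d → o :* (a :* b) :+ (((:- o) :* o) :* (c :* d) :+ con ℤ.0ℤ) := o :* (a :* b) :+ :- (o :* (o :* (c :* d)))) 1# _ _ _ _)
        (+-cong (*-identityˡ _) (-‿cong (trans (*-identityˡ _) (*-identityˡ _)))))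
      where
      det₁ : ∀ (M : Matrix 1) → det M ≈ M zero zero
      det₁ M = trans (+-identityʳ _) (trans (*-identityˡ _) (*-identityʳ _))

    module MonicQuadratic (q : Poly) (lead : coeff q 2 ≈ 1#) (above : ∀ i → 2 < i → coeff q i ≈ 0#) where
      open Reduction q 2 lead above
      open Reduce q 2

      private
        rows : ∀ d → (Fin 2 → Poly) → Fin (2 ℕ.+ d) → Poly
        rows d u i = [ u , (λ r → shift (d ∸ suc (toℕ r)) q) ]′ (splitAt 2 i)

      -- The mirror situation, with the monic polynomial in the lower rows. The pivot then sits in
      -- row 2 and carries the sign (-1)² = 1, so that no sign accumulates.
      det-monic-below : ∀ d (u : Fin 2 → Poly) →
        det (rowsMatrix (rows d u)) ≈ det (rowsMatrix (reduce d ∘ u))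
      det-monic-below zero u = det-cong same
        where
        same : ∀ i j → rowsMatrix (rows 0 u) i j ≈ rowsMatrix u i j
        same zero       j = refl
        same (suc zero) j = refl
      det-monic-below (suc d) u = begin
        det (rowsMatrix (rows (suc d) u))
          ≈⟨ det-pivot (rowsMatrix (rows (suc d) u)) (suc (suc zero)) (trans (reflexive (≡.cong (coeff (shift d q)) (ℕₚ.+-comm 2 d))) (coeff-shift-lead d)) ⟩
        (- 1# * (- 1# * 1#)) * det pivoted ≈⟨ trans (*-congʳ sign²) (*-identityˡ _) ⟩
        det pivoted                          ≈⟨ det-cong same ⟩
        det (rowsMatrix (rows d (reduceStep d ∘ u)))   ≈⟨ det-monic-below d (reduceStep d ∘ u) ⟩
        det (rowsMatrix (reduce (suc d) ∘ u))    ∎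
        where
        sign² : - 1# * (- 1# * 1#) ≈ 1#
        sign² = trans (solve 1 (λ o → (:- o) :* ((:- o) :* o) := o :* (o :* o)) 1#)
          (trans (*-identityˡ _) (*-identityˡ _))
        step : ∀ w j → coeff w (suc d ∸ toℕ j) + - coeff w (2 ℕ.+ d) * coeff (shift d q) (suc d ∸ toℕ j)
          ≈ coeff (reduceStep d w) (suc d ∸ toℕ {2 ℕ.+ d} j)
        step w j = sym (trans (coeff-reduceStep d w _)
          (+-congˡ (*-congʳ (-‿cong (reflexive (≡.cong (coeff w) (ℕₚ.+-comm d 2)))))))
        pivoted : Matrix (2 ℕ.+ d)
        pivoted i j = M (punchIn (suc (suc zero)) i) (suc j)
            + - M (punchIn (suc (suc zero)) i) zero * M (suc (suc zero)) (suc j)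
          where M = rowsMatrix (rows (suc d) u)
        same : ∀ i j → pivoted i j ≈ rowsMatrix (rows d (reduceStep d ∘ u)) i j
        same zero j = step (u zero) j
        same (suc zero) j = step (u (suc zero)) j
        same (suc (suc r)) j = trans (+-congˡ (trans (*-congʳ (trans (-‿cong
          (trans (reflexive (≡.cong (coeff (shift (d ∸ suc (toℕ r)) q)) (ℕₚ.+-comm 2 d)))
            (coeff-shift-above (d ∸ suc (toℕ r)) d (ℕₚ.∸-monoʳ-< (s≤s z≤n) (Finₚ.toℕ<n r))))) -0#≈0#)) (zeroˡ _)))
          (+-identityʳ _)

      -- With r = p mod q and s = Xp mod q the resultant is s₁r₀ - r₁s₀; multiplying the
      -- matrix of r and s by the Vandermonde matrix of the roots a, b gives the formula.
      Res-roots : deg q ≡ 2 → (S : Ring₀) {φ : Carrier → CommutativeRing.Carrier S} (φ-hom : IsHom ring₀ S φ) →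
        let open CommutativeRing S using () renaming (_≈_ to _≈ˢ_; _*_ to _*ˢ_; _-_ to _-ˢ_; 0# to 0ˢ)
            open Evaluation C S φ-hom in
        ∀ a b → ev a q ≈ˢ 0ˢ → ev b q ≈ˢ 0ˢ → ∀ p →
        φ (Res p q) *ˢ (a -ˢ b) ≈ˢ (ev a p *ˢ ev b p) *ˢ (a -ˢ b)
      Res-roots deg≡2 S {φ} φ-hom a b root-a root-b p = R.begin
        φ (Res p q) S.* (a S.- b) R.≈⟨ S.*-congʳ (H.cong res) ⟩
        φ (s₁ * r₀ - r₁ * s₀) S.* (a S.- b)
          R.≈⟨ S.*-congʳ (S.trans (H.‿-homo _ _) (S.+-cong (H.*-homo _ _) (S.-‿cong (H.*-homo _ _)))) ⟩
        (φ s₁ S.* φ r₀ S.- φ r₁ S.* φ s₀) S.* (a S.- b)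
          R.≈⟨ SR.solve 6 (λ s₁ s₀ r₁ r₀ a b → (s₁ SR.:* r₀ SR.:- r₁ SR.:* s₀) SR.:* (a SR.:- b)
            SR.:= (s₀ SR.:+ a SR.:* s₁) SR.:* (r₀ SR.:+ b SR.:* r₁) SR.:- (s₀ SR.:+ b SR.:* s₁) SR.:* (r₀ SR.:+ a SR.:* r₁)) (φ s₁) (φ s₀) (φ r₁) (φ r₀) a b ⟩
        (φ s₀ S.+ a S.* φ s₁) S.* (φ r₀ S.+ b S.* φ r₁) S.- (φ s₀ S.+ b S.* φ s₁) S.* (φ r₀ S.+ a S.* φ r₁)
          R.≈⟨ S.+-cong (S.*-cong (at a root-a (shift 1 p) s-bound) (at b root-b p r-bound))
               (S.-‿cong (S.*-cong (at b root-b (shift 1 p) s-bound) (at a root-a p r-bound))) ⟩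
        ev a (shift 1 p) S.* ev b p S.- ev b (shift 1 p) S.* ev a p
          R.≈⟨ S.+-cong (S.*-congʳ (S.trans (S.+-congʳ H.0-homo) (S.+-identityˡ _)))
               (S.-‿cong (S.*-congʳ (S.trans (S.+-congʳ H.0-homo) (S.+-identityˡ _)))) ⟩
        (a S.* ev a p) S.* ev b p S.- (b S.* ev b p) S.* ev a p
          R.≈⟨ SR.solve 4 (λ a b x y → (a SR.:* x) SR.:* y SR.:- (b SR.:* y) SR.:* x SR.:= (x SR.:* y) SR.:* (a SR.:- b)) a b (ev a p) (ev b p) ⟩
        (ev a p S.* ev b p) S.* (a S.- b) R.∎
        where
        module S = CommutativeRing S
        module R = SetoidReasoning S.setoid
        module SR = IntegerMultiples S
        module H = IsHom φ-hom
        open Evaluation C S φ-hom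
        d = deg p
        r s : Poly
        r = reduce d p
        s = reduce d (shift 1 p)
        r₀ = coeff r 0
        r₁ = coeff r 1
        s₀ = coeff s 0
        s₁ = coeff s 1
        r-bound : ∀ i → d ℕ.+ 2 ≤ i → coeff p i ≈ 0#
        r-bound i le = coeff-above-deg p i (ℕₚ.≤-trans (ℕₚ.m<m+n d {2} (s≤s z≤n)) le)
        s-bound : ∀ i → d ℕ.+ 2 ≤ i → coeff (shift 1 p) i ≈ 0#
        s-bound zero le = refl
        s-bound (suc i) le = coeff-above-deg p i (ℕ.s≤s⁻¹ (≡.subst (_≤ suc i) (ℕₚ.+-comm d 2) le))
        at : ∀ x → ev x q S.≈ S.0# → ∀ w → (∀ i → d ℕ.+ 2 ≤ i → coeff w i ≈ 0#) →
          φ (coeff (reduce d w) 0) S.+ x S.* φ (coeff (reduce d w) 1) S.≈ ev x w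
        at x root w bound = S.trans (S.sym (S.trans (ev-cong x linear) (S.+-congˡ (S.*-congˡ (ev-const x _)))))
          (ev-reduce S φ-hom x root d w)
          where
          linear : reduce d w ≋ coeff (reduce d w) 0 ∷ coeff (reduce d w) 1 ∷ []
          linear = coeff⇒≋ λ where
            zero          → refl
            (suc zero)    → refl
            (suc (suc i)) → reduce-deg d w bound (suc (suc i)) (s≤s (s≤s z≤n))
        rows-res : Res′ p q d (deg q) ≈ det (rowsMatrix (rows d (λ i → shift (1 ∸ toℕ i) p)))
        rows-res = trans (Res-rows p q) (≡.subst (λ e → det (rowsMatrix (sylvesterRows p q d e)) ≈ det (rowsMatrix (rows d (λ i → shift (1 ∸ toℕ i) p)))) (≡.sym deg≡2) refl)
        res : Res p q ≈ s₁ * r₀ - r₁ * s₀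
        res = trans rows-res (trans (det-monic-below d _) (det₂ (rowsMatrix (reduce d ∘ λ i → shift (1 ∸ toℕ i) p))))

-- The multiplier polynomials for periods 1 and 3

module MultiplierPolynomials where
  open import Defs
  open Rings
  open Domains
  open Determinants
  open Resultants
  open import Algebra.Bundles using (CommutativeRing)
  open import Data.Fin.Base as Fin using (Fin; zero; suc)
  open import Data.Fin.Patterns using (0F; 1F; 2F; 3F; 4F; 5F)
  open import Data.Integer.Base as ℤ using (ℤ; +_; -[1+_])
  import Data.Integer.Solver
  module ℤSolver = Data.Integer.Solver.+-*-Solver
  open import Data.List.Base as List using (List; []; _∷_)
  open import Data.Nat.Base using (ℕ; zero; suc)
  open import Data.Product.Base using (_,_)
  import Data.Sum.Base as Sum
  open import Relation.Nullary using (¬_; contradiction)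
  open import Relation.Binary.PropositionalEquality as ≡ using (_≡_; _≢_)

  ℤ[c]C ℤ[c][x]C ℤ[c][x][z]C : CRing
  ℤ[c]C       = Poly.polyC ℤC
  ℤ[c][x]C    = Poly.polyC ℤ[c]C
  ℤ[c][x][z]C = Poly.polyC ℤ[c][x]C

  ℤ[c]-domain : IsDomain (CRing.ring₀ ℤ[c]C)
  ℤ[c]-domain {p} {q} = PolyDomain.poly-domain ℤC ℤ-domain {p} {q}

  ℤ[c][x]-domain : IsDomain (CRing.ring₀ ℤ[c][x]C)
  ℤ[c][x]-domain {p} {q} = PolyDomain.poly-domain ℤ[c]C ℤ[c]-domain {p} {q}

  module Z1 = Decidable ℤ[c]C
  module Z2 = Decidable ℤ[c][x]C
  module Z3 = Decidable ℤ[c][x][z]C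
  open Polynomial ℤ[c] using () renaming (_≋_ to _≋ᶻ_; _⊗_ to _⊗ᶻ_; _⊕_ to _⊕ᶻ_; const to constᶻ; derivative to derivativeᶻ)
  module P2 = Polynomial ℤ[c][x]
  module Q2 = Poly ℤ[c][x]C
  module S2 = SylvesterRows ℤ[c][x]
  module R2 = Resultant ℤ[c][x]C

  1ᶜ : List ℤ
  1ᶜ = + 1 ∷ []

  -- The fixed point polynomial z² - z + c and the quotient of f∘f∘f(z) - z by it, as lists of
  -- coefficients in z.
  Φ₁ Φ₃ : List (List ℤ)
  Φ₁ = (+ 0 ∷ + 1 ∷ []) ∷ (-[1+ 0 ] ∷ []) ∷ (+ 1 ∷ []) ∷ []
  Φ₃ = (+ 1 ∷ + 1 ∷ + 2 ∷ + 1 ∷ []) ∷ (+ 1 ∷ + 2 ∷ + 1 ∷ []) ∷ (+ 1 ∷ + 3 ∷ + 3 ∷ []) ∷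
       (+ 1 ∷ + 2 ∷ []) ∷ (+ 1 ∷ + 3 ∷ []) ∷ 1ᶜ ∷ 1ᶜ ∷ []

  -- The fixed points have sum 1, product c and multipliers 2z, hence x² - 2x + 4c for period 1. For
  -- period 3 the constant term is 64 Φ₃(0), the product of the two multipliers, each of them 8
  -- times the product of its cycle.
  δ₁ δ₃ : List (List ℤ)
  δ₁ = (+ 0 ∷ + 4 ∷ []) ∷ (-[1+ 1 ] ∷ []) ∷ 1ᶜ ∷ []
  δ₃ = (+ 64 ∷ + 64 ∷ + 128 ∷ + 64 ∷ []) ∷ (-[1+ 15 ] ∷ -[1+ 7 ] ∷ []) ∷ 1ᶜ ∷ []

  -- Here and in the next lemma the Möbius equation is evaluated; since ℤ[c][z] is a domain, the
  -- product of the negative powers, which is 1 here and `Φ₁` for period 3, cancels.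
  IsDynatomic-1 : ∀ Φ → IsDynatomic 1 Φ → Φ ≋ᶻ Φ₁
  IsDynatomic-1 Φ e = Z2.cancelʳ (λ {p} {q} → ℤ[c][x]-domain {p} {q}) (((+ 1 ∷ []) ∷ [])) (λ { (Polynomial.∷≋[] (Polynomial.∷≋[] () _) _) })
    (Poly.≋-trans ℤ[c]C (Poly.⊗-congʳ ℤ[c]C Φ Z2.by-computation) (Poly.≋-trans ℤ[c]C e Z2.by-computation))

  IsDynatomic-3 : ∀ Φ → IsDynatomic 3 Φ → Φ ≋ᶻ Φ₃
  IsDynatomic-3 Φ e = Z2.cancelʳ (λ {p} {q} → ℤ[c][x]-domain {p} {q}) Φ₁ (λ { (Polynomial.∷≋[] (Polynomial.∷≋[] _ (Polynomial.∷≋[] () _)) _) })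
    (Poly.≋-trans ℤ[c]C (Poly.⊗-congʳ ℤ[c]C Φ Z2.by-computation) (Poly.≋-trans ℤ[c]C e Z2.by-computation))

  x-derivative : ℕ → P2.Poly
  x-derivative n = RawRing₀._-_ (ℤ[c][x] [X]) (Polynomial.const ℤ[c][x] (Polynomial.X ℤ[c]))
    (List.map (Polynomial.const ℤ[c]) (Polynomial.derivative ℤ[c] (iterate-f n)))

  opaque
    -- Outside the unfolding block below, these are known only through the degrees, leading
    -- coefficient, rows and defining equations proved there.
    Φ₃ᶻ q₃ : P2.Poly
    Φ₃ᶻ = List.map constᶻ Φ₃
    q₃  = x-derivative 3

  -- The rows of multiplication by x - (f^∘3)′ on polynomials in z modulo Φ₃.
  opaque
    reduced₃ : Fin 6 → P2.Poly
    reduced₃ 0F =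
      ((+ 0 ∷ + 0 ∷ + 16 ∷ + 16 ∷ + 32 ∷ + 16 ∷ []) ∷ []) ∷
      ((+ 0 ∷ + 8 ∷ + 16 ∷ + 40 ∷ + 8 ∷ -[1+ 7 ] ∷ []) ∷ []) ∷
      ((+ 0 ∷ + 0 ∷ + 16 ∷ + 24 ∷ + 32 ∷ []) ∷ []) ∷
      ((+ 0 ∷ + 8 ∷ + 24 ∷ + 40 ∷ -[1+ 15 ] ∷ []) ∷ []) ∷ ((+ 0 ∷ + 8 ∷ + 16 ∷ + 16 ∷ []) ∷ []) ∷
      ((-[1+ 7 ] ∷ + 0 ∷ + 24 ∷ -[1+ 7 ] ∷ []) ∷ 1ᶜ ∷ []) ∷ []
    reduced₃ 1F =
      ((+ 0 ∷ + 8 ∷ + 0 ∷ + 8 ∷ -[1+ 7 ] ∷ -[1+ 7 ] ∷ []) ∷ []) ∷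
      ((+ 0 ∷ + 0 ∷ + 0 ∷ -[1+ 23 ] ∷ -[1+ 15 ] ∷ []) ∷ []) ∷
      ((+ 0 ∷ + 8 ∷ + 8 ∷ + 8 ∷ -[1+ 15 ] ∷ []) ∷ []) ∷ ((+ 0 ∷ + 8 ∷ + 0 ∷ -[1+ 31 ] ∷ []) ∷ []) ∷
      ((-[1+ 7 ] ∷ + 0 ∷ + 8 ∷ -[1+ 7 ] ∷ []) ∷ 1ᶜ ∷ []) ∷ ((+ 0 ∷ + 0 ∷ -[1+ 15 ] ∷ []) ∷ []) ∷ []
    reduced₃ 2F =
      ((+ 0 ∷ -[1+ 7 ] ∷ -[1+ 7 ] ∷ -[1+ 15 ] ∷ -[1+ 7 ] ∷ []) ∷ []) ∷
      ((+ 0 ∷ + 0 ∷ -[1+ 7 ] ∷ + 8 ∷ + 8 ∷ []) ∷ []) ∷ ((+ 0 ∷ + 0 ∷ -[1+ 7 ] ∷ -[1+ 15 ] ∷ []) ∷ []) ∷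
      ((-[1+ 7 ] ∷ -[1+ 7 ] ∷ -[1+ 7 ] ∷ + 16 ∷ []) ∷ 1ᶜ ∷ []) ∷
      ((+ 0 ∷ -[1+ 7 ] ∷ -[1+ 7 ] ∷ []) ∷ []) ∷ ((+ 0 ∷ -[1+ 7 ] ∷ + 8 ∷ []) ∷ []) ∷ []
    reduced₃ 3F =
      ((+ 0 ∷ + 8 ∷ + 8 ∷ + 16 ∷ + 8 ∷ []) ∷ []) ∷ ((+ 0 ∷ + 8 ∷ + 16 ∷ + 8 ∷ []) ∷ []) ∷
      ((-[1+ 7 ] ∷ + 0 ∷ + 8 ∷ + 16 ∷ []) ∷ 1ᶜ ∷ []) ∷ ((+ 0 ∷ + 0 ∷ + 16 ∷ []) ∷ []) ∷
      ((+ 0 ∷ + 0 ∷ + 8 ∷ []) ∷ []) ∷ ((+ 0 ∷ + 8 ∷ []) ∷ []) ∷ []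
    reduced₃ 4F =
      [] ∷ ((-[1+ 7 ] ∷ -[1+ 7 ] ∷ -[1+ 15 ] ∷ -[1+ 7 ] ∷ []) ∷ 1ᶜ ∷ []) ∷
      ((+ 0 ∷ -[1+ 7 ] ∷ []) ∷ []) ∷ ((+ 0 ∷ -[1+ 7 ] ∷ -[1+ 15 ] ∷ []) ∷ []) ∷ [] ∷
      ((+ 0 ∷ -[1+ 7 ] ∷ []) ∷ []) ∷ []
    reduced₃ 5F =
      ((-[1+ 7 ] ∷ -[1+ 7 ] ∷ -[1+ 15 ] ∷ -[1+ 7 ] ∷ []) ∷ 1ᶜ ∷ []) ∷ ((+ 0 ∷ -[1+ 7 ] ∷ []) ∷ []) ∷
      ((+ 0 ∷ -[1+ 7 ] ∷ -[1+ 15 ] ∷ []) ∷ []) ∷ [] ∷ ((+ 0 ∷ -[1+ 7 ] ∷ []) ∷ []) ∷ [] ∷ []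

  map-const-cong : ∀ {p q} → p ≋ᶻ q → List.map constᶻ p P2.≋ List.map constᶻ q
  map-const-cong Polynomial.[]≋[] = P2.[]≋[]
  map-const-cong (Polynomial.∷≋∷ e f) = P2.∷≋∷ (Polynomial.∷≋∷ e Polynomial.[]≋[]) (map-const-cong f)
  map-const-cong (Polynomial.∷≋[] e f) = P2.∷≋[] (Polynomial.∷≋[] e Polynomial.[]≋[]) (map-const-cong f)
  map-const-cong (Polynomial.[]≋∷ e f) = P2.[]≋∷ (Polynomial.∷≋[] e Polynomial.[]≋[]) (map-const-cong f)

  opaque
    unfolding Φ₃ᶻ q₃ reduced₃

    -- The Sylvester matrix has size 7 + 6 = 13, too large for Laplace expansion. In its place, six
    -- remainders and a determinant of size 6 are checked by computation.
    reduces : SylvesterRows.ReducesTo ℤ[c][x] Φ₃ᶻ q₃ 6 7 reduced₃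
    reduces 0F = Z3.by-computation
    reduces 1F = Z3.by-computation
    reduces 2F = Z3.by-computation
    reduces 3F = Z3.by-computation
    reduces 4F = Z3.by-computation
    reduces 5F = Z3.by-computation

    -- Multiplication by x - (f∘f∘f)'(z) modulo Φ₃ has two eigenvalues, x minus the multiplier of
    -- either 3-cycle, each attained at three points. The determinant is therefore the cube of their
    -- product, written the way a third power unfolds.
    det-reduced₃ : P2.det (S2.rowsMatrix reduced₃) ≋ᶻ δ₃ ⊗ᶻ (δ₃ ⊗ᶻ (δ₃ ⊗ᶻ (1ᶜ ∷ [])))
    det-reduced₃ = Z2.by-computation

    lead₃ : P2.coeff Φ₃ᶻ 6 ≋ᶻ (1ᶜ ∷ [])
    lead₃ = Z2.by-computation

    deg-Φ₃ᶻ : P2.deg Φ₃ᶻ ≡ 6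
    deg-Φ₃ᶻ = ≡.refl

    deg-q₃ : P2.deg q₃ ≡ 7
    deg-q₃ = ≡.refl

    Φ₃ᶻ-def : List.map constᶻ Φ₃ ≡ Φ₃ᶻ
    Φ₃ᶻ-def = ≡.refl

    q₃-def : x-derivative 3 ≡ q₃
    q₃-def = ≡.refl

  -- The transport along `refl` reduces the comparison of the two statements to that of their base
  -- rings, which agree definitionally.
  Res-monic : SylvesterRows.ResMonic ℤ[c][x]
  Res-monic = ≡.subst SylvesterRows.ResMonic ≡.refl (λ {Φ′} {Φ} {q} {w} {d} {e} → R2.Res-monic {Φ′} {Φ} {q} {w} {d} {e})

  multiplierResultant-Res : ∀ n Φ {q} → x-derivative n ≡ q → multiplierResultant n Φ ≡ P2.Res (List.map constᶻ Φ) q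
  multiplierResultant-Res n Φ ≡.refl = ≡.refl

  resultant₃ : ∀ {Φ} → Φ ≋ᶻ Φ₃ → P2.Res (List.map constᶻ Φ) q₃ ≋ᶻ δ₃ ⊗ᶻ (δ₃ ⊗ᶻ (δ₃ ⊗ᶻ (1ᶜ ∷ [])))
  resultant₃ {Φ} e = Res-monic {List.map constᶻ Φ} {Φ₃ᶻ} {q₃} {_} {6} {7}
    (≡.subst (List.map constᶻ Φ P2.≋_) Φ₃ᶻ-def (map-const-cong e)) deg-Φ₃ᶻ deg-q₃ lead₃ reduced₃ reduces det-reduced₃

  Φ₁ᶻ : P2.Poly
  Φ₁ᶻ = List.map constᶻ Φ₁

  resultant₁ : ∀ {Φ} → Φ ≋ᶻ Φ₁ → multiplierResultant 1 Φ ≋ᶻ δ₁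
  resultant₁ {Φ} e = Poly.≋-trans ℤ[c]C (Res-cong {List.map constᶻ Φ} {Φ₁ᶻ} {x-derivative 1} {x-derivative 1} (map-const-cong e) Q2.≋-refl) Z2.by-computation
    where
    Res-cong : ∀ {p p′ q q′} → p P2.≋ p′ → q P2.≋ q′ → P2.Res p q ≋ᶻ P2.Res p′ q′
    Res-cong {p} {p′} {q} {q′} = R2.Res-cong {p} {p′} {q} {q′}

  private
    square+positive≢0 : ∀ i n → i ℤ.* i ℤ.+ (+ suc n) ≢ + 0
    square+positive≢0 (+ zero)    n ()
    square+positive≢0 (+ (suc m)) n ()
    square+positive≢0 -[1+ m ]    n ()

  module CubeRoot (R : Ring₀) (domain : IsDomain R) where
    open CommutativeRing R
    open IntegerMultiples R

    cube-difference : ∀ x y → x * (x * (x * 1#)) ≈ y * (y * (y * 1#)) → (x - y) * (x * x + x * y + y * y) ≈ 0#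
    cube-difference x y e = trans
      (solve 2 (λ x y → (x :- y) :* (x :* x :+ x :* y :+ y :* y) := x :* (x :* x) :- y :* (y :* y)) x y)
      (trans (+-cong (*-congˡ (*-congˡ (sym (*-identityʳ x)))) (-‿cong (*-congˡ (*-congˡ (sym (*-identityʳ y))))))
      (trans (+-congʳ e) (-‿inverseʳ _)))

    four-times : ∀ x y → ι (+ 4) * (x * x + x * y + y * y) ≈ (ι (+ 2) * x + y) * (ι (+ 2) * x + y) + ι (+ 3) * (y * y)
    four-times = solve 2 λ x y → con (+ 4) :* (x :* x :+ x :* y :+ y :* y)
      := (con (+ 2) :* x :+ y) :* (con (+ 2) :* x :+ y) :+ con (+ 3) :* (y :* y)

    cube-root : ∀ x y → x * (x * (x * 1#)) ≈ y * (y * (y * 1#)) → ¬ x * x + x * y + y * y ≈ 0# → x ≈ y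
    cube-root x y e h = Sum.[ difference , (λ z → contradiction z h) ]′ (domain (cube-difference x y e))
      where
      difference : x - y ≈ 0# → x ≈ y
      difference d = trans (solve 2 (λ x y → x := (x :- y) :+ y) x y) (trans (+-congʳ d) (+-identityˡ y))

  -- x² + xy + y² is definite, and δ₃ has the value 64 at x = c = 0.
  multiplier-3 : ∀ δ → IsMultiplierPolynomial 3 δ → δ ≋ᶻ δ₃
  multiplier-3 δ (Φ , dyn , _ , e) = CubeRoot.cube-root (CRing.ring₀ ℤ[c][x]C) (λ {p} {q} → ℤ[c][x]-domain {p} {q}) δ δ₃ cubes definite
    where
    power : ∀ r s → r ≡ s → δ ⊗ᶻ (δ ⊗ᶻ (δ ⊗ᶻ (1ᶜ ∷ []))) ≋ᶻ r → δ ⊗ᶻ (δ ⊗ᶻ (δ ⊗ᶻ (1ᶜ ∷ []))) ≋ᶻ s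
    power r .r ≡.refl h = h
    cubes : δ ⊗ᶻ (δ ⊗ᶻ (δ ⊗ᶻ (1ᶜ ∷ []))) ≋ᶻ δ₃ ⊗ᶻ (δ₃ ⊗ᶻ (δ₃ ⊗ᶻ (1ᶜ ∷ [])))
    cubes = Poly.≋-trans ℤ[c]C
      (power (multiplierResultant 3 Φ) (P2.Res (List.map constᶻ Φ) q₃)
        (multiplierResultant-Res 3 Φ {q₃} q₃-def) e)
      (resultant₃ (IsDynatomic-3 Φ dyn))
    module E₀ = Evaluation ℤC ℤ-ring (idHom ℤ-ring)
    module E₁ = Evaluation ℤ[c]C ℤ-ring (E₀.ev-hom (+ 0))
    module H = IsHom (E₁.ev-hom (+ 0))
    open IntegerMultiples ℤ-ring using (ι)
    module ℤ-Definite = CubeRoot ℤ-ring (λ {i} → ℤ-domain {i})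
    a = E₁.ev (+ 0) δ
    definite : ¬ (δ ⊗ᶻ δ ⊕ᶻ δ ⊗ᶻ δ₃ ⊕ᶻ δ₃ ⊗ᶻ δ₃ ≋ᶻ [])
    -- 12287 + 1 = 3 · 64², from 4(a² + 64a + 64²) = (2a + 64)² + 3 · 64².
    definite d = contradiction (≡.trans (≡.sym (ℤ-Definite.four-times a (+ 64))) (≡.cong (ι (+ 4) ℤ.*_) zero-at-0)) (square+positive≢0 (ι (+ 2) ℤ.* a ℤ.+ + 64) 12287)
      where
      zero-at-0 : a ℤ.* a ℤ.+ a ℤ.* + 64 ℤ.+ + 64 ℤ.* + 64 ≡ + 0
      zero-at-0 = ≡.trans (≡.sym (≡.trans (H.+-homo (δ ⊗ᶻ δ ⊕ᶻ δ ⊗ᶻ δ₃) (δ₃ ⊗ᶻ δ₃))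
        (≡.cong₂ ℤ._+_ (≡.trans (H.+-homo (δ ⊗ᶻ δ) (δ ⊗ᶻ δ₃)) (≡.cong₂ ℤ._+_ (H.*-homo δ δ) (H.*-homo δ δ₃))) ≡.refl)))
        (H.cong d)

  multiplier-1 : ∀ δ → IsMultiplierPolynomial 1 δ → δ ≋ᶻ δ₁
  multiplier-1 δ (Φ , dyn , _ , e) = Poly.≋-trans ℤ[c]C (Poly.≋-trans ℤ[c]C (Poly.≋-sym ℤ[c]C (CommutativeRing.*-identityʳ (CRing.ring₀ ℤ[c][x]C) δ)) e)
    (resultant₁ (IsDynatomic-1 Φ dyn))

-- Divisibility, quotient rings and polynomials over a field

module FieldPolynomials where
  open import Defs using (RawRing₀; module Polynomial; module RawRing₀)
  open Rings
  open Determinants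
  open Resultants
  open Domains using (IsDomain; HasInverses; Nontrivial; module PolyDomain)
  open import Algebra.Bundles using (CommutativeRing)
  import Algebra.Properties.Ring
  open import Data.Integer.Base using (+_)
  open import Data.List.Base as List using (List; []; _∷_)
  open import Data.Nat.Base as ℕ using (ℕ; zero; suc; _<_; _≤_; s≤s; z≤n)
  import Data.Nat.Properties as ℕₚ
  open import Data.Product.Base using (_,_; _×_; ∃-syntax; proj₁; proj₂)
  open import Data.Sum.Base as Sum using (_⊎_; inj₁; inj₂)
  open import Relation.Nullary using (¬_; Dec; yes; no; contradiction)
  open import Relation.Binary.PropositionalEquality as ≡ using (_≡_)
  open import Relation.Binary.Definitions using (tri<; tri≈; tri>)

  module Divisibility (R : Ring₀) where
    open CommutativeRing R
    open Algebra.Properties.Ring ring using (-0#≈0#)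
    open IntegerMultiples R

    infix 4 _∣_
    _∣_ : Carrier → Carrier → Set
    a ∣ b = ∃[ q ] q * a ≈ b

    -- Bézout coefficients make coprimality stable under homomorphisms and under passing to
    -- divisors, in every commutative ring.
    Coprime : Carrier → Carrier → Set
    Coprime a b = ∃[ u ] ∃[ v ] u * a + v * b ≈ 1#

    ∣-refl : ∀ {a} → a ∣ a
    ∣-refl = 1# , *-identityˡ _

    ∣-reflexive : ∀ {a b} → a ≈ b → a ∣ b
    ∣-reflexive e = 1# , trans (*-identityˡ _) e

    ∣-trans : ∀ {a b c} → a ∣ b → b ∣ c → a ∣ c
    ∣-trans (p , e) (q , f) = q * p , trans (*-assoc _ _ _) (trans (*-congˡ e) f)

    ∣-respʳ : ∀ {a b c} → b ≈ c → a ∣ b → a ∣ c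
    ∣-respʳ e (q , f) = q , trans f e

    ∣-respˡ : ∀ {a b c} → a ≈ b → a ∣ c → b ∣ c
    ∣-respˡ e (q , f) = q , trans (*-congˡ (sym e)) f

    ∣-0 : ∀ {a} → a ∣ 0#
    ∣-0 = 0# , zeroˡ _

    ∣-+ : ∀ {a b c} → a ∣ b → a ∣ c → a ∣ b + c
    ∣-+ (p , e) (q , f) = p + q , trans (distribʳ _ p q) (+-cong e f)

    ∣-neg : ∀ {a b} → a ∣ b → a ∣ - b
    ∣-neg {a} (p , e) = - p , trans (sym (Algebra.Properties.Ring.-‿distribˡ-* ring p a)) (-‿cong e)

    ∣-- : ∀ {a b c} → a ∣ b → a ∣ c → a ∣ b - c
    ∣-- x y = ∣-+ x (∣-neg y)

    ∣-*ˡ : ∀ {a b} c → a ∣ b → a ∣ c * b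
    ∣-*ˡ c (p , e) = c * p , trans (*-assoc c p _) (*-congˡ e)

    ∣-*ʳ : ∀ {a b} c → a ∣ b → a ∣ b * c
    ∣-*ʳ c x = ∣-respʳ (*-comm c _) (∣-*ˡ c x)

    ∣-*-cong : ∀ {a b c d} → a ∣ b → c ∣ d → a * c ∣ b * d
    ∣-*-cong {a} {b} {c} {d} (p , e) (q , f) = p * q ,
      trans (solve 4 (λ p q a c → (p :* q) :* (a :* c) := (p :* a) :* (q :* c)) p q a c) (*-cong e f)

    coprime-sym : ∀ {a b} → Coprime a b → Coprime b a
    coprime-sym (u , v , e) = v , u , trans (+-comm _ _) e

    coprime-∣ : ∀ {a b c} → Coprime a b → a ∣ b * c → a ∣ c
    coprime-∣ {a} {b} {c} (u , v , e) (q , f) = u * c + v * q ,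
      trans (solve 5 (λ u v a c q → (u :* c :+ v :* q) :* a := (u :* a) :* c :+ v :* (q :* a)) u v a c q)
      (trans (+-congˡ (*-congˡ f))
      (trans (solve 5 (λ u v a b c → (u :* a) :* c :+ v :* (b :* c) := (u :* a :+ v :* b) :* c) u v a b c)
      (trans (*-congʳ e) (*-identityˡ c))))

    coprime-* : ∀ {a b c} → Coprime a b → Coprime a c → Coprime a (b * c)
    coprime-* {a} {b} {c} (u , v , e) (s , t , f) = u * (s * a) + u * (t * c) + v * b * s , v * t ,
      trans (solve 7 (λ u v s t a b c → (u :* (s :* a) :+ u :* (t :* c) :+ v :* b :* s) :* a :+ v :* t :* (b :* c)
        := (u :* a :+ v :* b) :* (s :* a :+ t :* c)) u v s t a b c)
      (trans (*-cong e f) (*-identityˡ 1#))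

    coprime-1 : ∀ {a} → Coprime a 1#
    coprime-1 {a} = 0# , 1# , trans (+-cong (zeroˡ a) (*-identityˡ 1#)) (+-identityˡ 1#)

    coprime-∣ˡ : ∀ {a b c} → a ∣ b → Coprime b c → Coprime a c
    coprime-∣ˡ (q , e) (u , v , f) = u * q , v , trans (+-congʳ (trans (*-assoc u q _) (*-congˡ e))) f

    coprime-∣ʳ : ∀ {a b c} → a ∣ c → Coprime b c → Coprime b a
    coprime-∣ʳ x y = coprime-sym (coprime-∣ˡ x (coprime-sym y))

    coprime-≈ʳ : ∀ {a b c} → b ≈ c → Coprime a b → Coprime a c
    coprime-≈ʳ e (u , v , f) = u , v , trans (+-congˡ (*-congˡ (sym e))) f

    coprime-product-∣ : ∀ {a b c} → Coprime a b → a ∣ c → b ∣ c → a * b ∣ c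
    coprime-product-∣ {a} {b} {c} cop (p , e) b∣c = q ,
      trans (solve 3 (λ q a b → q :* (a :* b) := (q :* b) :* a) q a b) (trans (*-congʳ f) e)
      where
      b∣p : b ∣ p
      b∣p = coprime-∣ (coprime-sym cop) (∣-respʳ (trans (sym e) (*-comm p a)) b∣c)
      q = proj₁ b∣p
      f : q * b ≈ p
      f = proj₂ b∣p

    bézout-step : ∀ {a b g} q r u v → a ≈ q * b + r → u * b + v * r ≈ g → v * a + (u - v * q) * b ≈ g
    bézout-step {a} {b} q r u v e f = trans (+-congʳ (*-congˡ e))
      (trans (solve 5 (λ u v q r b → v :* (q :* b :+ r) :+ (u :- v :* q) :* b := u :* b :+ v :* r) u v q r b) f)

    remainder : ∀ {a b} q r → b ≈ q * a + r → b - q * a ≈ r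
    remainder {a} q r e = trans (+-congʳ e) (solve 2 (λ x r → (x :+ r) :- x := r) (q * a) r)

    remainder-∣ : ∀ {a b} q r → b ≈ q * a + r → a ∣ b → a ∣ r
    remainder-∣ {a} q r e d = ∣-respʳ (remainder q r e) (∣-- d (∣-*ˡ q ∣-refl))

    scaled-division : ∀ {a b b′ r} k s → b′ ≈ k * b → r ≈ a + s * b′ → a ≈ (- (k * s)) * b + r
    scaled-division {a} {b} k s e f = sym (trans (+-congˡ (trans f (+-congˡ (*-congˡ e))))
      (solve 4 (λ a b k s → :- (k :* s) :* b :+ (a :+ s :* (k :* b)) := a) a b k s))

    -- The carrier is kept and only the equality changes, to congruence modulo m. Every element is
    -- its own representative, and the projection is the identity function.
    quotient : Carrier → Ring₀
    quotient m = record
      { Carrier = Carrier ; _≈_ = λ a b → m ∣ a - b ; _+_ = _+_ ; _*_ = _*_ ; -_ = -_ ; 0# = 0# ; 1# = 1#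
      ; isCommutativeRing = record
        { isRing = record
          { +-isAbelianGroup = record
            { isGroup = record
              { isMonoid = record
                { isSemigroup = record
                  { isMagma = record
                    { isEquivalence = record
                      { refl = λ {a} → lift refl
                      ; sym = λ {a} {b} e → ∣-respʳ (solve 2 (λ a b → :- (a :- b) := b :- a) a b) (∣-neg e)
                      ; trans = λ {a} {b} {c} e f → ∣-respʳ (solve 3 (λ a b c → (a :- b) :+ (b :- c) := a :- c) a b c) (∣-+ e f) }
                    ; ∙-cong = λ {a} {b} {c} {d} e f → ∣-respʳ (solve 4 (λ a b c d → (a :- b) :+ (c :- d) := (a :+ c) :- (b :+ d)) a b c d) (∣-+ e f) }
                  ; assoc = λ a b c → lift (+-assoc a b c) }
                ; identity = (λ a → lift (+-identityˡ a)) , (λ a → lift (+-identityʳ a)) }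
              ; inverse = (λ a → lift (-‿inverseˡ a)) , (λ a → lift (-‿inverseʳ a))
              ; ⁻¹-cong = λ {a} {b} e → ∣-respʳ (solve 2 (λ a b → :- (a :- b) := :- a :- :- b) a b) (∣-neg e) }
            ; comm = λ a b → lift (+-comm a b) }
          ; *-cong = λ {a} {b} {c} {d} e f → ∣-respʳ
              (solve 4 (λ a b c d → (a :- b) :* c :+ b :* (c :- d) := a :* c :- b :* d) a b c d)
              (∣-+ (∣-*ʳ c e) (∣-*ˡ b f))
          ; *-assoc = λ a b c → lift (*-assoc a b c)
          ; *-identity = (λ a → lift (*-identityˡ a)) , (λ a → lift (*-identityʳ a))
          ; distrib = (λ a b c → lift (distribˡ a b c)) , (λ a b c → lift (distribʳ a b c)) }
        ; *-comm = λ a b → lift (*-comm a b) } }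
      where
      lift : ∀ {a b} → a ≈ b → m ∣ a - b
      lift {a} {b} e = 0# , trans (zeroˡ m) (sym (trans (+-congʳ e) (-‿inverseʳ b)))

    ≈⇒quotient : ∀ m {a b} → a ≈ b → m ∣ a - b
    ≈⇒quotient m {a} {b} e = 0# , trans (zeroˡ m) (sym (trans (+-congʳ e) (-‿inverseʳ b)))

    quotient-zero : ∀ {m a} → m ∣ a - 0# → m ∣ a
    quotient-zero {m} {a} = ∣-respʳ (trans (+-congˡ -0#≈0#) (+-identityʳ a))

    zero-quotient : ∀ {m a} → m ∣ a → m ∣ a - 0#
    zero-quotient {m} {a} = ∣-respʳ (sym (trans (+-congˡ -0#≈0#) (+-identityʳ a)))

    quotient-hom : ∀ m → IsHom R (quotient m) (λ a → a)
    quotient-hom m = record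
      { cong = ≈⇒quotient m ; +-homo = λ _ _ → ≈⇒quotient m refl ; *-homo = λ _ _ → ≈⇒quotient m refl
      ; -‿homo = λ _ → ≈⇒quotient m refl ; 0-homo = ≈⇒quotient m refl ; 1-homo = ≈⇒quotient m refl }

  module HomDivisibility {R S : Ring₀} {φ} (φ-hom : IsHom R S φ) where
    private
      module R = CommutativeRing R
      module S = CommutativeRing S
      module DR = Divisibility R
      module DS = Divisibility S
    open IsHom φ-hom

    ∣-hom : ∀ {a b} → a DR.∣ b → φ a DS.∣ φ b
    ∣-hom (q , e) = φ q , S.trans (S.sym (*-homo q _)) (cong e)

    coprime-hom : ∀ {a b} → DR.Coprime a b → DS.Coprime (φ a) (φ b)
    coprime-hom (u , v , e) = φ u , φ v ,
      S.trans (S.sym (S.trans (+-homo _ _) (S.+-cong (*-homo u _) (*-homo v _)))) (S.trans (cong e) 1-homo)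

  module Euclid (R : Ring₀) where
    open CommutativeRing R hiding (zero)
    open Divisibility R

    record Gcd (a b : Carrier) : Set where
      field
        gcd    : Carrier
        gcd∣ˡ  : gcd ∣ a
        gcd∣ʳ  : gcd ∣ b
        u v    : Carrier
        bézout : u * a + v * b ≈ gcd

    module _ (Below : Carrier → ℕ → Set) (below-0 : ∀ {b} → Below b 0 → b ≈ 0#)
      (divide : ∀ {n b} → Below b (suc n) → Below b n ⊎ (∀ a → ∃[ q ] ∃[ r ] a ≈ q * b + r × Below r n)) where

      -- `Below b n` bounds the size of b, not necessarily sharply: a step either improves the bound
      -- or divides by b and leaves a remainder with a smaller bound.
      euclid : ∀ n a b → Below b n → Gcd a b
      euclid zero a b h = record
        { gcd = a ; gcd∣ˡ = ∣-refl ; gcd∣ʳ = ∣-respʳ (sym (below-0 h)) ∣-0 ; u = 1# ; v = 0#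
        ; bézout = trans (+-cong (*-identityˡ a) (zeroˡ b)) (+-identityʳ a) }
      euclid (suc n) a b h with divide h
      ... | inj₁ h′ = euclid n a b h′
      ... | inj₂ div with q , r , e , below ← div a = record
        { gcd = G.gcd
        ; gcd∣ˡ = ∣-respʳ (sym e) (∣-+ (∣-*ˡ q G.gcd∣ˡ) G.gcd∣ʳ)
        ; gcd∣ʳ = G.gcd∣ˡ
        ; u = G.v
        ; v = G.u - G.v * q
        ; bézout = bézout-step q r G.u G.v e G.bézout }
        where module G = Gcd (euclid n b r below)

  module FieldPoly (C : CRing) (inverse : HasInverses (CRing.ring₀ C)) (1≉0 : Nontrivial (CRing.ring₀ C)) where
    open CRing C
    open RawRing₀ raw using (_≈0?)
    private module F = CommutativeRing ring₀
    open F using (Carrier; _≈_; _+_; _*_; -_; 0#; 1#)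
    open Polynomial raw
    open Poly C hiding (poly)
    open Resultant C
    open SylvesterRows raw
    open Divisibility (Poly.poly C)
    private module P = CommutativeRing (Poly.poly C)
    open Algebra.Properties.Ring P.ring using (-0#≈0#)
    open import Relation.Binary.Reasoning.Setoid F.setoid

    Below : Poly → ℕ → Set
    Below p n = ∀ i → n ≤ i → coeff p i ≈ 0#

    -- In contrast to `deg`, the zero polynomial has no degree, so that degrees of products always
    -- add up.
    record Degree (p : Poly) (n : ℕ) : Set where
      field
        lead≉0 : ¬ coeff p n ≈ 0#
        above  : Below p (suc n)

    field-domain : IsDomain ring₀
    field-domain {a} {b} e with a ≈0?
    ... | yes a≈0 = inj₁ a≈0
    ... | no a≉0 with c , f ← inverse a a≉0 = inj₂ (F.trans (F.sym (F.trans (F.*-congʳ f) (F.*-identityˡ b)))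
      (F.trans (F.*-assoc c a b) (F.trans (F.*-congˡ e) (F.zeroʳ c))))

    domain : IsDomain (Poly.poly C)
    domain {p} {q} = PolyDomain.poly-domain C field-domain {p} {q}

    Below-length : ∀ p → Below p (List.length p)
    Below-length []      i       le = F.refl
    Below-length (a ∷ p) (suc i) le = Below-length p i (ℕ.s≤s⁻¹ le)

    private
      degree-below : ∀ p n → Below p n → p ≋ [] ⊎ ∃[ m ] Degree p m
      degree-below p zero h = inj₁ (coeff⇒≋ λ i → h i z≤n)
      degree-below p (suc n) h with coeff p n ≈0?
      ... | no ≉0 = inj₂ (n , record { lead≉0 = ≉0 ; above = h })
      ... | yes ≈0 = degree-below p n λ i le → case i le (ℕₚ.m≤n⇒m<n∨m≡n le)
        where
        case : ∀ i → n ≤ i → n < i ⊎ n ≡ i → coeff p i ≈ 0#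
        case i le (inj₁ lt) = h i lt
        case i le (inj₂ ≡.refl) = ≈0

    degree : ∀ p → p ≋ [] ⊎ ∃[ n ] Degree p n
    degree p = degree-below p (List.length p) (Below-length p)

    coeff-⊗-above : ∀ p q n m → Below p (suc n) → Below q (suc m) → Below (p ⊗ q) (suc (n ℕ.+ m))
    coeff-⊗-above [] q n m hp hq i le = F.refl
    coeff-⊗-above (a ∷ p) q n m hp hq (suc i) le = F.trans (coeff-⊕ (a · q) _ (suc i))
      (F.trans (F.+-cong (F.trans (coeff-· a q (suc i)) (F.trans (F.*-congˡ (hq (suc i) (ℕₚ.≤-trans (s≤s (ℕₚ.m≤n+m m n)) le))) (F.zeroʳ a)))
        (tail n hp (ℕ.s≤s⁻¹ le))) (F.+-identityʳ 0#))
      where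
      tail : ∀ n → Below (a ∷ p) (suc n) → n ℕ.+ m ≤ i → coeff (p ⊗ q) i ≈ 0#
      tail zero hp le = ≋⇒coeff (⊗-congˡ q (coeff⇒≋ {p} {[]} λ j → hp (suc j) (s≤s z≤n))) i
      tail (suc n) hp le = coeff-⊗-above p q n m (λ j h → hp (suc j) (s≤s h)) hq i le

    coeff-⊗-top : ∀ p q n m → Below p (suc n) → Below q (suc m) → coeff (p ⊗ q) (n ℕ.+ m) ≈ coeff p n * coeff q m
    coeff-⊗-top [] q n m hp hq = F.sym (F.zeroˡ _)
    coeff-⊗-top (a ∷ p) q zero m hp hq = F.trans (≋⇒coeff (⊗-congˡ {a ∷ p} {const a} q (∷≋∷ F.refl (coeff⇒≋ λ j → hp (suc j) (s≤s z≤n)))) m)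
      (F.trans (≋⇒coeff (const-⊗ a q) m) (coeff-· a q m))
    coeff-⊗-top (a ∷ p) q (suc n) m hp hq = F.trans (coeff-⊕ (a · q) _ (suc (n ℕ.+ m)))
      (F.trans (F.+-cong (F.trans (coeff-· a q (suc (n ℕ.+ m))) (F.trans (F.*-congˡ (hq _ (s≤s (ℕₚ.m≤n+m m n)))) (F.zeroʳ a)))
        (coeff-⊗-top p q n m (λ j h → hp (suc j) (s≤s h)) hq)) (F.+-identityˡ _))

    degree-⊗ : ∀ {p q n m} → Degree p n → Degree q m → Degree (p ⊗ q) (n ℕ.+ m)
    degree-⊗ {p} {q} {n} {m} dp dq = record
      { lead≉0 = λ e → Sum.[ dp .Degree.lead≉0 , dq .Degree.lead≉0 ]′
          (field-domain (F.trans (F.sym (coeff-⊗-top p q n m (dp .Degree.above) (dq .Degree.above))) e))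
      ; above = coeff-⊗-above p q n m (dp .Degree.above) (dq .Degree.above) }

    degree-unique : ∀ {p q n m} → p ≋ q → Degree p n → Degree q m → n ≡ m
    degree-unique {p} {q} {n} {m} e dp dq with ℕₚ.<-cmp n m
    ... | tri< lt _ _ = contradiction (F.trans (F.sym (≋⇒coeff e m)) (dp .Degree.above m lt)) (dq .Degree.lead≉0)
    ... | tri≈ _ eq _ = eq
    ... | tri> _ _ gt = contradiction (F.trans (≋⇒coeff e n) (dq .Degree.above n gt)) (dp .Degree.lead≉0)

    degree-cong : ∀ {p q n} → p ≋ q → Degree p n → Degree q n
    degree-cong {n = n} e d = record
      { lead≉0 = λ f → d .Degree.lead≉0 (F.trans (≋⇒coeff e n) f)
      ; above = λ i le → F.trans (F.sym (≋⇒coeff e i)) (d .Degree.above i le) }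

    degree-const : ∀ {a} → ¬ a ≈ 0# → Degree (const a) 0
    degree-const a≉0 = record { lead≉0 = a≉0 ; above = λ { (suc i) _ → F.refl } }

    degree-1 : Degree (const 1#) 0
    degree-1 = degree-const 1≉0

    ≉0-degree : ∀ {p n} → Degree p n → ¬ p ≋ []
    ≉0-degree {n = n} d e = d .Degree.lead≉0 (≋⇒coeff e n)

    degree-factors : ∀ p q {r n} → Degree r n → p ⊗ q ≋ r → ∃[ i ] ∃[ j ] Degree p i × Degree q j × i ℕ.+ j ≡ n
    degree-factors p q d e with degree p | degree q
    ... | inj₁ p≋0 | _ = contradiction (≋-trans (≋-sym e) (⊗-congˡ {p} {[]} q p≋0)) (≉0-degree d)
    ... | inj₂ _ | inj₁ q≋0 = contradiction (≋-trans (≋-sym e) (≋-trans (⊗-congʳ p {q} {[]} q≋0) (⊗-zeroʳ p))) (≉0-degree d)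
    ... | inj₂ (i , dp) | inj₂ (j , dq) = i , j , dp , dq , degree-unique e (degree-⊗ dp dq) d

    degree-0-unit : ∀ {p} → Degree p 0 → p ∣ const 1#
    degree-0-unit {p} d with c , e ← inverse (coeff p 0) (d .Degree.lead≉0) = const c ,
      ≋-trans (⊗-congʳ (const c) {p} {const (coeff p 0)} (coeff⇒≋ λ { zero → F.refl ; (suc i) → d .Degree.above (suc i) (s≤s z≤n) }))
        (∷≋∷ (F.trans (F.+-identityʳ _) e) []≋[])

    nonunit : ∀ {p n} → Degree p (suc n) → ¬ p ∣ const 1#
    nonunit {p} d (q , e) with i , j , _ , dp , eq ← degree-factors q p degree-1 e
      = contradiction (≡.trans (≡.cong (i ℕ.+_) (degree-unique (≋-refl {p}) d dp)) eq) λ f → ℕₚ.1+n≢0 (≡.trans (≡.sym (ℕₚ.+-suc i _)) f)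

    -- After b has been scaled to be monic, the reduction that served the resultants gives quotient
    -- and remainder.
    divide : ∀ {b n} → Degree b n → ∀ a → ∃[ q ] ∃[ r ] a ≋ q ⊗ b ⊕ r × Below r n
    divide {b} {n} d a with c , e ← inverse (coeff b n) (d .Degree.lead≉0) = go
      where
      b′ = c · b
      lead : coeff b′ n ≈ 1#
      lead = F.trans (coeff-· c b n) e
      open Reduce b′ n
      open Reduction b′ n lead (λ i lt → F.trans (coeff-· c b i) (F.trans (F.*-congˡ (d .Degree.above i lt)) (F.zeroʳ c)))
      go : ∃[ q ] ∃[ r ] a ≋ q ⊗ b ⊕ r × Below r n
      go with s , f ← reduce-∣ (List.length a) a = neg (const c ⊗ s) , reduce (List.length a) a ,
        scaled-division {a} {b} {b′} (const c) s (≋-sym (const-⊗ c b)) f ,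
        reduce-deg (List.length a) a (λ i le → Below-length a i (ℕₚ.≤-trans (ℕₚ.m≤m+n _ n) le))

    open Euclid (Poly.poly C) using (Gcd; euclid) public

    gcd : ∀ a b → Gcd a b
    gcd a b = euclid Below (λ {b} h → coeff⇒≋ {b} {[]} λ i → h i z≤n) step (List.length b) a b (Below-length b)
      where
      step : ∀ {n b} → Below b (suc n) → Below b n ⊎ (∀ a → ∃[ q ] ∃[ r ] a ≋ q ⊗ b ⊕ r × Below r n)
      step {n} {b} h with coeff b n ≈0?
      ... | no ≉0 = inj₂ λ a → divide record { lead≉0 = ≉0 ; above = h } a
      ... | yes ≈0 = inj₁ λ i le → case i (ℕₚ.m≤n⇒m<n∨m≡n le)
        where
        case : ∀ i → n < i ⊎ n ≡ i → coeff b i ≈ 0#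
        case i (inj₁ lt) = h i lt
        case i (inj₂ ≡.refl) = ≈0

    ≉0-∣-degree : ∀ {a b n m} → Degree a n → Degree b m → a ∣ b → n ≤ m
    ≉0-∣-degree {a} da db (q , e) with i , j , _ , da′ , eq ← degree-factors q a db e =
      ≡.subst₂ _≤_ (degree-unique (≋-refl {a}) da′ da) eq (ℕₚ.m≤n+m j i)

    below-∣ : ∀ {a b n} → Degree a n → Below b n → a ∣ b → b ≋ []
    below-∣ {b = b} {n} da h a∣b with degree b
    ... | inj₁ e = e
    ... | inj₂ (m , db) = contradiction (h m (≉0-∣-degree da db a∣b)) (db .Degree.lead≉0)

    _∣?_ : ∀ {a n} → Degree a n → ∀ b → Dec (a ∣ b)
    _∣?_ {a} {n} da b = decide (divide da b)
      where
      decide : ∃[ q ] ∃[ r ] b ≋ q ⊗ a ⊕ r × Below r n → Dec (a ∣ b)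
      decide (q , r , e , below) = Sum.[ divisible , notDivisible ]′ (degree r)
        where
        divisible : r ≋ [] → Dec (a ∣ b)
        divisible r≋0 = yes (q , ≋-sym (≋-trans e (≋-trans (⊕-cong (≋-refl {q ⊗ a}) r≋0) (⊕-identityʳ (q ⊗ a)))))
        notDivisible : ∃[ m ] Degree r m → Dec (a ∣ b)
        notDivisible (m , dr) = no λ a∣b → ≉0-degree dr (below-∣ da below (remainder-∣ {a} {b} q r e a∣b))

-- Linear functionals on polynomials and the group ring of a cyclic group

module Functionals where
  open import Defs using (module Polynomial)
  open Rings
  open Determinants
  open FieldPolynomials
  open import Algebra.Bundles using (CommutativeRing)
  import Algebra.Properties.Ring
  import Algebra.Properties.Semiring.Exp
  import Algebra.Properties.Semiring.Mult
  import Algebra.Properties.CommutativeMonoid.Sum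
  import Algebra.Properties.Semiring.Sum
  open import Data.Bool.Base using (Bool; true; false; if_then_else_; T)
  open import Data.Fin.Base as Fin using (Fin; toℕ; fromℕ<)
  import Data.Fin.Properties as Finₚ
  open import Data.Integer.Base as ℤ using (ℤ; +_; -[1+_])
  import Data.Integer.Properties as ℤₚ
  open import Data.List.Base using ([]; _∷_; map)
  open import Data.Nat.Base as ℕ using (ℕ; zero; suc; _<_; _≤_)
  import Data.Nat.Properties as ℕₚ
  import Data.Nat.Divisibility as ℕ∣
  open import Data.Nat.DivMod using (_%_; %-distribˡ-+; [m+kn]%n≡m%n; %-remove-+ˡ; m%n<n; m<n⇒m%n≡m; m*n%n≡0)
  open import Data.Product.Base using (_,_; _×_; ∃-syntax)
  open import Data.Rational.Base as ℚ using (ℚ; 0ℚ; 1ℚ)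
  import Data.Rational.Properties as ℚₚ
  import Data.Rational.Unnormalised.Base as ℚᵘ
  import Data.Rational.Unnormalised.Properties as ℚᵘₚ
  open import Relation.Nullary using (¬_; yes; no; contradiction)
  open import Relation.Binary.PropositionalEquality as ≡ using (_≡_; _≢_)

  ℚ-ring : Ring₀
  ℚ-ring = CRing.ring₀ ℚC

  ℚ-inverse : ∀ a → ¬ a ≡ 0ℚ → ∃[ b ] b ℚ.* a ≡ 1ℚ
  ℚ-inverse a a≢0 = ℚ.1/ a , ℚₚ.*-inverseˡ a
    where instance _ = ℚ.≢-nonZero a≢0

  κ : ℤ → ℚ
  κ i = i ℚ./ 1

  private
    toκ : ∀ i → ℚ.toℚᵘ (κ i) ℚᵘ.≃ ℚᵘ.mkℚᵘ i 0
    toκ i = ℚₚ.toℚᵘ-fromℚᵘ (ℚᵘ.mkℚᵘ i 0)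

  κ-hom : IsHom ℤ-ring ℚ-ring κ
  κ-hom = record
    { cong = ≡.cong κ
    ; +-homo = λ i j → ℚₚ.toℚᵘ-injective (ℚᵘₚ.≃-trans (toκ (i ℤ.+ j)) (ℚᵘₚ.≃-trans
        (ℚᵘ.*≡* (≡.cong (ℤ._* + 1) (≡.sym (≡.cong₂ ℤ._+_ (ℤₚ.*-identityʳ i) (ℤₚ.*-identityʳ j)))))
        (ℚᵘₚ.≃-sym (ℚᵘₚ.≃-trans (ℚₚ.toℚᵘ-homo-+ (κ i) (κ j)) (ℚᵘₚ.+-cong (toκ i) (toκ j))))))
    ; *-homo = λ i j → ℚₚ.toℚᵘ-injective (ℚᵘₚ.≃-trans (toκ (i ℤ.* j))
        (ℚᵘₚ.≃-sym (ℚᵘₚ.≃-trans (ℚₚ.toℚᵘ-homo-* (κ i) (κ j)) (ℚᵘₚ.*-cong (toκ i) (toκ j)))))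
    ; -‿homo = λ i → ℚₚ.toℚᵘ-injective (ℚᵘₚ.≃-trans (toκ (ℤ.- i))
        (ℚᵘₚ.≃-sym (ℚᵘₚ.≃-trans (ℚₚ.toℚᵘ-homo‿- (κ i)) (ℚᵘₚ.-‿cong (toκ i)))))
    ; 0-homo = ≡.refl
    ; 1-homo = ≡.refl }

  κ-injective : ∀ {i j} → κ i ≡ κ j → i ≡ j
  κ-injective {i} {j} e with ℚᵘₚ.≃-trans (ℚᵘₚ.≃-sym (toκ i)) (ℚᵘₚ.≃-trans (ℚᵘₚ.≃-reflexive (≡.cong ℚ.toℚᵘ e)) (toκ j))
  ... | ℚᵘ.*≡* f = ≡.trans (≡.sym (ℤₚ.*-identityʳ i)) (≡.trans f (ℤₚ.*-identityʳ j))

  module HomLemmas {R S : Ring₀} {φ} (φ-hom : IsHom R S φ) where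
    private
      module R = CommutativeRing R
      module S = CommutativeRing S
      module ER = Algebra.Properties.Semiring.Exp R.semiring
      module ES = Algebra.Properties.Semiring.Exp S.semiring
      module MR = Algebra.Properties.Semiring.Mult R.semiring
      module MS = Algebra.Properties.Semiring.Mult S.semiring
      module IR = IntegerMultiples R
      module IS = IntegerMultiples S
    open IsHom φ-hom

    ^-homo : ∀ a n → φ (a ER.^ n) S.≈ φ a ES.^ n
    ^-homo a zero    = 1-homo
    ^-homo a (suc n) = S.trans (*-homo a _) (S.*-congˡ (^-homo a n))

    ×-homo : ∀ n a → φ (n MR.× a) S.≈ n MS.× φ a
    ×-homo zero    a = 0-homo
    ×-homo (suc n) a = S.trans (+-homo a _) (S.+-congˡ (×-homo n a))

    ι-homo : ∀ i → φ (IR.ι i) S.≈ IS.ι i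
    ι-homo (+ n) = S.trans (×-homo n _) (MS.×-congʳ n 1-homo)
    ι-homo -[1+ n ] = S.trans (-‿homo _) (S.-‿cong (S.trans (×-homo (suc n) _) (MS.×-congʳ (suc n) 1-homo)))

  ι-ℤ : ∀ i → IntegerMultiples.ι ℤ-ring i ≡ i
  ι-ℤ (+ n) = nat n
    where
    open Algebra.Properties.Semiring.Mult (CommutativeRing.semiring ℤ-ring) using () renaming (_×_ to _×ₙ_)
    nat : ∀ n → n ×ₙ (+ 1) ≡ + n
    nat zero = ≡.refl
    nat (suc n) = ≡.cong (ℤ._+_ (+ 1)) (nat n)
  ι-ℤ -[1+ n ] = ≡.cong ℤ.-_ (ι-ℤ (+ suc n))

  -- ℤ is initial. This identifies integer constants reached along different routes, and later it
  -- yields Fermat's little theorem.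
  ℤ-hom-unique : ∀ {R φ ψ} → IsHom ℤ-ring R φ → IsHom ℤ-ring R ψ → ∀ i → CommutativeRing._≈_ R (φ i) (ψ i)
  ℤ-hom-unique {R} {φ} {ψ} Φ Ψ i = trans (reflexive (≡.cong φ (≡.sym (ι-ℤ i))))
    (trans (HomLemmas.ι-homo Φ i) (trans (sym (HomLemmas.ι-homo Ψ i)) (reflexive (≡.cong ψ (ι-ℤ i)))))
    where open CommutativeRing R

  module PolyMap (C E : CRing) {φ} (φ-hom : IsHom (CRing.ring₀ C) (CRing.ring₀ E) φ) where
    private
      module R = CommutativeRing (CRing.ring₀ C)
      module S = CommutativeRing (CRing.ring₀ E)
      module PR = Polynomial (CRing.raw C)
      module PS = Polynomial (CRing.raw E)
      module R′ = Poly C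
      module S′ = Poly E
    open IsHom φ-hom

    coeff-map : ∀ p i → PS.coeff (map φ p) i S.≈ φ (PR.coeff p i)
    coeff-map []      i       = S.sym 0-homo
    coeff-map (a ∷ p) zero    = S.refl
    coeff-map (a ∷ p) (suc i) = coeff-map p i

    map-cong : ∀ {p q} → p PR.≋ q → map φ p PS.≋ map φ q
    map-cong {p} {q} e = S′.coeff⇒≋ λ i →
      S.trans (coeff-map p i) (S.trans (cong (R′.≋⇒coeff e i)) (S.sym (coeff-map q i)))

    map-⊕ : ∀ p q → map φ (p PR.⊕ q) PS.≋ map φ p PS.⊕ map φ q
    map-⊕ []      q       = S′.≋-refl
    map-⊕ (a ∷ p) []      = S′.≋-refl
    map-⊕ (a ∷ p) (b ∷ q) = PS.∷≋∷ (+-homo a b) (map-⊕ p q)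

    map-· : ∀ a p → map φ (a R′.· p) PS.≋ φ a S′.· map φ p
    map-· a []      = PS.[]≋[]
    map-· a (b ∷ p) = PS.∷≋∷ (*-homo a b) (map-· a p)

    map-⊗ : ∀ p q → map φ (p PR.⊗ q) PS.≋ map φ p PS.⊗ map φ q
    map-⊗ []      q = PS.[]≋[]
    map-⊗ (a ∷ p) q = S′.≋-trans (map-⊕ (a R′.· q) _) (S′.⊕-cong (map-· a q) (PS.∷≋∷ 0-homo (map-⊗ p q)))

    map-neg : ∀ p → map φ (R′.neg p) PS.≋ S′.neg (map φ p)
    map-neg []      = PS.[]≋[]
    map-neg (a ∷ p) = PS.∷≋∷ (-‿homo a) (map-neg p)

    map-hom : IsHom (Poly.poly C) (Poly.poly E) (map φ)
    map-hom = record
      { cong = map-cong ; +-homo = map-⊕ ; *-homo = map-⊗ ; -‿homo = map-neg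
      ; 0-homo = PS.[]≋[] ; 1-homo = PS.∷≋∷ 1-homo PS.[]≋[] }

  module Substitution (C : CRing) where
    open Evaluation C (Poly.poly C) (Poly.const-hom C) public
      renaming (ev to subst; ev-hom to subst-hom; ev-X to subst-X; ev-const to subst-const;
                ev-cong to subst-cong; ev-congˡ to subst-congˡ; ev-unique to subst-unique)

  module Functional (C : CRing) where
    open CRing C
    open CommutativeRing ring₀ hiding (zero)
    open Polynomial raw
    open Poly C hiding (poly)
    open IntegerMultiples ring₀
    private module P = CommutativeRing (Poly.poly C)
    open Algebra.Properties.Semiring.Exp P.semiring using (_^_)
    open Substitution C using (subst; subst-const)
    open Algebra.Properties.CommutativeMonoid.Sum +-commutativeMonoid using (sum; sum-cong-≋; ∑-distrib-+)
    open Algebra.Properties.Semiring.Sum semiring using (*-distribˡ-sum)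
    open import Relation.Binary.Reasoning.Setoid setoid

    -- The linear functional with X^i ↦ g i. With the indicator of a residue class modulo k for g,
    -- it gives a coefficient of the remainder modulo X^k - 1.
    L : (ℕ → Carrier) → Poly → Carrier
    L g []      = 0#
    L g (a ∷ p) = a * g 0 + L (λ i → g (suc i)) p

    L-congˡ : ∀ {g h} → (∀ i → g i ≈ h i) → ∀ p → L g p ≈ L h p
    L-congˡ e []      = refl
    L-congˡ e (a ∷ p) = +-cong (*-congˡ (e 0)) (L-congˡ (λ i → e (suc i)) p)

    private
      L-[] : ∀ g {p} → p ≋ [] → L g p ≈ 0#
      L-[] g []≋[] = refl
      L-[] g (∷≋[] e f) = trans (+-cong (trans (*-congʳ e) (zeroˡ _)) (L-[] _ f)) (+-identityˡ _)

    L-cong : ∀ g {p q} → p ≋ q → L g p ≈ L g q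
    L-cong g []≋[] = refl
    L-cong g (∷≋∷ e f) = +-cong (*-congʳ e) (L-cong _ f)
    L-cong g e@(∷≋[] _ _) = L-[] g e
    L-cong g e@([]≋∷ _ _) = sym (L-[] g (≋-sym e))

    L-⊕ : ∀ g p q → L g (p ⊕ q) ≈ L g p + L g q
    L-⊕ g []      q       = sym (+-identityˡ _)
    L-⊕ g (a ∷ p) []      = sym (+-identityʳ _)
    L-⊕ g (a ∷ p) (b ∷ q) = trans (+-congˡ (L-⊕ _ p q))
      (solve 5 (λ a b g p q → (a :+ b) :* g :+ (p :+ q) := (a :* g :+ p) :+ (b :* g :+ q)) a b (g 0) _ _)

    L-· : ∀ g a p → L g (a · p) ≈ a * L g p
    L-· g a []      = sym (zeroʳ a)
    L-· g a (b ∷ p) = trans (+-congˡ (L-· _ a p))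
      (solve 4 (λ a b g p → a :* b :* g :+ a :* p := a :* (b :* g :+ p)) a b (g 0) _)

    L-const : ∀ g a → L g (const a) ≈ a * g 0
    L-const g a = +-identityʳ _

    L-↑ : ∀ g p → L g (0# ∷ p) ≈ L (λ i → g (suc i)) p
    L-↑ g p = trans (+-congʳ (zeroˡ _)) (+-identityˡ _)

    L-⊗ : ∀ g p q → L g (p ⊗ q) ≈ L (λ i → L (λ j → g (i ℕ.+ j)) q) p
    L-⊗ g []      q = refl
    L-⊗ g (a ∷ p) q = trans (L-⊕ g (a · q) _) (+-cong (L-· g a q) (trans (L-↑ g (p ⊗ q)) (L-⊗ _ p q)))

    L-X^ : ∀ g m p → L g ((X ^ m) ⊗ p) ≈ L (λ i → g (m ℕ.+ i)) p
    L-X^ g zero    p = L-cong g (⊗-identityˡ p)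
    L-X^ g (suc m) p = begin
      L g ((X ⊗ (X ^ m)) ⊗ p)            ≈⟨ L-cong g (≋-trans (⊗-assoc X (X ^ m) p) (X⊗ _)) ⟩
      L g (0# ∷ (X ^ m) ⊗ p)             ≈⟨ L-↑ g ((X ^ m) ⊗ p) ⟩
      L (λ i → g (suc i)) ((X ^ m) ⊗ p)  ≈⟨ L-X^ _ m p ⟩
      L (λ i → g (suc m ℕ.+ i)) p        ∎

    L-subst-X^ : ∀ m g p → L g (subst (X ^ m) p) ≈ L (λ i → g (i ℕ.* m)) p
    L-subst-X^ m g []      = refl
    L-subst-X^ m g (a ∷ p) = trans (L-⊕ g (const a) ((X ^ m) ⊗ subst (X ^ m) p)) (+-cong (L-const g a)
      (trans (L-X^ g m (subst (X ^ m) p)) (L-subst-X^ m _ p)))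

    L-sum : ∀ {n} (f : Fin n → ℕ → Carrier) p → L (λ i → sum (λ r → f r i)) p ≈ sum (λ r → L (f r) p)
    L-sum {n} f [] = sym (trans (sum-zero′ n) refl)
      where
      sum-zero′ : ∀ n → sum {n} (λ _ → 0#) ≈ 0#
      sum-zero′ zero = refl
      sum-zero′ (suc n) = trans (+-identityˡ _) (sum-zero′ n)
    L-sum f (a ∷ p) = trans (+-cong (*-distribˡ-sum a (λ r → f r 0)) (L-sum (λ r i → f r (suc i)) p))
      (sym (∑-distrib-+ (λ r → a * f r 0) (λ r → L (λ i → f r (suc i)) p)))

    L-*ˡ : ∀ c g p → L (λ i → c * g i) p ≈ c * L g p
    L-*ˡ c g []      = sym (zeroʳ c)
    L-*ˡ c g (a ∷ p) = trans (+-congˡ (L-*ˡ c _ p))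
      (solve 4 (λ a c g p → a :* (c :* g) :+ c :* p := c :* (a :* g :+ p)) a c (g 0) _)

    L-*ʳ : ∀ c g p → L (λ i → g i * c) p ≈ L g p * c
    L-*ʳ c g p = trans (L-congˡ (λ i → *-comm _ c) p) (trans (L-*ˡ c g p) (*-comm c _))

    L-zero : ∀ g p → (∀ i → coeff p i * g i ≈ 0#) → L g p ≈ 0#
    L-zero g []      h = refl
    L-zero g (a ∷ p) h = trans (+-cong (h 0) (L-zero _ p (λ i → h (suc i)))) (+-identityˡ 0#)

    L-single : ∀ g p r → (∀ i → i ≢ r → coeff p i * g i ≈ 0#) → L g p ≈ coeff p r * g r
    L-single g []      r       h = sym (zeroˡ _)
    L-single g (a ∷ p) zero    h = trans (+-congˡ (L-zero _ p (λ i → h (suc i) (λ ())))) (+-identityʳ _)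
    L-single g (a ∷ p) (suc r) h = trans (+-congʳ (h 0 (λ ()))) (trans (+-identityˡ _)
      (L-single _ p r (λ i i≢r → h (suc i) (λ e → i≢r (ℕₚ.suc-injective e)))))

  -- Here k′ = k - 1 stands for -1 modulo k: conjugation sends X^j to X^(jk′), so the exponent i +
  -- jk′ of X^i (X^j)* is divisible by k exactly when i and j are congruent.
  congruent⇒∣ : ∀ k′ i j → let k = suc k′ in i % k ≡ j % k → (i ℕ.+ j ℕ.* k′) % k ≡ 0
  congruent⇒∣ k′ i j e = ≡.trans (%-distribˡ-+ i (j ℕ.* k′) k)
    (≡.trans (≡.cong (λ x → (x ℕ.+ (j ℕ.* k′) % k) % k) e)
    (≡.trans (≡.sym (%-distribˡ-+ j (j ℕ.* k′) k))
    (≡.trans (≡.cong (_% k) (≡.sym (ℕₚ.*-suc j k′))) (m*n%n≡0 j k))))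
    where k = suc k′

  ∣⇒congruent : ∀ k′ i j → let k = suc k′ in (i ℕ.+ j ℕ.* k′) % k ≡ 0 → i % k ≡ j % k
  ∣⇒congruent k′ i j e = ≡.trans (≡.sym ([m+kn]%n≡m%n i j k))
    (≡.trans (≡.cong (_% k) (≡.trans (≡.cong (i ℕ.+_) (≡.trans (ℕₚ.*-suc j k′) (ℕₚ.+-comm j _))) (≡.sym (ℕₚ.+-assoc i _ j))))
      (%-remove-+ˡ j (ℕ∣.m%n≡0⇒n∣m (i ℕ.+ j ℕ.* k′) k e)))
    where k = suc k′

  -- Residue functionals modulo X^k - 1, and the form ‖p‖² = λ(p p*) with p*(X) = p(X^{k-1}), which
  -- is the sum of the squares of the coefficients of p mod X^k - 1.
  module Residues (C : CRing) (k′ : ℕ) where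
    open CRing C
    open CommutativeRing ring₀ hiding (zero)
    open Polynomial raw
    open Poly C hiding (poly)
    open Functional C
    open Substitution C
    open IntegerMultiples ring₀
    private module P = CommutativeRing (Poly.poly C)
    private module PI = IntegerMultiples (Poly.poly C)
    open Algebra.Properties.Semiring.Exp P.semiring using (_^_)
    open Divisibility (Poly.poly C)
    open Determinant C using (sum-single)
    open Algebra.Properties.CommutativeMonoid.Sum +-commutativeMonoid using (sum; sum-cong-≋)
    open import Relation.Binary.Reasoning.Setoid setoid

    k = suc k′

    M : Poly
    M = X ^ k P.- const 1#

    ⟦_⟧ : Bool → Carrier
    ⟦ b ⟧ = if b then 1# else 0#

    e : ℕ → ℕ → Carrier
    e r i = ⟦ i % k ℕ.≡ᵇ r ⟧

    e-yes : ∀ r i → i % k ≡ r → e r i ≈ 1#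
    e-yes r i eq with i % k ℕ.≡ᵇ r in b
    ... | true = refl
    ... | false = contradiction (≡.subst T b (ℕₚ.≡⇒≡ᵇ _ _ eq)) λ ()

    e-no : ∀ r i → i % k ≢ r → e r i ≈ 0#
    e-no r i neq with i % k ℕ.≡ᵇ r in b
    ... | true = contradiction (ℕₚ.≡ᵇ⇒≡ _ _ (≡.subst T (≡.sym b) _)) neq
    ... | false = refl

    residue : ℕ → Poly → Carrier
    residue r = L (e r)

    L-M : ∀ r p → residue r (M ⊗ p) ≈ 0#
    L-M r p = begin
      L (e r) (M ⊗ p)
        ≈⟨ L-cong (e r) (PI.solve 3 (λ x o p → (x PI.:- o) PI.:* p PI.:= x PI.:* p PI.:+ PI.:- (o PI.:* p)) (X ^ k) (const 1#) p) ⟩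
      L (e r) ((X ^ k) ⊗ p ⊕ neg (const 1# ⊗ p))
        ≈⟨ L-⊕ (e r) ((X ^ k) ⊗ p) _ ⟩
      L (e r) ((X ^ k) ⊗ p) + L (e r) (neg (const 1# ⊗ p))
        ≈⟨ +-cong (L-X^ (e r) k p) (trans (L-cong (e r) (P.trans (neg-cong (⊗-identityˡ p)) (neg≋ p))) (L-· (e r) (- 1#) p)) ⟩
      L (λ i → e r (k ℕ.+ i)) p + - 1# * L (e r) p
        ≈⟨ +-congʳ (L-congˡ (λ i → reflexive (≡.cong (λ x → ⟦ x ℕ.≡ᵇ r ⟧) (%-remove-+ˡ i (ℕ∣.∣-refl {k})))) p) ⟩
      L (e r) p + - 1# * L (e r) p
        ≈⟨ +-congˡ (trans (sym (Algebra.Properties.Ring.-‿distribˡ-* ring 1# _)) (-‿cong (*-identityˡ _))) ⟩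
      L (e r) p + - L (e r) p ≈⟨ -‿inverseʳ _ ⟩
      0# ∎
      where
      neg≋ : ∀ p → neg p ≋ (- 1#) · p
      neg≋ p = coeff⇒≋ λ i → trans (coeff-neg p i) (trans (-‿cong (sym (*-identityˡ _)))
        (trans (Algebra.Properties.Ring.-‿distribˡ-* ring 1# _) (sym (coeff-· (- 1#) p i))))

    residue-∣ : ∀ r {p} → M ∣ p → residue r p ≈ 0#
    residue-∣ r (q , f) = trans (L-cong (e r) (P.trans (P.sym f) (⊗-comm q M))) (L-M r q)

    residue-below : ∀ r p → r < k → (∀ i → k ≤ i → coeff p i ≈ 0#) → residue r p ≈ coeff p r
    residue-below r p r<k below = trans (L-single (e r) p r other)
      (trans (*-congˡ (e-yes r r (m<n⇒m%n≡m r<k))) (*-identityʳ _))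
      where
      other : ∀ i → i ≢ r → coeff p i * e r i ≈ 0#
      other i i≢r with i ℕₚ.<? k
      ... | yes i<k = trans (*-congˡ (e-no r i (λ eq → i≢r (≡.trans (≡.sym (m<n⇒m%n≡m i<k)) eq)))) (zeroʳ _)
      ... | no i≮k  = trans (*-congʳ (below i (ℕₚ.≮⇒≥ i≮k))) (zeroˡ _)

    infix 9 _*ᶜ
    _*ᶜ : Poly → Poly
    p *ᶜ = subst (X ^ k′) p

    λ₀ : Poly → Carrier
    λ₀ = residue 0

    private
      -- Summed over the classes r, the product of the two indicators is 1 if i and j are congruent
      -- modulo k and 0 otherwise. This is what turns λ(p p*) into a sum of squares.
      orthogonal : ∀ i j → e 0 (i ℕ.+ j ℕ.* k′) ≈ sum {k} (λ r → e (toℕ r) i * e (toℕ r) j)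
      orthogonal i j = sym (trans (sum-single (λ r → e (toℕ r) i * e (toℕ r) j) r₀ other) main)
        where
        r₀ = fromℕ< (m%n<n i k)
        toℕr₀ : toℕ r₀ ≡ i % k
        toℕr₀ = Finₚ.toℕ-fromℕ< (m%n<n i k)
        other : ∀ r → r ≢ r₀ → e (toℕ r) i * e (toℕ r) j ≈ 0#
        other r r≢ = trans (*-congʳ (e-no (toℕ r) i λ eq → r≢ (Finₚ.toℕ-injective (≡.trans (≡.sym eq) (≡.sym toℕr₀))))) (zeroˡ _)
        main : e (toℕ r₀) i * e (toℕ r₀) j ≈ e 0 (i ℕ.+ j ℕ.* k′)
        main with i % k ℕₚ.≟ j % k
        ... | yes eq = trans (*-cong (e-yes (toℕ r₀) i (≡.sym toℕr₀)) (e-yes (toℕ r₀) j (≡.trans (≡.sym eq) (≡.sym toℕr₀))))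
                (trans (*-identityˡ _) (sym (e-yes 0 (i ℕ.+ j ℕ.* k′) (congruent⇒∣ k′ i j eq))))
        ... | no neq = trans (*-congˡ (e-no (toℕ r₀) j λ eq → neq (≡.trans (≡.sym toℕr₀) (≡.sym eq))))
                (trans (zeroʳ _) (sym (e-no 0 (i ℕ.+ j ℕ.* k′) λ eq → neq (∣⇒congruent k′ i j eq))))

    norm-squares : ∀ p → λ₀ (p ⊗ p *ᶜ) ≈ sum {k} (λ r → residue (toℕ r) p * residue (toℕ r) p)
    norm-squares p = begin
      L (e 0) (p ⊗ p *ᶜ)
        ≈⟨ L-⊗ (e 0) p (p *ᶜ) ⟩
      L (λ i → L (λ j → e 0 (i ℕ.+ j)) (p *ᶜ)) p
        ≈⟨ L-congˡ (λ i → trans (L-subst-X^ k′ (λ j → e 0 (i ℕ.+ j)) p) (L-congˡ (λ j → orthogonal i j) p)) p ⟩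
      L (λ i → L (λ j → sum {k} (λ r → e (toℕ r) i * e (toℕ r) j)) p) p
        ≈⟨ L-congˡ (λ i → trans (L-sum {k} (λ r j → e (toℕ r) i * e (toℕ r) j) p)
             (sum-cong-≋ {k} λ r → L-*ˡ (e (toℕ r) i) (e (toℕ r)) p)) p ⟩
      L (λ i → sum {k} (λ r → e (toℕ r) i * residue (toℕ r) p)) p
        ≈⟨ L-sum {k} (λ r i → e (toℕ r) i * residue (toℕ r) p) p ⟩
      sum {k} (λ r → L (λ i → e (toℕ r) i * residue (toℕ r) p) p)
        ≈⟨ sum-cong-≋ {k} (λ r → L-*ʳ (residue (toℕ r) p) (e (toℕ r)) p) ⟩
      sum {k} (λ r → residue (toℕ r) p * residue (toℕ r) p) ∎

-- Opaque polynomial rings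

module OpaquePolynomials where
  open import Defs using (RawRing₀; module Polynomial; module RawRing₀)
  open Rings
  open Domains
  open FieldPolynomials
  open Functionals
  open import Algebra.Bundles using (CommutativeRing)
  import Algebra.Properties.Ring
  import Data.Fin.Base
  import Algebra.Properties.Semiring.Exp
  open import Data.List.Base using (List; []; map)
  open import Data.Nat.Base as ℕ using (ℕ; zero; suc; _<_; _≤_; s≤s)
  import Data.Nat.Properties as ℕₚ
  open import Data.Product.Base using (_,_; _×_; ∃-syntax)
  open import Data.Sum.Base as Sum using (_⊎_)
  open import Relation.Nullary using (¬_; Dec)
  import Relation.Nullary.Decidable as Dec
  open import Relation.Binary.PropositionalEquality as ≡ using (_≡_)

  module OpaquePoly (C : CRing) where
    private
      K = CRing.ring₀ C
      module K = CommutativeRing K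
      module L = Polynomial (CRing.raw C)
      module LP = Poly C

    -- Opaque: unfolding the operations on coefficient lists makes conversion checking intractable.
    opaque
      ring₀ : Ring₀
      ring₀ = Poly.poly C

    open CommutativeRing ring₀ public hiding (zero)

    opaque
      unfolding ring₀

      fromList : List K.Carrier → Carrier
      fromList p = p

      toList : Carrier → List K.Carrier
      toList p = p

      from-to : ∀ p → fromList (toList p) ≡ p
      from-to p = ≡.refl

      to-from : ∀ p → toList (fromList p) ≡ p
      to-from p = ≡.refl

      fromList-hom : IsHom (Poly.poly C) ring₀ fromList
      fromList-hom = idHom (Poly.poly C)

      toList-hom : IsHom ring₀ (Poly.poly C) toList
      toList-hom = idHom (Poly.poly C)

    module From = IsHom fromList-hom
    module To = IsHom toList-hom

    to-from≋ : ∀ p → toList (fromList p) L.≋ p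
    to-from≋ p = ≡.subst (L._≋ p) (≡.sym (to-from p)) LP.≋-refl

    from-to≈ : ∀ p → fromList (toList p) ≈ p
    from-to≈ p = reflexive (from-to p)

    to-injective : ∀ {p q} → toList p L.≋ toList q → p ≈ q
    to-injective {p} {q} e = trans (sym (from-to≈ p)) (trans (From.cong e) (from-to≈ q))

    const : K.Carrier → Carrier
    const a = fromList (L.const a)

    const-hom : IsHom K ring₀ const
    const-hom = fromList-hom ∘ʰ Poly.const-hom C

    X : Carrier
    X = fromList L.X

    coeff : Carrier → ℕ → K.Carrier
    coeff p = L.coeff (toList p)

    coeff-cong : ∀ {p q} → p ≈ q → ∀ i → coeff p i K.≈ coeff q i
    coeff-cong e = LP.≋⇒coeff (To.cong e)

    coeff⇒≈ : ∀ {p q} → (∀ i → coeff p i K.≈ coeff q i) → p ≈ q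
    coeff⇒≈ h = to-injective (LP.coeff⇒≋ h)

    coeff-+ : ∀ p q i → coeff (p + q) i K.≈ coeff p i K.+ coeff q i
    coeff-+ p q i = K.trans (LP.≋⇒coeff (To.+-homo p q) i) (LP.coeff-⊕ (toList p) (toList q) i)

    coeff-neg : ∀ p i → coeff (- p) i K.≈ K.- coeff p i
    coeff-neg p i = K.trans (LP.≋⇒coeff (To.-‿homo p) i) (LP.coeff-neg (toList p) i)

    coeff-0 : ∀ i → coeff 0# i K.≈ K.0#
    coeff-0 i = LP.≋⇒coeff To.0-homo i

    coeff-1 : ∀ i → coeff 1# (suc i) K.≈ K.0#
    coeff-1 i = LP.≋⇒coeff To.1-homo (suc i)

    toList-const : ∀ a → toList (const a) L.≋ L.const a
    toList-const a = to-from≋ (L.const a)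

    coeff-const* : ∀ a p i → coeff (const a * p) i K.≈ a K.* coeff p i
    coeff-const* a p i = K.trans (LP.≋⇒coeff (To.*-homo (const a) p) i)
      (K.trans (LP.≋⇒coeff (LP.⊗-congˡ {toList (const a)} (toList p) (toList-const a)) i)
      (K.trans (LP.≋⇒coeff (LP.const-⊗ a (toList p)) i) (LP.coeff-· a (toList p) i)))

    module Ev (S : Ring₀) {φ} (φ-hom : IsHom K S φ) where
      private
        module S = CommutativeRing S
        module Eᵛ = Evaluation C S φ-hom

      ev : S.Carrier → Carrier → S.Carrier
      ev s p = Eᵛ.ev s (toList p)

      ev-hom : ∀ s → IsHom ring₀ S (ev s)
      ev-hom s = Eᵛ.ev-hom s ∘ʰ toList-hom

      ev-const : ∀ s a → ev s (const a) S.≈ φ a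
      ev-const s a = S.trans (Eᵛ.ev-cong s (toList-const a)) (Eᵛ.ev-const s a)

      ev-X : ∀ s → ev s X S.≈ s
      ev-X s = S.trans (Eᵛ.ev-cong s (to-from≋ L.X)) (Eᵛ.ev-X s)

      ev-congˡ : ∀ {s t} p → s S.≈ t → ev s p S.≈ ev t p
      ev-congˡ p = Eᵛ.ev-congˡ (toList p)

      ev-unique : ∀ {ψ} → IsHom ring₀ S ψ → (∀ a → ψ (const a) S.≈ φ a) → ∀ p → ψ p S.≈ ev (ψ X) p
      ev-unique {ψ} ψ-hom onConst p = S.trans (S.reflexive (≡.cong ψ (≡.sym (from-to p))))
        (Eᵛ.ev-unique (ψ-hom ∘ʰ fromList-hom) onConst (toList p))

    open Ev ring₀ const-hom public
      renaming (ev to subst; ev-hom to subst-hom; ev-X to subst-X; ev-const to subst-const;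
                ev-congˡ to subst-congˡ; ev-unique to subst-unique)

    subst-cong : ∀ s {p q} → p ≈ q → subst s p ≈ subst s q
    subst-cong s = IsHom.cong (subst-hom s)

    subst-identity : ∀ p → subst X p ≈ p
    subst-identity p = sym (subst-unique (idHom ring₀) (λ _ → refl) p)

    subst-subst : ∀ s t p → subst s (subst t p) ≈ subst (subst s t) p
    subst-subst s t p = trans
      (subst-unique (subst-hom s ∘ʰ subst-hom t) (λ a → trans (subst-cong s (subst-const t a)) (subst-const s a)) p)
      (subst-congˡ p (subst-cong s (subst-X t)))

    open Algebra.Properties.Semiring.Exp semiring public
    open Divisibility ring₀ public
    open IntegerMultiples ring₀ public hiding (Polynomial)

    subst-X^ : ∀ s n → subst s (X ^ n) ≈ s ^ n
    subst-X^ s n = trans (HomLemmas.^-homo (subst-hom s) X n) (^-congˡ n (subst-X s))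

    -- Both substitutions, followed by reduction modulo m, are homomorphisms that agree on constants
    -- and on X.
    subst-congruent : ∀ m s t p → m ∣ s - t → m ∣ subst s p - subst t p
    subst-congruent m s t p d = Q.trans (QE.ev-unique (quotient-hom m ∘ʰ subst-hom s) (λ a → ≈⇒quotient m (subst-const s a)) p)
      (Q.trans (QE.ev-congˡ p (Q.trans (≈⇒quotient m (subst-X s)) (Q.trans d (≈⇒quotient m (sym (subst-X t))))))
        (Q.sym (QE.ev-unique (quotient-hom m ∘ʰ subst-hom t) (λ a → ≈⇒quotient m (subst-const t a)) p)))
      where
      module Q = CommutativeRing (quotient m)
      module QE = Ev (quotient m) (quotient-hom m ∘ʰ const-hom)

    to-∣ : ∀ {a b} → a ∣ b → Divisibility._∣_ (Poly.poly C) (toList a) (toList b)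
    to-∣ = HomDivisibility.∣-hom toList-hom

    from-∣ : ∀ {a b} → Divisibility._∣_ (Poly.poly C) (toList a) (toList b) → a ∣ b
    from-∣ {a} {b} d = ≡.subst₂ _∣_ (from-to a) (from-to b) (HomDivisibility.∣-hom fromList-hom d)

    module Fn = Functional C

    functional : (ℕ → K.Carrier) → Carrier → K.Carrier
    functional g p = Fn.L g (toList p)

    functional-cong : ∀ g {p q} → p ≈ q → functional g p K.≈ functional g q
    functional-cong g e = Fn.L-cong g (To.cong e)

    functional-+ : ∀ g p q → functional g (p + q) K.≈ functional g p K.+ functional g q
    functional-+ g p q = K.trans (Fn.L-cong g (To.+-homo p q)) (Fn.L-⊕ g (toList p) (toList q))

    functional-const* : ∀ g a p → functional g (const a * p) K.≈ a K.* functional g p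
    functional-const* g a p = K.trans (Fn.L-cong g (LP.≋-trans (To.*-homo (const a) p)
      (LP.≋-trans (LP.⊗-congˡ {toList (const a)} (toList p) (toList-const a)) (LP.const-⊗ a (toList p))))) (Fn.L-· g a (toList p))

    functional-ι* : ∀ g i p → functional g (ι i * p) K.≈ IntegerMultiples.ι K i K.* functional g p
    functional-ι* g i p = K.trans (functional-cong g (*-congʳ (sym (HomLemmas.ι-homo const-hom i)))) (functional-const* g _ p)

    module _ (k′ : ℕ) where
      private module R = Residues C k′

      M : Carrier
      M = X ^ (suc k′) - 1#

      residue : ℕ → Carrier → K.Carrier
      residue r = functional (R.e r)

      to-M : toList M L.≋ R.M
      to-M = LP.≋-trans (To.‿-homo (X ^ suc k′) 1#) (CommutativeRing.+-cong (Poly.poly C)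
        (LP.≋-trans (HomLemmas.^-homo toList-hom X (suc k′)) (Algebra.Properties.Semiring.Exp.^-congˡ (CommutativeRing.semiring (Poly.poly C)) (suc k′) (to-from≋ L.X)))
        (CommutativeRing.-‿cong (Poly.poly C) To.1-homo))

      residue-∣ : ∀ r {p} → M ∣ p → residue r p K.≈ K.0#
      residue-∣ r d = R.residue-∣ r (Divisibility.∣-respˡ (Poly.poly C) to-M (to-∣ d))

      residue-below : ∀ r p → r < suc k′ → (∀ i → suc k′ ≤ i → coeff p i K.≈ K.0#) → residue r p K.≈ coeff p r
      residue-below r p = R.residue-below r (toList p)

      infix 9 _*ᶜ
      _*ᶜ : Carrier → Carrier
      p *ᶜ = subst (X ^ k′) p

      to-*ᶜ : ∀ p → toList (p *ᶜ) L.≋ toList p R.*ᶜ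
      to-*ᶜ p = LP.≋-trans (at-p (Eᵛ.ev-unique (toList-hom ∘ʰ subst-hom (X ^ k′) ∘ʰ fromList-hom)
          (λ a → LP.≋-trans (To.cong (subst-const (X ^ k′) a)) (toList-const a)) (toList p)))
        (Eᵛ.ev-congˡ (toList p) (LP.≋-trans (To.cong (subst-X (X ^ k′))) (LP.≋-trans (HomLemmas.^-homo toList-hom X k′)
          (Algebra.Properties.Semiring.Exp.^-congˡ (CommutativeRing.semiring (Poly.poly C)) k′ (to-from≋ L.X)))))
        where
        module Eᵛ = Evaluation C (Poly.poly C) (Poly.const-hom C)
        at-p : ∀ {r} → toList (subst (X ^ k′) (fromList (toList p))) L.≋ r → toList (subst (X ^ k′) p) L.≋ r
        at-p {r} = ≡.subst (λ x → toList (subst (X ^ k′) x) L.≋ r) (from-to p)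

      norm-squares : ∀ p → residue 0 (p * p *ᶜ) K.≈ RawRing₀.sum (CRing.raw C) {suc k′} (λ r → residue (Data.Fin.Base.toℕ r) p K.* residue (Data.Fin.Base.toℕ r) p)
      norm-squares p = K.trans (Fn.L-cong (R.e 0) (LP.≋-trans (To.*-homo p (p *ᶜ)) (LP.⊗-congʳ (toList p) (to-*ᶜ p)))) (R.norm-squares (toList p))

  module OpaqueFieldPoly (C : CRing) (inverse : HasInverses (CRing.ring₀ C)) (1≉0 : Nontrivial (CRing.ring₀ C)) where
    open OpaquePoly C public
    private
      K = CRing.ring₀ C
      module K = CommutativeRing K
      module FP = FieldPoly C inverse 1≉0
      module LP = Poly C
    module L = Polynomial (CRing.raw C)

    Degree : Carrier → ℕ → Set
    Degree p n = FP.Degree (toList p) n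

    Below : Carrier → ℕ → Set
    Below p n = ∀ i → n ≤ i → coeff p i K.≈ K.0#

    lead≉0 : ∀ {p n} → Degree p n → ¬ coeff p n K.≈ K.0#
    lead≉0 = FP.Degree.lead≉0

    above : ∀ {p n} → Degree p n → Below p (suc n)
    above = FP.Degree.above

    makeDegree : ∀ {p n} → ¬ coeff p n K.≈ K.0# → Below p (suc n) → Degree p n
    makeDegree l a = record { lead≉0 = l ; above = a }

    domain : IsDomain ring₀
    domain {p} {q} e = Sum.map from-zero from-zero (FP.domain {toList p} {toList q} (LP.≋-trans (LP.≋-sym (To.*-homo p q)) (LP.≋-trans (To.cong e) To.0-homo)))
      where
      from-zero : ∀ {p} → toList p L.≋ [] → p ≈ 0#
      from-zero e = to-injective (LP.≋-trans e (LP.≋-sym To.0-homo))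

    degree : ∀ p → p ≈ 0# ⊎ ∃[ n ] Degree p n
    degree p = Sum.map₁ (λ e → to-injective (LP.≋-trans e (LP.≋-sym To.0-homo))) (FP.degree (toList p))

    degree-cong : ∀ {p q n} → p ≈ q → Degree p n → Degree q n
    degree-cong e = FP.degree-cong (To.cong e)

    degree-* : ∀ {p q n m} → Degree p n → Degree q m → Degree (p * q) (n ℕ.+ m)
    degree-* {p} {q} dp dq = FP.degree-cong (LP.≋-sym (To.*-homo p q)) (FP.degree-⊗ dp dq)

    degree-unique : ∀ {p n m} → Degree p n → Degree p m → n ≡ m
    degree-unique {p} = FP.degree-unique (LP.≋-refl {toList p})

    degree-const : ∀ {a} → ¬ a K.≈ K.0# → Degree (const a) 0
    degree-const {a} h = FP.degree-cong (LP.≋-sym (toList-const a)) (FP.degree-const h)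

    degree-1 : Degree 1# 0
    degree-1 = FP.degree-cong (LP.≋-sym To.1-homo) FP.degree-1

    ≉0-degree : ∀ {p n} → Degree p n → ¬ p ≈ 0#
    ≉0-degree d e = FP.≉0-degree d (LP.≋-trans (To.cong e) To.0-homo)

    degree-factors : ∀ p q {r n} → Degree r n → p * q ≈ r → ∃[ i ] ∃[ j ] Degree p i × Degree q j × i ℕ.+ j ≡ n
    degree-factors p q d e = FP.degree-factors (toList p) (toList q) d (LP.≋-trans (LP.≋-sym (To.*-homo p q)) (To.cong e))

    degree-0-unit : ∀ {p} → Degree p 0 → p ∣ 1#
    degree-0-unit d = ∣-respʳ 1≈ (from-∣ (Divisibility.∣-respʳ (Poly.poly C) (LP.≋-sym (toList-const K.1#)) (FP.degree-0-unit d)))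
      where
      1≈ : const K.1# ≈ 1#
      1≈ = IsHom.1-homo const-hom

    nonunit : ∀ {p n} → Degree p (suc n) → ¬ p ∣ 1#
    nonunit d e = FP.nonunit d (Divisibility.∣-respʳ (Poly.poly C) To.1-homo (to-∣ e))

    degree-X : Degree X 1
    degree-X = FP.degree-cong (LP.≋-sym (to-from≋ L.X)) (record { lead≉0 = 1≉0 ; above = λ { (suc (suc i)) _ → K.refl ; (suc ℕ.zero) (s≤s ()) } })

    degree-X^ : ∀ n → Degree (X ^ n) n
    degree-X^ ℕ.zero = degree-1
    degree-X^ (suc n) = degree-* degree-X (degree-X^ n)

    degree-+ : ∀ {p q n} → Degree p n → Below q n → Degree (p + q) n
    degree-+ {p} {q} {n} d below = makeDegree
      (λ e → lead≉0 d (K.trans (K.sym (K.trans (K.+-congˡ (below n ℕₚ.≤-refl)) (K.+-identityʳ _))) (K.trans (K.sym (coeff-+ p q n)) e)))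
      (λ i le → K.trans (coeff-+ p q i) (K.trans (K.+-cong (above d i le) (below i (ℕₚ.<⇒≤ le))) (K.+-identityʳ _)))

    below-neg1 : ∀ {n} → Below (- 1#) (suc n)
    below-neg1 (suc i) _ = K.trans (coeff-neg 1# (suc i)) (K.trans (K.-‿cong (coeff-1 i)) (Algebra.Properties.Ring.-0#≈0# K.ring))

    degree-M : ∀ k′ → Degree (M k′) (suc k′)
    degree-M k′ = degree-+ (degree-X^ (suc k′)) below-neg1

    divide : ∀ {b n} → Degree b n → ∀ a → ∃[ q ] ∃[ r ] a ≈ q * b + r × Below r n
    divide {b} {n} d a = convert (FP.divide d (toList a))
      where
      convert : ∃[ q ] ∃[ r ] toList a L.≋ q L.⊗ toList b L.⊕ r × FP.Below r n → ∃[ q ] ∃[ r ] a ≈ q * b + r × Below r n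
      convert (q , r , e , below) = fromList q , fromList r ,
        trans (sym (from-to≈ a)) (trans (From.cong e) (trans (From.+-homo _ r) (+-congʳ (trans (From.*-homo q (toList b)) (*-congˡ (from-to≈ b)))))) ,
        λ i le → K.trans (LP.≋⇒coeff (to-from≋ r) i) (below i le)

    _∣?_ : ∀ {a n} → Degree a n → ∀ b → Dec (a ∣ b)
    d ∣? b = Dec.map′ from-∣ to-∣ (FP._∣?_ d (toList b))

    open Euclid ring₀ using (Gcd) public

    gcd : ∀ a b → Gcd a b
    gcd a b = record
      { gcd = fromList G.gcd
      ; gcd∣ˡ = ≡.subst (fromList G.gcd ∣_) (from-to a) (HomDivisibility.∣-hom fromList-hom G.gcd∣ˡ)
      ; gcd∣ʳ = ≡.subst (fromList G.gcd ∣_) (from-to b) (HomDivisibility.∣-hom fromList-hom G.gcd∣ʳ)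
      ; u = fromList G.u ; v = fromList G.v
      ; bézout = trans (+-cong (trans (*-congˡ (sym (from-to≈ a))) (sym (From.*-homo G.u (toList a))))
          (trans (*-congˡ (sym (from-to≈ b))) (sym (From.*-homo G.v (toList b)))))
          (trans (sym (From.+-homo _ _)) (From.cong G.bézout)) }
      where module G = Euclid.Gcd (FP.gcd (toList a) (toList b))

-- Polynomials over ℚ and the positive definite form

module RationalPolynomials where
  open import Defs using (module Polynomial)
  open Rings
  open FieldPolynomials
  open Functionals
  open OpaquePolynomials
  open import Algebra.Bundles using (CommutativeRing)
  import Algebra.Properties.CommutativeMonoid.Sum
  open import Data.Bool.Base using (true; false)
  open import Data.Nat.DivMod using (_%_)
  open import Data.Fin.Base as Fin using (Fin; toℕ; fromℕ<)
  import Data.Fin.Properties as Finₚ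
  open import Data.Integer.Base as ℤ using (ℤ; +_; -[1+_])
  import Data.Integer.Properties as ℤₚ
  open import Data.List.Base using ([]; _∷_; map)
  open import Data.Nat.Base as ℕ using (ℕ; zero; suc; _<_; _≤_; _∸_)
  import Data.Nat.Properties as ℕₚ
  open import Data.Product.Base using (_,_; _×_; ∃-syntax; proj₁; proj₂)
  open import Data.Rational.Base as ℚ using (ℚ; 0ℚ; mkℚ)
  import Data.Rational.Properties as ℚₚ
  import Data.Rational.Unnormalised.Base as ℚᵘ
  import Data.Rational.Unnormalised.Properties as ℚᵘₚ
  import Data.Sum.Base as Sum
  open import Relation.Nullary using (Dec; yes; no)
  open import Relation.Binary.PropositionalEquality as ≡ using (_≡_; _≢_)

  module ℚX = OpaqueFieldPoly ℚC ℚ-inverse (λ ())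
  module ℤX = OpaquePoly ℤC

  ℚ[X] ℤ[X] : Ring₀
  ℚ[X] = ℚX.ring₀
  ℤ[X] = ℤX.ring₀

  private module κᵐ = PolyMap ℤC ℚC κ-hom

  cast : ℤX.Carrier → ℚX.Carrier
  cast p = ℚX.fromList (map κ (ℤX.toList p))

  cast-hom : IsHom ℤ[X] ℚ[X] cast
  cast-hom = ℚX.fromList-hom ∘ʰ κᵐ.map-hom ∘ʰ ℤX.toList-hom

  module Cast = IsHom cast-hom

  coeff-cast : ∀ p i → ℚX.coeff (cast p) i ≡ κ (ℤX.coeff p i)
  coeff-cast p i = ≡.trans (Poly.≋⇒coeff ℚC (ℚX.to-from≋ _) i) (κᵐ.coeff-map (ℤX.toList p) i)

  cast-injective : ∀ {p q} → cast p ℚX.≈ cast q → p ℤX.≈ q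
  cast-injective {p} {q} e = ℤX.coeff⇒≈ λ i → κ-injective
    (≡.trans (≡.sym (coeff-cast p i)) (≡.trans (ℚX.coeff-cong e i) (coeff-cast q i)))

  cast-const : ∀ a → cast (ℤX.const a) ℚX.≈ ℚX.const (κ a)
  cast-const a = ℚX.From.cong (κᵐ.map-cong (ℤX.toList-const a))

  cast-X : cast ℤX.X ℚX.≈ ℚX.X
  cast-X = ℚX.From.cong (κᵐ.map-cong (ℤX.to-from≋ (Polynomial.X (CRing.raw ℤC))))

  cast-X^ : ∀ n → cast (ℤX.X ℤX.^ n) ℚX.≈ ℚX.X ℚX.^ n
  cast-X^ n = ℚX.trans (HomLemmas.^-homo cast-hom ℤX.X n) (ℚX.^-congˡ n cast-X)

  cast-subst : ∀ n p → cast (ℤX.subst (ℤX.X ℤX.^ n) p) ℚX.≈ ℚX.subst (ℚX.X ℚX.^ n) (cast p)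
  cast-subst n p = ℚX.trans
    (Eᶜ.ev-unique (cast-hom ∘ʰ ℤX.subst-hom s) (λ a → ℚX.trans (Cast.cong (ℤX.subst-const s a)) (cast-const a)) p)
    (ℚX.sym (ℚX.trans (Eᶜ.ev-unique (ℚX.subst-hom (ℚX.X ℚX.^ n) ∘ʰ cast-hom)
        (λ a → ℚX.trans (ℚX.subst-cong (ℚX.X ℚX.^ n) (cast-const a)) (ℚX.subst-const (ℚX.X ℚX.^ n) (κ a))) p)
      (Eᶜ.ev-congˡ p (ℚX.trans (ℚX.trans (ℚX.subst-cong (ℚX.X ℚX.^ n) cast-X) (ℚX.subst-X (ℚX.X ℚX.^ n)))
        (ℚX.sym (ℚX.trans (Cast.cong (ℤX.subst-X s)) (cast-X^ n)))))))
    where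
    s = ℤX.X ℤX.^ n
    module Eᶜ = ℤX.Ev ℚ[X] (ℚX.const-hom ∘ʰ κ-hom)

  κ-clear : ∀ q → ∃[ d ] ∃[ n ] d ≢ + 0 × κ d ℚ.* q ≡ κ n
  κ-clear q@(mkℚ n d-1 _) = + suc d-1 , n , (λ ()) , ℚₚ.toℚᵘ-injective
    (ℚᵘₚ.≃-trans (ℚₚ.toℚᵘ-homo-* (κ (+ suc d-1)) q)
    (ℚᵘₚ.≃-trans (ℚᵘₚ.*-congʳ (ℚₚ.toℚᵘ-fromℚᵘ (ℚᵘ.mkℚᵘ (+ suc d-1) 0)))
    (ℚᵘₚ.≃-trans (ℚᵘ.*≡* (≡.trans (ℤₚ.*-identityʳ _) (≡.trans (ℤₚ.*-comm (+ suc d-1) n) (≡.cong (λ x → n ℤ.* + suc x) (≡.sym (ℕₚ.+-identityʳ d-1))))))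
      (ℚᵘₚ.≃-sym (ℚₚ.toℚᵘ-fromℚᵘ (ℚᵘ.mkℚᵘ n 0))))))

  i*j≢0 : ∀ {i j} → i ≢ + 0 → j ≢ + 0 → i ℤ.* j ≢ + 0
  i*j≢0 {i} i≢0 j≢0 e = Sum.[ i≢0 , j≢0 ]′ (ℤₚ.i*j≡0⇒i≡0∨j≡0 i e)

  κ-κ : ∀ i j → κ i ℚ.* κ j ≡ κ (i ℤ.* j)
  κ-κ i j = ≡.sym (IsHom.*-homo κ-hom i j)

  private
    clear-list : ∀ p → ∃[ d ] ∃[ n ] d ≢ + 0 × Polynomial._≋_ (CRing.raw ℚC) (Poly._·_ ℚC (κ d) p) (map κ n)
    clear-list [] = + 1 , [] , (λ ()) , Polynomial.[]≋[]
    clear-list (q ∷ p) = combine (κ-clear q) (clear-list p)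
      where
      combine : _ → _ → _
      combine (d , n , d≢0 , eq) (D , N , D≢0 , eqs) =
        d ℤ.* D , D ℤ.* n ∷ Poly._·_ ℤC d N , i*j≢0 d≢0 D≢0 , Polynomial.∷≋∷ head tail
        where
        open ≡.≡-Reasoning
        head : κ (d ℤ.* D) ℚ.* q ≡ κ (D ℤ.* n)
        head = begin
          κ (d ℤ.* D) ℚ.* q     ≡⟨ ≡.cong (ℚ._* q) (≡.trans (≡.cong κ (ℤₚ.*-comm d D)) (≡.sym (κ-κ D d))) ⟩
          κ D ℚ.* κ d ℚ.* q     ≡⟨ ℚₚ.*-assoc (κ D) (κ d) q ⟩
          κ D ℚ.* (κ d ℚ.* q)   ≡⟨ ≡.cong (κ D ℚ.*_) eq ⟩
          κ D ℚ.* κ n           ≡⟨ κ-κ D n ⟩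
          κ (D ℤ.* n)           ∎
        tail : Polynomial._≋_ (CRing.raw ℚC) (Poly._·_ ℚC (κ (d ℤ.* D)) p) (map κ (Poly._·_ ℤC d N))
        tail = Poly.≋-trans ℚC (Poly.·-cong ℚC {p = p} (≡.sym (κ-κ d D)) (Poly.≋-refl ℚC))
          (Poly.≋-trans ℚC (Poly.≋-sym ℚC (Poly.·-· ℚC (κ d) (κ D) p))
          (Poly.≋-trans ℚC (Poly.·-cong ℚC {κ d} {κ d} ≡.refl eqs) (Poly.≋-sym ℚC (κᵐ.map-· d N))))

  clear-denominators : ∀ p → ∃[ d ] ∃[ n ] d ≢ + 0 × ℚX.const (κ d) ℚX.* p ℚX.≈ cast n
  clear-denominators p = convert (clear-list (ℚX.toList p))
    where
    convert : ∃[ d ] ∃[ n ] d ≢ + 0 × Polynomial._≋_ (CRing.raw ℚC) (Poly._·_ ℚC (κ d) (ℚX.toList p)) (map κ n) →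
      ∃[ d ] ∃[ n ] d ≢ + 0 × ℚX.const (κ d) ℚX.* p ℚX.≈ cast n
    convert (d , n , d≢0 , e) = d , ℤX.fromList n , d≢0 ,
      ℚX.coeff⇒≈ λ i → ≡.trans (ℚX.coeff-const* (κ d) p i) (≡.trans (≡.sym (Poly.coeff-· ℚC (κ d) (ℚX.toList p) i))
        (≡.trans (Poly.≋⇒coeff ℚC e i) (≡.trans (κᵐ.coeff-map n i)
          (≡.sym (≡.trans (coeff-cast (ℤX.fromList n) i) (≡.cong κ (Poly.≋⇒coeff ℤC (ℤX.to-from≋ n) i)))))))

  square-nonNeg : ∀ q → 0ℚ ℚ.≤ q ℚ.* q
  square-nonNeg q@(mkℚ (+ _) _ _) = ℚₚ.nonNegative⁻¹ (q ℚ.* q) {{ℚₚ.nonNeg*nonNeg⇒nonNeg q q}}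
  square-nonNeg q@(mkℚ -[1+ _ ] _ _) = ℚₚ.nonNegative⁻¹ (q ℚ.* q) {{ℚₚ.pos⇒nonNeg (q ℚ.* q) {{ℚₚ.neg*neg⇒pos q q}}}}

  open Algebra.Properties.CommutativeMonoid.Sum (CommutativeRing.+-commutativeMonoid ℚ-ring)
    using (sum; sum-cong-≋)

  sum-nonNeg : ∀ {n} (f : Fin n → ℚ) → (∀ i → 0ℚ ℚ.≤ f i) → 0ℚ ℚ.≤ sum f
  sum-nonNeg {zero}  f h = ℚₚ.≤-refl
  sum-nonNeg {suc n} f h = ℚₚ.+-mono-≤ (h Fin.zero) (sum-nonNeg (λ i → f (Fin.suc i)) λ i → h (Fin.suc i))

  nonNeg-+-zero : ∀ {p q} → 0ℚ ℚ.≤ p → 0ℚ ℚ.≤ q → p ℚ.+ q ≡ 0ℚ → p ≡ 0ℚ × q ≡ 0ℚ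
  nonNeg-+-zero {p} {q} 0≤p 0≤q e =
    ℚₚ.≤-antisym (≡.subst₂ ℚ._≤_ (ℚₚ.+-identityʳ p) e (ℚₚ.+-monoʳ-≤ p 0≤q)) 0≤p ,
    ℚₚ.≤-antisym (≡.subst₂ ℚ._≤_ (ℚₚ.+-identityˡ q) e (ℚₚ.+-monoˡ-≤ q 0≤p)) 0≤q

  sum-zero⇒zero : ∀ {n} (f : Fin n → ℚ) → (∀ i → 0ℚ ℚ.≤ f i) → sum f ≡ 0ℚ → ∀ i → f i ≡ 0ℚ
  sum-zero⇒zero {suc n} f h e i
    with f₀ , fs ← nonNeg-+-zero (h Fin.zero) (sum-nonNeg (λ i → f (Fin.suc i)) λ i → h (Fin.suc i)) e with i
  ... | Fin.zero = f₀
  ... | Fin.suc j = sum-zero⇒zero (λ i → f (Fin.suc i)) (λ i → h (Fin.suc i)) fs j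

  module Norm (k′ : ℕ) where
    private k = suc k′
    open ℚX hiding (M; residue; _*ᶜ; residue-∣; residue-below; norm-squares; degree-M)

    M : Carrier
    M = ℚX.M k′

    residue : ℕ → Carrier → ℚ
    residue = ℚX.residue k′

    infix 9 _*ᶜ
    _*ᶜ : Carrier → Carrier
    _*ᶜ = ℚX._*ᶜ k′

    residue-cong-M : ∀ r {p q} → M ∣ p - q → residue r p ≡ residue r q
    residue-cong-M r {p} {q} d = ≡.trans (functional-cong _ (solve 2 (λ p q → p := (p :- q) :+ q) p q))
      (≡.trans (functional-+ _ (p - q) q) (≡.trans (≡.cong (ℚ._+ residue r q) (ℚX.residue-∣ k′ r d)) (ℚₚ.+-identityˡ _)))

    -- The residues of p are those of its remainder modulo M, and a polynomial of degree below k has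
    -- its coefficients as residues.
    residues-zero : ∀ {p} → (∀ r → r < k → residue r p ≡ 0ℚ) → M ∣ p
    residues-zero {p} h = finish (divide (ℚX.degree-M k′) p)
      where
      finish : ∃[ q ] ∃[ r ] p ≈ q * M + r × Below r k → M ∣ p
      finish (q , r , e , below) = q , sym (trans e (trans (+-congˡ r≈0) (+-identityʳ _)))
        where
        residue-r : ∀ i → residue i r ≡ residue i p
        residue-r i = ≡.sym (residue-cong-M i (∣-respʳ (trans (solve 2 (λ x r → x := (x :+ r) :- r) (q * M) r) (+-congʳ (sym e))) (∣-*ˡ q ∣-refl)))
        r≈0 : r ≈ 0#
        r≈0 = coeff⇒≈ λ i → ≡.trans (case i (i ℕₚ.<? k)) (≡.sym (coeff-0 i))
          where
          case : ∀ i → Dec (i < k) → coeff r i ≡ 0ℚ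
          case i (yes i<k) = ≡.trans (≡.sym (ℚX.residue-below k′ i r i<k below)) (≡.trans (residue-r i) (h i i<k))
          case i (no i≮k) = below i (ℕₚ.≮⇒≥ i≮k)

    norm : Carrier → ℚ
    norm p = residue 0 (p * p *ᶜ)

    norm-squares : ∀ p → norm p ≡ sum {k} (λ r → residue (toℕ r) p ℚ.* residue (toℕ r) p)
    norm-squares = ℚX.norm-squares k′

    norm-nonNeg : ∀ p → 0ℚ ℚ.≤ norm p
    norm-nonNeg p = ≡.subst (0ℚ ℚ.≤_) (≡.sym (norm-squares p))
      (sum-nonNeg {k} (λ r → residue (toℕ r) p ℚ.* residue (toℕ r) p) λ r → square-nonNeg (residue (toℕ r) p))

    -- A sum of rational squares vanishes only if every residue does.
    norm-zero : ∀ {p} → norm p ≡ 0ℚ → M ∣ p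
    norm-zero {p} e = residues-zero λ r r<k → ≡.subst (λ x → residue x p ≡ 0ℚ) (Finₚ.toℕ-fromℕ< r<k)
      (Sum.reduce (FieldPoly.field-domain ℚC ℚ-inverse (λ ()) {residue (toℕ (fromℕ< r<k)) p}
        (sum-zero⇒zero {k} (λ r → residue (toℕ r) p ℚ.* residue (toℕ r) p) (λ r → square-nonNeg (residue (toℕ r) p))
        (≡.trans (≡.sym (norm-squares p)) e) (fromℕ< r<k))))

    norm-cong-M : ∀ {p q} → M ∣ p - q → norm p ≡ norm q
    norm-cong-M {p} {q} d = ≡.trans (norm-squares p) (≡.trans
      (sum-cong-≋ {k} λ r → ≡.cong₂ ℚ._*_ (residue-cong-M (toℕ r) d) (residue-cong-M (toℕ r) d))
      (≡.sym (norm-squares q)))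

    norm-scale : ∀ c p → norm (const c * p) ≡ (c ℚ.* c) ℚ.* norm p
    norm-scale c p = ≡.trans (functional-cong _ eq) (functional-const* _ (c ℚ.* c) (p * p *ᶜ))
      where
      eq : (const c * p) * (const c * p) *ᶜ ≈ const (c ℚ.* c) * (p * p *ᶜ)
      eq = trans (*-congˡ (trans (IsHom.*-homo (subst-hom (X ^ k′)) (const c) p) (*-congʳ (subst-const (X ^ k′) c))))
        (trans (solve 3 (λ c p q → (c :* p) :* (c :* q) := (c :* c) :* (p :* q)) (const c) p (p *ᶜ))
        (*-congʳ (sym (IsHom.*-homo const-hom c c))))

    residue-cast : ∀ r p → residue r (cast p) ≡ κ (ℤX.residue k′ r p)
    residue-cast r p = ≡.trans (Functional.L-cong ℚC _ (ℚX.to-from≋ (map κ (ℤX.toList p))))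
      (go _ _ (λ i → bool (i % k ℕ.≡ᵇ r)) (ℤX.toList p))
      where
      bool : ∀ b → Residues.⟦_⟧ ℚC k′ b ≡ κ (Residues.⟦_⟧ ℤC k′ b)
      bool true = ≡.refl
      bool false = ≡.refl
      go : ∀ g h → (∀ i → g i ≡ κ (h i)) → ∀ p → Functional.L ℚC g (map κ p) ≡ κ (Functional.L ℤC h p)
      go g h e [] = ≡.refl
      go g h e (a ∷ p) = ≡.trans (≡.cong₂ ℚ._+_ (≡.trans (≡.cong (κ a ℚ.*_) (e 0)) (κ-κ a (h 0))) (go _ _ (λ i → e (suc i)) p))
        (≡.sym (IsHom.+-homo κ-hom (a ℤ.* h 0) _))

    -- On integral polynomials the form takes natural numbers as values; the descent runs on these.
    norm-integral : ∀ p → ∃[ n ] norm (cast p) ≡ κ (+ n)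
    norm-integral p = proj₁ total , ≡.trans (norm-squares (cast p)) (proj₂ total)
      where
      sum-integral : ∀ {m} (f : Fin m → ℚ) → (∀ i → ∃[ z ] f i ≡ κ z) → ∃[ n ] sum (λ i → f i ℚ.* f i) ≡ κ (+ n)
      sum-integral {zero} f h = 0 , ≡.refl
      sum-integral {suc m} f h = add (h Fin.zero) (sum-integral (λ i → f (Fin.suc i)) (λ i → h (Fin.suc i)))
        where
        square : ∀ z → z ℤ.* z ≡ + (ℤ.∣ z ∣ ℕ.* ℤ.∣ z ∣)
        square (+ n) = ≡.sym (ℤₚ.pos-* n n)
        square -[1+ n ] = ≡.refl
        add : ∃[ z ] f Fin.zero ≡ κ z → ∃[ n ] sum (λ i → f (Fin.suc i) ℚ.* f (Fin.suc i)) ≡ κ (+ n) → ∃[ n ] sum (λ i → f i ℚ.* f i) ≡ κ (+ n)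
        add (z , e) (n , g) = ℤ.∣ z ∣ ℕ.* ℤ.∣ z ∣ ℕ.+ n ,
          ≡.trans (≡.cong₂ ℚ._+_ (≡.trans (≡.cong₂ ℚ._*_ e e) (≡.trans (κ-κ z z) (≡.cong κ (square z)))) g)
            (≡.sym (IsHom.+-homo κ-hom (+ (ℤ.∣ z ∣ ℕ.* ℤ.∣ z ∣)) (+ n)))
      total = sum-integral {k} (λ r → residue (toℕ r) (cast p)) (λ r → ℤX.residue k′ (toℕ r) p , residue-cast (toℕ r) p)

  κ-nonNeg : ∀ n → 0ℚ ℚ.≤ κ (+ n)
  κ-nonNeg n = ℚₚ.nonNegative⁻¹ (κ (+ n)) {{ℚₚ.normalize-nonNeg n 1}}

  κ-mono-≤ : ∀ {m n} → m ≤ n → κ (+ m) ℚ.≤ κ (+ n)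
  κ-mono-≤ {m} {n} m≤n = ≡.subst₂ ℚ._≤_ (ℚₚ.+-identityʳ _)
    (≡.trans (≡.sym (IsHom.+-homo κ-hom (+ m) (+ (n ∸ m)))) (≡.cong (λ x → κ (+ x)) (ℕₚ.m+[n∸m]≡n m≤n)))
    (ℚₚ.+-monoʳ-≤ (κ (+ m)) (κ-nonNeg (n ∸ m)))

  κ-cancel-< : ∀ {m n} → κ (+ m) ℚ.< κ (+ n) → m < n
  κ-cancel-< {m} {n} lt = ℕₚ.≰⇒> λ n≤m → ℚₚ.<-irrefl ≡.refl (ℚₚ.≤-<-trans (κ-mono-≤ n≤m) lt)

-- Frobenius and Landau's argument on roots of unity

module LandauArgument where
  open Rings
  open FieldPolynomials
  open Functionals
  open OpaquePolynomials
  open RationalPolynomials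
  open Domains
  open import Algebra.Bundles using (CommutativeRing)
  import Algebra.Properties.Ring
  import Algebra.Properties.Semiring.Exp
  import Algebra.Properties.Semiring.Mult
  import Algebra.Properties.CommutativeSemiring.Exp
  import Algebra.Properties.CommutativeSemiring.Binomial
  import Algebra.Properties.CommutativeMonoid.Sum
  open import Data.Fin.Base as Fin using (Fin; toℕ; inject₁)
  import Data.Fin.Properties as Finₚ
  open import Data.Integer.Base as ℤ using (ℤ; +_)
  import Data.Integer.Properties as ℤₚ
  open import Data.List.Base as List using (List; []; _∷_)
  open import Data.List.Relation.Unary.All using ([]; _∷_)
  open import Data.Nat.Base as ℕ using (ℕ; zero; suc; _<_; _≤_; s≤s; z≤n; _∸_; NonZero; _!)
  import Data.Nat.Properties as ℕₚ
  open import Data.Nat.Combinatorics using (_C_; nCn≡1; k![n∸k]!∣n!)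
  open import Data.Nat.Combinatorics.Specification using (nCk≡n!/k![n-k]!)
  open import Data.Nat.Divisibility as ℕ∣ using (divides) renaming (_∣_ to _∣ⁿ_)
  open import Data.Nat.DivMod using (_%_; _/_; m/n*n≡m; m%n<n; m≡m%n+[m/n]*n)
  open import Data.Nat.Coprimality using () renaming (Coprime to Coprimeⁿ)
  open import Data.Nat.Primality using (Prime; euclidsLemma; prime⇒nonZero; prime⇒nonTrivial)
  open import Data.Product.Base using (_,_; _×_; ∃-syntax; proj₁; proj₂)
  open import Data.Rational.Base as ℚ using (ℚ; 1ℚ)
  open import Data.Sum.Base as Sum using (inj₁; inj₂)
  open import Relation.Nullary using (¬_; contradiction)
  open import Relation.Binary.PropositionalEquality as ≡ using (_≡_; _≢_)

  ∤-factorial : ∀ {p} → Prime p → ∀ n → n < p → ¬ p ∣ⁿ n !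
  ∤-factorial pr zero lt d = contradiction (ℕ∣.∣1⇒≡1 d) λ { ≡.refl → ℕ.nonTrivial⇒≢1 {{prime⇒nonTrivial pr}} ≡.refl }
  ∤-factorial {p} pr (suc n) lt d with euclidsLemma (suc n) (n !) pr d
  ... | inj₁ p∣n = ℕₚ.<⇒≱ lt (ℕ∣.∣⇒≤ p∣n)
  ... | inj₂ p∣! = ∤-factorial pr n (ℕₚ.<-trans (ℕₚ.n<1+n n) lt) p∣!

  -- The prime divides p! = (p C k) k! (p - k)!, but neither k! nor (p - k)!.
  prime∣binomial : ∀ {p} → Prime p → ∀ k → 0 < k → k < p → p ∣ⁿ p C k
  prime∣binomial {p} pr k 0<k k<p = Sum.[ (λ d → d) , (λ d → contradiction d ∤k!) ]′ (euclidsLemma (p C k) (k ! ℕ.* (p ∸ k) !) pr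
      (≡.subst (p ∣ⁿ_) (≡.sym eq) (p∣p! p k<p)))
    where
    k≤p = ℕₚ.<⇒≤ k<p
    p∣p! : ∀ p → k < p → p ∣ⁿ p !
    p∣p! (suc p) _ = divides (p !) (ℕₚ.*-comm (suc p) (p !))
    instance
      denominator : NonZero (k ! ℕ.* (p ∸ k) !)
      denominator = ℕₚ.m*n≢0 (k !) ((p ∸ k) !) {{k ℕₚ.!≢0}} {{(p ∸ k) ℕₚ.!≢0}}
    eq : (p C k) ℕ.* (k ! ℕ.* (p ∸ k) !) ≡ p !
    eq = ≡.trans (≡.cong (ℕ._* (k ! ℕ.* (p ∸ k) !)) (nCk≡n!/k![n-k]! k≤p)) (m/n*n≡m (k![n∸k]!∣n! k≤p))
    ∤k! : ¬ p ∣ⁿ k ! ℕ.* (p ∸ k) !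
    ∤k! d with euclidsLemma (k !) ((p ∸ k) !) pr d
    ... | inj₁ x = ∤-factorial pr k k<p x
    ... | inj₂ x = ∤-factorial pr (p ∸ k) (ℕₚ.∸-monoʳ-< {p} 0<k k≤p) x

  Annihilates : ℕ → Ring₀ → Set
  Annihilates n R = ∀ x → n ×ₙ x ≈ 0#
    where
    open CommutativeRing R
    open Algebra.Properties.Semiring.Mult semiring using () renaming (_×_ to _×ₙ_)

  module Frobenius (R : Ring₀) (p : ℕ) (p-prime : Prime p) (char-p : Annihilates p R) where
    open CommutativeRing R hiding (zero)
    open Algebra.Properties.Semiring.Mult semiring using (×-assocˡ; ×-congʳ; ×-homo-1) renaming (_×_ to _×ₙ_)
    open Algebra.Properties.CommutativeSemiring.Exp commutativeSemiring using (_^_; ^-distrib-*; ^-congˡ)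
    open Algebra.Properties.CommutativeSemiring.Binomial commutativeSemiring using (binomialTerm; theorem)
    open Algebra.Properties.CommutativeMonoid.Sum +-commutativeMonoid using (sum; sum-init-last; sum-cong-≋; sum-replicate-zero)
    open Algebra.Properties.Ring ring using (-0#≈0#)
    open import Relation.Binary.Reasoning.Setoid setoid

    private
      multiple-zero : ∀ n x → p ∣ⁿ n → n ×ₙ x ≈ 0#
      multiple-zero n x (divides q ≡.refl) = trans (reflexive (≡.cong (_×ₙ x) (ℕₚ.*-comm q p)))
        (trans (sym (×-assocˡ x p q)) (char-p (q ×ₙ x)))

      0^ : ∀ n → 0 < n → 0# ^ n ≈ 0#
      0^ (suc n) _ = zeroˡ _

      1^ : ∀ n → 1# ^ n ≈ 1#
      1^ zero = refl
      1^ (suc n) = trans (*-identityˡ _) (1^ n)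

      0<p : 0 < p
      0<p = ℕₚ.n≢0⇒n>0 (ℕ.≢-nonZero⁻¹ p {{prime⇒nonZero p-prime}})

      -- The prime is written as `suc q` to split the binomial sum into its first term, its last
      -- term and middle terms that p annihilates.
      expansion : ∀ q → p ≡ suc q → ∀ x y → (x + y) ^ p ≈ x ^ p + y ^ p
      expansion q ≡.refl x y = begin
        (x + y) ^ p                             ≈⟨ theorem p x y ⟩
        t Fin.zero + sum (λ i → t (Fin.suc i))  ≈⟨ +-cong first (sum-init-last (λ i → t (Fin.suc i))) ⟩
        y ^ p + (sum (λ i → t (Fin.suc (inject₁ i))) + t (Fin.fromℕ p)) ≈⟨ +-congˡ (+-cong
          (trans (sum-cong-≋ middle) (sum-replicate-zero q)) lastTerm) ⟩
        y ^ p + (0# + x ^ p)                    ≈⟨ +-congˡ (+-identityˡ _) ⟩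
        y ^ p + x ^ p                           ≈⟨ +-comm _ _ ⟩
        x ^ p + y ^ p                           ∎
        where
        t = binomialTerm x y p
        first : t Fin.zero ≈ y ^ p
        first = trans (×-homo-1 _) (*-identityˡ _)
        middle : ∀ i → t (Fin.suc (inject₁ i)) ≈ 0#
        middle i = multiple-zero _ _ (prime∣binomial p-prime (suc (toℕ (inject₁ i))) (s≤s z≤n)
          (s≤s (≡.subst (_< q) (≡.sym (Finₚ.toℕ-inject₁ i)) (Finₚ.toℕ<n i))))
        lastTerm : t (Fin.fromℕ p) ≈ x ^ p
        lastTerm = trans (reflexive (≡.cong (λ n → (p C n) ×ₙ (x ^ n * y ^ (p ∸ n))) (Finₚ.toℕ-fromℕ p)))
          (trans (reflexive (≡.cong₂ (λ m n → m ×ₙ (x ^ p * y ^ n)) (nCn≡1 p) (ℕₚ.n∸n≡0 p)))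
          (trans (×-homo-1 _) (*-identityʳ _)))

    frobenius-+ : ∀ x y → (x + y) ^ p ≈ x ^ p + y ^ p
    frobenius-+ = expansion (ℕ.pred p) (≡.sym (ℕₚ.suc-pred p {{prime⇒nonZero p-prime}}))

    frobenius : IsHom R R (_^ p)
    frobenius = record
      { cong = ^-congˡ p ; +-homo = frobenius-+ ; *-homo = λ x y → ^-distrib-* x y p
      ; -‿homo = neg ; 0-homo = 0^ p 0<p ; 1-homo = 1^ p }
      where
      neg : ∀ x → (- x) ^ p ≈ - (x ^ p)
      neg x = begin
        (- x) ^ p                           ≈⟨ +-identityˡ _ ⟨
        0# + (- x) ^ p                      ≈⟨ +-congʳ (-‿inverseˡ (x ^ p)) ⟨
        - (x ^ p) + x ^ p + (- x) ^ p       ≈⟨ +-assoc _ _ _ ⟩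
        - (x ^ p) + (x ^ p + (- x) ^ p)     ≈⟨ +-congˡ (frobenius-+ x (- x)) ⟨
        - (x ^ p) + (x + - x) ^ p           ≈⟨ +-congˡ (trans (^-congˡ p (-‿inverseʳ x)) (0^ p 0<p)) ⟩
        - (x ^ p) + 0#                      ≈⟨ +-identityʳ _ ⟩
        - (x ^ p)                           ∎

  module _ where
    open ℤX

    private
      module Modulo (p : ℕ) where
        m = ι (+ p)
        S = quotient m
        module S = CommutativeRing S
        module S^ = Algebra.Properties.Semiring.Exp S.semiring
        open Algebra.Properties.Semiring.Mult semiring using (×-assoc-*; ×-congʳ) renaming (_×_ to _×ₙ_)
        module SM = Algebra.Properties.Semiring.Mult S.semiring
        ^-same : ∀ q n → q S^.^ n ≈ q ^ n
        ^-same q zero = refl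
        ^-same q (suc n) = *-congˡ {q} (^-same q n)
        ×-same : ∀ n q → n SM.× q ≈ n ×ₙ q
        ×-same zero q = refl
        ×-same (suc n) q = +-congˡ {q} (×-same n q)
        char-p : ∀ x → m ∣ (p SM.× x) - 0#
        char-p x = zero-quotient (∣-respʳ
          (trans (*-comm x m) (trans (×-assoc-* p 1# x) (trans (×-congʳ p (*-identityˡ x)) (sym (×-same p x))))) (x , refl))

    -- Modulo p both F(X^p) and F(X)^p are ring homomorphisms in F, the latter by the Frobenius map.
    -- They agree on X, and on constants by Fermat's little theorem.
    freshman : ∀ p → Prime p → ∀ F → ι (+ p) ∣ subst (X ^ p) F - F ^ p
    freshman p pr F = S.trans
      (EvS.ev-unique (quotient-hom m ∘ʰ subst-hom (X ^ p)) (λ a → ≈⇒quotient m (subst-const (X ^ p) a)) F)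
      (S.trans (EvS.ev-congˡ F (≈⇒quotient m (subst-X (X ^ p))))
        (S.sym (S.trans
          (S.sym (≈⇒quotient m (^-same F p)))
          (S.trans (EvS.ev-unique {λ q → q S^.^ p} (Frob.frobenius ∘ʰ quotient-hom m) fermat F) (EvS.ev-congˡ F (≈⇒quotient m (^-same X p)))))))
      where
      open Modulo p
      module EvS = Ev S (quotient-hom m ∘ʰ const-hom)
      module Frob = Frobenius S p pr char-p
      -- Fermat's little theorem: Frobenius after reduction is one more homomorphism out of ℤ, and
      -- there is only one.
      fermat : ∀ a → m ∣ (const a S^.^ p) - const a
      fermat a = ℤ-hom-unique {S} (Frob.frobenius ∘ʰ quotient-hom m ∘ʰ const-hom) (quotient-hom m ∘ʰ const-hom) a

  module PowerDivisibility (R : Ring₀) where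
    open CommutativeRing R hiding (zero)
    open Algebra.Properties.Semiring.Exp semiring
    open Divisibility R
    open IntegerMultiples R

    a-1∣a^n-1 : ∀ a n → a - 1# ∣ a ^ n - 1#
    a-1∣a^n-1 a zero = ∣-respʳ (sym (-‿inverseʳ 1#)) ∣-0
    a-1∣a^n-1 a (suc n) = ∣-respʳ
      (solve 3 (λ a x o → a :* (x :- o) :+ (a :* o :- o) := a :* x :- o) a (a ^ n) 1#)
      (∣-+ (∣-*ˡ a (a-1∣a^n-1 a n)) (∣-reflexive (+-congʳ (sym (*-identityʳ a)))))

    ∣-exponent : ∀ a {m n} → m ∣ⁿ n → a ^ m - 1# ∣ a ^ n - 1#
    ∣-exponent a {m} (divides q ≡.refl) = ∣-respʳ (+-congʳ (trans (^-assocʳ a m q) (^-congʳ a (ℕₚ.*-comm m q)))) (a-1∣a^n-1 (a ^ m) q)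

    periodic : ∀ a k i q → a ^ k - 1# ∣ a ^ (i ℕ.+ q ℕ.* k) - a ^ i
    periodic a k i q = ∣-respʳ
      (trans (trans (distribˡ (a ^ i) _ _) (+-congˡ (trans (sym (Algebra.Properties.Ring.-‿distribʳ-* ring (a ^ i) 1#)) (-‿cong (*-identityʳ _)))))
        (+-congʳ (sym (^-homo-* a i (q ℕ.* k)))))
      (∣-*ˡ (a ^ i) (∣-exponent a (divides q ≡.refl)))

  bounded : (f : ℕ → ℕ) → ∀ n → ∃[ B ] ∀ i → i < n → f i ≤ B
  bounded f zero = 0 , λ _ ()
  bounded f (suc n) with B , h ← bounded f n = B ℕ.+ f n , go
    where
    go : ∀ i → i < suc n → f i ≤ B ℕ.+ f n
    go i (s≤s le) with ℕₚ.m≤n⇒m<n∨m≡n le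
    ... | inj₁ lt = ℕₚ.≤-trans (h i lt) (ℕₚ.m≤m+n B (f n))
    ... | inj₂ ≡.refl = ℕₚ.m≤n+m (f n) B

  small-multiple-zero : ∀ (p : ℕ) (x y : ℤ) → x ≡ + p ℤ.* y → ℤ.∣ x ∣ < p → x ≡ + 0
  small-multiple-zero p x y e lt = ≡.trans e (≡.trans (≡.cong (+ p ℤ.*_) (ℤₚ.∣i∣≡0⇒i≡0 (case ℤ.∣ y ∣ ≡.refl))) (ℤₚ.*-zeroʳ (+ p)))
    where
    case : ∀ n → ℤ.∣ y ∣ ≡ n → ℤ.∣ y ∣ ≡ 0
    case zero eq = eq
    case (suc n) eq = contradiction (≡.subst (p ≤_) (≡.sym (≡.trans (≡.cong ℤ.∣_∣ e) (≡.trans (ℤₚ.abs-* (+ p) y) (≡.cong (p ℕ.*_) eq)))) (ℕₚ.m≤m*n p (suc n))) (ℕₚ.<⇒≱ lt)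

  -- Since M = f h divides z = c s h with c a unit, h cancels and f divides s.
  cancel-algebra : ∀ (R : Ring₀) → IsDomain R →
    let open CommutativeRing R
        open Divisibility R
    in
    ∀ {f h M s z c d q} → f * h ≈ M → ¬ h ≈ 0# → q * M ≈ z → z ≈ c * (s * h) → d * c ≈ 1# → f ∣ s
  cancel-algebra R domain {f} {h} {M} {s} {z} {c} {d} {q} fh h≉0 qM z≈ dc = d * q , domain-cancelʳ R domain h≉0
    (trans (solve 4 (λ d q f h → d :* q :* f :* h := d :* (q :* (f :* h))) d q f h)
    (trans (*-congˡ (trans (*-congˡ fh) (trans qM z≈)))
    (trans (solve 4 (λ d c s h → d :* (c :* (s :* h)) := d :* c :* (s :* h)) d c s h) (trans (*-congʳ dc) (*-identityˡ _)))))
    where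
    open CommutativeRing R
    open IntegerMultiples R

  -- Landau's argument: F(X^p) H ≡ F(X)^p H ≡ 0 modulo (p, X^k - 1), while the residues of F(X^p) H
  -- modulo X^k - 1 only depend on p mod k; for large p they must therefore vanish.
  module Landau (k′ : ℕ) where
    private
      module Z = ℤX
      module Q = ℚX
      module Nℚ = Norm k′
      k = suc k′
      Mᶻ = Z.M k′
      residueᶻ = Z.residue k′
    open Nℚ using (M)

    cast-M : cast Mᶻ Q.≈ M
    cast-M = Q.trans (Cast.‿-homo (Z.X Z.^ k) Z.1#) (Q.+-cong (cast-X^ k) (Q.-‿cong Cast.1-homo))

    module Cleared (f h : Q.Carrier) (fh≈M : f Q.* h Q.≈ M) (b c : ℤ) (F H : Z.Carrier) (b≢0 : b ≢ + 0) (c≢0 : c ≢ + 0)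
      (eF : Q.const (κ b) Q.* f Q.≈ cast F) (eH : Q.const (κ c) Q.* h Q.≈ cast H) where
      z : ℕ → Z.Carrier
      z j = Z.subst (Z.X Z.^ j) F Z.* H
      bounds : ∀ j → ∃[ B ] ∀ r → r < k → ℤ.∣ residueᶻ r (z j) ∣ ≤ B
      bounds j = bounded (λ r → ℤ.∣ residueᶻ r (z j) ∣) k
      -- One bound for the residues of all z j with j < k. As z p has the same residues as z (p mod
      -- k), it serves every prime p at once.
      B = proj₁ (bounded (λ j → proj₁ (bounds j)) k)
      residue-bound : ∀ j r → j < k → r < k → ℤ.∣ residueᶻ r (z j) ∣ ≤ B
      residue-bound j r j<k r<k = ℕₚ.≤-trans (proj₂ (bounds j) r r<k) (proj₂ (bounded (λ j → proj₁ (bounds j)) k) j j<k)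
      FH : F Z.* H Z.≈ Z.const (b ℤ.* c) Z.* Mᶻ
      FH = cast-injective (Q.trans (Cast.*-homo F H) (Q.trans (Q.*-cong (Q.sym eF) (Q.sym eH))
        (Q.trans (Q.solve 4 (λ b f c h → (b Q.:* f) Q.:* (c Q.:* h) Q.:= (b Q.:* c) Q.:* (f Q.:* h)) (Q.const (κ b)) f (Q.const (κ c)) h)
        (Q.trans (Q.*-cong (Q.trans (Q.sym (IsHom.*-homo Q.const-hom (κ b) (κ c))) (IsHom.cong Q.const-hom (κ-κ b c))) (Q.trans fh≈M (Q.sym cast-M)))
          (Q.sym (Q.trans (Cast.*-homo (Z.const (b ℤ.* c)) Mᶻ) (Q.*-congʳ (cast-const (b ℤ.* c)))))))))
      large : ∀ p → Prime p → B < p → f Q.∣ Q.subst (Q.X Q.^ p) f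
      large p pr B<p = cancel
        where
        j = p % k
        ιp = Z.ι (+ p)
        p-step : Mᶻ Z.∣ Z.subst (Z.X Z.^ p) F Z.- Z.subst (Z.X Z.^ j) F
        p-step = Z.subst-congruent Mᶻ (Z.X Z.^ p) (Z.X Z.^ j) F
          (≡.subst (λ n → Mᶻ Z.∣ Z.X Z.^ n Z.- Z.X Z.^ j) (≡.sym (m≡m%n+[m/n]*n p k))
            (PowerDivisibility.periodic ℤ[X] Z.X k j (p / k)))
        residue-step : ∀ r → residueᶻ r (z p) ≡ residueᶻ r (z j)
        residue-step r = ≡.trans (Z.functional-cong _
            (Z.solve 3 (λ x y h → x Z.:* h Z.:= (x Z.:- y) Z.:* h Z.:+ y Z.:* h) (Z.subst (Z.X Z.^ p) F) (Z.subst (Z.X Z.^ j) F) H))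
          (≡.trans (Z.functional-+ _ ((Z.subst (Z.X Z.^ p) F Z.- Z.subst (Z.X Z.^ j) F) Z.* H) (z j))
          (≡.trans (≡.cong (ℤ._+ residueᶻ r (z j)) (Z.residue-∣ k′ r (Z.∣-*ʳ H p-step))) (ℤₚ.+-identityˡ _)))
        divisible : ∀ r → ∃[ y ] residueᶻ r (z p) ≡ + p ℤ.* y
        divisible r = divisible-by (freshman p pr F)
          where
          open ≡.≡-Reasoning
          power-∣ : ∀ n → n ≢ 0 → Mᶻ Z.∣ F Z.^ n Z.* H
          power-∣ zero n≢0 = contradiction ≡.refl n≢0
          power-∣ (suc n) _ = Z.const (b ℤ.* c) Z.* F Z.^ n ,
            Z.trans (Z.solve 3 (λ c x m → (c Z.:* x) Z.:* m Z.:= x Z.:* (c Z.:* m)) (Z.const (b ℤ.* c)) (F Z.^ n) Mᶻ)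
            (Z.trans (Z.*-congˡ {F Z.^ n} (Z.sym FH)) (Z.solve 3 (λ x f h → x Z.:* (f Z.:* h) Z.:= (f Z.:* x) Z.:* h) (F Z.^ n) F H))
          divisible-by : Z.ι (+ p) Z.∣ Z.subst (Z.X Z.^ p) F Z.- F Z.^ p → ∃[ y ] residueᶻ r (z p) ≡ + p ℤ.* y
          divisible-by (G , eG) = residueᶻ r (G Z.* H) , (begin
              residueᶻ r (z p)
                ≡⟨ Z.functional-cong _ (Z.trans (Z.solve 3 (λ x y h → x Z.:* h Z.:= y Z.:* h Z.:+ (x Z.:- y) Z.:* h) (Z.subst (Z.X Z.^ p) F) (F Z.^ p) H)
                     (Z.+-congˡ {F Z.^ p Z.* H} (Z.trans (Z.*-congʳ {H} (Z.trans (Z.sym eG) (Z.*-comm G ιp))) (Z.*-assoc ιp G H)))) ⟩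
              residueᶻ r (F Z.^ p Z.* H Z.+ ιp Z.* (G Z.* H))
                ≡⟨ Z.functional-+ _ (F Z.^ p Z.* H) _ ⟩
              residueᶻ r (F Z.^ p Z.* H) ℤ.+ residueᶻ r (ιp Z.* (G Z.* H))
                ≡⟨ ≡.cong₂ ℤ._+_ (Z.residue-∣ k′ r {F Z.^ p Z.* H} (power-∣ p (ℕ.≢-nonZero⁻¹ p {{prime⇒nonZero pr}})))
                     (≡.trans (Z.functional-ι* _ (+ p) (G Z.* H)) (≡.cong (ℤ._* residueᶻ r (G Z.* H)) (ι-ℤ (+ p)))) ⟩
              + 0 ℤ.+ + p ℤ.* residueᶻ r (G Z.* H) ≡⟨ ℤₚ.+-identityˡ _ ⟩
              + p ℤ.* residueᶻ r (G Z.* H) ∎)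
        vanish : ∀ r → r < k → residueᶻ r (z p) ≡ + 0
        vanish r r<k = small-multiple-zero p _ (proj₁ (divisible r)) (proj₂ (divisible r))
          (≡.subst (λ x → ℤ.∣ x ∣ < p) (≡.sym (residue-step r)) (ℕₚ.≤-<-trans (residue-bound j r (m%n<n p k) r<k) B<p))
        M∣ : M Q.∣ cast (z p)
        M∣ = Nℚ.residues-zero λ r r<k → ≡.trans (Nℚ.residue-cast r (z p)) (≡.cong κ (vanish r r<k))
        cast-z : cast (z p) Q.≈ Q.const (κ (b ℤ.* c)) Q.* (Q.subst (Q.X Q.^ p) f Q.* h)
        cast-z = Q.trans (Cast.*-homo (Z.subst (Z.X Z.^ p) F) H)
          (Q.trans (Q.*-cong (Q.trans (cast-subst p F) (Q.trans (Q.subst-cong (Q.X Q.^ p) (Q.sym eF))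
              (Q.trans (IsHom.*-homo (Q.subst-hom (Q.X Q.^ p)) (Q.const (κ b)) f) (Q.*-congʳ (Q.subst-const (Q.X Q.^ p) (κ b)))))) (Q.sym eH))
          (Q.trans (Q.solve 4 (λ b f c h → (b Q.:* f) Q.:* (c Q.:* h) Q.:= (b Q.:* c) Q.:* (f Q.:* h)) (Q.const (κ b)) (Q.subst (Q.X Q.^ p) f) (Q.const (κ c)) h)
            (Q.*-congʳ (Q.trans (Q.sym (IsHom.*-homo Q.const-hom (κ b) (κ c))) (IsHom.cong Q.const-hom (κ-κ b c))))))
        h≉0 : ¬ h Q.≈ Q.0#
        h≉0 e = Q.≉0-degree (Q.degree-M k′) (Q.trans (Q.sym fh≈M) (Q.trans (Q.*-congˡ {f} e) (Q.zeroʳ f)))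
        cancel : f Q.∣ Q.subst (Q.X Q.^ p) f
        cancel = cancelled M∣ (ℚ-inverse (κ (b ℤ.* c)) (λ e → i*j≢0 b≢0 c≢0 (κ-injective e)))
          where
          cancelled : M Q.∣ cast (z p) → ∃[ d ] d ℚ.* κ (b ℤ.* c) ≡ 1ℚ → f Q.∣ Q.subst (Q.X Q.^ p) f
          cancelled (q , e) (d , d≡) = cancel-algebra ℚ[X] (λ {a} {b} → Q.domain {a} {b}) fh≈M h≉0 e cast-z
            (Q.trans (Q.sym (IsHom.*-homo Q.const-hom d (κ (b ℤ.* c)))) (Q.trans (IsHom.cong Q.const-hom d≡) (IsHom.1-homo Q.const-hom)))

    landau : ∀ f h → f Q.* h Q.≈ M → ∃[ B ] ∀ p → Prime p → B < p → f Q.∣ Q.subst (Q.X Q.^ p) f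
    landau f h fh≈M = clear (clear-denominators f) (clear-denominators h)
      where
      clear : ∃[ d ] ∃[ n ] d ≢ + 0 × Q.const (κ d) Q.* f Q.≈ cast n → ∃[ d ] ∃[ n ] d ≢ + 0 × Q.const (κ d) Q.* h Q.≈ cast n →
        ∃[ B ] ∀ p → Prime p → B < p → f Q.∣ Q.subst (Q.X Q.^ p) f
      clear (b , F , b≢0 , eF) (c , H , c≢0 , eH) = Cleared.B f h fh≈M b c F H b≢0 c≢0 eF eH , Cleared.large f h fh≈M b c F H b≢0 c≢0 eF eH

-- The ring ℚ[X]/(X^k - 1): substitutions X ↦ X^j and squarefreeness

module GroupRing where
  open Rings
  open Domains
  open FieldPolynomials
  open Functionals
  open OpaquePolynomials
  open RationalPolynomials
  open LandauArgument
  open import Data.List.Base as List using (List; []; _∷_)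
  open import Data.List.Relation.Unary.All using (All; []; _∷_)
  open import Data.Nat.Base as ℕ using (ℕ; zero; suc; _<_; _≤_; s≤s; z≤n; NonZero; _!)
  import Data.Nat.Properties as ℕₚ
  open import Data.Nat.Divisibility as ℕ∣ using (divides; _∣?_) renaming (_∣_ to _∣ⁿ_)
  open import Data.Nat.Coprimality using () renaming (Coprime to Coprimeⁿ)
  open import Data.Nat.Primality using (Prime; euclidsLemma; prime?; prime⇒nonTrivial; prime[2]; prime⇒nonZero)
  open import Data.Nat.Primality.Factorisation using (factorise; module PrimeFactorisation)
  open import Data.Nat.ListAction using (product)
  open import Data.Product.Base using (_,_; ∃-syntax)
  open import Data.Sum.Base as Sum using (inj₁; inj₂)
  open import Relation.Nullary using (¬_; yes; no; contradiction)
  open import Relation.Binary.PropositionalEquality as ≡ using (_≡_; _≢_)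

  RoughAbove : ℕ → ℕ → Set
  RoughAbove N j = ∀ p → Prime p → p ≤ N → ¬ p ∣ⁿ j

  private
    p∣!  : ∀ p N → p ≢ 0 → p ≤ N → p ∣ⁿ N !
    p∣! p zero p≢0 z≤n = contradiction ≡.refl p≢0
    p∣! p (suc N) p≢0 le with ℕₚ.m≤n⇒m<n∨m≡n le
    ... | inj₁ (s≤s le′) = ℕ∣.∣n⇒∣m*n (suc N) (p∣! p N p≢0 le′)
    ... | inj₂ ≡.refl = divides (N !) (ℕₚ.*-comm (suc N) (N !))

  -- Landau's argument covers large primes. An exponent prime to k is therefore moved within its
  -- class modulo k until all its prime factors are large. If the prime N + 1 divides the current
  -- representative, adding N! k repairs this, since N + 1 divides neither N! nor k, while smaller
  -- primes remain excluded because they divide N!.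
  rough-representative : ∀ j k → Coprimeⁿ j k → ∀ N → ∃[ q ] RoughAbove N (j ℕ.+ q ℕ.* k)
  rough-representative j k cop zero = 0 , λ { zero pr z≤n _ → contradiction (prime⇒nonZero pr) λ () }
  rough-representative j k cop (suc N) with rough-representative j k cop N
  ... | q , rough with prime? (suc N) | suc N ∣? (j ℕ.+ q ℕ.* k)
  ...   | no ¬pr | _ = q , λ p pr le d → Sum.[ (λ { (s≤s lt) → rough p pr lt d }) , (λ { ≡.refl → ¬pr pr }) ]′ (ℕₚ.m≤n⇒m<n∨m≡n le)
  ...   | yes pr | no ∤j′ = q , λ p pr le d → Sum.[ (λ { (s≤s lt) → rough p pr lt d }) , (λ { ≡.refl → ∤j′ d }) ]′ (ℕₚ.m≤n⇒m<n∨m≡n le)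
  ...   | yes pr | yes ∣j′ = q ℕ.+ N ! , λ p pr le d → Sum.[ (λ { (s≤s lt) → small p pr lt (≡.subst (p ∣ⁿ_) eq d) }) , (λ { ≡.refl → new (≡.subst (suc N ∣ⁿ_) eq d) }) ]′ (ℕₚ.m≤n⇒m<n∨m≡n le)
    where
    eq : j ℕ.+ (q ℕ.+ N !) ℕ.* k ≡ (j ℕ.+ q ℕ.* k) ℕ.+ N ! ℕ.* k
    eq = ≡.trans (≡.cong (j ℕ.+_) (ℕₚ.*-distribʳ-+ k q (N !))) (≡.sym (ℕₚ.+-assoc j (q ℕ.* k) (N ! ℕ.* k)))
    small : ∀ p → Prime p → p ≤ N → ¬ p ∣ⁿ (j ℕ.+ q ℕ.* k) ℕ.+ N ! ℕ.* k
    small p pr le d = rough p pr le (ℕ∣.∣m+n∣m⇒∣n (≡.subst (p ∣ⁿ_) (ℕₚ.+-comm (j ℕ.+ q ℕ.* k) (N ! ℕ.* k)) d)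
      (ℕ∣.∣m⇒∣m*n k (p∣! p N (ℕ.≢-nonZero⁻¹ p {{prime⇒nonZero pr}}) le)))
    new : ¬ suc N ∣ⁿ (j ℕ.+ q ℕ.* k) ℕ.+ N ! ℕ.* k
    new d with euclidsLemma (N !) k pr (ℕ∣.∣m+n∣m⇒∣n d ∣j′)
    ... | inj₁ x = ∤-factorial pr N ℕₚ.≤-refl x
    ... | inj₂ x = contradiction (cop (ℕ∣.∣m+n∣m⇒∣n (≡.subst (suc N ∣ⁿ_) (ℕₚ.+-comm j (q ℕ.* k)) ∣j′) (ℕ∣.∣n⇒∣m*n q x) , x))
                     (ℕ.nonTrivial⇒≢1 {{prime⇒nonTrivial pr}})

  module _ where
    open ℚX hiding (M; residue; _*ᶜ; residue-∣; residue-below; norm-squares; degree-M)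

    subst-power : ∀ m n f → subst (X ^ n) (subst (X ^ m) f) ≈ subst (X ^ (m ℕ.* n)) f
    subst-power m n f = trans (subst-subst (X ^ n) (X ^ m) f)
      (subst-congˡ f (trans (subst-X^ (X ^ n) m) (trans (^-assocʳ X n m) (^-congʳ X (ℕₚ.*-comm n m)))))

    subst-∣ : ∀ s {a b} → a ∣ b → subst s a ∣ subst s b
    subst-∣ s = HomDivisibility.∣-hom (subst-hom s)

    ∣-subst-product : ∀ f ps → All (λ p → f ∣ subst (X ^ p) f) ps → f ∣ subst (X ^ product ps) f
    ∣-subst-product f [] [] = ∣-reflexive (sym (trans (subst-congˡ f (*-identityʳ X)) (subst-identity f)))
    ∣-subst-product f (p ∷ ps) (d ∷ ds) =
      ∣-respʳ (subst-power p (product ps) f) (∣-trans (∣-subst-product f ps ds) (subst-∣ (X ^ product ps) d))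

    module Automorphisms (k′ : ℕ) where
      open Norm k′
      k = suc k′

      -- Each prime factor p of the representative j′ is large, so f divides f(X^p); composing these
      -- substitutions shows that f divides f(X^j′). As f divides X^k - 1, the exponent matters only
      -- modulo k.
      landau-coprime : ∀ f h → f * h ≈ M → ∀ j → Coprimeⁿ j k → f ∣ subst (X ^ j) f
      landau-coprime f h fh≈M j cop = large (Landau.landau k′ f h fh≈M)
        where
        f∣M : f ∣ M
        f∣M = h , trans (*-comm h f) fh≈M
        large : ∃[ B ] (∀ p → Prime p → B < p → f ∣ subst (X ^ p) f) → f ∣ subst (X ^ j) f
        -- The summand 2 excludes the prime 2 as well, so that the representative is nonzero and can
        -- be factorised.
        large (B , good) = replace (rough-representative j k cop (B ℕ.+ 2))
          where
          replace : ∃[ q ] RoughAbove (B ℕ.+ 2) (j ℕ.+ q ℕ.* k) → f ∣ subst (X ^ j) f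
          replace (q , rough) = ∣-respʳ (solve 2 (λ a b → a :- (a :- b) := b) (subst (X ^ j′) f) (subst (X ^ j) f))
              (∣-- f∣subst (∣-trans f∣M (subst-congruent M (X ^ j′) (X ^ j) f (PowerDivisibility.periodic ℚ[X] X k j q))))
            where
            j′ = j ℕ.+ q ℕ.* k
            instance
              j′≢0 : NonZero j′
              j′≢0 = ℕ.≢-nonZero λ e → rough 2 prime[2] (ℕₚ.m≤n+m 2 B) (≡.subst (2 ∣ⁿ_) (≡.sym e) (2 ℕ∣.∣0))
            open PrimeFactorisation (factorise j′)
            above-B : ∀ ps → All Prime ps → (∀ p → Prime p → p ∣ⁿ product ps → B < p) → All (λ p → f ∣ subst (X ^ p) f) ps
            above-B [] [] h = []
            above-B (p ∷ ps) (pr ∷ prs) h = good p pr (h p pr (ℕ∣.m∣m*n (product ps))) ∷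
              above-B ps prs (λ r r-pr d → h r r-pr (ℕ∣.∣n⇒∣m*n p d))
            f∣subst : f ∣ subst (X ^ j′) f
            f∣subst = ≡.subst (λ n → f ∣ subst (X ^ n) f) (≡.sym isFactorisation)
              (∣-subst-product f factors (above-B factors factorsPrime λ p pr d →
                ℕₚ.≰⇒> λ p≤B → rough p pr (ℕₚ.≤-trans p≤B (ℕₚ.m≤m+n B 2)) (≡.subst (p ∣ⁿ_) (≡.sym isFactorisation) d)))

      M∣conjugate : ∀ {p} → M ∣ p → M ∣ p *ᶜ
      M∣conjugate {p} d = ∣-trans M∣M*ᶜ (subst-∣ (X ^ k′) d)
        where
        M∣M*ᶜ : M ∣ M *ᶜ
        M∣M*ᶜ = ∣-respʳ (sym (trans (IsHom.‿-homo (subst-hom (X ^ k′)) (X ^ k) 1#)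
            (+-cong (trans (subst-X^ (X ^ k′) k) (^-assocʳ X k′ k)) (-‿cong (IsHom.1-homo (subst-hom (X ^ k′)))))))
          (PowerDivisibility.∣-exponent ℚ[X] X (ℕ∣.∣n⇒∣m*n k′ (ℕ∣.∣-refl {k})))

      -- The group ring is reduced because the form ‖p‖² = λ(p p*) is positive definite.
      reduced : ∀ {z} → M ∣ z * z → M ∣ z
      -- Read from the inside, modulo M: (z z*)(z z*)* contains the factor (z²)* = 0, so z z* = 0 by
      -- definiteness, and then z = 0 in the same way.
      reduced {z} d = norm-zero (ℚX.residue-∣ k′ 0 (norm-zero {z * z *ᶜ} (ℚX.residue-∣ k′ 0 square)))
        where
        square : M ∣ (z * z *ᶜ) * (z * z *ᶜ) *ᶜ
        square = ∣-respʳ (trans (*-congˡ (IsHom.*-homo (subst-hom (X ^ k′)) z z))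
            (trans (solve 3 (λ z z′ z″ → (z :* z″) :* (z′ :* z′) := (z :* z′) :* (z′ :* z″)) z (z *ᶜ) (z *ᶜ *ᶜ))
              (*-congˡ (sym (IsHom.*-homo (subst-hom (X ^ k′)) z (z *ᶜ))))))
          (∣-*ˡ (z * z *ᶜ *ᶜ) (M∣conjugate d))

      M≉0 : ¬ M ≈ 0#
      M≉0 = ≉0-degree (ℚX.degree-M k′)

      -- For a common divisor d of f and g, put z = M/d. Then d divides z, so M divides z²; as the
      -- group ring is reduced, M divides z, and d is a unit.
      squarefree : ∀ f g Θ → f * g * Θ ≈ M → Coprime f g
      squarefree f g Θ e = coprime (gcd f g)
        where
        coprime : Gcd f g → Coprime f g
        coprime G = from-unit (unit (G .Gcd.gcd∣ˡ) (G .Gcd.gcd∣ʳ))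
          where
          d = G .Gcd.gcd
          from-unit : d ∣ 1# → Coprime f g
          from-unit (c , cd≈1) = c * G .Gcd.u , c * G .Gcd.v ,
            trans (solve 5 (λ c u v f g → (c :* u) :* f :+ (c :* v) :* g := c :* (u :* f :+ v :* g)) c (G .Gcd.u) (G .Gcd.v) f g)
              (trans (*-congˡ (G .Gcd.bézout)) cd≈1)
          unit : d ∣ f → d ∣ g → d ∣ 1#
          unit (f′ , ef) (g′ , eg) = cancelled (reduced M∣zz)
            where
            w = f′ * g′ * Θ
            z = d * w
            M≈ : M ≈ d * z
            M≈ = trans (sym e) (trans (*-congʳ (*-cong (sym ef) (sym eg)))
              (solve 4 (λ d f g t → (f :* d) :* (g :* d) :* t := d :* (d :* (f :* g :* t))) d f′ g′ Θ))
            M∣zz : M ∣ z * z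
            M∣zz = w , trans (*-congˡ M≈) (solve 3 (λ w d z → w :* (d :* z) := (d :* w) :* z) w d z)
            z≉0 : ¬ z ≈ 0#
            z≉0 z≈0 = M≉0 (trans M≈ (trans (*-congˡ z≈0) (zeroʳ d)))
            cancelled : M ∣ z → d ∣ 1#
            cancelled (q , eq) = q , domain-cancelʳ ℚ[X] (λ {a} {b} → domain {a} {b}) z≉0
              (trans (solve 3 (λ q d z → (q :* d) :* z := q :* (d :* z)) q d z) (trans (*-congˡ (sym M≈)) (trans eq (sym (*-identityˡ z)))))

-- The Möbius function

module Möbius where
  open import Defs using (μ)
  open import Data.Bool.Base using (if_then_else_)
  open import Data.Integer.Base as ℤ using (ℤ; +_; -[1+_]; ∣_∣; 0ℤ; -1ℤ)
  import Data.Integer.Properties as ℤₚ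
  open import Data.List.Base as List using (List; []; _∷_; length)
  open import Data.List.Relation.Unary.All as All using (All; []; _∷_)
  open import Data.List.Relation.Unary.AllPairs using ([]; _∷_)
  open import Data.List.Relation.Unary.Unique.Propositional using (Unique)
  open import Data.List.Relation.Unary.Unique.DecPropositional using (unique?)
  open import Data.List.Membership.Propositional using (_∈_)
  open import Data.List.Relation.Unary.Any using (here; there)
  open import Data.List.Relation.Binary.Permutation.Propositional using (_↭_; ↭-sym; ↭⇒↭ₛ)
  open import Data.List.Relation.Binary.Permutation.Propositional.Properties using (↭-length)
  import Data.List.Relation.Binary.Permutation.Setoid.Properties as Permₛ
  open import Data.Nat.Base as ℕ using (ℕ; zero; suc; NonZero)
  import Data.Nat.Properties as ℕₚ
  open import Data.Nat.ListAction using (product)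
  open import Data.Nat.Divisibility as ℕ∣ using (divides) renaming (_∣_ to _∣ⁿ_)
  open import Data.Nat.Primality using (Prime; prime⇒nonZero)
  open import Data.Nat.Primality.Factorisation using (factorise; PrimeFactorisation; factorisationUnique)
  open import Data.Product.Base using (_,_; _×_)
  open import Relation.Nullary using (¬_; Dec; yes; no; contradiction; does)
  open import Relation.Binary.PropositionalEquality as ≡ using (_≡_; _≢_)

  open PrimeFactorisation

  private
    Unique-resp : ∀ {xs ys : List ℕ} → xs ↭ ys → Unique xs → Unique ys
    Unique-resp p = Permₛ.Unique-resp-↭ (≡.setoid ℕ) (↭⇒↭ₛ p)

    μ-list : List ℕ → ℤ
    μ-list ps = if does (unique? ℕₚ._≟_ ps) then -1ℤ ℤ.^ length ps else 0ℤ

    μ-list-unique : ∀ ps → Unique ps → μ-list ps ≡ -1ℤ ℤ.^ length ps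
    μ-list-unique ps u with unique? ℕₚ._≟_ ps
    ... | yes _ = ≡.refl
    ... | no ¬u = contradiction u ¬u

    μ-list-repeated : ∀ ps → ¬ Unique ps → μ-list ps ≡ 0ℤ
    μ-list-repeated ps ¬u with unique? ℕₚ._≟_ ps
    ... | yes u = contradiction u ¬u
    ... | no _ = ≡.refl

    μ-list-resp : ∀ {xs ys} → xs ↭ ys → μ-list xs ≡ μ-list ys
    μ-list-resp {xs} {ys} p with unique? ℕₚ._≟_ xs
    ... | yes u = ≡.trans (≡.cong (-1ℤ ℤ.^_) (↭-length p)) (≡.sym (μ-list-unique ys (Unique-resp p u)))
    ... | no ¬u = ≡.sym (μ-list-repeated ys λ u → ¬u (Unique-resp (↭-sym p) u))

    -- By unique factorisation every factorisation computes μ, so μ(pn) can be read off after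
    -- putting p in front of the factors of n.
    μ-factors : ∀ n .{{_ : NonZero n}} (F : PrimeFactorisation n) → μ n ≡ μ-list (factors F)
    μ-factors (suc n) F = μ-list-resp (factorisationUnique (factorise (suc n)) F)

    extend : ∀ {p n} → Prime p → PrimeFactorisation n → PrimeFactorisation (p ℕ.* n)
    extend {p} pr F = record
      { factors = p ∷ factors F ; isFactorisation = ≡.cong (p ℕ.*_) (isFactorisation F) ; factorsPrime = pr ∷ factorsPrime F }

    ∈-product : ∀ {p ps} → p ∈ ps → p ∣ⁿ product ps
    ∈-product {ps = q ∷ ps} (here ≡.refl) = ℕ∣.m∣m*n (product ps)
    ∈-product {ps = q ∷ ps} (there i) = ℕ∣.∣n⇒∣m*n q (∈-product i)

  μ-prime* : ∀ {p} → Prime p → ∀ n .{{_ : NonZero n}} → ¬ p ∣ⁿ n → μ (p ℕ.* n) ≡ ℤ.- μ n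
  μ-prime* {p} pr n p∤n = ≡.trans (μ-factors (p ℕ.* n) (extend pr F)) (≡.trans (neg (unique? ℕₚ._≟_ (factors F))) (≡.sym (≡.cong ℤ.-_ (μ-factors n F))))
    where
    instance
      pn≢0 : NonZero (p ℕ.* n)
      pn≢0 = ℕₚ.m*n≢0 p n {{prime⇒nonZero pr}}
    F = factorise n
    p∉F : All (p ≢_) (factors F)
    p∉F = All.tabulate λ {q} q∈ p≡q → p∤n (≡.subst₂ _∣ⁿ_ (≡.sym p≡q) (≡.sym (isFactorisation F)) (∈-product q∈))
    neg : Dec (Unique (factors F)) → μ-list (p ∷ factors F) ≡ ℤ.- μ-list (factors F)
    neg (yes u) = ≡.trans (μ-list-unique (p ∷ factors F) (p∉F ∷ u))
      (≡.trans (ℤₚ.-1*i≡-i _) (≡.sym (≡.cong ℤ.-_ (μ-list-unique (factors F) u))))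
    neg (no ¬u) = ≡.trans (μ-list-repeated (p ∷ factors F) λ { (_ ∷ u) → ¬u u })
      (≡.sym (≡.cong ℤ.-_ (μ-list-repeated (factors F) ¬u)))

  μ-square : ∀ {p} → Prime p → ∀ n .{{_ : NonZero n}} → p ∣ⁿ n → μ (p ℕ.* n) ≡ 0ℤ
  μ-square {p} pr n (divides r eq) = ≡.trans (≡.cong (λ x → μ (p ℕ.* x)) n≡)
      (≡.trans (μ-factors (p ℕ.* (p ℕ.* r)) (extend pr (extend pr (factorise r))))
        (μ-list-repeated (p ∷ p ∷ factors (factorise r)) λ { ((p≢p ∷ _) ∷ _) → p≢p ≡.refl }))
    where
    n≡ : n ≡ p ℕ.* r
    n≡ = ≡.trans eq (ℕₚ.*-comm r p)
    instance
      p≢0 : NonZero p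
      p≢0 = prime⇒nonZero pr
      r≢0 : NonZero r
      r≢0 = ℕ.≢-nonZero λ r≡0 → ℕ.≢-nonZero⁻¹ n (≡.trans eq (≡.cong (ℕ._* p) r≡0))
      pr≢0 : NonZero (p ℕ.* r)
      pr≢0 = ℕₚ.m*n≢0 p r
      ppr≢0 : NonZero (p ℕ.* (p ℕ.* r))
      ppr≢0 = ℕₚ.m*n≢0 p (p ℕ.* r)

  -- Positive and negative part of μ, the exponents on the right-hand and the left-hand side of
  -- `IsMöbiusProduct`.
  e⁺ e⁻ : ℕ → ℕ
  e⁺ q = ∣ μ q ℤ.⊔ 0ℤ ∣
  e⁻ q = ∣ μ q ℤ.⊓ 0ℤ ∣

  private
    neg-⊔ : ∀ i → ∣ (ℤ.- i) ℤ.⊔ 0ℤ ∣ ≡ ∣ i ℤ.⊓ 0ℤ ∣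
    neg-⊔ (+ zero) = ≡.refl
    neg-⊔ (+ suc n) = ≡.refl
    neg-⊔ -[1+ n ] = ≡.refl

    neg-⊓ : ∀ i → ∣ (ℤ.- i) ℤ.⊓ 0ℤ ∣ ≡ ∣ i ℤ.⊔ 0ℤ ∣
    neg-⊓ (+ zero) = ≡.refl
    neg-⊓ (+ suc n) = ≡.refl
    neg-⊓ -[1+ n ] = ≡.refl

  e⁺-prime* : ∀ {p} → Prime p → ∀ n .{{_ : NonZero n}} → ¬ p ∣ⁿ n → e⁺ (p ℕ.* n) ≡ e⁻ n
  e⁺-prime* pr n p∤n = ≡.trans (≡.cong (λ i → ∣ i ℤ.⊔ 0ℤ ∣) (μ-prime* pr n p∤n)) (neg-⊔ (μ n))

  e⁻-prime* : ∀ {p} → Prime p → ∀ n .{{_ : NonZero n}} → ¬ p ∣ⁿ n → e⁻ (p ℕ.* n) ≡ e⁺ n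
  e⁻-prime* pr n p∤n = ≡.trans (≡.cong (λ i → ∣ i ℤ.⊓ 0ℤ ∣) (μ-prime* pr n p∤n)) (neg-⊓ (μ n))

  e⁺-square : ∀ {p} → Prime p → ∀ n .{{_ : NonZero n}} → p ∣ⁿ n → e⁺ (p ℕ.* n) ≡ 0
  e⁺-square pr n p∣n = ≡.cong (λ i → ∣ i ℤ.⊔ 0ℤ ∣) (μ-square pr n p∣n)

  e⁻-square : ∀ {p} → Prime p → ∀ n .{{_ : NonZero n}} → p ∣ⁿ n → e⁻ (p ℕ.* n) ≡ 0
  e⁻-square pr n p∣n = ≡.cong (λ i → ∣ i ℤ.⊓ 0ℤ ∣) (μ-square pr n p∣n)

  -- At most one of the two exponents is nonzero.
  e⁺≡e⁻⇒0 : ∀ q → e⁺ q ≡ e⁻ q → e⁺ q ≡ 0 × e⁻ q ≡ 0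
  e⁺≡e⁻⇒0 q = go (μ q)
    where
    go : ∀ i → ∣ i ℤ.⊔ 0ℤ ∣ ≡ ∣ i ℤ.⊓ 0ℤ ∣ → ∣ i ℤ.⊔ 0ℤ ∣ ≡ 0 × ∣ i ℤ.⊓ 0ℤ ∣ ≡ 0
    go (+ zero) e = ≡.refl , ≡.refl

-- Cancellation in Möbius products

module Pairings where
  open Rings
  open Domains
  open FieldPolynomials
  open Möbius
  open import Algebra.Bundles using (CommutativeRing)
  import Algebra.Properties.Semiring.Exp
  import Algebra.Properties.Semiring.Mult
  import Algebra.Properties.CommutativeSemiring.Exp
  open import Data.Integer.Base using (+_)
  open import Data.List.Base as List using (List; []; _∷_; map; filter; upTo)
  open import Data.List.Relation.Unary.All as All using (All; []; _∷_)
  import Data.List.Relation.Unary.All.Properties as Allₚ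
  open import Data.List.Relation.Unary.AllPairs using ([]; _∷_)
  open import Data.List.Relation.Unary.Unique.Propositional using (Unique)
  import Data.List.Relation.Unary.Unique.Propositional.Properties as Uniqueₚ
  open import Data.List.Membership.Propositional using (_∈_)
  open import Data.List.Membership.Propositional.Properties using (∈-filter⁺; ∈-filter⁻; ∈-map⁺; ∈-map⁻; ∈-upTo⁺)
  open import Data.List.Membership.Propositional.Properties.WithK using (unique∧set⇒bag)
  open import Data.List.Relation.Binary.BagAndSetEquality using (∼bag⇒↭)
  open import Data.List.Relation.Binary.Permutation.Propositional as Perm using (_↭_)
  open import Data.List.Relation.Unary.Any using (here; there)
  open import Data.Nat.Base as ℕ using (ℕ; zero; suc; NonZero)
  import Data.Nat.Properties as ℕₚ
  open import Data.Nat.DivMod using (_/_; m*n/n≡m)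
  open import Data.Nat.Divisibility as ℕ∣ using (divides; _∣?_) renaming (_∣_ to _∣ⁿ_)
  open import Data.Nat.Coprimality using (coprime-Bézout) renaming (Coprime to Coprimeⁿ)
  open import Data.Nat.GCD using (module Bézout)
  open import Data.Nat.Primality using (Prime; prime⇒nonZero; prime⇒irreducible)
  open import Data.Product.Base using (_,_; _×_; ∃-syntax; proj₁; proj₂)
  open import Data.Sum.Base as Sum using (_⊎_; inj₁; inj₂)
  open import Function.Bundles using (mk⇔)
  open import Relation.Nullary using (¬_; Dec; yes; no; contradiction; ¬?)
  open import Relation.Unary using (Pred; Decidable)
  open import Relation.Binary.PropositionalEquality as ≡ using (_≡_)
  open import Level using (0ℓ)

  -- The divisors of k, shifted down by one.
  divisors : ℕ → List ℕ
  divisors k = filter (λ i → suc i ∣? k) (upTo k)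

  divisors-unique : ∀ k → Unique (divisors k)
  divisors-unique k = Uniqueₚ.filter⁺ (λ i → suc i ∣? k) (Uniqueₚ.upTo⁺ k)

  ∈-divisors⁺ : ∀ {k i} .{{_ : NonZero k}} → suc i ∣ⁿ k → i ∈ divisors k
  ∈-divisors⁺ {k} {i} d = ∈-filter⁺ (λ i → suc i ∣? k) (∈-upTo⁺ (ℕ∣.∣⇒≤ d)) d

  ∈-divisors⁻ : ∀ {k i} → i ∈ divisors k → suc i ∣ⁿ k
  ∈-divisors⁻ {k} i∈ = proj₂ (∈-filter⁻ (λ i → suc i ∣? k) {xs = upTo k} i∈)

  cofactor : ℕ → ℕ → ℕ
  cofactor k i = k / suc i

  cofactor-eq : ∀ {k i} q → q ℕ.* suc i ≡ k → cofactor k i ≡ q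
  cofactor-eq {i = i} q ≡.refl = m*n/n≡m q (suc i)

  cofactor-* : ∀ {k i} → suc i ∣ⁿ k → cofactor k i ℕ.* suc i ≡ k
  cofactor-* {k} {i} (divides q eq) = ≡.trans (≡.cong (ℕ._* suc i) (cofactor-eq q (≡.sym eq))) (≡.sym eq)

  unique-constant : ∀ {a : ℕ} xs → Unique xs → (∀ {x} → x ∈ xs → x ≡ a) → xs ≡ [] ⊎ xs ≡ a ∷ []
  unique-constant [] u h = inj₁ ≡.refl
  unique-constant (x ∷ []) u h = inj₂ (≡.cong (_∷ []) (h (here ≡.refl)))
  unique-constant (x ∷ y ∷ xs) ((x≢y ∷ _) ∷ _) h = contradiction (≡.trans (h (here ≡.refl)) (≡.sym (h (there (here ≡.refl))))) x≢y

  module Products (R : Ring₀) where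
    open CommutativeRing R hiding (zero)
    open Algebra.Properties.CommutativeSemiring.Exp commutativeSemiring using (_^_; ^-distrib-*; ^-homo-*; ^-congˡ; ^-congʳ)
    open Divisibility R
    open IntegerMultiples R

    ∏ : ∀ {A : Set} → (A → Carrier) → List A → Carrier
    ∏ f []       = 1#
    ∏ f (x ∷ xs) = f x * ∏ f xs

    ∏-cong : ∀ {A : Set} {f g : A → Carrier} xs → (∀ {x} → x ∈ xs → f x ≈ g x) → ∏ f xs ≈ ∏ g xs
    ∏-cong []       h = refl
    ∏-cong (x ∷ xs) h = *-cong (h (here ≡.refl)) (∏-cong xs (λ i → h (there i)))

    ∏-one : ∀ {A : Set} {f : A → Carrier} xs → (∀ {x} → x ∈ xs → f x ≈ 1#) → ∏ f xs ≈ 1#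
    ∏-one []       h = refl
    ∏-one (x ∷ xs) h = trans (*-cong (h (here ≡.refl)) (∏-one xs (λ i → h (there i)))) (*-identityˡ 1#)

    ∏-map : ∀ {A B : Set} (f : B → Carrier) (g : A → B) xs → ∏ f (map g xs) ≈ ∏ (λ x → f (g x)) xs
    ∏-map f g []       = refl
    ∏-map f g (x ∷ xs) = *-congˡ (∏-map f g xs)

    ∏-↭ : ∀ {A : Set} (f : A → Carrier) {xs ys} → xs ↭ ys → ∏ f xs ≈ ∏ f ys
    ∏-↭ f Perm.refl = refl
    ∏-↭ f (Perm.prep x p) = *-congˡ (∏-↭ f p)
    ∏-↭ f (Perm.swap x y p) = trans (solve 3 (λ a b c → a :* (b :* c) := b :* (a :* c)) (f x) (f y) _) (*-congˡ (*-congˡ (∏-↭ f p)))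
    ∏-↭ f (Perm.trans p q) = trans (∏-↭ f p) (∏-↭ f q)

    ∏-* : ∀ {A : Set} (f g : A → Carrier) xs → ∏ (λ x → f x * g x) xs ≈ ∏ f xs * ∏ g xs
    ∏-* f g [] = sym (*-identityˡ 1#)
    ∏-* f g (x ∷ xs) = trans (*-congˡ (∏-* f g xs))
      (solve 4 (λ a b c d → (a :* b) :* (c :* d) := (a :* c) :* (b :* d)) (f x) (g x) (∏ f xs) (∏ g xs))

    ∏-filter : ∀ {A : Set} {P : Pred A 0ℓ} (P? : Decidable P) (f : A → Carrier) xs →
      ∏ f xs ≈ ∏ f (filter P? xs) * ∏ f (filter (λ x → ¬? (P? x)) xs)
    ∏-filter P? f [] = sym (*-identityˡ 1#)
    ∏-filter P? f (x ∷ xs) with P? x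
    ... | yes _ = trans (*-congˡ (∏-filter P? f xs)) (sym (*-assoc _ _ _))
    ... | no _  = trans (*-congˡ (∏-filter P? f xs))
      (solve 3 (λ a b c → a :* (b :* c) := b :* (a :* c)) (f x) _ _)

    coprime-∏ : ∀ {A : Set} {a} (f : A → Carrier) xs → (∀ {x} → x ∈ xs → Coprime a (f x)) → Coprime a (∏ f xs)
    coprime-∏ f [] h = coprime-1
    coprime-∏ f (x ∷ xs) h = coprime-* (h (here ≡.refl)) (coprime-∏ f xs (λ i → h (there i)))

    coprime-^ : ∀ {a b} n → Coprime a b → Coprime a (b ^ n)
    coprime-^ zero c = coprime-1
    coprime-^ (suc n) c = coprime-* c (coprime-^ n c)

    nonzero-^ : IsDomain R → ¬ 1# ≈ 0# → ∀ {a} n → ¬ a ≈ 0# → ¬ a ^ n ≈ 0#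
    nonzero-^ d 1≉0 zero h = 1≉0
    nonzero-^ d 1≉0 (suc n) h e = Sum.[ h , nonzero-^ d 1≉0 n h ]′ (d e)

    nonzero-∏ : IsDomain R → ¬ 1# ≈ 0# → ∀ {A : Set} (f : A → Carrier) xs → (∀ {x} → x ∈ xs → ¬ f x ≈ 0#) → ¬ ∏ f xs ≈ 0#
    nonzero-∏ d 1≉0 f [] h = 1≉0
    nonzero-∏ d 1≉0 f (x ∷ xs) h e = Sum.[ h (here ≡.refl) , nonzero-∏ d 1≉0 f xs (λ i → h (there i)) ]′ (d e)

  module GeometricSum (R : Ring₀) where
    open CommutativeRing R hiding (zero)
    open Algebra.Properties.Semiring.Exp semiring
    open Divisibility R
    open IntegerMultiples R
    open Algebra.Properties.Semiring.Mult semiring using () renaming (_×_ to _×ₙ_)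

    geometric : ℕ → Carrier → Carrier
    geometric zero    a = 0#
    geometric (suc n) a = 1# + a * geometric n a

    geometric-* : ∀ n a → (a - 1#) * geometric n a ≈ a ^ n - 1#
    geometric-* zero a = trans (zeroʳ _) (sym (-‿inverseʳ 1#))
    geometric-* (suc n) a = trans (solve 3 (λ a o g → (a :- o) :* (o :+ a :* g) := (a :- o) :* o :+ a :* ((a :- o) :* g)) a 1# (geometric n a))
      (trans (+-cong (*-identityʳ _) (*-congˡ (geometric-* n a)))
      (trans (solve 3 (λ a o x → (a :- o) :+ a :* (x :- o) := a :* x :+ (a :- a :* o) :- o) a 1# (a ^ n))
        (+-congʳ (trans (+-congˡ (trans (+-congˡ (-‿cong (*-identityʳ a))) (-‿inverseʳ a))) (+-identityʳ _)))))

    geometric-≡ : ∀ n a → a - 1# ∣ geometric n a - n ×ₙ 1#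
    geometric-≡ zero a = ∣-respʳ (sym (-‿inverseʳ 0#)) ∣-0
    geometric-≡ (suc n) a = ∣-respʳ
      (trans (solve 4 (λ a o g t → a :* (g :- t) :+ (a :- o) :* t := a :* g :- o :* t) a 1# (geometric n a) (n ×ₙ 1#))
        (trans (+-congˡ (-‿cong (*-identityˡ _))) (solve 3 (λ x o t → x :- t := (o :+ x) :- (o :+ t)) (a * geometric n a) 1# (n ×ₙ 1#))))
      (∣-+ (∣-*ˡ a (geometric-≡ n a)) (∣-*ʳ (n ×ₙ 1#) ∣-refl))

    -- If a^q = 1 and 1 + a + … + a^{p-1} = 0 then a = a^{sp - tq} = 1, and so p = 0.
    module _ {p q} (p-unit : p ×ₙ 1# ∣ 1#) (cop : Coprimeⁿ p q) (a : Carrier) where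
      private
        Ideal : Carrier → Set
        Ideal x = ∃[ u ] ∃[ v ] u * (a ^ q - 1#) + v * geometric p a ≈ x

        ideal-≈ : ∀ {x y} → x ≈ y → Ideal x → Ideal y
        ideal-≈ e (u , v , f) = u , v , trans f e

        ideal-+ : ∀ {x y} → Ideal x → Ideal y → Ideal (x + y)
        ideal-+ (u , v , e) (s , t , f) = u + s , v + t ,
          trans (solve 6 (λ u v s t a b → (u :+ s) :* a :+ (v :+ t) :* b := (u :* a :+ v :* b) :+ (s :* a :+ t :* b)) u v s t _ _) (+-cong e f)

        ideal-* : ∀ c {x} → Ideal x → Ideal (c * x)
        ideal-* c (u , v , e) = c * u , c * v ,
          trans (solve 5 (λ c u v a b → (c :* u) :* a :+ (c :* v) :* b := c :* (u :* a :+ v :* b)) c u v _ _) (*-congˡ e)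

        ideal-∣ : ∀ {x y} → x ∣ y → Ideal x → Ideal y
        ideal-∣ (c , e) i = ideal-≈ e (ideal-* c i)

        in-q : Ideal (a ^ q - 1#)
        in-q = 1# , 0# , trans (+-cong (*-identityˡ _) (zeroˡ _)) (+-identityʳ _)

        in-N : Ideal (geometric p a)
        in-N = 0# , 1# , trans (+-cong (zeroˡ _) (*-identityˡ _)) (+-identityˡ _)

        in-p : Ideal (a ^ p - 1#)
        in-p = ideal-≈ (geometric-* p a) (ideal-* (a - 1#) in-N)

        a^-1∣ : ∀ b n → b - 1# ∣ b ^ n - 1#
        a^-1∣ b n = geometric n b , trans (*-comm _ _) (geometric-* n b)

        in-multiple : ∀ m n → Ideal (a ^ m - 1#) → Ideal (a ^ (n ℕ.* m) - 1#)
        in-multiple m n = ideal-∣ (∣-respʳ (+-congʳ (trans (^-assocʳ a m n) (^-congʳ a (ℕₚ.*-comm m n)))) (a^-1∣ (a ^ m) n))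

        from-suc : ∀ m n → 1 ℕ.+ m ≡ n → Ideal (a ^ m - 1#) → Ideal (a ^ n - 1#) → Ideal (a - 1#)
        from-suc m n ≡.refl im in′ = ideal-≈
          (trans (solve 3 (λ a x o → (a :* x :- o) :+ (:- a) :* (x :- o) := a :* o :- o) a (a ^ m) 1#) (+-congʳ (*-identityʳ a)))
          (ideal-+ in′ (ideal-* (- a) im))

        in-a : Ideal (a - 1#)
        in-a = bézout (coprime-Bézout cop)
          where
          bézout : Bézout.Identity 1 p q → Ideal (a - 1#)
          bézout (Bézout.+- x y eq) = from-suc (y ℕ.* q) (x ℕ.* p) eq (in-multiple q y in-q) (in-multiple p x in-p)
          bézout (Bézout.-+ x y eq) = from-suc (x ℕ.* p) (y ℕ.* q) eq (in-multiple p x in-p) (in-multiple q y in-q)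

      coprime-geometric : Coprime (a ^ q - 1#) (geometric p a)
      coprime-geometric = ideal-∣ p-unit (ideal-≈
        (solve 2 (λ g t → g :+ (:- con (+ 1)) :* (g :- t) := t) (geometric p a) (p ×ₙ 1#))
        (ideal-+ in-N (ideal-* (- ι (+ 1)) (ideal-∣ (geometric-≡ p a) in-a))))

  coprime-prime : ∀ {p q} → Prime p → ¬ p ∣ⁿ q → Coprimeⁿ p q
  coprime-prime pr p∤q {d} (d∣p , d∣q) with prime⇒irreducible pr d∣p
  ... | inj₁ d≡1 = d≡1
  ... | inj₂ d≡p = contradiction (≡.subst (_∣ⁿ _) d≡p d∣q) p∤q

  -- The divisors j of k = mp for which p does not divide k/j correspond, by j ↦ j/p, to those for
  -- which p divides k/j exactly once.
  module Pairing (p m : ℕ) (p-prime : Prime p) .{{m≢0 : NonZero m}} where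
    k = m ℕ.* p

    instance
      p≢0 : NonZero p
      p≢0 = prime⇒nonZero p-prime
      k≢0 : NonZero k
      k≢0 = ℕₚ.m*n≢0 m p

    q : ℕ → ℕ
    q = cofactor k

    p∣q? : ∀ i → Dec (p ∣ⁿ q i)
    p∣q? i = p ∣? q i

    pp∣q? : ∀ i → Dec (p ℕ.* p ∣ⁿ q i)
    pp∣q? i = (p ℕ.* p) ∣? q i

    free once : List ℕ
    free = filter (λ i → ¬? (p∣q? i)) (divisors k)
    once = filter (λ i → ¬? (pp∣q? i)) (filter p∣q? (divisors k))

    lower : ℕ → ℕ
    lower i = ℕ.pred (suc i / p)

    record Pair (i : ℕ) : Set where
      field
        j≡p*j′ : suc i ≡ p ℕ.* suc (lower i)
        q-free : ¬ p ∣ⁿ q i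
        q-eq   : q i ℕ.* suc i ≡ k
        q≢0    : NonZero (q i)
        q-low  : q (lower i) ≡ p ℕ.* q i
        m-eq   : suc (lower i) ℕ.* q i ≡ m
        lower∣ : suc (lower i) ∣ⁿ k

    pair : ∀ {i} → i ∈ free → Pair i
    pair {i} i∈ = record { j≡p*j′ = j≡ ; q-free = p∤q ; q-eq = qj ; q≢0 = q≢0 ; q-low = cofactor-eq (p ℕ.* q i) low-eq ; m-eq = m-eq ; lower∣ = divides (p ℕ.* q i) (≡.sym low-eq) }
      where
      i∈′ = ∈-filter⁻ (λ i → ¬? (p∣q? i)) {xs = divisors k} i∈
      p∤q : ¬ p ∣ⁿ q i
      p∤q = proj₂ i∈′
      qj : q i ℕ.* suc i ≡ k
      qj = cofactor-* (∈-divisors⁻ {k} (proj₁ i∈′))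
      q≢0 : NonZero (q i)
      q≢0 = ℕ.≢-nonZero λ e → ℕ.≢-nonZero⁻¹ k (≡.trans (≡.sym qj) (≡.cong (ℕ._* suc i) e))
      p∣j : p ∣ⁿ suc i
      p∣j = Sum.[ (λ d → contradiction d p∤q) , (λ d → d) ]′ (euclidsLemma (q i) (suc i) p-prime (divides m qj))
        where open import Data.Nat.Primality using (euclidsLemma)
      j/p : ℕ
      j/p = ℕ∣.quotient p∣j
      j/p-eq : suc i ≡ j/p ℕ.* p
      j/p-eq = _∣ⁿ_.equality p∣j
      instance
        j/p≢0 : NonZero j/p
        j/p≢0 = ℕ.≢-nonZero λ e → ℕₚ.1+n≢0 (≡.trans j/p-eq (≡.cong (ℕ._* p) e))
      low : suc (lower i) ≡ j/p
      low = ≡.trans (≡.cong (λ x → suc (ℕ.pred x)) (≡.trans (≡.cong (_/ p) j/p-eq) (m*n/n≡m j/p p))) (ℕₚ.suc-pred j/p)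
      j≡ : suc i ≡ p ℕ.* suc (lower i)
      j≡ = ≡.trans j/p-eq (≡.trans (ℕₚ.*-comm j/p p) (≡.cong (p ℕ.*_) (≡.sym low)))
      low-eq : (p ℕ.* q i) ℕ.* suc (lower i) ≡ k
      low-eq = ≡.trans (≡.cong (ℕ._* suc (lower i)) (ℕₚ.*-comm p (q i))) (≡.trans (ℕₚ.*-assoc (q i) p (suc (lower i))) (≡.trans (≡.cong (q i ℕ.*_) (≡.sym j≡)) qj))
      m-eq : suc (lower i) ℕ.* q i ≡ m
      m-eq = ℕₚ.*-cancelʳ-≡ (suc (lower i) ℕ.* q i) m p (≡.trans (≡.trans (ℕₚ.*-comm (suc (lower i) ℕ.* q i) p)
        (≡.trans (≡.cong (p ℕ.*_) (ℕₚ.*-comm (suc (lower i)) (q i))) (≡.sym (ℕₚ.*-assoc p (q i) (suc (lower i)))))) low-eq)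

    once↭ : once ↭ map lower free
    once↭ = ∼bag⇒↭ (unique∧set⇒bag
      (Uniqueₚ.filter⁺ (λ i → ¬? (pp∣q? i)) (Uniqueₚ.filter⁺ p∣q? (divisors-unique k)))
      (unique-map free (Uniqueₚ.filter⁺ (λ i → ¬? (p∣q? i)) (divisors-unique k)) λ x∈ y∈ → lower-injective (pair x∈) (pair y∈))
      (mk⇔ to from))
      where
      lower-injective : ∀ {x y} → Pair x → Pair y → lower x ≡ lower y → x ≡ y
      lower-injective P Q e = ℕₚ.suc-injective (≡.trans (Pair.j≡p*j′ P) (≡.trans (≡.cong (λ n → p ℕ.* suc n) e) (≡.sym (Pair.j≡p*j′ Q))))
      unique-map : ∀ xs → Unique xs → (∀ {x y} → x ∈ xs → y ∈ xs → lower x ≡ lower y → x ≡ y) → Unique (map lower xs)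
      unique-map [] u h = []
      unique-map (x ∷ xs) (x∉ ∷ u) h = Allₚ.map⁺ (All.tabulate λ y∈ e → All.lookup x∉ y∈ (h (here ≡.refl) (there y∈) e)) ∷ unique-map xs u (λ a b → h (there a) (there b))
      from : ∀ {x} → x ∈ map lower free → x ∈ once
      from {x} x∈ with i , i∈ , ≡.refl ← ∈-map⁻ lower x∈ = ∈-filter⁺ (λ i → ¬? (pp∣q? i)) (∈-filter⁺ p∣q? (∈-divisors⁺ (Pair.lower∣ P)) p∣) pp∤
        where
        P = pair i∈
        p∣ : p ∣ⁿ q (lower i)
        p∣ = ≡.subst (p ∣ⁿ_) (≡.sym (Pair.q-low P)) (ℕ∣.m∣m*n (q i))
        pp∤ : ¬ p ℕ.* p ∣ⁿ q (lower i)
        pp∤ d = Pair.q-free P (ℕ∣.*-cancelˡ-∣ p (≡.subst (p ℕ.* p ∣ⁿ_) (Pair.q-low P) d))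
      to : ∀ {x} → x ∈ once → x ∈ map lower free
      to {x} x∈ = ≡.subst (_∈ map lower free) low (∈-map⁺ lower (∈-filter⁺ (λ i → ¬? (p∣q? i)) (∈-divisors⁺ i∣k) p∤qi))
        where
        x∈₁ = ∈-filter⁻ (λ i → ¬? (pp∣q? i)) {xs = filter p∣q? (divisors k)} x∈
        x∈₂ = ∈-filter⁻ p∣q? {xs = divisors k} (proj₁ x∈₁)
        r = ℕ∣.quotient (proj₂ x∈₂)
        qx : q x ≡ r ℕ.* p
        qx = _∣ⁿ_.equality (proj₂ x∈₂)
        qxj : q x ℕ.* suc x ≡ k
        qxj = cofactor-* (∈-divisors⁻ {k} (proj₁ x∈₂))
        i = ℕ.pred (p ℕ.* suc x)
        si : suc i ≡ p ℕ.* suc x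
        si = ℕₚ.suc-pred (p ℕ.* suc x) {{ℕₚ.m*n≢0 p (suc x)}}
        ri : r ℕ.* suc i ≡ k
        ri = ≡.trans (≡.cong (r ℕ.*_) si) (≡.trans (≡.sym (ℕₚ.*-assoc r p (suc x))) (≡.trans (≡.cong (ℕ._* suc x) (≡.sym qx)) qxj))
        i∣k : suc i ∣ⁿ k
        i∣k = divides r (≡.sym ri)
        p∤qi : ¬ p ∣ⁿ q i
        p∤qi d = proj₂ x∈₁ (≡.subst (p ℕ.* p ∣ⁿ_) (≡.sym (≡.trans qx (ℕₚ.*-comm r p)))
          (ℕ∣.*-monoʳ-∣ p (≡.subst (p ∣ⁿ_) (cofactor-eq r ri) d)))
        low : lower i ≡ x
        low = ≡.cong ℕ.pred (≡.trans (≡.cong (_/ p) (≡.trans si (ℕₚ.*-comm p (suc x)))) (m*n/n≡m (suc x) p))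

    square-free-exponent : ∀ {i} (e : ℕ → ℕ) → (∀ n .{{_ : NonZero n}} → p ∣ⁿ n → e (p ℕ.* n) ≡ 0) →
      i ∈ divisors k → p ℕ.* p ∣ⁿ q i → e (q i) ≡ 0
    square-free-exponent {i} e e-square i∈ (divides r eq) = ≡.trans (≡.cong e qi≡) (e-square (p ℕ.* r) {{pr≢0}} (ℕ∣.m∣m*n r))
      where
      qi≡ : q i ≡ p ℕ.* (p ℕ.* r)
      qi≡ = ≡.trans eq (≡.trans (ℕₚ.*-comm r (p ℕ.* p)) (ℕₚ.*-assoc p p r))
      pr≢0 : NonZero (p ℕ.* r)
      pr≢0 = ℕ.≢-nonZero λ z → ℕ.≢-nonZero⁻¹ k (≡.trans (≡.sym (cofactor-* (∈-divisors⁻ {k} i∈)))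
        (≡.cong (ℕ._* suc i) (≡.trans qi≡ (≡.trans (≡.cong (p ℕ.*_) z) (ℕₚ.*-zeroʳ p)))))

  NotRootOfUnity : (R : Ring₀) → CommutativeRing.Carrier R → Set
  NotRootOfUnity R X = ∀ i → ¬ X ^ suc i - 1# ≈ 0#
    where
    open CommutativeRing R
    open Algebra.Properties.Semiring.Exp semiring using (_^_)

  PositiveIntegersInvertible : Ring₀ → Set
  PositiveIntegersInvertible R = ∀ n → suc n ×ₙ 1# ∣ 1#
    where
    open CommutativeRing R
    open Divisibility R
    open Algebra.Properties.Semiring.Mult semiring using () renaming (_×_ to _×ₙ_)

  module MöbiusProduct (R : Ring₀) (domain : IsDomain R) (1≉0 : Nontrivial R)
    (X : CommutativeRing.Carrier R) (nonzero : NotRootOfUnity R X) (units : PositiveIntegersInvertible R) where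
    open CommutativeRing R hiding (zero)
    open Algebra.Properties.CommutativeSemiring.Exp commutativeSemiring
    open Divisibility R
    open Products R
    open GeometricSum R
    open IntegerMultiples R

    factor : (ℕ → ℕ) → ℕ → ℕ → Carrier
    factor e k i = (X ^ suc i - 1#) ^ e (cofactor k i)

    module _ {ψ : Carrier} {k : ℕ} (möbius : ψ * ∏ (factor e⁻ k) (divisors k) ≈ ∏ (factor e⁺ k) (divisors k)) where

      private
        module Split (p m : ℕ) (p-prime : Prime p) (m≢0 : NonZero m) (k≡ : k ≡ m ℕ.* p) where
          open Pairing p m p-prime {{m≢0}} hiding (k)

          N base : ℕ → Carrier
          base i = X ^ suc (lower i) - 1#
          N i = geometric p (X ^ suc (lower i))

          -- For j = p j′ with p not dividing k/j, X^j - 1 = (X^j′ - 1) N, where N is a geometric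
          -- sum. The partner j′ contributes a power of the same base X^j′ - 1, and divisors with p²
          -- dividing k/j contribute 1. The lemma is applied with `e⁺` and `e⁻` in either order.
          split : ∀ (e e′ : ℕ → ℕ) → (∀ n .{{_ : NonZero n}} → p ∣ⁿ n → e (p ℕ.* n) ≡ 0) →
            (∀ n .{{_ : NonZero n}} → ¬ p ∣ⁿ n → e (p ℕ.* n) ≡ e′ n) →
            ∏ (factor e (m ℕ.* p)) (divisors (m ℕ.* p)) ≈
            ∏ (λ i → base i ^ e (q i) * base i ^ e′ (q i)) free * ∏ (λ i → N i ^ e (q i)) free
          split e e′ square prime* =
            trans (∏-filter p∣q? F (divisors (m ℕ.* p)))
            (trans (*-cong once-part free-part)
              (trans (solve 3 (λ a b c → a :* (b :* c) := (b :* a) :* c) _ _ _)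
                (*-congʳ (sym (∏-* (λ i → base i ^ e (q i)) (λ i → base i ^ e′ (q i)) free)))))
            where
            F = factor e (m ℕ.* p)
            vanish : ∀ {i} → i ∈ filter pp∣q? (filter p∣q? (divisors (m ℕ.* p))) → F i ≈ 1#
            vanish {i} i∈ = ^-congʳ (X ^ suc i - 1#) (square-free-exponent e square
              (proj₁ (∈-filter⁻ p∣q? {xs = divisors (m ℕ.* p)} (proj₁ i∈′))) (proj₂ i∈′))
              where i∈′ = ∈-filter⁻ pp∣q? {xs = filter p∣q? (divisors (m ℕ.* p))} i∈
            once-part : ∏ F (filter p∣q? (divisors (m ℕ.* p))) ≈ ∏ (λ i → base i ^ e′ (q i)) free
            once-part = trans (∏-filter pp∣q? F (filter p∣q? (divisors (m ℕ.* p))))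
              (trans (*-cong (∏-one (filter pp∣q? (filter p∣q? (divisors (m ℕ.* p)))) vanish) (trans (∏-↭ F once↭) (∏-map F lower free)))
              (trans (*-identityˡ _) (∏-cong free λ {i} i∈ → let P = pair i∈ in
                ^-congʳ (base i) (≡.trans (≡.cong e (Pair.q-low P)) (prime* (q i) {{Pair.q≢0 P}} (Pair.q-free P))))))
            free-part : ∏ F free ≈ ∏ (λ i → base i ^ e (q i)) free * ∏ (λ i → N i ^ e (q i)) free
            free-part = trans (∏-cong free λ {i} i∈ → trans (^-congˡ (e (q i))
                (trans (+-congʳ (trans (^-congʳ X (≡.trans (Pair.j≡p*j′ (pair i∈)) (ℕₚ.*-comm p (suc (lower i))))) (sym (^-assocʳ X (suc (lower i)) p))))
                  (sym (geometric-* p (X ^ suc (lower i))))))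
                (^-distrib-* (base i) (N i) (e (q i))))
              (∏-* (λ i → base i ^ e (q i)) (λ i → N i ^ e (q i)) free)

          -- As μ(pq) = -μ(q) when p does not divide q, each base X^j′ - 1 has the same total
          -- exponent on both sides of the product and cancels; the geometric sums remain.
          reduced-product : ψ * ∏ (λ i → N i ^ e⁻ (q i)) free ≈ ∏ (λ i → N i ^ e⁺ (q i)) free
          reduced-product = domain-cancelʳ R domain B≉0 (trans (*-assoc ψ _ _) (trans (*-congˡ (*-comm _ _)) (trans (*-congˡ (sym neg))
            (trans möbius′ (trans pos (*-comm _ _))))))
            where
            B = ∏ (λ i → base i ^ e⁻ (q i) * base i ^ e⁺ (q i)) free
            B≉0 : ¬ B ≈ 0#
            B≉0 = nonzero-∏ domain 1≉0 _ free λ {i} _ e → Sum.[ nonzero-^ domain 1≉0 (e⁻ (q i)) (nonzero (lower i)) , nonzero-^ domain 1≉0 (e⁺ (q i)) (nonzero (lower i)) ]′ (domain e)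
            neg : ∏ (factor e⁻ (m ℕ.* p)) (divisors (m ℕ.* p)) ≈ B * ∏ (λ i → N i ^ e⁻ (q i)) free
            neg = split e⁻ e⁺ (e⁻-square p-prime) (e⁻-prime* p-prime)
            pos : ∏ (factor e⁺ (m ℕ.* p)) (divisors (m ℕ.* p)) ≈ B * ∏ (λ i → N i ^ e⁺ (q i)) free
            pos = trans (split e⁺ e⁻ (e⁺-square p-prime) (e⁺-prime* p-prime)) (*-congʳ (∏-cong free λ _ → *-comm _ _))
            möbius′ : ψ * ∏ (factor e⁻ (m ℕ.* p)) (divisors (m ℕ.* p)) ≈ ∏ (factor e⁺ (m ℕ.* p)) (divisors (m ℕ.* p))
            möbius′ = ≡.subst (λ k → ψ * ∏ (factor e⁻ k) (divisors k) ≈ ∏ (factor e⁺ k) (divisors k)) k≡ möbius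

          -- Here m = j′ q with p not dividing q, so X^m - 1 = a^q - 1 for a = X^j′, and N = 1 + a +
          -- ... + a^(p-1).
          coprime-N : ∀ {i} → i ∈ free → Coprime (X ^ m - 1#) (N i)
          coprime-N {i} i∈ = ≡.subst (λ n → Coprime (X ^ n - 1#) (N i)) (Pair.m-eq P)
            (coprime-≈ˡ (+-congʳ (^-assocʳ X (suc (lower i)) (q i)))
              (coprime-geometric p-unit (coprime-prime p-prime (Pair.q-free P)) (X ^ suc (lower i))))
            where
            P = pair i∈
            open import Algebra.Properties.Semiring.Mult semiring using () renaming (_×_ to _×ₙ_)
            p-unit : p ×ₙ 1# ∣ 1#
            p-unit = ≡.subst (λ n → n ×ₙ 1# ∣ 1#) (ℕₚ.suc-pred p) (units (ℕ.pred p))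
            coprime-≈ˡ : ∀ {a b c} → a ≈ b → Coprime a c → Coprime b c
            coprime-≈ˡ e c = coprime-sym (coprime-≈ʳ e (coprime-sym c))

          coprime-maximal : Coprime ψ (X ^ m - 1#)
          coprime-maximal = coprime-sym (coprime-∣ʳ ψ∣ (coprime-∏ _ free λ {i} i∈ → coprime-^ (e⁺ (q i)) (coprime-N i∈)))
            where
            ψ∣ : ψ ∣ ∏ (λ i → N i ^ e⁺ (q i)) free
            ψ∣ = ∏ (λ i → N i ^ e⁻ (q i)) free , trans (*-comm _ ψ) reduced-product

      -- In terms of roots: the order of a root of ψ never divides k/p.
      coprime-prime-quotient : ∀ p m → Prime p → NonZero m → k ≡ m ℕ.* p → Coprime ψ (X ^ m - 1#)
      coprime-prime-quotient p m pr m≢0 k≡ = Split.coprime-maximal p m pr m≢0 k≡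

-- Cyclotomic polynomials from their product formula

module Cyclotomic where
  open Rings
  open Domains
  open FieldPolynomials
  open Functionals
  open OpaquePolynomials
  open RationalPolynomials
  open LandauArgument
  open GroupRing
  open Möbius
  open Pairings
  import Algebra.Properties.Semiring.Mult
  open import Data.Integer.Base as ℤ using (ℤ; +_)
  open import Data.List.Base as List using (List; []; _∷_; filter)
  open import Data.List.Relation.Unary.All using (All; []; _∷_)
  open import Data.List.Membership.Propositional using (_∈_)
  open import Data.List.Membership.Propositional.Properties using (∈-filter⁻)
  open import Data.List.Relation.Unary.Any using (here; there)
  import Data.List.Relation.Unary.Unique.Propositional.Properties as Uniqueₚ
  open import Data.Nat.Base as ℕ using (ℕ; zero; suc; NonZero; _<_; s≤s; z≤n)
  import Data.Nat.Properties as ℕₚ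
  open import Data.Nat.Divisibility as ℕ∣ using (divides) renaming (_∣_ to _∣ⁿ_)
  open import Data.Nat.ListAction using (product)
  open import Data.Nat.Primality using (Prime)
  open import Data.Nat.Primality.Factorisation using (factorise; PrimeFactorisation)
  open import Data.Product.Base using (_,_; _×_; ∃-syntax; proj₁; proj₂)
  open import Data.Rational.Base as ℚ using (ℚ; 0ℚ; 1ℚ)
  import Data.Rational.Properties as ℚₚ
  open import Data.Sum.Base as Sum using (_⊎_; inj₁; inj₂)
  open import Relation.Nullary using (¬_; Dec; yes; no; contradiction; ¬?; _×-dec_)
  open import Relation.Binary.PropositionalEquality as ≡ using (_≡_; _≢_)

  prime-divisor : ∀ n .{{_ : NonZero n}} → n ≢ 1 → ∃[ p ] Prime p × p ∣ⁿ n
  prime-divisor n n≢1 = first (factors F) (factorsPrime F) (isFactorisation F)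
    where
    F = factorise n
    open PrimeFactorisation
    first : ∀ ps → All Prime ps → n ≡ product ps → ∃[ p ] Prime p × p ∣ⁿ n
    first [] [] e = contradiction e n≢1
    first (p ∷ ps) (pr ∷ _) e = p , pr , ≡.subst (p ∣ⁿ_) (≡.sym e) (ℕ∣.m∣m*n (product ps))

  least : ∀ {P : ℕ → Set} → (∀ n → Dec (P n)) → ∀ n → P n → ∃[ m ] P m × (∀ i → i < m → ¬ P i)
  least {P} P? n Pn = go n 0 (λ _ ()) (≡.subst P (≡.sym (ℕₚ.+-identityʳ n)) Pn)
    where
    go : ∀ fuel m → (∀ i → i < m → ¬ P i) → P (fuel ℕ.+ m) → ∃[ m ] P m × (∀ i → i < m → ¬ P i)
    go fuel m below Pf with P? m
    ... | yes Pm = m , Pm , below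
    go zero m below Pf | no ¬Pm = contradiction Pf ¬Pm
    go (suc fuel) m below Pf | no ¬Pm = go fuel (suc m) below′ (≡.subst P (≡.sym (ℕₚ.+-suc fuel m)) Pf)
      where
      below′ : ∀ i → i < suc m → ¬ P i
      below′ i (s≤s le) = Sum.[ below i , (λ { ≡.refl → ¬Pm }) ]′ (ℕₚ.m≤n⇒m<n∨m≡n le)

  module _ where
    open ℚX hiding (M; residue; _*ᶜ; residue-∣; residue-below; norm-squares; degree-M)
    open Algebra.Properties.Semiring.Mult semiring using () renaming (_×_ to _×ₙ_)

    1≉0 : ¬ 1# ≈ 0#
    1≉0 = ≉0-degree degree-1

    X^-1≉0 : ∀ i → ¬ X ^ suc i - 1# ≈ 0#
    X^-1≉0 i = ≉0-degree (ℚX.degree-M i)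

    const-unit : ∀ {a} → a ≢ 0ℚ → const a ∣ 1#
    const-unit a≢0 = degree-0-unit (degree-const a≢0)

    multiple-unit : ∀ n → suc n ×ₙ 1# ∣ 1#
    multiple-unit n = ∣-respˡ {a = const (κ (+ suc n))} (ℤ-hom-unique (const-hom ∘ʰ κ-hom) ι-hom (+ suc n)) (const-unit λ e → κ-≢ (κ-injective e))
      where
      κ-≢ : + suc n ≢ + 0
      κ-≢ ()

    coeff-X*-0 : ∀ p → coeff (X * p) 0 ≡ 0ℚ
    coeff-X*-0 p = ≡.trans (LP.≋⇒coeff (To.*-homo X p) 0) (≡.trans (LP.≋⇒coeff (LP.⊗-congˡ (toList p) (to-from≋ L.X)) 0) (LP.≋⇒coeff (LP.X⊗ (toList p)) 0))
      where module LP = Poly ℚC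

    coeff-X*-suc : ∀ p i → coeff (X * p) (suc i) ≡ coeff p i
    coeff-X*-suc p i = ≡.trans (LP.≋⇒coeff (To.*-homo X p) (suc i)) (≡.trans (LP.≋⇒coeff (LP.⊗-congˡ (toList p) (to-from≋ L.X)) (suc i)) (LP.≋⇒coeff (LP.X⊗ (toList p)) (suc i)))
      where module LP = Poly ℚC

    coeff-X^* : ∀ n p → coeff (X ^ n * p) n ≡ coeff p 0
    coeff-X^* zero p = coeff-cong (*-identityˡ p) 0
    coeff-X^* (suc n) p = ≡.trans (coeff-cong (*-assoc X (X ^ n) p) (suc n)) (≡.trans (coeff-X*-suc (X ^ n * p) n) (coeff-X^* n p))

    -- p ≡ s (1 - t X^n) modulo X^{n+1}, where n = n′ + 1.
    module LowOrder (n′ : ℕ) where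
      n = suc n′
      Z Y : Carrier
      Z = X ^ n′
      Y = X ^ n

      record Low (p : Carrier) (t : ℕ) : Set where
        constructor low
        field
          s    : ℚ
          s≢0  : s ≢ 0ℚ
          r    : Carrier
          form : p ≈ const s * (1# - ι (+ t) * Y) + Y * (X * r)

      low-1 : Low 1# 0
      low-1 = low 1ℚ (λ ()) 0# (sym (trans (+-congʳ (*-congʳ (IsHom.1-homo const-hom)))
        (trans (solve 3 (λ o y x → o :* (o :- con (+ 0) :* y) :+ y :* (x :* con (+ 0)) := o :* o) 1# Y X) (*-identityˡ 1#))))

      low-* : ∀ {p p′ t t′} → Low p t → Low p′ t′ → Low (p * p′) (t ℕ.+ t′)
      low-* {t = t} {t′} (low s s≢0 r e) (low s′ s′≢0 r′ e′) = low (s ℚ.* s′) (λ z → Sum.[ s≢0 , s′≢0 ]′ (ℚ-domain z)) R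
        (trans (*-cong e e′) (trans
          (solve 9 (λ c c′ a b o X Z r r′ →
              (c :* (o :- a :* (X :* Z)) :+ (X :* Z) :* (X :* r)) :* (c′ :* (o :- b :* (X :* Z)) :+ (X :* Z) :* (X :* r′))
            := (c :* c′) :* (o :* o :- (o :* a :+ o :* b) :* (X :* Z)) :+ (X :* Z) :* (X :*
              (Z :* c :* c′ :* a :* b :+ r :* (c′ :* (o :- b :* (X :* Z))) :+ (c :* (o :- a :* (X :* Z))) :* r′ :+ (X :* Z) :* (X :* (r :* r′)))))
            (const s) (const s′) (ι (+ t)) (ι (+ t′)) 1# X Z r r′)
          (+-congʳ (*-cong (sym (IsHom.*-homo const-hom s s′)) (+-cong (*-identityˡ 1#) (-‿cong (*-congʳ
            (trans (+-cong (*-identityˡ _) (*-identityˡ _)) (sym (IsHom.+-homo ι-hom (+ t) (+ t′)))))))))))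
        where
        ℚ-domain : s ℚ.* s′ ≡ 0ℚ → s ≡ 0ℚ ⊎ s′ ≡ 0ℚ
        ℚ-domain = FieldPoly.field-domain ℚC ℚ-inverse (λ ()) {s} {s′}
        R = Z * const s * const s′ * ι (+ t) * ι (+ t′) + r * (const s′ * (1# - ι (+ t′) * Y)) + (const s * (1# - ι (+ t) * Y)) * r′ + Y * (X * (r * r′))

      low-^ : ∀ {p t} → Low p t → ∀ e → Low (p ^ e) (e ℕ.* t)
      low-^ l zero = low-1
      low-^ l (suc e) = low-* l (low-^ l e)

      private
        const-neg1 : const (ℚ.- 1ℚ) ≈ - 1#
        const-neg1 = trans (IsHom.-‿homo const-hom 1ℚ) (-‿cong (IsHom.1-homo const-hom))

      low-exact : Low (X ^ suc n′ - 1#) 1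
      low-exact = low (ℚ.- 1ℚ) (λ ()) 0# (sym (trans (+-congʳ (*-cong const-neg1 (+-congˡ (-‿cong (*-congʳ (IsHom.1-homo ι-hom))))))
        (trans (solve 3 (λ o y x → (:- o) :* (o :- o :* y) :+ y :* (x :* con (+ 0)) := o :* (o :* y) :- o :* o) 1# Y X)
          (+-cong (trans (*-identityˡ _) (*-identityˡ _)) (-‿cong (*-identityˡ 1#))))))

      low-higher : ∀ d → Low (X ^ (n ℕ.+ suc d) - 1#) 0
      low-higher d = low (ℚ.- 1ℚ) (λ ()) (X ^ d) (sym (trans (+-congʳ (*-congʳ const-neg1))
        (trans (solve 4 (λ o y x z → (:- o) :* (o :- con (+ 0) :* y) :+ y :* (x :* z) := y :* (x :* z) :- o :* o) 1# Y X (X ^ d))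
          (+-cong (sym (^-homo-* X n (suc d))) (-‿cong (*-identityˡ 1#))))))

      open Products ℚ[X] using (∏)

      count : List ℕ → ℕ
      count [] = 0
      count (i ∷ L) with i ℕₚ.≟ n′
      ... | yes _ = suc (count L)
      ... | no  _ = count L

      count-∈ : ∀ {L} → n′ ∈ L → count L ≢ 0
      count-∈ {i ∷ L} i∈ e with i ℕₚ.≟ n′
      count-∈ {i ∷ L} i∈ () | yes _
      count-∈ {i ∷ L} (here p) e | no i≢ = i≢ (≡.sym p)
      count-∈ {i ∷ L} (there i∈) e | no _ = count-∈ i∈ e

      -- Factors with i < n′ have exponent 0, and those with i > n′ are -1 modulo X^(n+1). Only X^n
      -- - 1, counted with multiplicity, affects the ratio of the coefficients of X^n and 1.
      low-∏ : ∀ (e : ℕ → ℕ) L → (∀ {i} → i ∈ L → i < n′ → e i ≡ 0) → Low (∏ (λ i → (X ^ suc i - 1#) ^ e i) L) (count L ℕ.* e n′)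
      low-∏ e [] h = low-1
      low-∏ e (i ∷ L) h with i ℕₚ.≟ n′
      ... | yes ≡.refl = low-* (≡.subst (Low _) (ℕₚ.*-identityʳ (e n′)) (low-^ low-exact (e n′))) (low-∏ e L (λ j∈ → h (there j∈)))
      ... | no i≢ = low-* (other (ℕₚ.<-cmp i n′)) (low-∏ e L (λ j∈ → h (there j∈)))
        where
        open import Relation.Binary.Definitions using (Tri; tri<; tri≈; tri>)
        other : Tri (i < n′) (i ≡ n′) (n′ < i) → Low ((X ^ suc i - 1#) ^ e i) 0
        other (tri< lt _ _) = ≡.subst (λ m → Low ((X ^ suc i - 1#) ^ m) 0) (≡.sym (h (here ≡.refl) lt)) low-1
        other (tri≈ _ eq _) = contradiction eq i≢
        other (tri> _ _ gt) = ≡.subst (Low _) (ℕₚ.*-zeroʳ (e i)) (low-^ (≡.subst (λ m → Low (X ^ m - 1#) 0) index (low-higher d)) (e i))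
          where
          d = i ℕ.∸ suc n′
          index : n ℕ.+ suc d ≡ suc i
          index = ≡.trans (ℕₚ.+-suc n d) (≡.cong suc (ℕₚ.m+[n∸m]≡n gt))

      low-coeff-0 : ∀ {p t} (l : Low p t) → coeff p 0 ≡ Low.s l
      low-coeff-0 {p} {t} (low s _ r e) = ≡.trans (coeff-cong (trans e (solve 6 (λ c o a x z r → c :* (o :- a :* (x :* z)) :+ (x :* z) :* (x :* r) := c :* o :+ x :* (z :* (:- (c :* a) :+ x :* r))) (const s) 1# (ι (+ t)) X Z r)) 0)
        (≡.trans (coeff-+ (const s * 1#) _ 0) (≡.trans (≡.cong₂ ℚ._+_ (≡.trans (coeff-cong (*-identityʳ _) 0) coeff-const) (coeff-X*-0 _)) (ℚₚ.+-identityʳ s)))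
        where
        coeff-const : coeff (const s) 0 ≡ s
        coeff-const = Poly.≋⇒coeff ℚC (toList-const s) 0

      low-coeff-n : ∀ {p t} (l : Low p t) → coeff p n ≡ Low.s l ℚ.* κ (ℤ.- (+ t))
      low-coeff-n {p} {t} (low s _ r e) = ≡.trans (coeff-cong (trans e (solve 6 (λ c o a x z r → c :* (o :- a :* (x :* z)) :+ (x :* z) :* (x :* r) := c :* o :+ (x :* z) :* (c :* :- a :+ x :* r)) (const s) 1# (ι (+ t)) X Z r)) n)
        (≡.trans (coeff-+ (const s * 1#) _ n) (≡.trans (≡.cong₂ ℚ._+_ (≡.trans (coeff-const* s 1# n) (≡.trans (≡.cong (s ℚ.*_) (coeff-1 n′)) (ℚₚ.*-zeroʳ s))) (coeff-X^* n _))
        (≡.trans (ℚₚ.+-identityˡ _) (≡.trans (coeff-+ (const s * - ι (+ t)) (X * r) 0) (≡.trans (≡.cong₂ ℚ._+_ (coeff-cong main 0) (coeff-X*-0 r)) (≡.trans (ℚₚ.+-identityʳ _) (Poly.≋⇒coeff ℚC (toList-const _) 0)))))))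
        where
        main : const s * - ι (+ t) ≈ const (s ℚ.* κ (ℤ.- (+ t)))
        main = trans (*-congˡ (trans (sym (IsHom.-‿homo ι-hom (+ t))) (sym (ℤ-hom-unique (const-hom ∘ʰ κ-hom) ι-hom (ℤ.- (+ t)))))) (sym (IsHom.*-homo const-hom s _))

    open Products ℚ[X]

    module CyclotomicProduct (k′ : ℕ) (ψ : Carrier) where
      private k = suc k′

      module MP = MöbiusProduct ℚ[X] (λ {a} {b} → domain {a} {b}) 1≉0 X X^-1≉0 multiple-unit
      open MP using (factor)

      Cyclotomic : Set
      Cyclotomic = ψ * ∏ (factor e⁻ k) (divisors k) ≈ ∏ (factor e⁺ k) (divisors k)

      module _ (möbius : Cyclotomic) where

        -- For a proper divisor of k, some prime p divides the cofactor; the divisor then divides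
        -- k/p, and `coprime-prime-quotient` applies.
        coprime-proper : ∀ d → suc d ∣ⁿ k → suc d ≢ k → Coprime ψ (X ^ suc d - 1#)
        coprime-proper d (divides c k≡) d≢k = via (prime-divisor c {{c≢0}} c≢1)
          where
          c≢0 : NonZero c
          c≢0 = ℕ.≢-nonZero λ { ≡.refl → ℕₚ.1+n≢0 k≡ }
          c≢1 : c ≢ 1
          c≢1 ≡.refl = d≢k (≡.sym (≡.trans k≡ (ℕₚ.*-identityˡ (suc d))))
          via : ∃[ p ] Prime p × p ∣ⁿ c → Coprime ψ (X ^ suc d - 1#)
          via (p , pr , divides c′ c≡) = coprime-∣ʳ (PowerDivisibility.∣-exponent ℚ[X] X (divides c′ ≡.refl))
            (MP.coprime-prime-quotient {ψ} {k} möbius p (c′ ℕ.* suc d) pr (ℕ.≢-nonZero m≢0) k-eq)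
            where
            k-eq : k ≡ c′ ℕ.* suc d ℕ.* p
            k-eq = ≡.trans k≡ (≡.trans (≡.cong (ℕ._* suc d) c≡) (≡.trans (ℕₚ.*-assoc c′ p (suc d))
              (≡.trans (≡.cong (c′ ℕ.*_) (ℕₚ.*-comm p (suc d))) (≡.sym (ℕₚ.*-assoc c′ (suc d) p)))))
            m≢0 : c′ ℕ.* suc d ≢ 0
            m≢0 e = ℕₚ.1+n≢0 (≡.trans k-eq (≡.cong (ℕ._* p) e))

        -- ψ divides the right-hand product but is coprime to all its factors except X^k - 1, which
        -- occurs at most once in the list and has exponent μ(1) = 1.
        ψ∣M : ψ ∣ X ^ k - 1#
        ψ∣M = ∣-trans ψ∣top top∣
          where
          top? : ∀ i → Dec (i ≡ k′)
          top? i = i ℕₚ.≟ k′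
          tops = filter top? (divisors k)
          ψ∣pos : ψ ∣ ∏ (factor e⁺ k) (divisors k)
          ψ∣pos = ∏ (factor e⁻ k) (divisors k) , trans (*-comm _ ψ) möbius
          ψ∣top : ψ ∣ ∏ (factor e⁺ k) tops
          ψ∣top = coprime-∣ (coprime-∏ (factor e⁺ k) (filter (λ i → ¬? (top? i)) (divisors k)) λ {i} i∈ →
              let i∈′ = ∈-filter⁻ (λ i → ¬? (top? i)) {xs = divisors k} i∈ in
              coprime-^ (e⁺ (cofactor k i)) (coprime-proper i (∈-divisors⁻ {k} (proj₁ i∈′)) (λ e → proj₂ i∈′ (ℕₚ.suc-injective e))))
            (∣-respʳ (trans (∏-filter top? (factor e⁺ k) (divisors k)) (*-comm _ _)) ψ∣pos)
          exponent : e⁺ (cofactor k k′) ≡ 1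
          exponent = ≡.cong e⁺ (cofactor-eq {k} {k′} 1 (ℕₚ.*-identityˡ k))
          top∣ : ∏ (factor e⁺ k) tops ∣ X ^ k - 1#
          top∣ = Sum.[ (λ e → ≡.subst (λ L → ∏ (factor e⁺ k) L ∣ X ^ k - 1#) (≡.sym e) (X ^ k - 1# , *-identityʳ _))
                     , (λ e → ≡.subst (λ L → ∏ (factor e⁺ k) L ∣ X ^ k - 1#) (≡.sym e)
                         (∣-reflexive (trans (*-identityʳ _) (trans (^-congʳ (X ^ k - 1#) exponent) (*-identityʳ _))))) ]′
            (unique-constant tops (Uniqueₚ.filter⁺ top? (divisors-unique k)) (λ x∈ → proj₂ (∈-filter⁻ top? {xs = divisors k} x∈)))

        ψ≉0 : ¬ ψ ≈ 0#
        ψ≉0 e = nonzero-∏ (λ {a} {b} → domain {a} {b}) 1≉0 (factor e⁺ k) (divisors k)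
          (λ {i} _ → nonzero-^ (λ {a} {b} → domain {a} {b}) 1≉0 (e⁺ (cofactor k i)) (X^-1≉0 i))
          (trans (sym möbius) (trans (*-congʳ e) (zeroˡ _)))

        private
          Differ : ℕ → Set
          Differ i = suc i ∣ⁿ k × e⁺ (cofactor k i) ≢ e⁻ (cofactor k i)

          differ? : ∀ i → Dec (Differ i)
          differ? i = (suc i ℕ∣.∣? k) ×-dec ¬? (e⁺ (cofactor k i) ℕₚ.≟ e⁻ (cofactor k i))

          differ-top : Differ k′
          differ-top = ℕ∣.∣-refl , λ e → contradiction (≡.trans (≡.sym (≡.cong e⁺ cofactor≡1)) (≡.trans e (≡.cong e⁻ cofactor≡1))) λ ()
            where
            cofactor≡1 : cofactor k k′ ≡ 1
            cofactor≡1 = cofactor-eq {k} {k′} 1 (ℕₚ.*-identityˡ k)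

        -- Modulo X^{n+1}, with n least such that μ(k/n) ≠ 0, exactly one side of the Möbius
        -- product is constant.
        ψ-nonconstant : ∀ u → ¬ ψ ≈ const u
        ψ-nonconstant u ψ≈u = at-least (least differ? k′ differ-top)
          where
          at-least : ∃[ m ] Differ m × (∀ i → i < m → ¬ Differ i) → _
          -- Comparing the coefficients of 1 and X^n on both sides yields c e⁻ = c e⁺ at k/n. The
          -- multiplicity c of n′ in the list is nonzero, which contradicts the choice of n.
          at-least (n′ , (n∣k , differ) , minimal) = differ (≡.sym (ℕₚ.*-cancelˡ-≡ (e⁻ (cofactor k n′)) (e⁺ (cofactor k n′)) c {{ℕ.≢-nonZero c≢0}} t≡))
            where
            open LowOrder n′
            c = count (divisors k)
            c≢0 : c ≢ 0
            c≢0 = count-∈ (∈-divisors⁺ {k} n∣k)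
            zeros : ∀ {i} → i ∈ divisors k → i < n′ → e⁺ (cofactor k i) ≡ 0 × e⁻ (cofactor k i) ≡ 0
            zeros {i} i∈ lt with e⁺ (cofactor k i) ℕₚ.≟ e⁻ (cofactor k i)
            ... | yes e = e⁺≡e⁻⇒0 (cofactor k i) e
            ... | no ¬e = contradiction (∈-divisors⁻ {k} i∈ , ¬e) (minimal i lt)
            L⁺ = low-∏ (λ i → e⁺ (cofactor k i)) (divisors k) λ i∈ lt → proj₁ (zeros i∈ lt)
            L⁻ = low-∏ (λ i → e⁻ (cofactor k i)) (divisors k) λ i∈ lt → proj₂ (zeros i∈ lt)
            s⁺ = Low.s L⁺
            s⁻ = Low.s L⁻
            eq : const u * ∏ (factor e⁻ k) (divisors k) ≈ ∏ (factor e⁺ k) (divisors k)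
            eq = trans (*-congʳ (sym ψ≈u)) möbius
            us : u ℚ.* s⁻ ≡ s⁺
            us = ≡.trans (≡.cong (u ℚ.*_) (≡.sym (low-coeff-0 L⁻))) (≡.trans (≡.sym (coeff-const* u _ 0)) (≡.trans (coeff-cong eq 0) (low-coeff-0 L⁺)))
            ust : u ℚ.* (s⁻ ℚ.* κ (ℤ.- (+ (c ℕ.* e⁻ (cofactor k n′))))) ≡ s⁺ ℚ.* κ (ℤ.- (+ (c ℕ.* e⁺ (cofactor k n′))))
            ust = ≡.trans (≡.cong (u ℚ.*_) (≡.sym (low-coeff-n L⁻))) (≡.trans (≡.sym (coeff-const* u _ n)) (≡.trans (coeff-cong eq n) (low-coeff-n L⁺)))
            cancelˡ : ∀ {a b} → s⁺ ℚ.* a ≡ s⁺ ℚ.* b → a ≡ b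
            cancelˡ {a} {b} e = domain-cancelʳ ℚ-ring (λ {x} {y} → FieldPoly.field-domain ℚC ℚ-inverse (λ ()) {x} {y}) {a} {b} {s⁺} (Low.s≢0 L⁺)
              (≡.trans (ℚₚ.*-comm a s⁺) (≡.trans e (ℚₚ.*-comm s⁺ b)))
            t≡ : c ℕ.* e⁻ (cofactor k n′) ≡ c ℕ.* e⁺ (cofactor k n′)
            t≡ = ℤₚ.+-injective (ℤₚ.neg-injective (κ-injective (cancelˡ (≡.trans (≡.cong (ℚ._* _) (≡.sym us)) (≡.trans (ℚₚ.*-assoc u s⁻ _) ust)))))
              where import Data.Integer.Properties as ℤₚ

        ψ-degree : ∃[ d ] Degree ψ (suc d)
        ψ-degree = positive (degree ψ)
          where
          positive : ψ ≈ 0# ⊎ (∃[ n ] Degree ψ n) → ∃[ d ] Degree ψ (suc d)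
          positive (inj₁ e) = contradiction e ψ≉0
          positive (inj₂ (suc d , deg)) = d , deg
          positive (inj₂ (zero , deg)) = contradiction (coeff⇒≈ same) (ψ-nonconstant (coeff ψ 0))
            where
            same : ∀ i → coeff ψ i ≡ coeff (const (coeff ψ 0)) i
            same zero = ≡.sym (Poly.≋⇒coeff ℚC (toList-const (coeff ψ 0)) 0)
            same (suc i) = ≡.trans (above deg (suc i) (s≤s z≤n)) (≡.sym (Poly.≋⇒coeff ℚC (toList-const (coeff ψ 0)) (suc i)))

-- Irreducibility of cyclotomic polynomials

module CyclotomicIrreducibility where
  open Rings
  open FieldPolynomials
  open Functionals
  open OpaquePolynomials
  open RationalPolynomials
  open LandauArgument
  open GroupRing
  open Möbius
  open Pairings
  open Cyclotomic
  open import Defs using (module Polynomial)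
  open import Algebra.Bundles using (CommutativeRing)
  open import Data.Integer.Base using (+_)
  open import Data.List.Base as List using (List; []; _∷_; length; map; take)
  import Data.List.Properties as Listₚ
  open import Data.List.Relation.Unary.All using (All; []; _∷_)
  open import Data.Nat.Base as ℕ using (ℕ; zero; suc; _<_; _≤_; s≤s; z≤n)
  import Data.Nat.Properties as ℕₚ
  open import Data.Nat.Divisibility as ℕ∣ using (divides) renaming (_∣_ to _∣ⁿ_)
  open import Data.Nat.Coprimality using (coprime?) renaming (Coprime to Coprimeⁿ)
  open import Data.Nat.GCD as GCD using (module Bézout; module GCD)
  open import Data.Product.Base using (_,_; _×_; ∃-syntax; proj₁; proj₂)
  open import Data.Rational.Base using (ℚ; 0ℚ)
  open import Data.Sum.Base as Sum using (_⊎_; inj₁; inj₂)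
  open import Relation.Nullary using (¬_; Dec; yes; no; contradiction)
  open import Relation.Binary.PropositionalEquality as ≡ using (_≡_; _≢_)

  module Roots (S : Ring₀) where
    open CommutativeRing S hiding (zero)
    open IntegerMultiples S

    value : Carrier → List Carrier → Carrier
    value s []      = 0#
    value s (a ∷ p) = a + s * value s p

    -- quot r p is the quotient of (a + Xp) - (a + rp(r)) by X - r.
    quot : Carrier → List Carrier → List Carrier
    quot r []      = []
    quot r (b ∷ p) = value r (b ∷ p) ∷ quot r p

    length-quot : ∀ r p → length (quot r p) ≡ length p
    length-quot r []      = ≡.refl
    length-quot r (b ∷ p) = ≡.cong suc (length-quot r p)

    quot-value : ∀ y r a p → value y (a ∷ p) - value r (a ∷ p) ≈ (y - r) * value y (quot r p)
    quot-value y r a [] = solve 3 (λ y r a → (a :+ y :* con (+ 0)) :- (a :+ r :* con (+ 0)) := (y :- r) :* con (+ 0)) y r a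
    quot-value y r a (b ∷ p) = trans
      (solve 5 (λ y r a v w → (a :+ y :* v) :- (a :+ r :* w) := (y :- r) :* w :+ y :* (v :- w)) y r a (value y (b ∷ p)) (value r (b ∷ p)))
      (trans (+-congˡ (*-congˡ (quot-value y r b p)))
        (solve 4 (λ y r w q → (y :- r) :* w :+ y :* ((y :- r) :* q) := (y :- r) :* (w :+ y :* q)) y r (value r (b ∷ p)) (value y (quot r p))))

    Zero : List Carrier → Set
    Zero = All (_≈ 0#)

    zero-from-quot : ∀ r a p → Zero (quot r p) → value r (a ∷ p) ≈ 0# → Zero (a ∷ p)
    zero-from-quot r a [] z e = trans (sym (trans (+-congˡ (zeroʳ r)) (+-identityʳ a))) e ∷ []
    zero-from-quot r a (b ∷ p) (z ∷ zs) e = trans (sym (trans (+-congˡ (trans (*-congˡ z) (zeroʳ r))) (+-identityʳ a))) e ∷ zero-from-quot r b p zs z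

    -- The usual bound on the number of roots, in a ring that may have zero divisors: after X - r 0
    -- is split off, the other roots stay roots because their differences can be cancelled. It is
    -- applied modulo a factor f of ψ, before ψ is known to be irreducible.
    many-roots : ∀ n (r : ℕ → Carrier) p → length p ≤ n → (∀ i → i < n → value (r i) p ≈ 0#) →
      (∀ i j → i < j → j < n → ∀ x → (r j - r i) * x ≈ 0# → x ≈ 0#) → Zero p
    many-roots n r [] le roots regular = []
    many-roots (suc n) r (a ∷ p) (s≤s le) roots regular = zero-from-quot (r 0) a p
      (many-roots n (λ i → r (suc i)) (quot (r 0) p) (≡.subst (_≤ n) (≡.sym (length-quot (r 0) p)) le)
        (λ i i<n → regular 0 (suc i) (s≤s z≤n) (s≤s i<n) _ (trans (sym (quot-value (r (suc i)) (r 0) a p))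
          (trans (+-cong (roots (suc i) (s≤s i<n)) (-‿cong (roots 0 (s≤s z≤n)))) (-‿inverseʳ 0#))))
        (λ i j i<j j<n → regular (suc i) (suc j) (s≤s i<j) (s≤s j<n)))
      (roots 0 (s≤s z≤n))

  module _ where
    open ℚX hiding (M; residue; _*ᶜ; residue-∣; residue-below; norm-squares; degree-M)
    open Products ℚ[X] using (∏)

    module CyclotomicField (k′ : ℕ) (ψ : Carrier) (möbius : CyclotomicProduct.Cyclotomic k′ ψ) where
      open CyclotomicProduct k′ ψ
      open Norm k′
      open Automorphisms k′

      Θ : Carrier
      Θ = proj₁ (ψ∣M möbius)

      ψΘ≈M : ψ * Θ ≈ M
      ψΘ≈M = trans (*-comm ψ Θ) (proj₂ (ψ∣M möbius))

      Coprime-proper : ∀ e → e ≢ 0 → e ∣ⁿ k → e ≢ k → Coprime ψ (X ^ e - 1#)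
      Coprime-proper zero e≢0 d e≢k = contradiction ≡.refl e≢0
      Coprime-proper (suc e) _ d e≢k = coprime-proper möbius e d e≢k

      power-subst : ∀ j n → subst (X ^ j) (X ^ n - 1#) ≈ X ^ (j ℕ.* n) - 1#
      power-subst j n = trans (IsHom.‿-homo (subst-hom (X ^ j)) (X ^ n) 1#)
        (+-cong (trans (subst-X^ (X ^ j) n) (^-assocʳ X j n)) (-‿cong (IsHom.1-homo (subst-hom (X ^ j)))))

      M∣multiple : ∀ {n} → k ∣ⁿ n → M ∣ X ^ n - 1#
      M∣multiple d = PowerDivisibility.∣-exponent ℚ[X] X d

      -- If f vanishes at ω then, by Landau, it vanishes at ω^j for all j prime to k, so g does not;
      -- for other j, ω^j has smaller order and is not a root of g either. Hence h = M/g has the k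
      -- roots ω^j modulo f, but degree less than k.
      module Factors (f g : Carrier) (fg≈ψ : f * g ≈ ψ) {i j} (deg-f : Degree f (suc i)) (deg-g : Degree g (suc j)) where

        fgΘ≈M : f * g * Θ ≈ M
        fgΘ≈M = trans (*-congʳ fg≈ψ) ψΘ≈M

        h : Carrier
        h = f * Θ

        gh≈M : g * h ≈ M
        gh≈M = trans (solve 3 (λ f g t → g :* (f :* t) := f :* g :* t) f g Θ) fgΘ≈M

        f∣M : f ∣ M
        f∣M = g * Θ , trans (solve 3 (λ f g t → g :* t :* f := f :* g :* t) f g Θ) fgΘ≈M

        f∣ψ : f ∣ ψ
        f∣ψ = g , trans (*-comm g f) fg≈ψ

        g∣ψ : g ∣ ψ
        g∣ψ = f , fg≈ψ

        coprime-conjugate : ∀ n → Dec (Coprimeⁿ n k) → Coprime f (subst (X ^ n) g)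
        coprime-conjugate n (yes cop) = coprime-∣ˡ
          (landau-coprime f (g * Θ) (trans (sym (*-assoc f g Θ)) fgΘ≈M) n cop)
          (HomDivisibility.coprime-hom (subst-hom (X ^ n)) (squarefree f g Θ fgΘ≈M))
        coprime-conjugate n (no ¬cop) = coprime-sym (coprime-∣ʳ f∣X^ne-1
          (coprime-≈ʳ (power-subst n e) (HomDivisibility.coprime-hom (subst-hom (X ^ n)) (coprime-∣ˡ g∣ψ (Coprime-proper e e≢0 e∣k e≢k)))))
          where
          d = GCD.gcd n k
          e = ℕ∣.quotient (GCD.gcd[m,n]∣n n k)
          k≡ : k ≡ e ℕ.* d
          k≡ = _∣ⁿ_.equality (GCD.gcd[m,n]∣n n k)
          e∣k : e ∣ⁿ k
          e∣k = divides d (≡.trans k≡ (ℕₚ.*-comm e d))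
          e≢0 : e ≢ 0
          e≢0 z = ℕₚ.1+n≢0 (≡.trans k≡ (≡.cong (ℕ._* d) z))
          d≢1 : d ≢ 1
          d≢1 d≡1 = ¬cop λ {x} (x∣n , x∣k) → ℕ∣.∣1⇒≡1 (≡.subst (x ∣ⁿ_) d≡1 (GCD.gcd-greatest x∣n x∣k))
          e≢k : e ≢ k
          e≢k e≡k = d≢1 (≡.sym (ℕₚ.*-cancelˡ-≡ 1 d k (≡.trans (ℕₚ.*-identityʳ k) (≡.trans k≡ (≡.cong (ℕ._* d) e≡k)))))
          f∣X^ne-1 : f ∣ X ^ (n ℕ.* e) - 1#
          f∣X^ne-1 = ∣-trans f∣M (M∣multiple (divides n′ (≡.trans (≡.cong (ℕ._* e) n≡) (≡.trans (ℕₚ.*-assoc n′ d e) (≡.cong (n′ ℕ.*_) (≡.trans (ℕₚ.*-comm d e) (≡.sym k≡)))))))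
            where
            n′ = ℕ∣.quotient (GCD.gcd[m,n]∣m n k)
            n≡ : n ≡ n′ ℕ.* d
            n≡ = _∣ⁿ_.equality (GCD.gcd[m,n]∣m n k)

        -- M(X^n) = g(X^n) h(X^n) is divisible by f, and g(X^n) is coprime to f.
        f∣subst-h : ∀ n → f ∣ subst (X ^ n) h
        f∣subst-h n = coprime-∣ (coprime-conjugate n (coprime? n k))
          (∣-respʳ (trans (sym (power-subst n k)) (trans (subst-cong (X ^ n) (sym gh≈M)) (IsHom.*-homo (subst-hom (X ^ n)) g h)))
            (∣-trans f∣M (M∣multiple (ℕ∣.∣n⇒∣m*n n ℕ∣.∣-refl))))

        -- A Bézout relation between the exponents shows that X^d - 1 annihilates x modulo f, where
        -- d = gcd(n, k). As d is a proper divisor of k, X^d - 1 is coprime to f.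
        regular-power : ∀ n → n ≢ 0 → n < k → ∀ x → f ∣ (X ^ n - 1#) * x → f ∣ x
        regular-power n n≢0 n<k x d∣ = coprime-∣ (coprime-∣ˡ f∣ψ (Coprime-proper d d≢0 (GCD.gcd[m,n]∣n n k) d≢k)) (via (Bézout.identity (GCD.gcd-GCD n k)))
          where
          d = GCD.gcd n k
          d≤n : d ≤ n
          d≤n = ℕ∣.∣⇒≤ {{ℕ.≢-nonZero n≢0}} (GCD.gcd[m,n]∣m n k)
          d≢k : d ≢ k
          d≢k d≡k = ℕₚ.<⇒≱ n<k (≡.subst (_≤ n) d≡k d≤n)
          d≢0 : d ≢ 0
          d≢0 e = n≢0 (GCD.gcd[m,n]≡0⇒m≡0 {n} {k} e)
          step : ∀ a → f ∣ (X ^ (d ℕ.+ a) - 1#) * x → f ∣ (X ^ a - 1#) * x → f ∣ (X ^ d - 1#) * x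
          step a p q = ∣-respʳ (trans
            (+-congʳ (*-congʳ (+-congʳ (^-homo-* X d a))))
            (trans (solve 4 (λ u v o x → (u :* v :- o) :* x :- u :* ((v :- o) :* x) := (u :* o :- o) :* x) (X ^ d) (X ^ a) 1# x) (*-congʳ (+-congʳ (*-identityʳ _)))))
            (∣-- p (∣-*ˡ (X ^ d) q))
          from-n : ∀ y → f ∣ (X ^ (y ℕ.* n) - 1#) * x
          from-n y = ∣-trans d∣ (∣-*-cong (PowerDivisibility.∣-exponent ℚ[X] X (divides y ≡.refl)) ∣-refl)
          from-k : ∀ y → f ∣ (X ^ (y ℕ.* k) - 1#) * x
          from-k y = ∣-*ʳ x (∣-trans f∣M (M∣multiple (divides y ≡.refl)))
          via : Bézout.Identity d n k → f ∣ (X ^ d - 1#) * x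
          via (Bézout.+- a b eq) = step (b ℕ.* k) (≡.subst (λ m → f ∣ (X ^ m - 1#) * x) (≡.sym eq) (from-n a)) (from-k b)
          via (Bézout.-+ a b eq) = step (a ℕ.* n) (≡.subst (λ m → f ∣ (X ^ m - 1#) * x) (≡.sym eq) (from-k b)) (from-n a)

        coprime-X^ : ∀ n → Coprime f (X ^ n)
        coprime-X^ zero = coprime-1
        coprime-X^ (suc n) = coprime-* (coprime-∣ˡ f∣M (- 1# , X ^ k′ ,
          trans (solve 3 (λ o x z → (:- o) :* (x :* z :- o) :+ z :* x := o :* o :+ (x :* z :- o :* (x :* z))) 1# X (X ^ k′))
            (trans (+-cong (*-identityˡ 1#) (trans (+-congˡ (-‿cong (*-identityˡ _))) (-‿inverseʳ _))) (+-identityʳ 1#)))) (coprime-X^ n)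

        Q : Ring₀
        Q = quotient f

        private
          module Q = CommutativeRing Q
          module QE = Ev Q (quotient-hom f ∘ʰ const-hom)
          module EL = Evaluation ℚC Q (quotient-hom f ∘ʰ const-hom)
          open Roots Q

          value-map : ∀ s p → value s (map const p) Q.≈ EL.ev s p
          value-map s []      = Q.refl
          value-map s (a ∷ p) = Q.+-congˡ {const a} (Q.*-congˡ {s} (value-map s p))

          coeffs : List ℚ
          coeffs = take k (toList h)

          below-h : Below h k
          below-h = small (degree-factors g h (ℚX.degree-M k′) gh≈M)
            where
            small : ∃[ a ] ∃[ b ] Degree g a × Degree h b × a ℕ.+ b ≡ k → Below h k
            small (a , b , da , db , eq) n le = above db n (ℕₚ.≤-trans (ℕₚ.≤-trans (ℕₚ.m≤n+m (suc b) j) (ℕₚ.≤-reflexive (≡.trans (ℕₚ.+-suc j b) (≡.trans (≡.cong (ℕ._+ b) (degree-unique deg-g da)) eq)))) le)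

          coeff-take : ∀ n p i → (∀ m → n ≤ m → Polynomial.coeff (CRing.raw ℚC) p m ≡ 0ℚ) →
            Polynomial.coeff (CRing.raw ℚC) (take n p) i ≡ Polynomial.coeff (CRing.raw ℚC) p i
          coeff-take zero p i z = ≡.sym (z i z≤n)
          coeff-take (suc n) [] i z = ≡.refl
          coeff-take (suc n) (a ∷ p) zero z = ≡.refl
          coeff-take (suc n) (a ∷ p) (suc i) z = coeff-take n p i λ m le → z (suc m) (s≤s le)

          roots : ∀ n → n < k → value (X ^ n) (map const coeffs) Q.≈ Q.0#
          roots n _ = Q.trans (value-map (X ^ n) coeffs)
            (Q.trans (EL.ev-cong (X ^ n) {coeffs} {toList h} (Poly.coeff⇒≋ ℚC {coeffs} {toList h} λ i → coeff-take k (toList h) i below-h))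
            (Q.trans (QE.ev-congˡ h (Q.sym (≈⇒quotient f (subst-X (X ^ n)))))
            (Q.trans (Q.sym (QE.ev-unique (quotient-hom f ∘ʰ subst-hom (X ^ n)) (λ a → ≈⇒quotient f (subst-const (X ^ n) a)) h))
              (zero-quotient (f∣subst-h n)))))

          regular : ∀ a b → a < b → b < k → ∀ x → (X ^ b - X ^ a) * x Q.≈ Q.0# → x Q.≈ Q.0#
          regular a b a<b b<k x e = zero-quotient (regular-power n n≢0 (ℕₚ.≤-<-trans (ℕₚ.m∸n≤m b a) b<k) x
              (coprime-∣ (coprime-X^ a) (∣-respʳ (trans (*-congʳ (+-congʳ X^b))
                (trans (solve 4 (λ u v o x → (u :* v :- u) :* x := u :* ((v :- o) :* x) :+ (u :* o :- u) :* x) (X ^ a) (X ^ n) 1# x)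
                (trans (+-congˡ (trans (*-congʳ (trans (+-congʳ (*-identityʳ _)) (-‿inverseʳ _))) (zeroˡ x))) (+-identityʳ _)))) (quotient-zero e))))
            where
            n = b ℕ.∸ a
            n≢0 : n ≢ 0
            n≢0 = ℕₚ.m>n⇒m∸n≢0 a<b
            X^b : X ^ b ≈ X ^ a * X ^ n
            X^b = trans (^-congʳ X (≡.sym (ℕₚ.m+[n∸m]≡n (ℕₚ.<⇒≤ a<b)))) (^-homo-* X a n)

          zeros : Zero (map const coeffs)
          zeros = many-roots k (X ^_) (map const coeffs)
            (≡.subst (_≤ k) (≡.sym (Listₚ.length-map const coeffs)) (≡.subst (_≤ k) (≡.sym (Listₚ.length-take k (toList h))) (ℕₚ.m⊓n≤m k _)))
            roots regular

          f∣coeff : ∀ p i → Zero (map const p) → f ∣ const (Polynomial.coeff (CRing.raw ℚC) p i)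
          f∣coeff []      i       z = ∣-respʳ (sym (IsHom.0-homo const-hom)) ∣-0
          f∣coeff (a ∷ p) zero    (z ∷ zs) = quotient-zero z
          f∣coeff (a ∷ p) (suc i) (z ∷ zs) = f∣coeff p i zs

        -- All coefficients of h vanish modulo f. The leading one is a nonzero rational number, so f
        -- would be a unit.
        impossible : ∀ {A : Set} → A
        impossible = contradiction (f∣1 (degree-factors g h (ℚX.degree-M k′) gh≈M)) (nonunit deg-f)
          where
          f∣1 : ∃[ a ] ∃[ b ] Degree g a × Degree h b × a ℕ.+ b ≡ k → f ∣ 1#
          f∣1 (_ , b , _ , db , _) = ∣-trans (f∣coeff coeffs b zeros)
            (const-unit (λ e → lead≉0 db (≡.trans (≡.sym (coeff-take k (toList h) b below-h)) e)))

      ψ-irreducible : ∀ f g → f * g ≈ ψ → f ∣ 1# ⊎ g ∣ 1#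
      ψ-irreducible f g e = by-degree (degree-factors f g (proj₂ (ψ-degree möbius)) e)
        where
        by-degree : ∃[ i ] ∃[ j ] Degree f i × Degree g j × i ℕ.+ j ≡ suc (proj₁ (ψ-degree möbius)) → f ∣ 1# ⊎ g ∣ 1#
        by-degree (zero , j , df , dg , _) = inj₁ (degree-0-unit df)
        by-degree (suc i , zero , df , dg , _) = inj₂ (degree-0-unit dg)
        by-degree (suc i , suc j , df , dg , _) = Factors.impossible f g e df dg

      -- Up to units, the gcd of a and the irreducible ψ is ψ or 1; in the second case the Bézout
      -- coefficient of a gives the inverse.
      ψ-field : ∀ a → ψ ∣ a ⊎ (∃[ b ] ψ ∣ a * b - 1#)
      ψ-field a = split (gcd a ψ)
        where
        split : Gcd a ψ → ψ ∣ a ⊎ (∃[ b ] ψ ∣ a * b - 1#)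
        split Γ = Sum.[ (λ c∣1 → inj₁ (∣-trans (ψ∣d c∣1) Γ.gcd∣ˡ)) , (λ d∣1 → inj₂ (inverse d∣1)) ]′ (ψ-irreducible c d cd≈ψ)
          where
          module Γ = Gcd Γ
          d = Γ.gcd
          c = proj₁ Γ.gcd∣ʳ
          cd≈ψ : c * d ≈ ψ
          cd≈ψ = proj₂ Γ.gcd∣ʳ
          ψ∣d : c ∣ 1# → ψ ∣ d
          ψ∣d (c′ , e) = c′ , trans (*-congˡ (sym cd≈ψ)) (trans (sym (*-assoc c′ c d)) (trans (*-congʳ e) (*-identityˡ d)))
          inverse : d ∣ 1# → ∃[ b ] ψ ∣ a * b - 1#
          inverse (e , ed≈1) = e * Γ.u , - (e * Γ.v) , trans
            (solve 6 (λ e u v a p o → (:- (e :* v)) :* p := (a :* (e :* u)) :- e :* (u :* a :+ v :* p)) e Γ.u Γ.v a ψ 1#)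
            (+-congˡ (-‿cong (trans (*-congˡ Γ.bézout) ed≈1)))

      ψ∤1 : ¬ ψ ∣ 1#
      ψ∤1 = nonunit (proj₂ (ψ-degree möbius))

      ψ-prime : ∀ {a b} → ψ ∣ a * b → ψ ∣ a ⊎ ψ ∣ b
      ψ-prime {a} {b} d = Sum.map₂ cancel (ψ-field a)
        where
        cancel : (∃[ c ] ψ ∣ a * c - 1#) → ψ ∣ b
        cancel (c , e) = ∣-respʳ (trans (solve 4 (λ a b c o → c :* (a :* b) :- b :* (a :* c :- o) := o :* b) a b c 1#) (*-identityˡ b))
          (∣-- (∣-*ˡ c d) (∣-*ˡ b e))

      ψ∤X-1 : k ≢ 1 → ¬ ψ ∣ X - 1#
      ψ∤X-1 k≢1 d = ψ∤1 (coprime-∣ (coprime-≈ʳ (+-congʳ (*-identityʳ X)) (Coprime-proper 1 (λ ()) (ℕ∣.1∣ k) (λ e → k≢1 (≡.sym e)))) (∣-*ʳ 1# d))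

      -- Landau's result at the exponent k - 1, which is prime to k. It makes complex conjugation
      -- well defined on ℚ[X]/ψ.
      ψ∣conjugate : ψ ∣ ψ *ᶜ
      ψ∣conjugate = landau-coprime ψ Θ ψΘ≈M k′ λ {d} (d∣k′ , d∣k) → ℕ∣.∣1⇒≡1 (ℕ∣.∣m+n∣m⇒∣n (≡.subst (d ∣ⁿ_) (ℕₚ.+-comm 1 k′) d∣k) d∣k′)

-- The cubic A, and descent for A(T) = ω

module Descent where
  open Rings
  open Domains
  open FieldPolynomials
  open Functionals
  open OpaquePolynomials
  open RationalPolynomials
  open LandauArgument
  open GroupRing
  open Möbius
  open Pairings
  open Cyclotomic
  open CyclotomicIrreducibility
  open import Algebra.Bundles using (CommutativeRing)
  import Algebra.Properties.Ring
  open import Data.Integer.Base as ℤ using (ℤ; +_)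
  open import Data.Nat.Base using (ℕ; zero; suc; _<_; _≤_; s≤s)
  import Data.Nat.Properties as ℕₚ
  open import Data.Product.Base using (_,_; _×_; ∃-syntax; proj₁; proj₂)
  open import Data.Rational.Base as ℚ using (ℚ; 0ℚ)
  import Data.Rational.Properties as ℚₚ
  import Data.Sum.Base as Sum
  open import Relation.Nullary using (¬_; Dec; yes; no; contradiction)
  open import Relation.Nullary.Decidable using (from-yes)
  open import Relation.Binary.PropositionalEquality as ≡ using (_≡_; _≢_)

  -- With 4c = -(t² + 7), the multipliers of the two 3-cycles of z² + c are A(t) and A(-t).
  module Cubic (R : Ring₀) where
    open CommutativeRing R
    open IntegerMultiples R

    A : Carrier → Carrier
    A t = ((t * t * t - t * t) + ι (+ 7) * t) + ι (+ 1)

    A-cong : ∀ {s t} → s ≈ t → A s ≈ A t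
    A-cong e = +-congʳ (+-cong (+-cong (*-cong (*-cong e e) e) (-‿cong (*-cong e e))) (*-congˡ e))

    -- The unit circle identity 16 = 27|y|² + 4|1 + A(T)|² + |c|² for A(T) of absolute value 1.
    y b c : Carrier → Carrier → Carrier
    y T S = T * ((T + S) - ι (+ 1))
    b T S = ι (+ 1) + A T
    c T S = T * ((ι (+ 13) - ι (+ 2) * (T * S)) + (T + S))

    y-cong : ∀ {T T′ S S′} → T ≈ T′ → S ≈ S′ → y T S ≈ y T′ S′
    y-cong e f = *-cong e (+-congʳ (+-cong e f))

    c-cong : ∀ {T T′ S S′} → T ≈ T′ → S ≈ S′ → c T S ≈ c T′ S′
    c-cong e f = *-cong e (+-cong (+-congˡ (-‿cong (*-congˡ (*-cong e f)))) (+-cong e f))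

    first-identity : ∀ T S → A T * A S ≈ ι (+ 1) →
      ι (+ 16) ≈ (ι (+ 27) * (y T S * y S T) + ι (+ 4) * (b T S * b S T)) + ι (+ 1) * (c T S * c S T)
    first-identity T S e = sym (trans
      (solve 2 (λ T S →
        let A = λ t → ((t :* t :* t :- t :* t) :+ con (+ 7) :* t) :+ con (+ 1)
            y = λ T S → T :* ((T :+ S) :- con (+ 1))
            b = λ T → con (+ 1) :+ A T
            c = λ T S → T :* ((con (+ 13) :- con (+ 2) :* (T :* S)) :+ (T :+ S)) in
        (con (+ 27) :* (y T S :* y S T) :+ con (+ 4) :* (b T :* b S)) :+ con (+ 1) :* (c T S :* c S T) :=
        con (+ 16) :+ con (+ 8) :* (A T :* A S :- con (+ 1))) T S)
      (trans (+-congˡ (trans (*-congˡ (trans (+-congʳ e) (-‿inverseʳ _))) (zeroʳ _))) (+-identityʳ _)))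

    A-at-zero : ∀ {T} → T ≈ 0# → A T ≈ ι (+ 1)
    A-at-zero {T} e = trans
      (solve 1 (λ T → ((T :* T :* T :- T :* T) :+ con (+ 7) :* T) :+ con (+ 1) := T :* (T :* T :- T :+ con (+ 7)) :+ con (+ 1)) T)
      (trans (+-congʳ (trans (*-congʳ e) (zeroˡ _))) (+-identityˡ _))

    -- The case T + T̄ = 1, where S = 1 - T is the conjugate of T, v = |T|² and A(T) = 1 + T u. As
    -- |A(T)|² - 1 = u (1 + v u), the unit circle leaves u = 0, which forces A(T) = 1, or 1 + v u =
    -- 0.
    module Symmetric (T : Carrier) where
      S = ι (+ 1) - T
      v = T * S
      u = ι (+ 7) - v

      A-T : A T ≈ ι (+ 1) + T * u
      A-T = solve 1 (λ T → ((T :* T :* T :- T :* T) :+ con (+ 7) :* T) :+ con (+ 1) :=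
        con (+ 1) :+ T :* (con (+ 7) :- T :* (con (+ 1) :- T))) T

      product : A T * A S - ι (+ 1) ≈ u * (ι (+ 1) + v * u)
      product = solve 1 (λ T →
        let A = λ t → ((t :* t :* t :- t :* t) :+ con (+ 7) :* t) :+ con (+ 1)
            S = con (+ 1) :- T ; v = T :* S ; u = con (+ 7) :- v in
        A T :* A S :- con (+ 1) := u :* (con (+ 1) :+ v :* u)) T

      A-T+A-S : (ι (+ 2) - A T) - A S ≈ - u
      A-T+A-S = solve 1 (λ T →
        let A = λ t → ((t :* t :* t :- t :* t) :+ con (+ 7) :* t) :+ con (+ 1)
            S = con (+ 1) :- T ; v = T :* S ; u = con (+ 7) :- v in
        (con (+ 2) :- A T) :- A S := :- u) T

      -- Since 2 - ω - ω′ = -u and v = 7 - u, the relation 1 + v u = 0 reads 1 = u² - 7u, and -u is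
      -- also (1 - ω)(1 - ω′). The summand with coefficient 0 brings it into the form that
      -- `size-combination` expects.
      second-identity : ∀ {ω ω′} → ω ≈ A T → ω′ ≈ A S → ι (+ 1) + v * u ≈ 0# →
        ι (+ 1) ≈ (ι (+ 1) * (((ι (+ 2) - ω) - ω′) * ((ι (+ 2) - ω′) - ω)) + ι (+ 7) * ((ι (+ 1) - ω) * (ι (+ 1) - ω′))) + ι (+ 0) * (ω * ω′)
      second-identity {ω} {ω′} e e′ p = trans (trans (sym (+-identityʳ _)) (trans (+-congˡ (sym (trans (*-congʳ p) (zeroˡ _)))) polynomial)) (sym substituted)
        where
        polynomial : ι (+ 1) + (ι (+ 1) + v * u) * (ι (+ 7) * u - ι (+ 1)) ≈
          (ι (+ 1) * (((ι (+ 2) - A T) - A S) * ((ι (+ 2) - A S) - A T)) + ι (+ 7) * ((ι (+ 1) - A T) * (ι (+ 1) - A S))) + ι (+ 0) * (A T * A S)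
        polynomial = solve 1 (λ T →
          let A = λ t → ((t :* t :* t :- t :* t) :+ con (+ 7) :* t) :+ con (+ 1)
              S = con (+ 1) :- T ; v = T :* S ; u = con (+ 7) :- v in
          con (+ 1) :+ (con (+ 1) :+ v :* u) :* (con (+ 7) :* u :- con (+ 1)) :=
          (con (+ 1) :* (((con (+ 2) :- A T) :- A S) :* ((con (+ 2) :- A S) :- A T)) :+ con (+ 7) :* ((con (+ 1) :- A T) :* (con (+ 1) :- A S))) :+ con (+ 0) :* (A T :* A S)) T
        substituted : (ι (+ 1) * (((ι (+ 2) - ω) - ω′) * ((ι (+ 2) - ω′) - ω)) + ι (+ 7) * ((ι (+ 1) - ω) * (ι (+ 1) - ω′))) + ι (+ 0) * (ω * ω′) ≈
          (ι (+ 1) * (((ι (+ 2) - A T) - A S) * ((ι (+ 2) - A S) - A T)) + ι (+ 7) * ((ι (+ 1) - A T) * (ι (+ 1) - A S))) + ι (+ 0) * (A T * A S)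
        substituted = +-cong (+-cong
          (*-congˡ (*-cong (+-cong (+-congˡ (-‿cong e)) (-‿cong e′)) (+-cong (+-congˡ (-‿cong e′)) (-‿cong e))))
          (*-congˡ (*-cong (+-congˡ (-‿cong e)) (+-congˡ (-‿cong e′)))))
          (*-congˡ (*-cong e e′))

    cubic-relation : ∀ T ω → A T ≈ ω → T * T * T ≈ (((T * T - ι (+ 7) * T) - ι (+ 1)) + ω)
    cubic-relation T ω e = trans
      (solve 1 (λ T → T :* T :* T := ((T :* T :- con (+ 7) :* T) :- con (+ 1)) :+ (((T :* T :* T :- T :* T) :+ con (+ 7) :* T) :+ con (+ 1))) T)
      (+-congˡ e)

  module CubicHom {R S : Ring₀} {φ} (φ-hom : IsHom R S φ) where
    private
      module R = CommutativeRing R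
      module S = CommutativeRing S
      module CR = Cubic R
      module CS = Cubic S
    open IsHom φ-hom
    open HomLemmas φ-hom

    A-hom : ∀ t → φ (CR.A t) S.≈ CS.A (φ t)
    A-hom t = S.trans (+-homo _ _) (S.+-cong (S.trans (+-homo _ _) (S.+-cong (S.trans (‿-homo _ _)
      (S.+-cong (S.trans (*-homo _ _) (S.*-congʳ (*-homo t t))) (S.-‿cong (*-homo t t))))
      (S.trans (*-homo _ _) (S.*-congʳ (ι-homo (+ 7)))))) (ι-homo (+ 1)))

    b-hom : ∀ T U → φ (CR.b T U) S.≈ CS.b (φ T) (φ U)
    b-hom T U = S.trans (+-homo _ _) (S.+-cong (ι-homo (+ 1)) (A-hom T))

    y-hom : ∀ T U → φ (CR.y T U) S.≈ CS.y (φ T) (φ U)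
    y-hom T U = S.trans (*-homo _ _) (S.*-congˡ (S.trans (‿-homo _ _) (S.+-cong (+-homo T U) (S.-‿cong (ι-homo (+ 1))))))

    c-hom : ∀ T U → φ (CR.c T U) S.≈ CS.c (φ T) (φ U)
    c-hom T U = S.trans (*-homo _ _) (S.*-congˡ (S.trans (+-homo _ _) (S.+-cong (S.trans (‿-homo _ _)
      (S.+-cong (ι-homo (+ 13)) (S.-‿cong (S.trans (*-homo _ _) (S.*-cong (ι-homo (+ 2)) (*-homo T U)))))) (+-homo T U))))

  nonNeg-* : ∀ {p q} → 0ℚ ℚ.≤ p → 0ℚ ℚ.≤ q → 0ℚ ℚ.≤ p ℚ.* q
  nonNeg-* {p} {q} 0≤p 0≤q = ℚₚ.nonNegative⁻¹ (p ℚ.* q) {{ℚₚ.nonNeg*nonNeg⇒nonNeg p {{ℚ.nonNegative 0≤p}} q {{ℚ.nonNegative 0≤q}}}}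

  nonNeg≢0⇒pos : ∀ {p} → 0ℚ ℚ.≤ p → p ≢ 0ℚ → 0ℚ ℚ.< p
  nonNeg≢0⇒pos 0≤p p≢0 = ℚₚ.≰⇒> λ p≤0 → p≢0 (ℚₚ.≤-antisym p≤0 0≤p)

  first-strict : ∀ {p q r s} {n a b c : ℚ} → p ℚ.< q → 0ℚ ℚ.≤ q → 0ℚ ℚ.≤ r → 0ℚ ℚ.≤ s → 0ℚ ℚ.< n → 0ℚ ℚ.≤ b → 0ℚ ℚ.≤ c →
    p ℚ.* n ≡ (q ℚ.* a ℚ.+ r ℚ.* b) ℚ.+ s ℚ.* c → a ℚ.< n
  first-strict {p} {q} {r} {s} {n} {a} {b} {c} p<q 0≤q 0≤r 0≤s 0<n 0≤b 0≤c e = ℚₚ.≰⇒> λ n≤a → ℚₚ.<-irrefl ≡.refl (begin-strict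
    p ℚ.* n                                       <⟨ ℚₚ.*-monoˡ-<-pos n {{ℚ.positive 0<n}} p<q ⟩
    q ℚ.* n                                       ≤⟨ ℚₚ.*-monoˡ-≤-nonNeg q {{ℚ.nonNegative 0≤q}} n≤a ⟩
    q ℚ.* a                                       ≡⟨ ≡.sym (≡.trans (ℚₚ.+-identityʳ _) (ℚₚ.+-identityʳ _)) ⟩
    q ℚ.* a ℚ.+ 0ℚ ℚ.+ 0ℚ                         ≤⟨ ℚₚ.+-mono-≤ (ℚₚ.+-monoʳ-≤ (q ℚ.* a) (nonNeg-* 0≤r 0≤b)) (nonNeg-* 0≤s 0≤c) ⟩
    q ℚ.* a ℚ.+ r ℚ.* b ℚ.+ s ℚ.* c               ≡⟨ ≡.sym e ⟩
    p ℚ.* n                                       ∎)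
    where open ℚₚ.≤-Reasoning

  -- Here both leading coefficients are p, and strictness has to come from the middle term, which is
  -- positive.
  second-strict : ∀ {p r s} {n a b c : ℚ} → 0ℚ ℚ.< p → 0ℚ ℚ.< r → 0ℚ ℚ.≤ s → 0ℚ ℚ.< b → 0ℚ ℚ.≤ c →
    p ℚ.* n ≡ (p ℚ.* a ℚ.+ r ℚ.* b) ℚ.+ s ℚ.* c → a ℚ.< n
  second-strict {p} {r} {s} {n} {a} {b} {c} 0<p 0<r 0≤s 0<b 0≤c e = ℚₚ.≰⇒> λ n≤a → ℚₚ.<-irrefl ≡.refl (begin-strict
    p ℚ.* n                                       ≤⟨ ℚₚ.*-monoˡ-≤-nonNeg p {{ℚₚ.pos⇒nonNeg p {{ℚ.positive 0<p}}}} n≤a ⟩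
    p ℚ.* a                                       ≡⟨ ≡.sym (≡.trans (ℚₚ.+-identityʳ _) (ℚₚ.+-identityʳ _)) ⟩
    p ℚ.* a ℚ.+ 0ℚ ℚ.+ 0ℚ                         <⟨ ℚₚ.+-mono-<-≤ (ℚₚ.+-monoʳ-< (p ℚ.* a) (ℚₚ.positive⁻¹ (r ℚ.* b) {{ℚₚ.pos*pos⇒pos r {{ℚ.positive 0<r}} b {{ℚ.positive 0<b}}}})) (nonNeg-* 0≤s 0≤c) ⟩
    p ℚ.* a ℚ.+ r ℚ.* b ℚ.+ s ℚ.* c               ≡⟨ ≡.sym e ⟩
    p ℚ.* n                                       ∎)
    where open ℚₚ.≤-Reasoning

  module _ where
    open ℚX hiding (M; residue; _*ᶜ; residue-∣; residue-below; norm-squares; degree-M)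
    open Products ℚ[X] using (∏)

    module NoRoot (k′ : ℕ) (ψ : Carrier) (möbius : CyclotomicProduct.Cyclotomic k′ ψ) where
      open CyclotomicProduct k′ ψ using (ψ-degree; ψ∣M)
      open CyclotomicField k′ ψ möbius
      open Norm k′
      private k = suc k′

      Q : Ring₀
      Q = quotient ψ

      module Q = CommutativeRing Q
      module ιQ = IntegerMultiples Q

      ι-Q : ∀ i → ι i Q.≈ ιQ.ι i
      ι-Q = HomLemmas.ι-homo (quotient-hom ψ)

      ≈Q : ∀ {a b} → a ≈ b → a Q.≈ b
      ≈Q = ≈⇒quotient ψ

      conj : IsHom ℚ[X] ℚ[X] _*ᶜ
      conj = subst-hom (X ^ k′)

      conj-Q : IsHom Q Q _*ᶜ
      conj-Q = record
        { cong = λ {a} {b} d → ∣-respʳ (IsHom.‿-homo conj a b) (∣-trans ψ∣conjugate (HomDivisibility.∣-hom conj d))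
        ; +-homo = λ a b → ≈Q (IsHom.+-homo conj a b) ; *-homo = λ a b → ≈Q (IsHom.*-homo conj a b)
        ; -‿homo = λ a → ≈Q (IsHom.-‿homo conj a) ; 0-homo = ≈Q (IsHom.0-homo conj) ; 1-homo = ≈Q (IsHom.1-homo conj) }

      X*ᶜ : X *ᶜ ≈ X ^ k′
      X*ᶜ = subst-X (X ^ k′)

      ωω* : X * X *ᶜ Q.≈ 1#
      ωω* = ∣-respʳ (+-congʳ (*-congˡ (sym X*ᶜ))) (ψ∣M möbius)

      X** : X *ᶜ *ᶜ Q.≈ X
      X** = Q.trans (Q.sym (Q.trans (Q.*-congʳ {X *ᶜ *ᶜ} ωω*) (Q.*-identityˡ (X *ᶜ *ᶜ))))
        (Q.trans (Q.*-assoc X (X *ᶜ) (X *ᶜ *ᶜ)) (Q.trans (Q.*-congˡ {X} conj-ωω*) (Q.*-identityʳ X)))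
        where
        conj-ωω* : X *ᶜ * X *ᶜ *ᶜ Q.≈ 1#
        conj-ωω* = Q.trans (Q.sym (IsHom.*-homo conj-Q X (X *ᶜ))) (Q.trans (IsHom.cong conj-Q ωω*) (IsHom.1-homo conj-Q))

      conj-conj : ∀ a → a *ᶜ *ᶜ Q.≈ a
      conj-conj a = Q.trans (≈Q (subst-subst (X ^ k′) (X ^ k′) a))
        (Q.trans (subst-congruent ψ (subst (X ^ k′) (X ^ k′)) X a (Q.trans (≈Q (subst-cong (X ^ k′) (sym X*ᶜ))) X**)) (≈Q (subst-identity a)))

      ∣Θ : ∀ {a} c → ψ ∣ a → M ∣ a * (Θ * c)
      ∣Θ {a} c (q , e) = q * c , trans (*-congˡ (sym ψΘ≈M)) (trans (solve 4 (λ q c p t → (q :* c) :* (p :* t) := (q :* p) :* (t :* c)) q c ψ Θ) (*-congʳ e))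

      -- Multiplication by Θ embeds ℚ[X]/ψ into ℚ[X]/(X^k - 1), so this depends on a only modulo ψ,
      -- and z ↦ trace (z z*) inherits positive definiteness.
      trace : Carrier → ℚ
      trace a = residue 0 (a * (Θ * Θ *ᶜ))

      trace-cong : ∀ {a b} → a Q.≈ b → trace a ≡ trace b
      trace-cong {a} {b} d = residue-cong-M 0 (∣-respʳ (solve 3 (λ a b t → (a :- b) :* t := a :* t :- b :* t) a b (Θ * Θ *ᶜ)) (∣Θ (Θ *ᶜ) d))

      trace-+ : ∀ a b → trace (a + b) ≡ trace a ℚ.+ trace b
      trace-+ a b = ≡.trans (functional-cong _ (distribʳ _ a b)) (functional-+ _ _ _)

      trace-ι* : ∀ i a → trace (ι i * a) ≡ IntegerMultiples.ι ℚ-ring i ℚ.* trace a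
      trace-ι* i a = ≡.trans (functional-cong _ (*-assoc (ι i) a _)) (functional-ι* _ i _)

      size : Carrier → ℚ
      size z = norm (z * Θ)

      size-trace : ∀ z → size z ≡ trace (z * z *ᶜ)
      size-trace z = functional-cong _ (trans (*-congˡ (IsHom.*-homo conj z Θ))
        (solve 4 (λ z z′ t t′ → (z :* t) :* (z′ :* t′) := (z :* z′) :* (t :* t′)) z (z *ᶜ) Θ (Θ *ᶜ)))

      size-nonNeg : ∀ z → 0ℚ ℚ.≤ size z
      size-nonNeg z = norm-nonNeg (z * Θ)

      size-pos : ∀ {z} → ¬ ψ ∣ z → 0ℚ ℚ.< size z
      size-pos {z} h = nonNeg≢0⇒pos (size-nonNeg z) λ e → h (cancel (norm-zero e))
        where
        Θ≉0 : ¬ Θ ≈ 0#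
        Θ≉0 e = ≉0-degree (ℚX.degree-M k′) (trans (sym ψΘ≈M) (trans (*-congˡ e) (zeroʳ ψ)))
        cancel : M ∣ z * Θ → ψ ∣ z
        cancel (q , e) = q , domain-cancelʳ ℚ[X] (λ {a} {b} → domain {a} {b}) Θ≉0 (trans (*-assoc q ψ Θ) (trans (*-congˡ ψΘ≈M) e))

      -- The identity is multiplied by z z* and the trace is applied; each product a a* z z* becomes
      -- the size of a z.
      size-combination : ∀ p q r s {y y′ b b′ c c′} → y *ᶜ Q.≈ y′ → b *ᶜ Q.≈ b′ → c *ᶜ Q.≈ c′ →
        ιQ.ι p Q.≈ (ιQ.ι q * (y * y′) + ιQ.ι r * (b * b′)) + ιQ.ι s * (c * c′) → ∀ z →
        let ι′ = IntegerMultiples.ι ℚ-ring in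
        ι′ p ℚ.* size z ≡ (ι′ q ℚ.* size (y * z) ℚ.+ ι′ r ℚ.* size (b * z)) ℚ.+ ι′ s ℚ.* size (c * z)
      size-combination p q r s {y} {y′} {b} {b′} {c} {c′} ey eb ec e z = begin
        ι′ p ℚ.* size z                     ≡⟨ ≡.cong (ι′ p ℚ.*_) (size-trace z) ⟩
        ι′ p ℚ.* trace (z * z *ᶜ)           ≡⟨ trace-ι* p _ ⟨
        trace (ι p * (z * z *ᶜ))            ≡⟨ trace-cong combination ⟩
        trace ((ι q * ((y * z) * (y * z) *ᶜ) + ι r * ((b * z) * (b * z) *ᶜ)) + ι s * ((c * z) * (c * z) *ᶜ)) ≡⟨ trace-+ _ _ ⟩
        trace (ι q * ((y * z) * (y * z) *ᶜ) + ι r * ((b * z) * (b * z) *ᶜ)) ℚ.+ trace (ι s * ((c * z) * (c * z) *ᶜ)) ≡⟨ ≡.cong₂ ℚ._+_ (trace-+ _ _) (term s c) ⟩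
        (trace (ι q * ((y * z) * (y * z) *ᶜ)) ℚ.+ trace (ι r * ((b * z) * (b * z) *ᶜ))) ℚ.+ ι′ s ℚ.* size (c * z) ≡⟨ ≡.cong (ℚ._+ ι′ s ℚ.* size (c * z)) (≡.cong₂ ℚ._+_ (term q y) (term r b)) ⟩
        (ι′ q ℚ.* size (y * z) ℚ.+ ι′ r ℚ.* size (b * z)) ℚ.+ ι′ s ℚ.* size (c * z) ∎
        where
        open ≡.≡-Reasoning
        ι′ = IntegerMultiples.ι ℚ-ring
        term : ∀ i a → trace (ι i * ((a * z) * (a * z) *ᶜ)) ≡ ι′ i ℚ.* size (a * z)
        term i a = ≡.trans (trace-ι* i _) (≡.cong (ι′ i ℚ.*_) (≡.sym (size-trace (a * z))))
        square : ∀ i a {a′} → a *ᶜ Q.≈ a′ → ιQ.ι i * (a * a′) * (z * z *ᶜ) Q.≈ ι i * ((a * z) * (a * z) *ᶜ)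
        square i a {a′} f = Q.trans (Q.*-congʳ {z * z *ᶜ} (Q.*-cong (Q.sym (ι-Q i)) (Q.*-congˡ {a} (Q.sym f))))
          (≈Q (trans (solve 5 (λ i a a′ z z′ → i :* (a :* a′) :* (z :* z′) := i :* ((a :* z) :* (a′ :* z′))) (ι i) a (a *ᶜ) z (z *ᶜ))
            (*-congˡ (*-congˡ (sym (IsHom.*-homo conj a z))))))
        combination : ι p * (z * z *ᶜ) Q.≈ (ι q * ((y * z) * (y * z) *ᶜ) + ι r * ((b * z) * (b * z) *ᶜ)) + ι s * ((c * z) * (c * z) *ᶜ)
        combination = Q.trans (Q.*-congʳ {z * z *ᶜ} (Q.trans (ι-Q p) e))
          (Q.trans (≈Q (trans (distribʳ _ _ _) (+-congʳ (distribʳ _ _ _))))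
            (Q.+-cong (Q.+-cong (square q y ey) (square r b eb)) (square s c ec)))

      -- The class lies in ℤ[ω]. For T and its conjugate only a denominator is controlled, whence
      -- the factors D, e and δ below.
      Integral : Carrier → Set
      Integral z = ∃[ n ] z Q.≈ cast n

      integral-cong : ∀ {a b} → a Q.≈ b → Integral a → Integral b
      integral-cong e (n , f) = n , Q.trans (Q.sym e) f

      integral-+ : ∀ {a b} → Integral a → Integral b → Integral (a + b)
      integral-+ (m , e) (n , f) = m ℤX.+ n , Q.trans (Q.+-cong e f) (≈Q (sym (Cast.+-homo m n)))

      integral-neg : ∀ {a} → Integral a → Integral (- a)
      integral-neg (m , e) = ℤX.- m , Q.trans (Q.-‿cong e) (≈Q (sym (Cast.-‿homo m)))

      integral-* : ∀ {a b} → Integral a → Integral b → Integral (a * b)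
      integral-* (m , e) (n , f) = m ℤX.* n , Q.trans (Q.*-cong e f) (≈Q (sym (Cast.*-homo m n)))

      integral-ι : ∀ i → Integral (ι i)
      integral-ι i = ℤX.ι i , ≈Q (sym (HomLemmas.ι-homo cast-hom i))

      integral-1 : Integral 1#
      integral-1 = ℤX.1# , ≈Q (sym Cast.1-homo)

      integral-X^ : ∀ n → Integral (X ^ n)
      integral-X^ n = ℤX.X ℤX.^ n , ≈Q (sym (cast-X^ n))

      integral-X : Integral X
      integral-X = ℤX.X , ≈Q (sym cast-X)

      -- Powers of y have a common denominator, so their sizes lie in a lattice and cannot decrease forever.
      descent : ∀ y D → D ≢ + 0 → (∀ m → Integral (const (κ D) * y ^ m)) →
        (∀ z → ¬ ψ ∣ z → size (y * z) ℚ.< size z) → ψ ∣ y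
      descent y D D≢0 integral strict = finish (clear-denominators Θ)
        where
        root : ∀ m → ψ ∣ y ^ m → ψ ∣ y
        root zero d = contradiction d ψ∤1
        root (suc m) d = Sum.[ (λ d → d) , root m ]′ (ψ-prime d)

        finish : ∃[ B ] ∃[ θ ] B ≢ + 0 × const (κ B) * Θ ≈ cast θ → ψ ∣ y
        finish (B , θ , B≢0 , e) = root (proj₁ found) (proj₂ found)
          where
          scale : ℚ
          scale = κ (D ℤ.* B)

          scale≢0 : scale ≢ 0ℚ
          scale≢0 z = i*j≢0 D≢0 B≢0 (κ-injective z)

          scale²>0 : 0ℚ ℚ.< scale ℚ.* scale
          scale²>0 = nonNeg≢0⇒pos (square-nonNeg scale) λ z →
            scale≢0 (Sum.reduce (FieldPoly.field-domain ℚC ℚ-inverse (λ ()) {scale} z))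

          -- `scale` absorbs the denominators of y^m and of Θ, so this is the value of the form at
          -- an integral polynomial, hence a natural number.
          height : ∀ m → ∃[ n ] (scale ℚ.* scale) ℚ.* size (y ^ m) ≡ κ (+ n)
          height m = convert (integral m)
            where
            convert : Integral (const (κ D) * y ^ m) → ∃[ n ] (scale ℚ.* scale) ℚ.* size (y ^ m) ≡ κ (+ n)
            convert (p , d) = proj₁ (norm-integral (p ℤX.* θ)) , ≡.trans (≡.sym (norm-scale scale (y ^ m * Θ)))
              (≡.trans (norm-cong-M (∣-respʳ same (∣Θ (const (κ B)) d))) (proj₂ (norm-integral (p ℤX.* θ))))
              where
              same : (const (κ D) * y ^ m - cast p) * (Θ * const (κ B)) ≈ const scale * (y ^ m * Θ) - cast (p ℤX.* θ)
              same = trans (solve 5 (λ D y p t B → (D :* y :- p) :* (t :* B) := (D :* B) :* (y :* t) :- p :* (B :* t)) (const (κ D)) (y ^ m) (cast p) Θ (const (κ B)))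
                (+-cong (*-congʳ (trans (sym (IsHom.*-homo const-hom (κ D) (κ B))) (IsHom.cong const-hom (κ-κ D B))))
                  (-‿cong (trans (*-congˡ e) (sym (Cast.*-homo p θ)))))

          decreasing : ∀ m → ¬ ψ ∣ y ^ m → proj₁ (height (suc m)) < proj₁ (height m)
          decreasing m h = κ-cancel-< (≡.subst₂ ℚ._<_ (proj₂ (height (suc m))) (proj₂ (height m))
            (ℚₚ.*-monoʳ-<-pos (scale ℚ.* scale) {{ℚ.positive scale²>0}} (strict (y ^ m) h)))

          search : ∀ fuel m → proj₁ (height m) < fuel → ∃[ m ] ψ ∣ y ^ m
          search (suc fuel) m (s≤s lt) = decide (proj₂ (ψ-degree möbius) ℚX.∣? (y ^ m))
            where
            decide : Dec (ψ ∣ y ^ m) → ∃[ m ] ψ ∣ y ^ m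
            decide (yes d) = m , d
            decide (no ∤) = search fuel (suc m) (ℕₚ.<-≤-trans (decreasing m ∤) lt)

          found : ∃[ m ] ψ ∣ y ^ m
          found = search (suc (proj₁ (height 0))) 0 ℕₚ.≤-refl

      module Root (k≢1 : k ≢ 1) (T : Carrier) (A-T : Cubic.A Q T Q.≈ X) where
        private
          module CQ = Cubic Q
          module conjᶜ = CubicHom conj-Q

        T* : Carrier
        T* = T *ᶜ

        A-T* : CQ.A T* Q.≈ X *ᶜ
        A-T* = Q.trans (Q.sym (conjᶜ.A-hom T)) (IsHom.cong conj-Q A-T)

        ι1≈1 : ιQ.ι (+ 1) Q.≈ 1#
        ι1≈1 = Q.+-identityʳ 1#

        unimodular : CQ.A T * CQ.A T* Q.≈ ιQ.ι (+ 1)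
        unimodular = Q.trans (Q.*-cong A-T A-T*) (Q.trans ωω* (Q.sym ι1≈1))

        X≉1 : ¬ X Q.≈ ιQ.ι (+ 1)
        X≉1 e = ψ∤X-1 k≢1 (Q.trans e ι1≈1)

        y : Carrier
        y = CQ.y T T*

        -- The unit circle identity read in sizes: 16 size z is 27 size (y z) plus nonnegative
        -- terms.
        y-strict : ∀ z → ¬ ψ ∣ z → size (y * z) ℚ.< size z
        y-strict z h = first-strict
          (from-yes (IntegerMultiples.ι ℚ-ring (+ 16) ℚₚ.<? IntegerMultiples.ι ℚ-ring (+ 27))) (from-yes (0ℚ ℚₚ.≤? IntegerMultiples.ι ℚ-ring (+ 27)))
          (from-yes (0ℚ ℚₚ.≤? IntegerMultiples.ι ℚ-ring (+ 4))) (from-yes (0ℚ ℚₚ.≤? IntegerMultiples.ι ℚ-ring (+ 1)))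
          (size-pos h) (size-nonNeg (CQ.b T T* * z)) (size-nonNeg (CQ.c T T* * z))
          (size-combination (+ 16) (+ 27) (+ 4) (+ 1) {y} {CQ.y T* T} {CQ.b T T*} {CQ.b T* T} {CQ.c T T*} {CQ.c T* T}
            (Q.trans (conjᶜ.y-hom T T*) (CQ.y-cong (Q.refl {T*}) (conj-conj T)))
            (conjᶜ.b-hom T T*)
            (Q.trans (conjᶜ.c-hom T T*) (CQ.c-cong (Q.refl {T*}) (conj-conj T)))
            (CQ.first-identity T T* unimodular) z)

        cube : ∀ t w → CQ.A t Q.≈ w → t * t * t Q.≈ (((t * t - ι (+ 7) * t) - ι (+ 1)) + w)
        cube t w e = Q.trans (CQ.cubic-relation t w e)
          (Q.+-congʳ {w} (Q.+-cong (Q.+-congˡ {t * t} (Q.-‿cong (Q.*-congʳ {t} (Q.sym (ι-Q (+ 7)))))) (Q.-‿cong (Q.sym (ι-Q (+ 1))))))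

        -- The cubic relation expresses t^(n+3) through lower powers with coefficients in ℤ[ω], so a
        -- denominator common to 1, t and t² serves all powers.
        powers-integral : ∀ t w e → CQ.A t Q.≈ w → Integral w → Integral e → Integral (e * t) → Integral (e * (t * t)) → ∀ i → Integral (e * t ^ i)
        powers-integral t w e A-t w-int i₀ i₁ i₂ i = proj₁ (go i)
          where
          relation : ∀ n → ((e * t ^ suc (suc n) - ι (+ 7) * (e * t ^ suc n)) - ι (+ 1) * (e * t ^ n)) + w * (e * t ^ n) Q.≈ e * t ^ suc (suc (suc n))
          relation n = Q.trans (≈Q (solve 6 (λ e p t w c₇ c₁ → ((e :* (t :* (t :* p)) :- c₇ :* (e :* (t :* p))) :- c₁ :* (e :* p)) :+ w :* (e :* p)
                := (((t :* t :- c₇ :* t) :- c₁) :+ w) :* (e :* p)) e (t ^ n) t w (ι (+ 7)) (ι (+ 1))))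
            (Q.trans (Q.*-congʳ {e * t ^ n} (Q.sym (cube t w A-t)))
              (≈Q (solve 3 (λ e p t → t :* t :* t :* (e :* p) := e :* (t :* (t :* (t :* p)))) e (t ^ n) t)))
          go : ∀ n → Integral (e * t ^ n) × Integral (e * t ^ suc n) × Integral (e * t ^ suc (suc n))
          go zero = integral-cong (≈Q (sym (*-identityʳ e))) i₀ , integral-cong (≈Q (*-congˡ (sym (*-identityʳ t)))) i₁ ,
            integral-cong (≈Q (*-congˡ (*-congˡ (sym (*-identityʳ t))))) i₂
          go (suc n) = step (go n)
            where
            step : _ → _
            step (a , b , c) = b , c , integral-cong (relation n)
              (integral-+ (integral-+ (integral-+ c (integral-neg (integral-* (integral-ι (+ 7)) b))) (integral-neg (integral-* (integral-ι (+ 1)) a))) (integral-* w-int a))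

        common-denominator : ∃[ d ] ∃[ t ] d ≢ + 0 × const (κ d) * T ≈ cast t →
          ∃[ D ] D ≢ + 0 × (∀ m → Integral (const (κ D) * y ^ m))
        common-denominator (d , t , d≢0 , dT) = D , i*j≢0 (i*j≢0 d≢0 d≢0) (i*j≢0 d≢0 d≢0) ,
            λ m → integral-cong (≈Q (*-congʳ (trans (*-cong (*-identityʳ e) (*-identityʳ e)) (sym const-D)))) (closed-power m 0 0)
          where
          -- d clears T and T*, e = d² clears all powers of either, and D = e² clears their products
          -- T^i T*^j.
          D = (d ℤ.* d) ℤ.* (d ℤ.* d)
          δ = const (κ d)
          e = δ * δ

          const-D : const (κ D) ≈ e * e
          const-D = trans (IsHom.*-homo (const-hom ∘ʰ κ-hom) (d ℤ.* d) (d ℤ.* d)) (*-cong dd dd)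
            where
            dd : const (κ (d ℤ.* d)) ≈ e
            dd = IsHom.*-homo (const-hom ∘ʰ κ-hom) d d

          δ-int : Integral δ
          δ-int = ℤX.const d , ≈Q (sym (cast-const d))

          small : ∀ s w → CQ.A s Q.≈ w → Integral w → Integral (δ * s) → ∀ i → Integral (e * s ^ i)
          small s w A-s w-int δs = powers-integral s w e A-s w-int (integral-* δ-int δ-int)
            (integral-cong (≈Q (sym (*-assoc δ δ s))) (integral-* δ-int δs))
            (integral-cong (≈Q (solve 2 (λ d s → (d :* s) :* (d :* s) := d :* d :* (s :* s)) δ s)) (integral-* δs δs))

          δT : Integral (δ * T)
          δT = t , ≈Q dT

          δT* : Integral (δ * T*)
          δT* = ℤX.subst (ℤX.X ℤX.^ k′) t , ≈Q (trans (*-congʳ (sym (subst-const (X ^ k′) (κ d))))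
            (trans (sym (IsHom.*-homo conj δ T)) (trans (subst-cong (X ^ k′) dT) (sym (cast-subst k′ t)))))

          X*-int : Integral (X *ᶜ)
          X*-int = integral-cong (≈Q (sym X*ᶜ)) (integral-X^ k′)

          -- Quantifying over all i and j makes the condition stable under multiplication by T and
          -- T*, hence by y, so that it reaches all powers of y by induction.
          Closed : Carrier → Set
          Closed z = ∀ i j → Integral ((e * T ^ i) * (e * T* ^ j) * z)

          closed-1 : Closed 1#
          closed-1 i j = integral-cong (≈Q (sym (*-identityʳ _)))
            (integral-* (small T X A-T integral-X δT i) (small T* (X *ᶜ) A-T* X*-int δT* j))

          closed-T : ∀ {z} → Closed z → Closed (T * z)
          closed-T {z} h i j = integral-cong (≈Q (solve 5 (λ e p q t z → (e :* (t :* p)) :* (e :* q) :* z := (e :* p) :* (e :* q) :* (t :* z)) e (T ^ i) (T* ^ j) T z)) (h (suc i) j)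

          closed-T* : ∀ {z} → Closed z → Closed (T* * z)
          closed-T* {z} h i j = integral-cong (≈Q (solve 5 (λ e p q t z → (e :* p) :* (e :* (t :* q)) :* z := (e :* p) :* (e :* q) :* (t :* z)) e (T ^ i) (T* ^ j) T* z)) (h i (suc j))

          closed-y : ∀ {z} → Closed z → Closed (y * z)
          closed-y {z} h i j = integral-cong (Q.trans (≈Q (factor-out ((e * T ^ i) * (e * T* ^ j)) (T * (T * z)) (T * (T* * z)) (T * z)))
              (Q.*-congˡ {(e * T ^ i) * (e * T* ^ j)} expand))
            (integral-+ (integral-+ (closed-T (closed-T h) i j) (closed-T (closed-T* h) i j)) (integral-neg (closed-T h i j)))
            where
            factor-out : ∀ w p q r → (w * p + w * q) + - (w * r) ≈ w * ((p + q) + - r)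
            factor-out = solve 4 λ w p q r → (w :* p :+ w :* q) :+ (:- (w :* r)) := w :* ((p :+ q) :+ (:- r))
            expand : (T * (T * z) + T * (T* * z)) + - (T * z) Q.≈ y * z
            expand = Q.trans (≈Q (solve 3 (λ t s z → (t :* (t :* z) :+ t :* (s :* z)) :+ (:- (t :* z)) := t :* ((t :+ s) :- con (+ 1)) :* z) T T* z))
              (Q.*-congʳ {z} (Q.*-congˡ {T} (Q.+-congˡ {T + T*} (Q.-‿cong (ι-Q (+ 1))))))

          closed-power : ∀ m → ∀ i j → Integral ((e * T ^ i) * (e * T* ^ j) * y ^ m)
          closed-power zero = closed-1
          closed-power (suc m) = closed-y (closed-power m)

        ψ∣y : ψ ∣ y
        ψ∣y = apply (common-denominator (clear-denominators T))
          where
          apply : ∃[ D ] D ≢ + 0 × (∀ m → Integral (const (κ D) * y ^ m)) → ψ ∣ y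
          apply (D , D≢0 , int) = descent y D D≢0 int y-strict

        module Sym = CQ.Symmetric T

        -- In complex terms |1 - ω|², since ω has absolute value 1. In the case T + T̄ = 1 it equals
        -- -u.
        y₂ : Carrier
        y₂ = (ιQ.ι (+ 2) - X) - X *ᶜ

        y₂-integral : ∀ m → Integral (const (κ (+ 1)) * y₂ ^ m)
        y₂-integral m = integral-cong (≈Q (sym (trans (*-congʳ (IsHom.1-homo (const-hom ∘ʰ κ-hom))) (*-identityˡ _)))) (go m)
          where
          y₂-int : Integral y₂
          y₂-int = integral-+ (integral-+ (integral-cong (ι-Q (+ 2)) (integral-ι (+ 2))) (integral-neg integral-X))
            (integral-neg (integral-cong (≈Q (sym X*ᶜ)) (integral-X^ k′)))
          go : ∀ m → Integral (y₂ ^ m)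
          go zero = integral-1
          go (suc m) = integral-* y₂-int (go m)

        conj-ι-minus : ∀ i a → (ιQ.ι i - a) *ᶜ Q.≈ ιQ.ι i - a *ᶜ
        conj-ι-minus i a = Q.trans (IsHom.‿-homo conj-Q (ιQ.ι i) a) (Q.+-congʳ { - a *ᶜ} (HomLemmas.ι-homo conj-Q i))

        -- The second identity read in sizes: size z is size (y₂ z) plus 7 size ((1 - ω) z), and the
        -- latter is positive for nonzero z because ω is not 1.
        ψ∣y₂ : T* Q.≈ Sym.S → ιQ.ι (+ 1) + Sym.v * Sym.u Q.≈ 0# → ψ ∣ y₂
        ψ∣y₂ T*≈ p = descent y₂ (+ 1) (λ ()) y₂-integral λ z h → second-strict
          (from-yes (0ℚ ℚₚ.<? IntegerMultiples.ι ℚ-ring (+ 1))) (from-yes (0ℚ ℚₚ.<? IntegerMultiples.ι ℚ-ring (+ 7))) (from-yes (0ℚ ℚₚ.≤? IntegerMultiples.ι ℚ-ring (+ 0)))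
          (size-pos λ d → Sum.[ (λ d → X≉1 (Q.sym d)) , h ]′ (ψ-prime d)) (size-nonNeg (X * z))
          (size-combination (+ 1) (+ 1) (+ 7) (+ 0) {y₂} {(ιQ.ι (+ 2) - X *ᶜ) - X} {ιQ.ι (+ 1) - X} {ιQ.ι (+ 1) - X *ᶜ} {X} {X *ᶜ}
            (Q.trans (IsHom.‿-homo conj-Q (ιQ.ι (+ 2) - X) (X *ᶜ)) (Q.+-cong (conj-ι-minus (+ 2) X) (Q.-‿cong X**)))
            (conj-ι-minus (+ 1) X) (Q.refl {X *ᶜ})
            (Sym.second-identity (Q.sym A-T) (Q.trans (Q.sym A-T*) (CQ.A-cong T*≈)) p) z)

        impossible : ∀ {P : Set} → P
        impossible = Sum.[ T-zero , T-symmetric ]′ (ψ-prime ψ∣y)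
          where
          T-zero : ∀ {P : Set} → ψ ∣ T → P
          T-zero d = contradiction (Q.trans (Q.sym A-T) (CQ.A-at-zero (zero-quotient d))) X≉1
          u-zero : ∀ {P : Set} → Sym.u Q.≈ 0# → P
          u-zero e = contradiction (Q.trans (Q.sym A-T) (Q.trans Sym.A-T
            (Q.trans (Q.+-congˡ {ιQ.ι (+ 1)} (Q.trans (Q.*-congˡ {T} e) (Q.zeroʳ T))) (Q.+-identityʳ (ιQ.ι (+ 1)))))) X≉1
          T-symmetric : ∀ {P : Set} → ψ ∣ (T + T*) - ιQ.ι (+ 1) → P
          T-symmetric {P} d = Sum.[ (λ e → u-zero (zero-quotient e)) , (λ p → second (ψ∣y₂ T*≈ (zero-quotient p))) ]′ (ψ-prime product-zero)
            where
            T*≈ : T* Q.≈ Sym.S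
            T*≈ = ∣-respʳ (solve 3 (λ t s i → (t :+ s) :- i := s :- (i :- t)) T T* (ιQ.ι (+ 1))) d
            product-zero : ψ ∣ Sym.u * (ιQ.ι (+ 1) + Sym.v * Sym.u)
            product-zero = quotient-zero (Q.trans (Q.sym Sym.product)
              (Q.trans (Q.+-congʳ { - ιQ.ι (+ 1)} (Q.trans (Q.*-congˡ {CQ.A T} (Q.sym (CQ.A-cong T*≈))) unimodular)) (Q.-‿inverseʳ (ιQ.ι (+ 1)))))
            second : ψ ∣ y₂ → P
            second d = u-zero (Q.trans (Q.sym (Algebra.Properties.Ring.-‿involutive Q.ring Sym.u))
              (Q.trans (Q.-‿cong (Q.trans (Q.sym Sym.A-T+A-S) (Q.trans
                (Q.+-cong (Q.+-congˡ {ιQ.ι (+ 2)} (Q.-‿cong A-T)) (Q.-‿cong (Q.trans (Q.sym (CQ.A-cong T*≈)) A-T*))) (zero-quotient d))))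
                (Algebra.Properties.Ring.-0#≈0# Q.ring)))

      no-root : k ≢ 1 → ∀ T → ¬ ψ ∣ Cubic.A ℚ[X] T - X
      no-root k≢1 T d = Root.impossible k≢1 T (Q.trans (Q.sym (CubicHom.A-hom (quotient-hom ψ) T)) d)

-- Cubic extensions of ℚ(ω) and the composition Ψ_k(A(t))

module CubicExtensions where
  open Rings
  open Domains
  open FieldPolynomials
  open Functionals
  open OpaquePolynomials
  open RationalPolynomials
  open LandauArgument
  open GroupRing
  open Möbius
  open Pairings
  open Cyclotomic
  open CyclotomicIrreducibility
  open Descent
  open import Defs using (module Polynomial)
  open import Algebra.Bundles using (CommutativeRing)
  import Algebra.Properties.Ring
  open import Data.Integer.Base as ℤ using (ℤ; +_; -[1+_])
  open import Data.List.Base using ([]; _∷_)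
  open import Data.Nat.Base as ℕ using (ℕ; zero; suc; s≤s; z≤n)
  import Data.Nat.Properties as ℕₚ
  open import Data.Product.Base using (_,_; _×_; ∃-syntax; proj₁; proj₂)
  open import Data.Rational.Base as ℚ using (ℚ; 0ℚ; 1ℚ)
  import Data.Rational.Properties as ℚₚ
  open import Data.Sum.Base as Sum using (_⊎_; inj₁; inj₂)
  open import Relation.Nullary using (¬_; contradiction)
  open import Relation.Binary.PropositionalEquality as ≡ using (_≡_; _≢_)

  module Units (R : Ring₀) where
    open CommutativeRing R
    open IntegerMultiples R

    Unit : Carrier → Set
    Unit a = ∃[ b ] a * b ≈ 1#

    unit-≈ : ∀ {a b} → a ≈ b → Unit a → Unit b
    unit-≈ e (c , f) = c , trans (*-congʳ (sym e)) f

    unit-* : ∀ {a b} → Unit a → Unit b → Unit (a * b)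
    unit-* {a} {b} (c , e) (d , f) = c * d ,
      trans (solve 4 (λ a b c d → (a :* b) :* (c :* d) := (a :* c) :* (b :* d)) a b c d) (trans (*-cong e f) (*-identityˡ 1#))

    unit-neg : ∀ {a} → Unit a → Unit (- a)
    unit-neg {a} (b , e) = - b , trans (solve 2 (λ a b → (:- a) :* (:- b) := a :* b) a b) e

    unit-factor : ∀ {a b} → Unit (a * b) → Unit a
    unit-factor {a} {b} (c , e) = b * c , trans (sym (*-assoc a b c)) e

  -- Division of A - x by t² + pt + q has the quotient t - s with s = p + 1; evaluated at t = s,
  -- only the linear remainder is left.
  evaluate-remainder : (R : Ring₀) →
    let open CommutativeRing R
        open IntegerMultiples R
    in ∀ p q x → let s = p + ι (+ 1) in
    Cubic.A R s ≈ x + ((ι (+ 7) - (q - s * p)) * s + ((ι (+ 1) - x) + s * q))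
  evaluate-remainder R = solve 3 λ p q x →
    let A = λ t → ((t :* t :* t :- t :* t) :+ con (+ 7) :* t) :+ con (+ 1) ; s = p :+ con (+ 1) in
    A s := x :+ ((con (+ 7) :- (q :- s :* p)) :* s :+ ((con (+ 1) :- x) :+ s :* q))
    where open IntegerMultiples R

  -- If the cubic A - x has no root in the field B, then adjoining a root t yields a field: an element
  -- of degree 1 or 2 in t divides a nonzero element of smaller degree.
  module CubicExtension (B : Ring₀) (decide : ∀ a → CommutativeRing._≈_ B a (CommutativeRing.0# B) ⊎ Units.Unit B a)
    (x : CommutativeRing.Carrier B) (no-root : ∀ s → ¬ CommutativeRing._≈_ B (Cubic.A B s) x)
    (L : Ring₀) {ρ : CommutativeRing.Carrier B → CommutativeRing.Carrier L} (ρ-hom : IsHom B L ρ)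
    (t : CommutativeRing.Carrier L) (t-root : CommutativeRing._≈_ L (Cubic.A L t) (ρ x)) where
    open CommutativeRing L
    open IntegerMultiples L
    open Units L
    open IsHom ρ-hom
    open HomLemmas ρ-hom using (ι-homo)
    private
      module B = CommutativeRing B
      module IB = IntegerMultiples B
      module UB = Units B

    unit-ρ : ∀ {a} → UB.Unit a → Unit (ρ a)
    unit-ρ (b , e) = ρ b , trans (sym (*-homo _ b)) (trans (cong e) 1-homo)

    zero-sum : ∀ {a b} → a ≈ 0# → a + b ≈ b
    zero-sum e = trans (+-congʳ e) (+-identityˡ _)

    zero-ρ : ∀ {a} c → a B.≈ B.0# → ρ a * c ≈ 0#
    zero-ρ c e = trans (*-congʳ (trans (cong e) 0-homo)) (zeroˡ c)

    -- With r = -a₀/a₁, the element t - r divides A(t) - A(r) = x - A(r), which is a unit because A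
    -- - x has no root in B.
    linear : ∀ a₁ a₀ → UB.Unit a₁ → Unit (ρ a₁ * t + ρ a₀)
    linear a₁ a₀ (b , e) = unit-≈ factored (unit-* (unit-ρ (b , e)) (root (decide (Cubic.A B r B.- x))))
      where
      r : B.Carrier
      r = B.- (b B.* a₀)
      factored : ρ a₁ * (t - ρ r) ≈ ρ a₁ * t + ρ a₀
      factored = trans (solve 3 (λ a t r → a :* (t :- r) := a :* t :+ (:- (a :* r))) (ρ a₁) t (ρ r))
        (+-congˡ (trans (-‿cong (sym (*-homo a₁ r))) (trans (sym (-‿homo _)) (cong
          (B.trans (IB.solve 3 (λ a b c → IB.:- (a IB.:* (IB.:- (b IB.:* c))) IB.:= (a IB.:* b) IB.:* c) a₁ b a₀) (B.trans (B.*-congʳ e) (B.*-identityˡ a₀)))))))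
      root : Cubic.A B r B.- x B.≈ B.0# ⊎ UB.Unit (Cubic.A B r B.- x) → Unit (t - ρ r)
      root (inj₁ z) = contradiction (B.trans (IB.solve 2 (λ a x → a IB.:= (a IB.:- x) IB.:+ x) (Cubic.A B r) x) (B.trans (B.+-congʳ z) (B.+-identityˡ x))) (no-root r)
      root (inj₂ u) = unit-factor (unit-≈ (sym quotient) (unit-neg (unit-ρ u)))
        where
        quotient : (t - ρ r) * ((t * t + t * ρ r + ρ r * ρ r - (t + ρ r)) + ι (+ 7)) ≈ - ρ (Cubic.A B r B.- x)
        quotient = trans (solve 2 (λ t r → (t :- r) :* ((t :* t :+ t :* r :+ r :* r :- (t :+ r)) :+ con (+ 7)) :=
            (((t :* t :* t :- t :* t) :+ con (+ 7) :* t) :+ con (+ 1)) :- (((r :* r :* r :- r :* r) :+ con (+ 7) :* r) :+ con (+ 1))) t (ρ r))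
          (trans (+-congʳ t-root) (trans (solve 2 (λ x a → x :- a := :- (a :- x)) (ρ x) (Cubic.A L (ρ r)))
            (-‿cong (trans (+-congʳ (sym (CubicHom.A-hom ρ-hom r))) (sym (‿-homo (Cubic.A B r) x))))))

    -- The quadratic divides the linear remainder of A - x. A nonzero remainder is a unit, by
    -- `linear` or as a constant; if it were zero, s = p + 1 would be a root of A - x in B.
    quadratic : ∀ p q → Unit (t * t + ρ p * t + ρ q)
    quadratic p q = unit-factor (unit-≈ (trans (-‿cong (sym remainder)) (solve 2 (λ a b → :- (:- (a :* b)) := b :* a) (t - ρ s) (t * t + ρ p * t + ρ q))) (unit-neg (nonzero (decide r₁) (decide r₀))))
      where
      s r₁ r₀ : B.Carrier
      s = p B.+ IB.ι (+ 1)
      r₁ = IB.ι (+ 7) B.- (q B.- s B.* p)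
      r₀ = (IB.ι (+ 1) B.- x) B.+ s B.* q
      remainder : - ((t - ρ s) * (t * t + ρ p * t + ρ q)) ≈ ρ r₁ * t + ρ r₀
      remainder = trans (-‿cong (*-congʳ (+-congˡ (-‿cong ρs))))
        (trans (trans (sym (+-identityʳ _)) (trans (+-congˡ (sym (trans (+-congʳ t-root) (-‿inverseʳ (ρ x))))) (solve 4 (λ t p q x →
            let A = λ t → ((t :* t :* t :- t :* t) :+ con (+ 7) :* t) :+ con (+ 1) ; s = p :+ con (+ 1) in
            (:- ((t :- s) :* (t :* t :+ p :* t :+ q))) :+ (A t :- x) := (con (+ 7) :- (q :- s :* p)) :* t :+ ((con (+ 1) :- x) :+ s :* q)) t (ρ p) (ρ q) (ρ x))))
          (sym (+-cong (*-congʳ ρr₁) ρr₀)))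
        where
        ρs : ρ s ≈ ρ p + ι (+ 1)
        ρs = trans (+-homo p _) (+-congˡ (ι-homo (+ 1)))
        ρr₁ : ρ r₁ ≈ ι (+ 7) - (ρ q - (ρ p + ι (+ 1)) * ρ p)
        ρr₁ = trans (‿-homo _ _) (+-cong (ι-homo (+ 7)) (-‿cong (trans (‿-homo q _) (+-congˡ (-‿cong (trans (*-homo s p) (*-congʳ ρs)))))))
        ρr₀ : ρ r₀ ≈ (ι (+ 1) - ρ x) + (ρ p + ι (+ 1)) * ρ q
        ρr₀ = trans (+-homo _ _) (+-cong (trans (‿-homo _ x) (+-congʳ (ι-homo (+ 1)))) (trans (*-homo s q) (*-congʳ ρs)))
      nonzero : r₁ B.≈ B.0# ⊎ UB.Unit r₁ → r₀ B.≈ B.0# ⊎ UB.Unit r₀ → Unit (ρ r₁ * t + ρ r₀)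
      nonzero (inj₂ u) _ = linear r₁ r₀ u
      nonzero (inj₁ z) (inj₂ u) = unit-≈ (sym (zero-sum (zero-ρ t z))) (unit-ρ u)
      nonzero (inj₁ z) (inj₁ z′) = contradiction (B.trans
        (evaluate-remainder B p q x)
        (B.trans (B.+-congˡ (B.trans (B.+-cong (B.trans (B.*-congʳ z) (B.zeroˡ s)) z′) (B.+-identityˡ _))) (B.+-identityʳ x))) (no-root s)

    combination : B.Carrier → B.Carrier → B.Carrier → Carrier
    combination u₀ u₁ u₂ = ρ u₂ * (t * t) + (ρ u₁ * t + ρ u₀)

    combination-field : ∀ u₀ u₁ u₂ → combination u₀ u₁ u₂ ≈ 0# ⊎ Unit (combination u₀ u₁ u₂)
    combination-field u₀ u₁ u₂ = case (decide u₂) (decide u₁) (decide u₀)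
      where
      case : u₂ B.≈ B.0# ⊎ UB.Unit u₂ → u₁ B.≈ B.0# ⊎ UB.Unit u₁ → u₀ B.≈ B.0# ⊎ UB.Unit u₀ →
        combination u₀ u₁ u₂ ≈ 0# ⊎ Unit (combination u₀ u₁ u₂)
      case (inj₂ (b , e)) _ _ = inj₂ (unit-≈ factored (unit-* (unit-ρ (b , e)) (quadratic (b B.* u₁) (b B.* u₀))))
        where
        cancel : ∀ u → ρ u₂ * ρ (b B.* u) ≈ ρ u
        cancel u = trans (sym (*-homo u₂ _)) (cong (B.trans (B.sym (B.*-assoc u₂ b u)) (B.trans (B.*-congʳ e) (B.*-identityˡ u))))
        factored : ρ u₂ * (t * t + ρ (b B.* u₁) * t + ρ (b B.* u₀)) ≈ combination u₀ u₁ u₂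
        factored = trans (solve 4 (λ u t p q → u :* (t :* t :+ p :* t :+ q) := u :* (t :* t) :+ ((u :* p) :* t :+ u :* q)) (ρ u₂) t (ρ (b B.* u₁)) (ρ (b B.* u₀)))
          (+-congˡ (+-cong (*-congʳ (cancel u₁)) (cancel u₀)))
      case (inj₁ z) (inj₂ u) _ = inj₂ (unit-≈ (sym (zero-sum (zero-ρ _ z))) (linear u₁ u₀ u))
      case (inj₁ z) (inj₁ z′) (inj₂ u) = inj₂ (unit-≈ (sym (trans (zero-sum (zero-ρ _ z)) (zero-sum (zero-ρ t z′)))) (unit-ρ u))
      case (inj₁ z) (inj₁ z′) (inj₁ z″) = inj₁ (trans (zero-sum (zero-ρ _ z)) (trans (zero-sum (zero-ρ t z′)) (trans (cong z″) 0-homo)))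

    Spanned : Carrier → Set
    Spanned a = ∃[ u₀ ] ∃[ u₁ ] ∃[ u₂ ] combination u₀ u₁ u₂ ≈ a

    spanned-field : ∀ {a} → Spanned a → a ≈ 0# ⊎ Unit a
    spanned-field (u₀ , u₁ , u₂ , e) = Sum.map (trans (sym e)) (unit-≈ e) (combination-field u₀ u₁ u₂)

    spanned-0 : Spanned 0#
    spanned-0 = B.0# , B.0# , B.0# , trans (zero-sum (zero-ρ _ B.refl)) (trans (zero-sum (zero-ρ t B.refl)) 0-homo)

    spanned-step : ∀ c {a} → Spanned a → Spanned (ρ c + t * a)
    -- The coefficients of c + t (u₂ t² + u₁ t + u₀), where t³ is replaced by t² - 7t + (x - 1).
    spanned-step c {a} (u₀ , u₁ , u₂ , e) = c B.+ (x B.- IB.ι (+ 1)) B.* u₂ , u₀ B.- IB.ι (+ 7) B.* u₂ , u₁ B.+ u₂ ,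
      trans (+-cong (*-congʳ (+-homo u₁ u₂)) (+-cong (*-congʳ (trans (‿-homo u₀ _) (+-congˡ (-‿cong (trans (*-homo _ u₂) (*-congʳ (ι-homo (+ 7))))))))
          (trans (+-homo c _) (+-congˡ (trans (*-homo _ u₂) (*-congʳ (trans (‿-homo x _) (+-congˡ (-‿cong (ι-homo (+ 1)))))))))))
        (trans (trans (+-congˡ (+-congˡ (+-congˡ (*-congʳ (+-congʳ (sym t-root))))))
            (solve 5 (λ t c u₀ u₁ u₂ → let A = ((t :* t :* t :- t :* t) :+ con (+ 7) :* t) :+ con (+ 1) in
              (u₁ :+ u₂) :* (t :* t) :+ ((u₀ :- con (+ 7) :* u₂) :* t :+ (c :+ (A :- con (+ 1)) :* u₂)) :=
              c :+ t :* (u₂ :* (t :* t) :+ (u₁ :* t :+ u₀))) t (ρ c) (ρ u₀) (ρ u₁) (ρ u₂)))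
          (+-congˡ (*-congˡ e)))

  module _ where
    open ℚX hiding (M; residue; _*ᶜ; residue-∣; residue-below; norm-squares; degree-M)
    private module LP = Poly ℚC

    induction : ∀ {P : Carrier → Set} → (∀ {p q} → p ≈ q → P p → P q) → P 0# → (∀ a q → P q → P (const a + X * q)) → ∀ p → P p
    induction {P} resp P0 step p = ≡.subst P (from-to p) (go (toList p))
      where
      go : ∀ l → P (fromList l)
      go [] = resp (sym From.0-homo) P0
      go (a ∷ l) = resp (sym (trans (From.cong (LP.∷-decompose a l)) (trans (From.+-homo (Polynomial.const (CRing.raw ℚC) a) (Polynomial._⊗_ (CRing.raw ℚC) (Polynomial.X (CRing.raw ℚC)) l))
        (+-congˡ (From.*-homo (Polynomial.X (CRing.raw ℚC)) l))))) (step a (fromList l) (go l))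

    coeff-const-0 : ∀ a → coeff (const a) 0 ≡ a
    coeff-const-0 a = LP.≋⇒coeff (toList-const a) 0

    coeff-const-suc : ∀ a i → coeff (const a) (suc i) ≡ 0ℚ
    coeff-const-suc a i = LP.≋⇒coeff (toList-const a) (suc i)

    coeff-∷-0 : ∀ a q → coeff (const a + X * q) 0 ≡ a
    coeff-∷-0 a q = ≡.trans (coeff-+ (const a) (X * q) 0) (≡.trans (≡.cong₂ ℚ._+_ (coeff-const-0 a) (coeff-X*-0 q)) (ℚₚ.+-identityʳ a))

    coeff-∷-suc : ∀ a q i → coeff (const a + X * q) (suc i) ≡ coeff q i
    coeff-∷-suc a q i = ≡.trans (coeff-+ (const a) (X * q) (suc i)) (≡.trans (≡.cong₂ ℚ._+_ (coeff-const-suc a i) (coeff-X*-suc q i)) (ℚₚ.+-identityˡ _))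

    split : ∀ p → ∃[ a ] ∃[ q ] p ≈ const a + X * q
    split = induction (λ e (a , q , f) → a , q , trans (sym e) f)
      (0ℚ , 0# , sym (trans (+-cong (IsHom.0-homo const-hom) (zeroʳ X)) (+-identityˡ 0#))) (λ a q _ → a , q , refl)

    constant : ∀ {p} → Below p 1 → p ≈ const (coeff p 0)
    constant {p} below = coeff⇒≈ λ { zero → ≡.sym (coeff-const-0 (coeff p 0)) ; (suc i) → ≡.trans (below (suc i) (s≤s z≤n)) (≡.sym (coeff-const-suc (coeff p 0) i)) }

    degree-∷ : ∀ {p a q n} → p ≈ const a + X * q → Degree p (suc n) → Degree q n
    degree-∷ {p} {a} {q} {n} e d = makeDegree (λ z → lead≉0 d (≡.trans (shifted n) z)) (λ i le → ≡.trans (≡.sym (shifted i)) (above d (suc i) (s≤s le)))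
      where
      shifted : ∀ i → coeff p (suc i) ≡ coeff q i
      shifted i = ≡.trans (coeff-cong e (suc i)) (coeff-∷-suc a q i)

    subst-∷ : ∀ g {p a q} → p ≈ const a + X * q → subst g p ≈ const a + g * subst g q
    subst-∷ g {p} {a} {q} e = trans (subst-cong g e) (trans (IsHom.+-homo (subst-hom g) (const a) (X * q))
      (+-cong (subst-const g a) (trans (IsHom.*-homo (subst-hom g) X q) (*-congʳ (subst-X g)))))

    degree-subst : ∀ {g m} → Degree g (suc m) → ∀ n p → Degree p n → Degree (subst g p) (n ℕ.* suc m)
    degree-subst {g} dg zero p d = degree-cong (sym (trans (subst-cong g (constant (above d))) (subst-const g (coeff p 0)))) (degree-const (lead≉0 d))
    degree-subst {g} {m} dg (suc n) p d = step (split p)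
      where
      step : ∃[ a ] ∃[ q ] p ≈ const a + X * q → Degree (subst g p) (suc n ℕ.* suc m)
      step (a , q , e) = degree-cong (sym (trans (subst-∷ g e) (+-comm _ _)))
        (degree-+ (degree-* dg (degree-subst dg n q (degree-∷ e d))) λ { (suc i) _ → coeff-const-suc a i })

    𝔸 : Carrier
    𝔸 = Cubic.A ℚ[X] X

    𝔸* : ∀ q → 𝔸 * q ≈ ((X * (X * (X * q)) - X * (X * q)) + const (κ (+ 7)) * (X * q)) + q
    𝔸* q = trans (trans (*-congʳ (+-congˡ (+-identityʳ 1#))) (solve 4 (λ x c o q → (((x :* x :* x :- x :* x) :+ c :* x) :+ o) :* q :=
        ((x :* (x :* (x :* q)) :- x :* (x :* q)) :+ c :* (x :* q)) :+ o :* q) X (ι (+ 7)) 1# q))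
      (+-cong (+-congˡ (*-congʳ (sym (ℤ-hom-unique (const-hom ∘ʰ κ-hom) ι-hom (+ 7))))) (*-identityˡ q))

    coeff-𝔸* : ∀ q i → coeff (𝔸 * q) (3 ℕ.+ i) ≡ ((coeff q i ℚ.- coeff q (1 ℕ.+ i)) ℚ.+ κ (+ 7) ℚ.* coeff q (2 ℕ.+ i)) ℚ.+ coeff q (3 ℕ.+ i)
    coeff-𝔸* q i = ≡.trans (coeff-cong (𝔸* q) j) (≡.trans (coeff-+ _ q j) (≡.cong (ℚ._+ coeff q j)
      (≡.trans (coeff-+ _ _ j) (≡.cong₂ ℚ._+_
        (≡.trans (coeff-+ _ _ j) (≡.cong₂ ℚ._+_
          (≡.trans (coeff-X*-suc _ (2 ℕ.+ i)) (≡.trans (coeff-X*-suc _ (1 ℕ.+ i)) (coeff-X*-suc q i)))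
          (≡.trans (coeff-neg _ j) (≡.cong ℚ.-_ (≡.trans (coeff-X*-suc _ (2 ℕ.+ i)) (coeff-X*-suc q (1 ℕ.+ i)))))))
        (≡.trans (coeff-const* _ _ j) (≡.cong (κ (+ 7) ℚ.*_) (coeff-X*-suc q (2 ℕ.+ i))))))))
      where j = 3 ℕ.+ i

    degree-𝔸 : Degree 𝔸 3
    degree-𝔸 = makeDegree (λ e → contradiction (≡.trans (≡.sym (≡.trans (at 0) (coeff-const-0 1ℚ))) e) λ ()) λ { (suc (suc (suc (suc i)))) _ → ≡.trans (at (suc i)) (coeff-const-suc 1ℚ i) ; (suc zero) (s≤s ()) ; (suc (suc zero)) (s≤s (s≤s ())) ; (suc (suc (suc zero))) (s≤s (s≤s (s≤s ()))) }
      where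
      at : ∀ i → coeff 𝔸 (3 ℕ.+ i) ≡ coeff (const 1ℚ) i
      at i = ≡.trans (coeff-cong (sym (trans (*-congˡ (IsHom.1-homo const-hom)) (*-identityʳ 𝔸))) (3 ℕ.+ i))
        (≡.trans (coeff-𝔸* (const 1ℚ) i) (≡.trans (≡.cong₂ ℚ._+_ (≡.cong₂ ℚ._+_ (≡.cong (λ z → coeff (const 1ℚ) i ℚ.- z) (coeff-const-suc 1ℚ i)) (≡.cong (κ (+ 7) ℚ.*_) (coeff-const-suc 1ℚ (suc i)))) (coeff-const-suc 1ℚ (suc (suc i))))
          (≡.trans (ℚₚ.+-identityʳ _) (≡.trans (ℚₚ.+-identityʳ _) (ℚₚ.+-identityʳ _)))))

    -- The factor X avoids an exceptional case in degree 0.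
    leading : ∀ n p → Degree p n → let q = X * subst 𝔸 p in
      coeff q (n ℕ.* 3) ≡ κ (ℤ.- (+ n)) ℚ.* coeff p n × coeff q (suc (n ℕ.* 3)) ≡ coeff p n
    leading zero p d = ≡.trans (coeff-X*-0 _) (≡.sym (ℚₚ.*-zeroˡ (coeff p 0))) ,
      ≡.trans (coeff-X*-suc _ 0) (≡.trans (coeff-cong (trans (subst-cong 𝔸 (constant (above d))) (subst-const 𝔸 (coeff p 0))) 0) (coeff-const-0 (coeff p 0)))
    -- A(X)^n = X^(3n) - n X^(3n-1) + ...: each multiplication by A lowers the second coefficient by
    -- the leading one and keeps the latter.
    leading (suc n) p d = step (split p)
      where
      Goal : Set
      Goal = coeff (X * subst 𝔸 p) (3 ℕ.+ n ℕ.* 3) ≡ κ (ℤ.- (+ suc n)) ℚ.* coeff p (suc n) × coeff (X * subst 𝔸 p) (4 ℕ.+ n ℕ.* 3) ≡ coeff p (suc n)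
      step : ∃[ a ] ∃[ q ] p ≈ const a + X * q → Goal
      step (a , q , e) = combine (leading n q (degree-∷ e d))
        where
        g = X * subst 𝔸 q
        below : Below g (2 ℕ.+ n ℕ.* 3)
        below = above (degree-* degree-X (degree-subst degree-𝔸 n q (degree-∷ e d)))
        lead : coeff p (suc n) ≡ coeff q n
        lead = ≡.trans (coeff-cong e (suc n)) (coeff-∷-suc a q n)
        expand : X * subst 𝔸 p ≈ X * const a + 𝔸 * g
        expand = trans (*-congˡ (subst-∷ 𝔸 e)) (solve 4 (λ x a b s → x :* (a :+ b :* s) := x :* a :+ b :* (x :* s)) X (const a) 𝔸 (subst 𝔸 q))
        at : ∀ i → coeff (X * subst 𝔸 p) (3 ℕ.+ i) ≡ ((coeff g i ℚ.- coeff g (1 ℕ.+ i)) ℚ.+ κ (+ 7) ℚ.* coeff g (2 ℕ.+ i)) ℚ.+ coeff g (3 ℕ.+ i)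
        at i = ≡.trans (coeff-cong expand (3 ℕ.+ i)) (≡.trans (coeff-+ (X * const a) (𝔸 * g) (3 ℕ.+ i))
          (≡.trans (≡.cong₂ ℚ._+_ (≡.trans (coeff-X*-suc (const a) (2 ℕ.+ i)) (coeff-const-suc a (1 ℕ.+ i))) (coeff-𝔸* g i)) (ℚₚ.+-identityˡ _)))
        drop : ∀ {u v w} z → v ≡ 0ℚ → w ≡ 0ℚ → u ≡ z → (u ℚ.+ κ (+ 7) ℚ.* v) ℚ.+ w ≡ z
        drop z ≡.refl ≡.refl ≡.refl = ≡.trans (ℚₚ.+-identityʳ _) (ℚₚ.+-identityʳ z)
        combine : _ → Goal
        combine (h₀ , h₁) =
          ≡.trans (at (n ℕ.* 3)) (drop _ (below _ ℕₚ.≤-refl) (below _ (ℕₚ.n≤1+n _)) (≡.trans (≡.cong₂ ℚ._-_ h₀ h₁) (≡.trans arithmetic (≡.cong (κ (ℤ.- (+ suc n)) ℚ.*_) (≡.sym lead))))) ,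
          ≡.trans (at (suc (n ℕ.* 3))) (drop _ (below _ (ℕₚ.n≤1+n _)) (below _ (ℕₚ.≤-trans (ℕₚ.n≤1+n _) (ℕₚ.n≤1+n _)))
            (≡.trans (≡.cong₂ ℚ._-_ h₁ (below _ ℕₚ.≤-refl)) (≡.trans (ℚₚ.+-identityʳ _) (≡.sym lead))))
          where
          l = coeff q n
          arithmetic : κ (ℤ.- (+ n)) ℚ.* l ℚ.- l ≡ κ (ℤ.- (+ suc n)) ℚ.* l
          arithmetic = ≡.trans (≡.cong (κ (ℤ.- (+ n)) ℚ.* l ℚ.+_) (≡.trans (≡.cong ℚ.-_ (≡.sym (ℚₚ.*-identityˡ l))) (ℚₚ.neg-distribˡ-* 1ℚ l)))
            (≡.trans (≡.sym (ℚₚ.*-distribʳ-+ l (κ (ℤ.- (+ n))) (ℚ.- 1ℚ))) (≡.cong (ℚ._* l) (≡.trans (≡.sym (IsHom.+-homo κ-hom (ℤ.- (+ n)) -[1+ 0 ])) (≡.cong κ (negative n)))))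
            where
            negative : ∀ n → ℤ.- (+ n) ℤ.+ -[1+ 0 ] ≡ -[1+ n ]
            negative zero = ≡.refl
            negative (suc n) = ≡.cong (λ m → -[1+ suc m ]) (ℕₚ.+-identityʳ n)

    sign : ℕ → ℚ
    sign zero    = 1ℚ
    sign (suc i) = ℚ.- sign i

    coeff-subst-neg : ∀ p i → coeff (subst (- X) p) i ≡ sign i ℚ.* coeff p i
    coeff-subst-neg = induction (λ {p} {q} e h i → ≡.trans (coeff-cong (subst-cong (- X) (sym e)) i) (≡.trans (h i) (≡.cong (sign i ℚ.*_) (coeff-cong e i))))
      (λ i → ≡.trans (coeff-cong (IsHom.0-homo (subst-hom (- X))) i) (≡.trans (coeff-0 i) (≡.sym (≡.trans (≡.cong (sign i ℚ.*_) (coeff-0 i)) (ℚₚ.*-zeroʳ (sign i))))))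
      step
      where
      step : ∀ a q → (∀ i → coeff (subst (- X) q) i ≡ sign i ℚ.* coeff q i) → ∀ i → coeff (subst (- X) (const a + X * q)) i ≡ sign i ℚ.* coeff (const a + X * q) i
      step a q h i = ≡.trans (coeff-cong (trans (subst-∷ (- X) refl)
          (+-congˡ (solve 2 (λ x s → (:- x) :* s := x :* (:- s)) X (subst (- X) q)))) i) (at i)
        where
        at : ∀ i → coeff (const a + X * (- subst (- X) q)) i ≡ sign i ℚ.* coeff (const a + X * q) i
        at zero = ≡.trans (coeff-∷-0 a _) (≡.sym (≡.trans (ℚₚ.*-identityˡ _) (coeff-∷-0 a q)))
        at (suc i) = ≡.trans (coeff-∷-suc a _ i) (≡.trans (coeff-neg (subst (- X) q) i) (≡.trans (≡.cong ℚ.-_ (h i))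
          (≡.trans (ℚₚ.neg-distribˡ-* (sign i) (coeff q i)) (≡.cong (ℚ.- sign i ℚ.*_) (≡.sym (coeff-∷-suc a q i))))))

    degree-subst-neg : ∀ {p n} → Degree p n → Degree (subst (- X) p) n
    degree-subst-neg {p} {n} d = makeDegree (λ e → Sum.[ sign≢0 n , lead≉0 d ]′ (FieldPoly.field-domain ℚC ℚ-inverse (λ ()) {sign n} (≡.trans (≡.sym (coeff-subst-neg p n)) e)))
      (λ i le → ≡.trans (coeff-subst-neg p i) (≡.trans (≡.cong (sign i ℚ.*_) (above d i le)) (ℚₚ.*-zeroʳ (sign i))))
      where
      sign≢0 : ∀ n → sign n ≢ 0ℚ
      sign≢0 zero ()
      sign≢0 (suc n) e = sign≢0 n (≡.trans (≡.sym (Algebra.Properties.Ring.-‿involutive (CommutativeRing.ring ℚ-ring) (sign n))) (≡.cong ℚ.-_ e))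

    -- p(A(X)) and p(A(-X)) have the same degree, but the quotient of their leading
    -- coefficients differs in sign from that of the next ones.
    no-symmetry : ∀ {n} p → Degree p (suc n) → ¬ subst 𝔸 p ∣ subst (- X) (subst 𝔸 p)
    no-symmetry {n} p d (q , e) = by-degree (degree-factors q P (degree-subst-neg degree-P) e)
      where
      P = subst 𝔸 p
      degree-P : Degree P (suc n ℕ.* 3)
      degree-P = degree-subst degree-𝔸 (suc n) p d
      by-degree : ∃[ i ] ∃[ j ] Degree q i × Degree P j × i ℕ.+ j ≡ suc n ℕ.* 3 → _
      by-degree (i , j , dq , dP , eq) = opposite (2 ℕ.+ n ℕ.* 3) (≡.trans (cancel _ (λ z → second≢0 z)) (≡.sym (cancel (3 ℕ.+ n ℕ.* 3) (lead≉0 degree-P))))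
        where
        i≡0 : i ≡ 0
        i≡0 = ℕₚ.+-cancelʳ-≡ j i 0 (≡.trans eq (degree-unique degree-P dP))
        c = coeff q 0
        proportional : ∀ m → sign m ℚ.* coeff P m ≡ c ℚ.* coeff P m
        proportional m = ≡.trans (≡.sym (coeff-subst-neg P m)) (≡.trans (coeff-cong (trans (sym e) (*-congʳ (constant (above (≡.subst (Degree q) i≡0 dq))))) m) (coeff-const* c P m))
        cancel : ∀ m → coeff P m ≢ 0ℚ → sign m ≡ c
        cancel m nz = domain-cancelʳ ℚ-ring (λ {a} {b} → FieldPoly.field-domain ℚC ℚ-inverse (λ ()) {a} {b}) {sign m} {c} {coeff P m} nz (proportional m)
        second≢0 : coeff P (2 ℕ.+ n ℕ.* 3) ≢ 0ℚ
        second≢0 z = Sum.[ (λ z → contradiction (κ-injective {ℤ.- (+ suc n)} {+ 0} z) λ ()) , lead≉0 d ]′ (FieldPoly.field-domain ℚC ℚ-inverse (λ ()) {κ (ℤ.- (+ suc n))}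
          (≡.trans (≡.sym (proj₁ (leading (suc n) p d))) (≡.trans (coeff-X*-suc P (2 ℕ.+ n ℕ.* 3)) z)))
        opposite : ∀ m → sign m ≢ ℚ.- sign m
        opposite zero ()
        opposite (suc m) e = opposite m (≡.trans (≡.sym (Algebra.Properties.Ring.-‿involutive (CommutativeRing.ring ℚ-ring) (sign m))) (≡.trans (≡.sym e) ≡.refl))

    module PrimeComposition (k′ : ℕ) (ψ : Carrier) (möbius : CyclotomicProduct.Cyclotomic k′ ψ) (k≢1 : suc k′ ≢ 1) where
      open CyclotomicProduct k′ ψ using (ψ-degree)
      open CyclotomicField k′ ψ möbius
      open NoRoot k′ ψ möbius using (no-root)

      H : Carrier
      H = subst 𝔸 ψ

      private
        Qψ QH : Ring₀
        Qψ = quotient ψ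
        QH = quotient H
        module Qψ = CommutativeRing Qψ
        module QH = CommutativeRing QH

        -- The map from ℚ(ω) = ℚ[X]/ψ to ℚ[X]/H with ω ↦ A(X); the class of X is then a root of A -
        -- ω.
        ρ-hom : IsHom Qψ QH (subst 𝔸)
        ρ-hom = record
          { cong = λ {a} {b} d → ∣-respʳ (IsHom.‿-homo hom a b) (HomDivisibility.∣-hom hom d)
          ; +-homo = λ a b → ≈⇒quotient H (IsHom.+-homo hom a b) ; *-homo = λ a b → ≈⇒quotient H (IsHom.*-homo hom a b)
          ; -‿homo = λ a → ≈⇒quotient H (IsHom.-‿homo hom a) ; 0-homo = ≈⇒quotient H (IsHom.0-homo hom) ; 1-homo = ≈⇒quotient H (IsHom.1-homo hom) }
          where hom = subst-hom 𝔸

        module Extension = CubicExtension Qψ (λ a → Sum.map₁ zero-quotient (ψ-field a)) X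
          (λ s e → no-root k≢1 s (Qψ.trans (CubicHom.A-hom (quotient-hom ψ) s) e)) QH ρ-hom X
          (QH.trans (QH.sym (CubicHom.A-hom (quotient-hom H) X)) (≈⇒quotient H (sym (subst-X 𝔸))))

        -- Horner's scheme: multiplying by X and adding a rational constant preserves the span of 1,
        -- X and X² over the image of ℚ(ω).
        spanned : ∀ p → Extension.Spanned p
        spanned = induction (λ e (u₀ , u₁ , u₂ , f) → u₀ , u₁ , u₂ , QH.trans f (≈⇒quotient H e)) Extension.spanned-0
          λ a q (s) → respond a q (Extension.spanned-step (const a) s)
          where
          respond : ∀ a q → Extension.Spanned (subst 𝔸 (const a) + X * q) → Extension.Spanned (const a + X * q)
          respond a q (u₀ , u₁ , u₂ , f) = u₀ , u₁ , u₂ , QH.trans f (≈⇒quotient H (+-congʳ (subst-const 𝔸 a)))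

      H-field : ∀ a → H ∣ a ⊎ ∃[ b ] H ∣ a * b - 1#
      H-field a = Sum.map₁ quotient-zero (Extension.spanned-field (spanned a))

      coprime-inverse : ∀ {a} → ∃[ b ] H ∣ a * b - 1# → Coprime H a
      coprime-inverse {a} (b , q , e) = - q , b , trans (+-congʳ (trans (solve 2 (λ q h → (:- q) :* h := :- (q :* h)) q H) (-‿cong e)))
        (solve 3 (λ a b o → (:- (a :* b :- o)) :+ b :* a := o) a b 1#)

      H-prime : ∀ {a b} → H ∣ a * b → H ∣ a ⊎ H ∣ b
      H-prime {a} {b} d = Sum.map₂ (λ i → coprime-∣ (coprime-inverse i) d) (H-field a)

      -- Modulo H the class of H(-X) is zero or a unit, and `no-symmetry` excludes zero.
      coprime-symmetric : Coprime H (subst (- X) H)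
      coprime-symmetric = Sum.[ (λ d → contradiction d (no-symmetry ψ (proj₂ (ψ-degree möbius)))) , coprime-inverse ]′ (H-field (subst (- X) H))

      degree-H : ∃[ d ] Degree H (suc d)
      degree-H = _ , degree-subst degree-𝔸 _ ψ (proj₂ (ψ-degree möbius))

-- Irreducibility of the delta factors

module DeltaFactors where
  open Rings
  open Domains
  open Resultants
  open MultiplierPolynomials
  open FieldPolynomials
  open Functionals
  open OpaquePolynomials
  open RationalPolynomials
  open LandauArgument
  open Möbius
  open Pairings
  open Cyclotomic
  open Descent
  open CubicExtensions
  open import Defs hiding (ℤ[X])
  open import Algebra.Bundles using (CommutativeRing)
  import Algebra.Definitions.RawMagma as RawMagma
  open import Algebra.Definitions.RawSemiring using (mkIrred)
  open import Data.Integer.Base using (ℤ; +_; -[1+_])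
  open import Data.List.Base as List using (List; []; _∷_)
  open import Data.Nat.Base as ℕ using (ℕ; zero; suc; _<_; s≤s; z≤n)
  import Data.Nat.Properties as ℕₚ
  open import Data.Nat.DivMod using (_/_)
  open import Data.Nat.Divisibility using (divides) renaming (_∣_ to _∣ⁿ_)
  open import Data.Product.Base using (_,_; _×_; ∃-syntax; proj₂)
  open import Data.Rational.Base as ℚ using (ℚ; 1ℚ)
  open import Data.Sum.Base as Sum using (_⊎_; inj₁; inj₂)
  open import Relation.Nullary using (¬_; contradiction)
  open import Relation.Binary.PropositionalEquality as ≡ using (_≡_; _≢_)

  -- The left-hand side is `δ₃` at x = A(t) and c = g, in the Horner form in which evaluation
  -- unfolds. As a polynomial it is a multiple of 4g + t² + 7.
  δ₃-root : (R : Ring₀) →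
    let open CommutativeRing R
        open IntegerMultiples R
        open Cubic R
    in
    ∀ g t → ι (+ 4) * g ≈ - (t * t + ι (+ 7)) →
    (ι (+ 64) + g * (ι (+ 64) + g * (ι (+ 128) + g * (ι (+ 64) + g * 0#)))) +
      A t * ((ι -[1+ 15 ] + g * (ι -[1+ 7 ] + g * 0#)) + A t * ((ι (+ 1) + g * 0#) + A t * 0#)) ≈ 0#
  δ₃-root R g t e = trans
    (solve 2 (λ g t →
      let a = ((t :* t :* t :- t :* t) :+ con (+ 7) :* t) :+ con (+ 1)
          e = con (+ 4) :* g ; e₀ = :- (t :* t :+ con (+ 7)) in
      (con (+ 64) :+ g :* (con (+ 64) :+ g :* (con (+ 128) :+ g :* (con (+ 64) :+ g :* con (+ 0))))) :+
        a :* ((con -[1+ 15 ] :+ g :* (con -[1+ 7 ] :+ g :* con (+ 0))) :+ a :* ((con (+ 1) :+ g :* con (+ 0)) :+ a :* con (+ 0))) :=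
      ((con (+ 16) :+ con (+ 8) :* (e :+ e₀)) :+ ((e :* e :+ e :* e₀) :+ e₀ :* e₀) :- con (+ 2) :* a) :* (e :- e₀)) g t)
    (trans (*-congˡ (trans (+-congʳ e) (-‿inverseʳ _))) (zeroʳ _))
    where
    open CommutativeRing R
    open IntegerMultiples R

  module _ where
    open ℚX hiding (M; residue; _*ᶜ; residue-∣; residue-below; norm-squares; degree-M)
    open Products ℚ[X] using (∏)
    private
      module LP = Poly ℚC
      module κᵐ = PolyMap ℤC ℚC κ-hom
      module Eᶻ = Evaluation ℤC ℚ[X] (const-hom ∘ʰ κ-hom)

    κ-list : List ℤ → Carrier
    κ-list p = fromList (List.map κ p)

    κ-list-hom : IsHom (Poly.poly ℤC) ℚ[X] κ-list
    κ-list-hom = fromList-hom ∘ʰ κᵐ.map-hom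

    coeff-κ-list : ∀ p i → coeff (κ-list p) i ≡ κ (Polynomial.coeff ℤR p i)
    coeff-κ-list p i = ≡.trans (LP.≋⇒coeff (to-from≋ (List.map κ p)) i) (κᵐ.coeff-map p i)

    subst-κ-list : ∀ g p → subst g (κ-list p) ≈ Eᶻ.ev g p
    subst-κ-list g p = trans (Eᶻ.ev-unique (subst-hom g ∘ʰ κ-list-hom) (λ a → subst-const g (κ a)) p)
      (Eᶻ.ev-congˡ p (trans (subst-cong g X≈) (subst-X g)))
      where
      X≈ : κ-list (Polynomial.X ℤR) ≈ X
      X≈ = refl

    module _ (k′ : ℕ) (Ψ : List ℤ) where
      private
        k = suc k′
        ψ = κ-list Ψ
        module ψ-product = CyclotomicProduct k′ ψ
        open ψ-product.MP using (factor)
        module ℤx = RawRing₀ (ℤR [X])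

      κ-list-X^ : ∀ n → κ-list (Polynomial.X ℤR ℤx.^ n) ≈ X ^ n
      κ-list-X^ n = HomLemmas.^-homo κ-list-hom (Polynomial.X ℤR) n

      private
        pairs : List ℕ → List (ℕ × ℕ)
        pairs = List.map (λ i → suc i , k / suc i)

        terms : (ℕ → ℕ) → List (ℕ × ℕ) → List (List ℤ)
        terms e = List.map (λ (j , q) → (Polynomial.X ℤR ℤx.^ j ℤx.- ℤx.1#) ℤx.^ e q)

      κ-list-∏ : ∀ e ds → κ-list (ℤx.∏ (terms e (pairs ds))) ≈ ∏ (factor e k) ds
      κ-list-∏ e [] = IsHom.1-homo κ-list-hom
      κ-list-∏ e (i ∷ ds) = trans (IsHom.*-homo κ-list-hom ((Polynomial.X ℤR ℤx.^ suc i ℤx.- ℤx.1#) ℤx.^ e (k / suc i)) (ℤx.∏ (terms e (pairs ds))))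
        (*-cong (trans (HomLemmas.^-homo κ-list-hom (Polynomial.X ℤR ℤx.^ suc i ℤx.- ℤx.1#) (e (k / suc i))) (^-congˡ (e (k / suc i)) binomial)) (κ-list-∏ e ds))
        where
        binomial : κ-list (Polynomial.X ℤR ℤx.^ suc i ℤx.- ℤx.1#) ≈ X ^ suc i - 1#
        binomial = trans (IsHom.‿-homo κ-list-hom (Polynomial.X ℤR ℤx.^ suc i) ℤx.1#) (+-cong (κ-list-X^ (suc i)) (-‿cong (IsHom.1-homo κ-list-hom)))

      möbius-product : IsCyclotomic k Ψ → ψ-product.Cyclotomic
      möbius-product cyc = trans (*-congˡ (sym (κ-list-∏ e⁻ (divisors k))))
        (trans (sym (IsHom.*-homo κ-list-hom Ψ (ℤx.∏ (terms e⁻ (pairs (divisors k)))))) (trans (IsHom.cong κ-list-hom cyc) (κ-list-∏ e⁺ (divisors k))))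

    irreducible-list : ∀ Δ → ¬ κ-list Δ ∣ 1# → (∀ u v → u * v ≈ κ-list Δ → u ∣ 1# ⊎ v ∣ 1#) → IrreducibleOverℚ Δ
    irreducible-list Δ nonunit′ factors = mkIrred
      (λ (q RawMagma., e) → nonunit′ (fromList q , trans (sym (From.*-homo q (List.map κ Δ))) (trans (From.cong e) From.1-homo)))
      λ {x} {y} e → Sum.map (list-unit x) (list-unit y) (factors (fromList x) (fromList y) (trans (sym (From.*-homo x y)) (sym (From.cong e))))
      where
      list-unit : ∀ x → fromList x ∣ 1# → _
      list-unit x (q , e) = toList q RawMagma., LP.≋-trans (LP.⊗-congʳ (toList q) (LP.≋-sym (to-from≋ x)))
        (LP.≋-trans (LP.≋-sym (To.*-homo q (fromList x))) (LP.≋-trans (To.cong e) To.1-homo))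

    linear-irreducible : ∀ Δ → Degree (κ-list Δ) 1 → IrreducibleOverℚ Δ
    linear-irreducible Δ d = irreducible-list Δ (nonunit d) λ u v e → by-degree (degree-factors u v d e)
      where
      by-degree : ∀ {u v} → ∃[ i ] ∃[ j ] Degree u i × Degree v j × i ℕ.+ j ≡ 1 → u ∣ 1# ⊎ v ∣ 1#
      by-degree (zero , j , du , dv , eq) = inj₁ (degree-0-unit du)
      by-degree (suc zero , zero , du , dv , eq) = inj₂ (degree-0-unit dv)
      by-degree (suc zero , suc j , du , dv , ())
      by-degree (suc (suc i) , j , du , dv , ())

    const-ι : ∀ i → const (κ i) ≈ ι i
    const-ι = ℤ-hom-unique (const-hom ∘ʰ κ-hom) ι-hom

    γ : Carrier
    γ = const (-[1+ 0 ] ℚ./ 4) * (X * X + ι (+ 7))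

    4γ : ι (+ 4) * γ ≈ - (X * X + ι (+ 7))
    4γ = trans (sym (*-assoc _ _ _)) (trans (*-congʳ -1≈) (trans (solve 2 (λ o a → (:- o) :* a := :- (o :* a)) 1# (X * X + ι (+ 7))) (-‿cong (*-identityˡ _))))
      where
      -1≈ : ι (+ 4) * const (-[1+ 0 ] ℚ./ 4) ≈ - 1#
      -1≈ = trans (*-congʳ (sym (const-ι (+ 4)))) (trans (sym (IsHom.*-homo const-hom (κ (+ 4)) (-[1+ 0 ] ℚ./ 4)))
        (trans (IsHom.-‿homo const-hom 1ℚ) (-‿cong (IsHom.1-homo const-hom))))

    degree-γ : Degree γ 2
    degree-γ = degree-* (degree-const {a = -[1+ 0 ] ℚ./ 4} (λ ())) (degree-+ (degree-* degree-X degree-X)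
      λ { (suc i) _ → ≡.trans (coeff-cong (sym (const-ι (+ 7))) (suc i)) (coeff-const-suc (κ (+ 7)) i) })

    subst-neg-γ : subst (- X) γ ≈ γ
    subst-neg-γ = trans (S.*-homo _ _) (*-cong (subst-const (- X) _)
      (trans (S.+-homo _ _) (+-cong (trans (S.*-homo X X) (trans (*-cong (subst-X (- X)) (subst-X (- X))) (solve 1 (λ x → (:- x) :* (:- x) := x :* x) X)))
        (HomLemmas.ι-homo (subst-hom (- X)) (+ 7)))))
      where module S = IsHom (subst-hom (- X))

    𝔸⁻ : Carrier
    𝔸⁻ = Cubic.A ℚ[X] (- X)

    subst-neg-𝔸 : subst (- X) 𝔸 ≈ 𝔸⁻
    subst-neg-𝔸 = trans (CubicHom.A-hom (subst-hom (- X)) X) (Cubic.A-cong ℚ[X] (subst-X (- X)))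

    -- The value at 1 is A(1) - A(-1) = 8 + 8. The difference of the two roots has to be cancelled
    -- from the formula for the resultant.
    𝔸-𝔸⁻≉0 : ¬ 𝔸 - 𝔸⁻ ≈ 0#
    𝔸-𝔸⁻≉0 e = contradiction (≡.trans (≡.sym at-1) (≡.trans (E₁.cong e) E₁.0-homo)) λ ()
      where
      module Ev₁ = Ev ℚ-ring (idHom ℚ-ring)
      module E₁ = IsHom (Ev₁.ev-hom 1ℚ)
      at-1 : Ev₁.ev 1ℚ (𝔸 - 𝔸⁻) ≡ Cubic.A ℚ-ring 1ℚ ℚ.- Cubic.A ℚ-ring (ℚ.- 1ℚ)
      at-1 = ≡.trans (E₁.‿-homo 𝔸 𝔸⁻) (≡.cong₂ ℚ._-_
        (≡.trans (CubicHom.A-hom (Ev₁.ev-hom 1ℚ) X) (≡.cong (Cubic.A ℚ-ring) (Ev₁.ev-X 1ℚ)))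
        (≡.trans (CubicHom.A-hom (Ev₁.ev-hom 1ℚ) (- X)) (≡.cong (Cubic.A ℚ-ring) (≡.trans (E₁.-‿homo X) (≡.cong ℚ.-_ (Ev₁.ev-X 1ℚ))))))

    φ-hom : IsHom (Poly.poly ℤC) ℚ[X] (Eᶻ.ev γ)
    φ-hom = Eᶻ.ev-hom γ

    module Eᶜ = Evaluation ℤ[c]C ℚ[X] φ-hom

    root : ∀ t → ι (+ 4) * γ ≈ - (t * t + ι (+ 7)) → Eᶜ.ev (Cubic.A ℚ[X] t) δ₃ ≈ 0#
    root t e = trans
      (+-cong (+-cong (const-ι (+ 64)) (*-congˡ (+-cong (const-ι (+ 64)) (*-congˡ (+-cong (const-ι (+ 128)) (*-congˡ (+-congʳ (const-ι (+ 64)))))))))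
        (*-congˡ (+-cong (+-cong (const-ι -[1+ 15 ]) (*-congˡ (+-congʳ (const-ι -[1+ 7 ])))) (*-congˡ (+-congʳ (+-congʳ (const-ι (+ 1))))))))
      (δ₃-root ℚ[X] γ t e)

    private
      module Mapᶜ = PolyMap ℤC ℤ[c]C (Poly.const-hom ℤC)

      ev-map : ∀ a Ψ → Eᶜ.ev a (List.map (Polynomial.const ℤR) Ψ) ≈ subst a (κ-list Ψ)
      ev-map a Ψ = trans (Eᶻ.ev-unique (Eᶜ.ev-hom a ∘ʰ Mapᶜ.map-hom) (λ i → trans (Eᶜ.ev-const a (Polynomial.const ℤR i)) (Eᶻ.ev-const γ i)) Ψ)
        (trans (Eᶻ.ev-congˡ Ψ (trans (Eᶜ.ev-cong a X≈) (Eᶜ.ev-X a))) (sym (subst-κ-list a Ψ)))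
        where
        X≈ : Polynomial._≋_ ℤ[c] (List.map (Polynomial.const ℤR) (Polynomial.X ℤR)) (Polynomial.X ℤ[c])
        X≈ = Z2.by-computation

      δ₃-above : ∀ i → 2 < i → Polynomial._≋_ ℤR (Polynomial.coeff ℤ[c] δ₃ i) []
      δ₃-above (suc (suc (suc i))) _ = Poly.≋-refl ℤC {[]}
      δ₃-above (suc zero) (s≤s ())
      δ₃-above (suc (suc zero)) (s≤s (s≤s ()))

      module δ₃-quadratic = Resultant.MonicQuadratic ℤ[c]C δ₃ (Poly.≋-refl ℤC) δ₃-above

    -- `Res-roots` gives the product of the values of Ψ at both roots of `δ₃`, with both sides
    -- multiplied by the difference of the roots, which cancels.
    delta-factor : ∀ Ψ Δ → Polynomial._≋_ ℤR Δ (Polynomial.Res ℤ[c] (List.map (Polynomial.const ℤR) Ψ) δ₃) →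
      subst γ (κ-list Δ) ≈ subst 𝔸 (κ-list Ψ) * subst (- X) (subst 𝔸 (κ-list Ψ))
    delta-factor Ψ Δ e = trans (subst-κ-list γ Δ) (trans (Eᶻ.ev-cong γ e)
      (trans (domain-cancelʳ ℚ[X] (λ {a} {b} → domain {a} {b}) 𝔸-𝔸⁻≉0 formula)
      (*-cong (ev-map 𝔸 Ψ) (trans (ev-map 𝔸⁻ Ψ) (sym (trans (subst-subst (- X) 𝔸 (κ-list Ψ)) (subst-congˡ (κ-list Ψ) subst-neg-𝔸)))))))
      where
      formula = δ₃-quadratic.Res-roots ≡.refl ℚ[X] φ-hom 𝔸 𝔸⁻ (root X 4γ)
        (root (- X) (trans 4γ (-‿cong (+-congʳ (solve 1 (λ x → x :* x := (:- x) :* (:- x)) X))))) (List.map (Polynomial.const ℤR) Ψ)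

    module _ (k′ : ℕ) (Ψ : List ℤ) (cyclotomic : IsCyclotomic (suc k′) Ψ) (k≢1 : suc k′ ≢ 1)
      (Δ : List ℤ) (Δ≈ : subst γ (κ-list Δ) ≈ subst 𝔸 (κ-list Ψ) * subst (- X) (subst 𝔸 (κ-list Ψ))) where
      open PrimeComposition k′ (κ-list Ψ) (möbius-product k′ Ψ cyclotomic) k≢1

      private
        H⁻ : Carrier
        H⁻ = subst (- X) H

        degree-HH⁻ : Degree (H * H⁻) _
        degree-HH⁻ = degree-* (proj₂ degree-H) (degree-subst-neg (proj₂ degree-H))

        -- Substituting `γ` doubles the degree, so nonconstant polynomials stay nonconstant.
        unit-of-unit : ∀ v → subst γ v ∣ 1# → v ∣ 1#
        unit-of-unit v d = by-degree (degree v)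
          where
          by-degree : v ≈ 0# ⊎ ∃[ n ] Degree v n → v ∣ 1#
          by-degree (inj₁ e) = ∣-respˡ (trans (subst-cong γ e) (trans (IsHom.0-homo (subst-hom γ)) (sym e))) d
          by-degree (inj₂ (zero , dv)) = degree-0-unit dv
          by-degree (inj₂ (suc n , dv)) = contradiction d (nonunit (degree-subst degree-γ (suc n) v dv))

        -- u(γ) is even, hence divisible by both coprime factors H and H⁻.
        cofactor-unit : ∀ u v → u * v ≈ κ-list Δ → H ∣ subst γ u → v ∣ 1#
        cofactor-unit u v e d = unit-of-unit v (finish (coprime-product-∣ coprime-symmetric d H⁻∣))
          where
          H⁻∣ : H⁻ ∣ subst γ u
          H⁻∣ = ∣-respʳ (trans (subst-subst (- X) γ u) (subst-congˡ u subst-neg-γ)) (HomDivisibility.∣-hom (subst-hom (- X)) d)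
          finish : H * H⁻ ∣ subst γ u → subst γ v ∣ 1#
          finish (w , f) = w , domain-cancelʳ ℚ[X] (λ {a} {b} → domain {a} {b}) (≉0-degree degree-HH⁻)
            (trans (solve 3 (λ w v h → (w :* v) :* h := (w :* h) :* v) w (subst γ v) (H * H⁻))
            (trans (*-congʳ f) (trans (sym (IsHom.*-homo (subst-hom γ) u v)) (trans (subst-cong γ e) (trans Δ≈ (sym (*-identityˡ _)))))))

      -- For u v = Δ the prime H divides u(γ) v(γ), hence one of the factors; the other one is a
      -- unit by `cofactor-unit`.
      resultant-irreducible : IrreducibleOverℚ Δ
      resultant-irreducible = irreducible-list Δ
        (λ d → nonunit degree-HH⁻ (∣-respˡ Δ≈ (∣-respʳ (IsHom.1-homo (subst-hom γ)) (HomDivisibility.∣-hom (subst-hom γ) d))))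
        λ u v e → Sum.[ (λ d → inj₂ (cofactor-unit u v e d)) , (λ d → inj₁ (cofactor-unit v u (trans (*-comm v u) e) d)) ]′
          (H-prime (∣-respʳ (trans (sym (trans (subst-cong γ e) Δ≈)) (IsHom.*-homo (subst-hom γ) u v)) (∣-*ʳ H⁻ ∣-refl)))

    private
      open Polynomial ℤR using (_≋_; _⊗_)
      module ℤP = Poly ℤC

      Φ-3 : List ℤ
      Φ-3 = + 1 ∷ + 1 ∷ + 1 ∷ []

      -- Δ_{3,1} = 16c² + 4c + 7 is the resultant of x² + x + 1 and x² - 2x + 4c, and δ₃(1, c) = (4c
      -- + 7) Δ_{3,1}.
      4c+7 Δ₃₁ : List ℤ
      4c+7 = + 7 ∷ + 4 ∷ []
      Δ₃₁ = + 7 ∷ + 4 ∷ + 16 ∷ []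

      cyclotomic-3 : ∀ Ψ → IsCyclotomic 3 Ψ → Ψ ≋ Φ-3
      cyclotomic-3 Ψ e = Z1.cancelʳ (λ {p} {q} → ℤ[c]-domain {p} {q}) {Ψ} {Φ-3} (-[1+ 0 ] ∷ + 1 ∷ []) (λ { (Polynomial.∷≋[] () _) })
        (ℤP.≋-trans (ℤP.⊗-congʳ Ψ Z1.by-computation) (ℤP.≋-trans e Z1.by-computation))

      -- With the indices as variables, matching on the equations leaves only the constructor
      -- `proper`; its quotient q satisfies 3 = q · 1 and is rewritten to 3.
      delta-factor-3-1 : ∀ {n m Δ} → n ≡ 3 → m ≡ 1 → IsDeltaFactor n m Δ → Δ ≋ Δ₃₁
      delta-factor-3-1 ≡.refl ≡.refl (proper {Ψ = Ψ} {δ = δ} (divides q eq) lt cyc mult e) = ℤP.≋-trans e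
        (ℤP.≋-trans (Resultant.Res-cong ℤ[c]C (Mapᶜ.map-cong {Ψ} {Φ-3} (cyclotomic-3 Ψ (≡.subst (λ q → IsCyclotomic q Ψ) (≡.trans (≡.sym (ℕₚ.*-identityʳ q)) (≡.sym eq)) cyc))) (multiplier-1 δ mult))
          Z1.by-computation)

    delta-factor-irreducible : ∀ {n m Δ} → m ≡ 3 → IsDeltaFactor n m Δ → IrreducibleOverℚ Δ
    -- The condition m < n excludes the quotients 0 and 1, so the cyclotomic index is at least 2.
    delta-factor-irreducible ≡.refl (proper (divides zero ≡.refl) () cyc mult e)
    delta-factor-irreducible ≡.refl (proper (divides (suc zero) ≡.refl) (s≤s (s≤s (s≤s ()))) cyc mult e)
    delta-factor-irreducible {Δ = Δ} ≡.refl (proper {Ψ = Ψ} {δ = δ} (divides (suc (suc j)) _) _ cyc mult e) =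
      resultant-irreducible (suc j) Ψ cyc (λ ()) Δ (delta-factor Ψ Δ (ℤP.≋-trans e (Resultant.Res-cong ℤ[c]C (Poly.≋-refl ℤ[c]C {List.map (Polynomial.const ℤR) Ψ}) (multiplier-3 δ mult))))
    -- The case n = 3: cancelling Δ_{3,1} from δ₃(1, c) leaves 4c + 7, which is linear.
    delta-factor-irreducible {Δ = Δ₃₃} ≡.refl (diagonal {δ = δ} Δ mult factors e) = linear-irreducible Δ₃₃
      (makeDegree (λ z → contradiction (≡.trans (≡.sym (at 1)) z) λ ()) λ { (suc (suc i)) _ → at (suc (suc i)) ; (suc zero) (s≤s ()) })
      where
      Δ₃₁≋ : Δ 1 ≋ Δ₃₁
      Δ₃₁≋ = delta-factor-3-1 ≡.refl ≡.refl (factors 1 (divides 3 ≡.refl) (s≤s (s≤s z≤n)))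
      module E₁ = Evaluation ℤ[c]C (Poly.poly ℤC) (idHom (Poly.poly ℤC))
      eval-ev : ∀ p → Polynomial.eval ℤ[c] p 1ᶜ ≡ E₁.ev 1ᶜ p
      eval-ev [] = ≡.refl
      eval-ev (b ∷ p) = ≡.cong (λ v → Polynomial._⊕_ ℤR b (1ᶜ ⊗ v)) (eval-ev p)
      product : Δ₃₃ ⊗ Δ₃₁ ≋ 4c+7 ⊗ Δ₃₁
      product = ℤP.≋-trans (ℤP.⊗-congʳ Δ₃₃ (ℤP.≋-trans (ℤP.≋-sym Δ₃₁≋) (ℤP.≋-sym (CommutativeRing.*-identityʳ (Poly.poly ℤC) (Δ 1)))))
        (ℤP.≋-trans (ℤP.≋-sym e) (ℤP.≋-trans (≡.subst (_≋ E₁.ev 1ᶜ δ₃) (≡.sym (eval-ev δ)) (E₁.ev-cong 1ᶜ {δ} {δ₃} (multiplier-3 δ mult))) Z1.by-computation))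
      at : ∀ i → coeff (κ-list Δ₃₃) i ≡ κ (Polynomial.coeff ℤR 4c+7 i)
      at i = ≡.trans (coeff-κ-list Δ₃₃ i) (≡.cong κ (ℤP.≋⇒coeff (Z1.cancelʳ (λ {p} {q} → ℤ[c]-domain {p} {q}) {Δ₃₃} {4c+7} Δ₃₁ (λ { (Polynomial.∷≋[] () _) }) product) i))

open import Defs using (RawRing₀; ℤ[c]; IsDeltaFactor; IrreducibleOverℚ)
open import Data.Nat.Base using (ℕ; NonZero; _*_)
open import Relation.Binary.PropositionalEquality using (refl)
open DeltaFactors using (delta-factor-irreducible)

theorem1p2 : (k : ℕ) .{{_ : NonZero k}} (Δ : RawRing₀.Carrier ℤ[c]) →
    IsDeltaFactor (3 * k) 3 Δ → IrreducibleOverℚ Δ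
theorem1p2 k Δ factor = delta-factor-irreducible refl factor
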